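{- The raw Shapley-Shubik power index $\mathrm{SS}^*$ is $\#\mathrm{P}$-many-one-complete; that is, $\mathrm{SS}^*\in\#\mathrm{P}$ and for every $h\in\#\mathrm{P}$ there exist polynomial-time computable functions $\varphi,\psi$ with $h(x)=\psi(\mathrm{SS}^*(\varphi(x)))$ for all $x\in\{0,1\}^*$.
   Context: An $n$-player weighted voting game $G=(w_1,\ldots,w_n;q)$ consists of nonnegative integer weights and a nonnegative integer quota; players are $N=\{1,\ldots,n\}$. For $S\subseteq N$, $\mathrm{succ}_G(S)=1$ if $\sum_{i\in S}w_i\ge q$ and $0$ otherwise. The raw Shapley-Shubik index is $\mathrm{SS}^*(G,i)=\sum_{S\subseteq N\setminus\{i\}}|S|!\,(n-|S|-1)!\,(\mathrm{succ}_G(S\cup\{i\})-\mathrm{succ}_G(S))$, viewed as a function on binary encodings of pairs $(G,i)$, with numbers in binary; $\psi$ takes natural numbers in binary. $\#\mathrm{P}$ is the class of functions $f:\{0,1\}^*\to\mathbb{N}$ for which there is a nondeterministic polynomial-time Turing machine whose number of accepting paths on $x$ equals $f(x)$. -}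

module Defs where

open import Data.Nat using (ℕ; zero; suc; _+_; _*_; _∸_; _^_; _≤ᵇ_; _<?_; _!; _/_; _%_; _≡ᵇ_)
open import Data.Bool using (Bool; true; false; if_then_else_; _∨_; _∧_; not)
open import Data.List using (List; []; _∷_; _++_; length; map; concatMap; allFin; reverse; null)
open import Data.Nat.ListAction using (sum)
open import Data.Maybe using (Maybe; just; nothing)
import Data.Maybe as Maybe
open import Data.Fin using (Fin; zero; suc; fromℕ<; _≟_)
open import Data.Vec using (Vec; []; _∷_; lookup; zipWith; toList)
import Data.Vec as Vec
open import Data.Fin.Subset using (Subset; ∣_∣; ⁅_⁆; _∪_)
open import Data.Product using (Σ; _×_; _,_; proj₁; proj₂; ∃)
open import Relation.Nullary using (yes; no; does)
open import Relation.Binary.PropositionalEquality using (_≡_)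

BitString : Set
BitString = List Bool

∣_∣ₛ : BitString → ℕ
∣ x ∣ₛ = length x

bitsToℕ : BitString → ℕ
bitsToℕ = go 0
  where
  go : ℕ → BitString → ℕ
  go acc []       = acc
  go acc (b ∷ bs) = go (2 * acc + (if b then 1 else 0)) bs

-- Canonical binary encoding of a natural: MSB first, no leading zeros; 0 ↦ empty string
toBin : ℕ → BitString
toBin n = go n n
  where
  go : ℕ → ℕ → BitString
  go zero    m = []
  go (suc f) zero = []
  go (suc f) (suc m) = go f (suc m / 2) ++ ((suc m % 2 ≡ᵇ 1) ∷ [])

poly : ℕ → ℕ → ℕ → ℕ
poly c k n = c * n ^ k + c

-- Single-tape Turing machines over the tape alphabet Fin (3 + extra)
-- symbol 0 = blank, symbol 1 = bit 0, symbol 2 = bit 1.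

data Move : Set where
  mL mR mS : Move

allMoves : List Move
allMoves = mL ∷ mR ∷ mS ∷ []

Sym : ℕ → Set
Sym e = Fin (3 + e)

blank : ∀ {e} → Sym e
blank = zero

bitSym : ∀ {e} → Bool → Sym e
bitSym false = suc zero
bitSym true  = suc (suc zero)

symBit : ∀ {e} → Sym e → Maybe Bool
symBit (suc zero)       = just false
symBit (suc (suc zero)) = just true
symBit _                = nothing

-- Tape: reversed left part, scanned symbol, right part (blanks beyond the ends)
record Tape (e : ℕ) : Set where
  constructor tape
  field
    left  : List (Sym e)
    headS : Sym e
    right : List (Sym e)
open Tape public

write : ∀ {e} → Sym e → Tape e → Tape e
write s (tape l _ r) = tape l s r

moveHead : ∀ {e} → Move → Tape e → Tape e
moveHead mL (tape []      h r) = tape [] blank (h ∷ r)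
moveHead mL (tape (a ∷ l) h r) = tape l a (h ∷ r)
moveHead mR (tape l h [])      = tape (h ∷ l) blank []
moveHead mR (tape l h (a ∷ r)) = tape (h ∷ l) a r
moveHead mS t = t

inputTape : ∀ {e} → BitString → Tape e
inputTape []       = tape [] blank []
inputTape (b ∷ bs) = tape [] (bitSym b) (map bitSym bs)

tapeOutput : ∀ {e} → Tape e → BitString
tapeOutput {e} (tape _ h r) = go (h ∷ r)
  where
  go : List (Sym e) → BitString
  go [] = []
  go (s ∷ ss) with symBit s
  ... | just b  = b ∷ go ss
  ... | nothing = []

-- Nondeterministic Turing machines; the transition relation is a
-- Boolean-valued relation δ q s q' s' m ("from state q reading s, may
-- go to q', write s', move m").

record NTM : Set where
  field
    nQ     : ℕ
    extra  : ℕ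
    start  : Fin nQ
    accept : Fin nQ
    reject : Fin nQ
    δ      : Fin nQ → Sym extra → Fin nQ → Sym extra → Move → Bool

module _ (M : NTM) where
  open NTM M

  record NConfig : Set where
    constructor nconf
    field
      state : Fin nQ
      ntape : Tape extra

  nInit : BitString → NConfig
  nInit x = nconf start (inputTape x)

  nSucc : NConfig → List NConfig
  nSucc (nconf q t) =
    concatMap (λ q' → concatMap (λ s' → concatMap (λ m →
      if δ q (headS t) q' s' m then nconf q' (moveHead m (write s' t)) ∷ [] else [])
      allMoves) (allFin (3 + extra))) (allFin nQ)

  isAccept isReject : NConfig → Bool
  isAccept (nconf q _) = does (q ≟ accept)
  isReject (nconf q _) = does (q ≟ reject)

  -- a configuration ends a computation path if it is in a halting state
  -- or has no successor (such a stuck path is rejecting unless accepting)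
  isTerminal : NConfig → Bool
  isTerminal c = isAccept c ∨ isReject c ∨ null (nSucc c)

  allB : {A : Set} → (A → Bool) → List A → Bool
  allB p [] = true
  allB p (a ∷ as) = p a ∧ allB p as

  haltsWithin : ℕ → NConfig → Bool
  haltsWithin zero    c = isTerminal c
  haltsWithin (suc t) c = isTerminal c ∨ allB (haltsWithin t) (nSucc c)

  accPaths : ℕ → NConfig → ℕ
  accPaths t c with isAccept c | isReject c
  ... | true  | _    = 1
  ... | false | true = 0
  accPaths zero    c | false | false = 0
  accPaths (suc t) c | false | false = sum (map (accPaths t) (nSucc c))

SharpP : (BitString → ℕ) → Set
SharpP f = Σ NTM λ M → Σ ℕ λ c → Σ ℕ λ k →
  ((x : BitString) → haltsWithin M (poly c k ∣ x ∣ₛ) (nInit M x) ≡ true) ×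
  ((x : BitString) → f x ≡ accPaths M (poly c k ∣ x ∣ₛ) (nInit M x))

record DTM : Set where
  field
    nQ    : ℕ
    extra : ℕ
    start : Fin nQ
    halt  : Fin nQ
    δ     : Fin nQ → Sym extra → Fin nQ × Sym extra × Move

module _ (M : DTM) where
  open DTM M

  record DConfig : Set where
    constructor dconf
    field
      dstate : Fin nQ
      dtape  : Tape extra

  dInit : BitString → DConfig
  dInit x = dconf start (inputTape x)

  dStep : DConfig → DConfig
  dStep (dconf q t) with q ≟ halt
  ... | yes _ = dconf q t
  ... | no  _ with δ q (headS t)
  ...   | (q' , s' , m) = dconf q' (moveHead m (write s' t))

  dRun : ℕ → DConfig → DConfig
  dRun zero    c = c
  dRun (suc t) c = dRun t (dStep c)

PolyTimeComputable : (BitString → BitString) → Set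
PolyTimeComputable f = Σ DTM λ M → Σ ℕ λ c → Σ ℕ λ k →
  (x : BitString) →
    DConfig.dstate (dRun M (poly c k ∣ x ∣ₛ) (dInit M x)) ≡ DTM.halt M ×
    tapeOutput (DConfig.dtape (dRun M (poly c k ∣ x ∣ₛ) (dInit M x))) ≡ f x

PolyTimeComputableℕ : (ℕ → ℕ) → Set
PolyTimeComputableℕ ψ = Σ (BitString → BitString) λ f →
  PolyTimeComputable f × ((n : ℕ) → f (toBin n) ≡ toBin (ψ n))

allSubsets : (n : ℕ) → List (Subset n)
allSubsets zero    = [] ∷ []
allSubsets (suc n) = map (false ∷_) (allSubsets n) ++ map (true ∷_) (allSubsets n)

weightOf : ∀ {n} → Vec ℕ n → Subset n → ℕ
weightOf ws S = Vec.sum (zipWith (λ w b → if b then w else 0) ws S)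

succG : ∀ {n} → Vec ℕ n → ℕ → Subset n → ℕ
succG ws q S = if q ≤ᵇ weightOf ws S then 1 else 0

-- SS*(G, i) for G = (ws; q), player i (Fin n, i.e. players 0..n-1 here)
-- sum over S ⊆ N∖{i} of |S|! (n-|S|-1)! (succ(S ∪ {i}) - succ(S))
-- (the difference is 0 or 1 since weights are nonnegative, so ∸ is exact)
SSraw : (n : ℕ) → Vec ℕ n → ℕ → Fin n → ℕ
SSraw n ws q i = sum (map term (allSubsets n))
  where
  term : Subset n → ℕ
  term S = if lookup S i then 0
           else (∣ S ∣ !) * ((n ∸ ∣ S ∣ ∸ 1) !) * (succG ws q (S ∪ ⁅ i ⁆) ∸ succG ws q S)

-- Binary encoding of pairs (G, i)
-- A list of naturals [a₁,…,aₘ] is encoded by writing each aⱼ in binary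
-- (MSB first) with every bit doubled (0 ↦ 00, 1 ↦ 11), followed by 01.
-- The pair ((w₁,…,wₙ;q), i) with 1 ≤ i ≤ n is encoded as the list
-- [w₁,…,wₙ,q,i].  Strings that are not such encodings get value 0.

encodeNat : ℕ → BitString
encodeNat a = concatMap (λ b → b ∷ b ∷ []) (toBin a) ++ (false ∷ true ∷ [])

encodeList : List ℕ → BitString
encodeList = concatMap encodeNat

decodeList : BitString → Maybe (List ℕ)
decodeList = go []
  where
  go : BitString → BitString → Maybe (List ℕ)
  go cur []                    = if null cur then just [] else nothing
  go cur (_ ∷ [])              = nothing
  go cur (false ∷ false ∷ r)   = go (false ∷ cur) r
  go cur (true  ∷ true  ∷ r)   = go (true ∷ cur) r
  go cur (false ∷ true  ∷ r)   = Maybe.map (bitsToℕ (reverse cur) ∷_) (go [] r)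
  go cur (true  ∷ false ∷ r)   = nothing

-- an instance: number of players, weights, quota, player (0-based)
Instance : Set
Instance = Σ ℕ λ n → Vec ℕ n × ℕ × Fin n

mkInstance : List ℕ → ℕ → ℕ → Maybe Instance
mkInstance ws q zero    = nothing
mkInstance ws q (suc j) with j <? length ws
... | yes j<n = just (length ws , Vec.fromList ws , q , fromℕ< j<n)
... | no _    = nothing

decodeInstance : List ℕ → Maybe Instance
decodeInstance l with reverse l
... | i ∷ q ∷ rws = mkInstance (reverse rws) q i
... | _           = nothing

SSstar : BitString → ℕ
SSstar x with decodeList x
... | nothing = 0
... | just l with decodeInstance l
...   | nothing                 = 0
...   | just (n , ws , q , i)   = SSraw n ws q i

{-# OPTIONS --safe #-}
module Submission where

-- Membership.  SS* counts the pairs of a coalition that is pivotal for i and an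
-- insertion sequence building a linear order around i; with the choices written as
-- one-hot digits this is a number of accepted words of polynomial length.  Polynomial
-- time is obtained by programming machines with four stacks, kept on four tracks of a
-- single tape.
--
-- Hardness.  The machine is run on a cyclic tape that is long enough never to wrap
-- around, so that a configuration is a state and a queue.  Every step of this queue
-- machine reads and appends one letter, and becomes one digit of a subset-sum
-- instance: exactly one of τ tiles (transitions) has to be chosen per step, so that
-- accepting runs correspond to solutions with J items each, J being the number of
-- steps.  With all weights doubled and 1 added to the doubled quota, a player of
-- weight 1 is pivotal exactly for the solutions, and
-- SS* = J! (J (τ − 1))! h(x).  Since J depends on the length n of x only and this
-- factor grows with n faster than h can, h(x) is the last nonzero one among the
-- quotients of SS* by the factors for all n up to the binary length of SS*.

-- The statement speaks of literal single-tape machines, so every polynomial-time claim has to end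
-- in an explicit machine; hence a small language of composable machines with explicit bounds
-- precedes all game theory.
--
-- The obstacle to hardness is that SS* weighs a coalition by its size: all solutions of the
-- subset-sum instance must have the same number of items, or different factors get mixed. This
-- rules out optional slack items. Instead a configuration is read as one number in base `B`. A tile
-- completes the lowest digit, made of state and front letter, to a constant, and adds the next
-- state and the written letter at fixed higher digits; after division by `B` the sum is again that
-- of a configuration. So the target is one constant digit per step, followed by the last
-- configuration. As this has to be prescribed, accepting runs blank their queue and all end alike.
--
-- The function ψ sees neither x nor its length. The factor must therefore be recognised from the
-- value alone, and the queue is padded so that the ratio of successive factors exceeds every
-- possible count.

open import Defs
open import Data.Nat using (ℕ; zero; suc; pred; _+_; _*_; _∸_; _^_; _≤_; _<_; z≤n; s≤s; s≤s⁻¹; _≤ᵇ_; _<?_; _!; _/_; _%_; _≡ᵇ_; _⊓_; NonZero)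
open import Data.Nat.Properties
open import Data.Nat.Tactic.RingSolver using (solve-∀)
open import Data.Nat.ListAction using (sum)
open import Data.Bool using (Bool; true; false; if_then_else_; _∨_; _∧_; not; T)
open import Data.Bool.Properties using (∨-zeroʳ; ∨-identityʳ; ∨-assoc; not-involutive)
open import Data.List using (List; []; _∷_; _++_; _ʳ++_; length; map; concatMap; allFin; reverse; null; replicate; foldl; foldr; concat)
open import Data.List.Properties using (++-identityʳ; ++-assoc; length-++; length-ʳ++; ʳ++-defn; ++-ʳ++; ʳ++-ʳ++; map-++; map-ʳ++; length-map; map-∘; map-cong; map-tabulate; foldl-++; length-tabulate; concatMap-cong; reverse-foldl; reverse-map; reverse-++; map-id; reverse-involutive; unfold-reverse; length-reverse; length-replicate; ∷-injectiveˡ; ∷-injectiveʳ; ∷ʳ-injective)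
open import Data.List.Relation.Unary.All using (All; []; _∷_; universal)
open import Data.List.Relation.Unary.All.Properties using (++⁺; map⁺)
open import Data.Fin using (Fin; zero; suc; combine; remQuot; splitAt; _↑ˡ_; _↑ʳ_)
import Data.Fin as Fin
import Data.Fin.Properties as Finₚ
open import Data.Vec using (Vec; []; _∷_; lookup; _[_]≔_)
import Data.Vec as Vec
import Data.Vec.Properties as Vecₚ
open import Data.Sum using (_⊎_; inj₁; inj₂)
open import Data.Product using (Σ; _×_; _,_; proj₁; proj₂; ∃)
import Data.Maybe
open import Data.Maybe using (Maybe; just; nothing)
open import Data.Unit using (⊤; tt)
open import Data.Empty using (⊥; ⊥-elim)
open import Function using (_∘_; id; _$_; _∋_)
open import Relation.Nullary using (yes; no; does)
open import Relation.Binary.PropositionalEquality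
open import Data.Fin.Subset using (Subset; ∣_∣; ⁅_⁆; _∪_)
import Data.Fin.Subset
open import Data.Fin.Subset.Properties using (∣p∣≤n)
open import Data.Nat.DivMod using (m/n<m; m%n<n; m≡m%n+[m/n]*n; [m+kn]%n≡m%n)

-- Stack machines

-- A tape cell carries one ternary digit (none, bit 0, bit 1) for each of four
-- stacks; the bottoms of the stacks are next to the cell marked home.
Cell : Set
Cell = Vec (Fin 3) 4

data Sy : Set where
  home : Sy
  cell : Cell → Sy

blankCell : Cell
blankCell = zero ∷ zero ∷ zero ∷ zero ∷ []

bitF : Bool → Fin 3
bitF false = suc zero
bitF true  = suc (suc zero)

Store : Set
Store = Vec (List Bool) 4

Stack : Set
Stack = Fin 4

record ATape : Set where
  constructor atape
  field
    aleft  : List Sy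
    ahead  : Sy
    aright : List Sy
open ATape public

moveA : Move → ATape → ATape
moveA mL (atape []      h r) = atape [] (cell blankCell) (h ∷ r)
moveA mL (atape (a ∷ l) h r) = atape l a (h ∷ r)
moveA mR (atape l h [])      = atape (h ∷ l) (cell blankCell) []
moveA mR (atape l h (a ∷ r)) = atape (h ∷ l) a r
moveA mS t = t

writeA : Sy → ATape → ATape
writeA s (atape l _ r) = atape l s r

data Ex : Set where
  e0 e1 e2 : Ex

-- The Boolean argument of δ is a coin: a machine is nondeterministic where the
-- two values differ.
record Mach : Set₁ where
  no-eta-equality
  field
    Q       : Set
    nQ      : ℕ
    encQ    : Q → Fin nQ
    decQ    : Fin nQ → Q
    dec-enc : ∀ q → decQ (encQ q) ≡ q
    start   : Q
    δ       : Bool → Q → Sy → (Q ⊎ Ex) × Sy × Move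
open Mach public

Track : Stack → Store → List Cell → Set
Track i s r = ∃ λ m → map (λ c → lookup c i) r ≡ map bitF (lookup s i) ʳ++ replicate m zero

record Rep (s : Store) (t : ATape) : Set where
  constructor rep
  field
    cells  : List Cell
    shape  : t ≡ atape [] home (map cell cells)
    tracks : ∀ i → Track i s cells

Outcome : Set
Outcome = Ex × Store

-- A computation tree of depth at most n whose leaves, with multiplicity, are the list of outcomes.
-- A fork demands two different actions: the transition relation of an `NTM` is Boolean, so equal
-- actions would form a single path. Exits require a tape in normal form, with the head back on
-- `home`, which is what makes machines composable.
mutual
  data Outs (M : Mach) (q : Q M) (t : ATape) : ℕ → List Outcome → Set where
    det  : ∀ {n L} → δ M false q (ahead t) ≡ δ M true q (ahead t) →
           Res M (δ M false q (ahead t)) t n L → Outs M q t (suc n) L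
    fork : ∀ {n L L′} → δ M false q (ahead t) ≢ δ M true q (ahead t) →
           Res M (δ M false q (ahead t)) t n L → Res M (δ M true q (ahead t)) t n L′ →
           Outs M q t (suc n) (L ++ L′)

  Res : (M : Mach) → (Q M ⊎ Ex) × Sy × Move → ATape → ℕ → List Outcome → Set
  Res M (x , s , m) t n L = Cont M x (moveA m (writeA s t)) n L

  data Cont (M : Mach) : Q M ⊎ Ex → ATape → ℕ → List Outcome → Set where
    go  : ∀ {q t n L} → Outs M q t n L → Cont M (inj₁ q) t n L
    out : ∀ {e t n s} → Rep s t → Cont M (inj₂ e) t n ((e , s) ∷ [])

Exec : Mach → Store → ℕ → List Outcome → Set
Exec M s n L = ∀ t → Rep s t → Outs M (start M) t n L

mutual
  outs-≤ : ∀ {M q t n m L} → n ≤ m → Outs M q t n L → Outs M q t m L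
  outs-≤ (s≤s le) (det e r)      = det e (cont-≤ le r)
  outs-≤ (s≤s le) (fork e r1 r2) = fork e (cont-≤ le r1) (cont-≤ le r2)

  cont-≤ : ∀ {M x t n m L} → n ≤ m → Cont M x t n L → Cont M x t m L
  cont-≤ le (go o)  = go (outs-≤ le o)
  cont-≤ le (out r) = out r

exec-≤ : ∀ {M s n m L} → n ≤ m → Exec M s n L → Exec M s m L
exec-≤ le x t r = outs-≤ le (x t r)

-- Composition replaces each leaf of a tree by the list of leaves of the tree that is continued
-- there, hence the concatenation.
data Conts (P : Outcome → List Outcome → Set) : List Outcome → List Outcome → Set where
  []  : Conts P [] []
  _∷_ : ∀ {o L Ls Ls′} → P o L → Conts P Ls Ls′ → Conts P (o ∷ Ls) (L ++ Ls′)

record Split (P : Outcome → List Outcome → Set) (L₁ L₂ L : List Outcome) : Set where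
  constructor mkSplit
  field
    {R₁ R₂} : List Outcome
    glue    : L ≡ R₁ ++ R₂
    first   : Conts P L₁ R₁
    second  : Conts P L₂ R₂

conts-split : ∀ {P} L₁ {L₂ L} → Conts P (L₁ ++ L₂) L → Split P L₁ L₂ L
conts-split []       c       = mkSplit refl [] c
conts-split (o ∷ L₁) (_∷_ {L = L} p c) with conts-split L₁ c
... | mkSplit {R₁} {R₂} refl c₁ c₂ = mkSplit (sym (++-assoc L R₁ R₂)) (p ∷ c₁) c₂

map₁-inj : ∀ {A B C : Set} (f : A → B) → (∀ {x y} → f x ≡ f y → x ≡ y) →
           ∀ {x y : A × C} → (f (proj₁ x) , proj₂ x) ≡ (f (proj₁ y) , proj₂ y) → x ≡ y
map₁-inj f inj eq = cong₂ _,_ (inj (cong proj₁ eq)) (cong proj₂ eq)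

on₁ : ∀ {A B C : Set} → (A → B) → A × C → B × C
on₁ f (a , c) = f a , c

encEx : {F : Ex → Set} {n : Ex → ℕ} → ((e : Ex) → F e → Fin (n e)) → Σ Ex F → Fin (n e0 + (n e1 + n e2))
encEx f (e0 , q) = f e0 q ↑ˡ _
encEx {n = n} f (e1 , q) = n e0 ↑ʳ (f e1 q ↑ˡ _)
encEx {n = n} f (e2 , q) = n e0 ↑ʳ (n e1 ↑ʳ f e2 q)

decEx : {F : Ex → Set} {n : Ex → ℕ} → ((e : Ex) → Fin (n e) → F e) → Fin (n e0 + (n e1 + n e2)) → Σ Ex F
decEx {n = n} g i with splitAt (n e0) i
... | inj₁ j = e0 , g e0 j
... | inj₂ i′ with splitAt (n e1) i′
...   | inj₁ j = e1 , g e1 j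
...   | inj₂ j = e2 , g e2 j

dec-encEx : {F : Ex → Set} {n : Ex → ℕ} (f : (e : Ex) → F e → Fin (n e)) (g : (e : Ex) → Fin (n e) → F e) →
            (∀ e q → g e (f e q) ≡ q) → ∀ p → decEx {F} {n} g (encEx f p) ≡ p
dec-encEx {n = n} f g h (e0 , q) rewrite Finₚ.splitAt-↑ˡ (n e0) (f e0 q) (n e1 + n e2) = cong (e0 ,_) (h e0 q)
dec-encEx {n = n} f g h (e1 , q)
  rewrite Finₚ.splitAt-↑ʳ (n e0) (n e1 + n e2) (f e1 q ↑ˡ n e2) | Finₚ.splitAt-↑ˡ (n e1) (f e1 q) (n e2) = cong (e1 ,_) (h e1 q)
dec-encEx {n = n} f g h (e2 , q)
  rewrite Finₚ.splitAt-↑ʳ (n e0) (n e1 + n e2) (n e1 ↑ʳ f e2 q) | Finₚ.splitAt-↑ʳ (n e1) (n e2) (f e2 q) = cong (e2 ,_) (h e2 q)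

enc⊎ : {A B : Set} {m n : ℕ} → (A → Fin m) → (B → Fin n) → A ⊎ B → Fin (m + n)
enc⊎ f g (inj₁ a) = f a ↑ˡ _
enc⊎ {m = m} f g (inj₂ b) = m ↑ʳ g b

dec⊎ : {A B : Set} {m n : ℕ} → (Fin m → A) → (Fin n → B) → Fin (m + n) → A ⊎ B
dec⊎ {m = m} f g i with splitAt m i
... | inj₁ j = inj₁ (f j)
... | inj₂ j = inj₂ (g j)

dec-enc⊎ : {A B : Set} {m n : ℕ} (f : A → Fin m) (g : B → Fin n) (f′ : Fin m → A) (g′ : Fin n → B) →
           (∀ a → f′ (f a) ≡ a) → (∀ b → g′ (g b) ≡ b) → ∀ x → dec⊎ f′ g′ (enc⊎ f g x) ≡ x
dec-enc⊎ {m = m} {n} f g f′ g′ p q (inj₁ a) rewrite Finₚ.splitAt-↑ˡ m (f a) n = cong inj₁ (p a)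
dec-enc⊎ {m = m} {n} f g f′ g′ p q (inj₂ b) rewrite Finₚ.splitAt-↑ʳ m n (g b) = cong inj₂ (q b)

module Bind (M : Mach) (N : Ex → Mach) where
  Qb : Set
  Qb = Q M ⊎ Σ Ex (λ e → Q (N e))

  injM : Q M ⊎ Ex → Qb ⊎ Ex
  injM (inj₁ q) = inj₁ (inj₁ q)
  injM (inj₂ e) = inj₁ (inj₂ (e , start (N e)))

  injN : ∀ e → Q (N e) ⊎ Ex → Qb ⊎ Ex
  injN e (inj₁ q) = inj₁ (inj₂ (e , q))
  injN e (inj₂ x) = inj₂ x

  δb : Bool → Qb → Sy → (Qb ⊎ Ex) × Sy × Move
  δb c (inj₁ q) s       = on₁ injM (δ M c q s)
  δb c (inj₂ (e , q)) s = on₁ (injN e) (δ (N e) c q s)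

  -- Renaming states must not identify the two actions of a fork, since its branches would then
  -- merge and the number of paths would drop.
  injM-inj : ∀ {x y} → injM x ≡ injM y → x ≡ y
  injM-inj {inj₁ _} {inj₁ _} refl = refl
  injM-inj {inj₂ _} {inj₂ _} refl = refl

  injN-inj : ∀ {e x y} → injN e x ≡ injN e y → x ≡ y
  injN-inj {x = inj₁ _} {inj₁ _} refl = refl
  injN-inj {x = inj₂ _} {inj₂ _} refl = refl

bind : Mach → (Ex → Mach) → Mach
bind M N .Q       = Bind.Qb M N
bind M N .nQ      = nQ M + (nQ (N e0) + (nQ (N e1) + nQ (N e2)))
bind M N .encQ    = enc⊎ (encQ M) (encEx (λ e → encQ (N e)))
bind M N .decQ    = dec⊎ (decQ M) (decEx (λ e → decQ (N e)))
bind M N .dec-enc = dec-enc⊎ (encQ M) _ (decQ M) _ (dec-enc M) (dec-encEx (λ e → encQ (N e)) (λ e → decQ (N e)) (λ e → dec-enc (N e)))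
bind M N .start   = inj₁ (start M)
bind M N .δ       = Bind.δb M N

module _ (M : Mach) (N : Ex → Mach) where
  open Bind M N

  mutual
    outsN : ∀ {e q t n L} → Outs (N e) q t n L → Outs (bind M N) (inj₂ (e , q)) t n L
    outsN (det eq r) = det (cong (on₁ (injN _)) eq) (contN r)
    outsN (fork ne r1 r2) = fork (λ eq → ne (map₁-inj (injN _) injN-inj eq)) (contN r1) (contN r2)

    contN : ∀ {e x t n L} → Cont (N e) x t n L → Cont (bind M N) (injN e x) t n L
    contN (go o)  = go (outsN o)
    contN (out r) = out r

  After : ℕ → Outcome → List Outcome → Set
  After m (e , s) L = Exec (N e) s m L

  mutual
    outsM : ∀ {m q t n L L′} → Outs M q t n L → Conts (After m) L L′ → Outs (bind M N) (inj₁ q) t (n + m) L′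
    outsM (det eq r) ks = det (cong (on₁ injM) eq) (contM r ks)
    outsM (fork {L = L} ne r₁ r₂) ks with conts-split L ks
    ... | mkSplit refl k₁ k₂ = fork (λ eq → ne (map₁-inj injM injM-inj eq)) (contM r₁ k₁) (contM r₂ k₂)

    contM : ∀ {m x t n L L′} → Cont M x t n L → Conts (After m) L L′ → Cont (bind M N) (injM x) t (n + m) L′
    contM (go o) ks = go (outsM o ks)
    contM {m} {n = n} (out r) (_∷_ {L = L} k []) rewrite ++-identityʳ L = go (outs-≤ (m≤n+m m n) (outsN (k _ r)))

  exec-bind : ∀ {m s n L L′} → Exec M s n L → Conts (After m) L L′ → Exec (bind M N) s (n + m) L′
  exec-bind x ks t r = outsM (x t r) ks

module Loop (M : Mach) where
  Ql : Set
  Ql = ⊤ ⊎ Q M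

  injL : Q M ⊎ Ex → Ql ⊎ Ex
  injL (inj₁ q)  = inj₁ (inj₂ q)
  injL (inj₂ e0) = inj₂ e0
  injL (inj₂ e1) = inj₁ (inj₁ tt)
  injL (inj₂ e2) = inj₂ e2

  injL-inj : ∀ {x y} → injL x ≡ injL y → x ≡ y
  injL-inj {inj₁ _} {inj₁ _} refl = refl
  injL-inj {inj₁ _} {inj₂ e0} ()
  injL-inj {inj₁ _} {inj₂ e1} ()
  injL-inj {inj₁ _} {inj₂ e2} ()
  injL-inj {inj₂ e0} {inj₁ _} ()
  injL-inj {inj₂ e1} {inj₁ _} ()
  injL-inj {inj₂ e2} {inj₁ _} ()
  injL-inj {inj₂ e0} {inj₂ e0} eq = refl
  injL-inj {inj₂ e1} {inj₂ e1} eq = refl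
  injL-inj {inj₂ e2} {inj₂ e2} eq = refl
  injL-inj {inj₂ e0} {inj₂ e1} ()
  injL-inj {inj₂ e0} {inj₂ e2} ()
  injL-inj {inj₂ e1} {inj₂ e0} ()
  injL-inj {inj₂ e1} {inj₂ e2} ()
  injL-inj {inj₂ e2} {inj₂ e0} ()
  injL-inj {inj₂ e2} {inj₂ e1} ()

  δl : Bool → Ql → Sy → (Ql ⊎ Ex) × Sy × Move
  δl c (inj₁ tt) s = inj₁ (inj₂ (start M)) , s , mS
  δl c (inj₂ q)  s = on₁ injL (δ M c q s)

-- Exit e1 of the body restarts it.  The restart passes through a fresh state, so
-- that coin branches stay distinct.
loop : Mach → Mach
loop M .Q       = Loop.Ql M
loop M .nQ      = 1 + nQ M
loop M .encQ    = enc⊎ (λ _ → zero {0}) (encQ M)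
loop M .decQ    = dec⊎ (λ _ → tt) (decQ M)
loop M .dec-enc = dec-enc⊎ (λ _ → zero {0}) (encQ M) (λ _ → tt) (decQ M) (λ _ → refl) (dec-enc M)
loop M .start   = inj₂ (start M)
loop M .δ       = Loop.δl M

module _ (M : Mach) where
  open Loop M

  Again : ℕ → Outcome → List Outcome → Set
  Again m (e0 , s) L = L ≡ (e0 , s) ∷ []
  Again m (e1 , s) L = Exec (loop M) s m L
  Again m (e2 , s) L = L ≡ (e2 , s) ∷ []

  mutual
    outsL : ∀ {m q t n L L′} → Outs M q t n L → Conts (Again m) L L′ → Outs (loop M) (inj₂ q) t (n + suc m) L′
    outsL (det eq r) ks = det (cong (on₁ injL) eq) (contL r ks)
    outsL (fork {L = L} ne r₁ r₂) ks with conts-split L ks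
    ... | mkSplit refl k₁ k₂ = fork (λ eq → ne (map₁-inj injL injL-inj eq)) (contL r₁ k₁) (contL r₂ k₂)

    contL : ∀ {m x t n L L′} → Cont M x t n L → Conts (Again m) L L′ → Cont (loop M) (injL x) t (n + suc m) L′
    contL (go o) ks = go (outsL o ks)
    contL (out {e = e0} r) (refl ∷ []) = out r
    contL (out {e = e2} r) (refl ∷ []) = out r
    contL {m} {t = t} {n = n} (out {e = e1} r) (_∷_ {L = L} k []) rewrite ++-identityʳ L =
      go (outs-≤ (m≤n+m (suc m) n) (det refl (go (stay t (k t r)))))
      where
      stay : ∀ t {L} → Outs (loop M) (inj₂ (start M)) t m L → Outs (loop M) (inj₂ (start M)) (moveA mS (writeA (ahead t) t)) m L
      stay (atape l h r) o = o

  exec-loop : ∀ {m s n L L′} → Exec M s n L → Conts (Again m) L L′ → Exec (loop M) s (n + suc m) L′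
  exec-loop x ks t r = outsL (x t r) ks

-- Machines for single stack operations

finMach : (n : ℕ) → Fin n → (Bool → Fin n → Sy → (Fin n ⊎ Ex) × Sy × Move) → Mach
finMach n s d .Q         = Fin n
finMach n s d .nQ        = n
finMach n s d .encQ      = id
finMach n s d .decQ      = id
finMach n s d .dec-enc _ = refl
finMach n s d .start     = s
finMach n s d .δ         = d

pattern q0 = zero
pattern q1 = suc zero
pattern q2 = suc (suc zero)
pattern q3 = suc (suc (suc zero))
pattern q4 = suc (suc (suc (suc zero)))

skipM : Ex → Mach
skipM e = finMach 1 zero (λ _ _ s → inj₂ e , s , mS)

coinM : Mach
coinM = finMach 1 zero λ where
  false _ s → inj₂ e0 , s , mS
  true  _ s → inj₂ e1 , s , mS

digit : Stack → Cell → Fin 3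
digit i c = lookup c i

δpush : Stack → Bool → Fin 3 → Sy → (Fin 3 ⊎ Ex) × Sy × Move
δpush i b q0 s = inj₁ q1 , s , mR
δpush i b q1 home = inj₂ e0 , home , mS
δpush i b q1 (cell c) with digit i c
... | zero  = inj₁ q2 , cell (c [ i ]≔ bitF b) , mL
... | suc _ = inj₁ q1 , cell c , mR
δpush i b q2 home = inj₂ e0 , home , mS
δpush i b q2 (cell c) = inj₁ q2 , cell c , mL

push : Stack → Bool → Mach
push i b = finMach 3 q0 (λ _ → δpush i b)

exB : Bool → Ex
exB false = e1
exB true  = e2

δpop : Stack → Fin 5 → Sy → (Fin 5 ⊎ Ex) × Sy × Move
δpop i q0 s = inj₁ q1 , s , mR
δpop i q1 home = inj₂ e0 , home , mS
δpop i q1 (cell c) with digit i c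
... | zero  = inj₁ q2 , cell c , mL
... | suc _ = inj₁ q1 , cell c , mR
δpop i q2 home = inj₂ e0 , home , mS
δpop i q2 (cell c) with digit i c
... | suc zero = inj₁ q3 , cell (c [ i ]≔ zero) , mL
... | _        = inj₁ q4 , cell (c [ i ]≔ zero) , mL
δpop i q3 home = inj₂ e1 , home , mS
δpop i q3 (cell c) = inj₁ q3 , cell c , mL
δpop i q4 home = inj₂ e2 , home , mS
δpop i q4 (cell c) = inj₁ q4 , cell c , mL

-- Exit e0 means that the stack was empty.
pop : Stack → Mach
pop i = finMach 5 q0 (λ _ → δpop i)

-- The cells in u have been passed and lie in reverse order left of the head.
at : List Cell → List Cell → ATape
at u []       = atape (map cell u ++ home ∷ []) (cell blankCell) []
at u (c ∷ cs) = atape (map cell u ++ home ∷ []) (cell c) (map cell cs)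

-- The head stands on the last cell passed, or on `home` when none is left; this is the form of the
-- tape on the way back.
lf : List Cell → List Cell → ATape
lf []      r = atape [] home (map cell r)
lf (c ∷ u) r = atape (map cell u ++ home ∷ []) (cell c) (map cell r)

at-right : ∀ u c cs → moveA mR (at u (c ∷ cs)) ≡ at (c ∷ u) cs
at-right u c []       = refl
at-right u c (_ ∷ cs) = refl

at-left : ∀ u c c′ cs → moveA mL (writeA (cell c′) (at u (c ∷ cs))) ≡ lf u (c′ ∷ cs)
at-left []      c c′ cs = refl
at-left (d ∷ u) c c′ cs = refl

lf-left : ∀ c c′ u r → moveA mL (writeA (cell c′) (lf (c ∷ u) r)) ≡ lf u (c′ ∷ r)
lf-left c c′ []      r = refl
lf-left c c′ (_ ∷ u) r = refl

home-right : ∀ r → moveA mR (atape [] home (map cell r)) ≡ at [] r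
home-right []      = refl
home-right (_ ∷ r) = refl

unmap-ʳ++ : ∀ {A B : Set} (f : A → B) r xs ys → map f r ≡ xs ʳ++ ys →
            ∃ λ u → ∃ λ r2 → r ≡ u ʳ++ r2 × map f u ≡ xs × map f r2 ≡ ys
unmap-ʳ++ f r [] ys eq = [] , r , refl , refl , eq
unmap-ʳ++ f r (x ∷ xs) ys eq with unmap-ʳ++ f r xs (x ∷ ys) eq
... | u , (c ∷ r2) , p , q , refl = (c ∷ u) , r2 , p , cong (f c ∷_) q , refl

module _ {n : ℕ} (s0 : Fin n) (d : Fin n → Sy → (Fin n ⊎ Ex) × Sy × Move) where
  private
    M : Mach
    M = finMach n s0 (λ _ → d)

  step : ∀ {q q′ s m t k L t′} → d q (ahead t) ≡ (inj₁ q′ , s , m) → moveA m (writeA s t) ≡ t′ →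
         Outs M q′ t′ k L → Outs M q t (suc k) L
  step {q} {t = t} {L = L} eq refl o = det refl (subst (λ z → Res M z t _ L) (sym eq) (go o))

  stop : ∀ {q e s m t k st t′} → d q (ahead t) ≡ (inj₂ e , s , m) → moveA m (writeA s t) ≡ t′ →
         Rep st t′ → Outs M q t (suc k) ((e , st) ∷ [])
  stop {q} {t = t} eq refl r = det refl (subst (λ z → Res M z t _ _) (sym eq) (out r))

  seek : ∀ (i : Stack) q → (∀ c b → digit i c ≡ bitF b → d q (cell c) ≡ (inj₁ q , cell c , mR)) →
         ∀ u u0 r2 bs {k L} → map (digit i) u ≡ map bitF bs →
         Outs M q (at (u ++ u0) r2) k L → Outs M q (at u0 (u ʳ++ r2)) (length u + k) L
  seek i q h [] u0 r2 bs eq o = o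
  seek i q h (c ∷ u) u0 r2 (b ∷ bs) {k} {L} eq o =
    subst (λ z → Outs M q (at u0 (u ʳ++ c ∷ r2)) z L) (+-suc (length u) k)
      (seek i q h u u0 (c ∷ r2) bs (cong tl′ eq)
        (step (h c b (cong (λ { [] → zero ; (x ∷ _) → x }) eq)) (at-right (u ++ u0) c r2) o))
    where
    tl′ : ∀ {A : Set} → List A → List A
    tl′ [] = []
    tl′ (_ ∷ xs) = xs

  return : ∀ q e → (∀ c → d q (cell c) ≡ (inj₁ q , cell c , mL)) → d q home ≡ (inj₂ e , home , mS) →
           ∀ u r {st} → Rep st (atape [] home (map cell (u ʳ++ r))) →
           Outs M q (lf u r) (length u + 1) ((e , st) ∷ [])
  return q e h h′ [] r R = stop h′ refl R
  return q e h h′ (c ∷ u) r R = step (h c) (lf-left c c u r) (return q e h h′ u (c ∷ r) R)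

Tracks : Store → List Cell → Set
Tracks s r = ∀ i → Track i s r

split-track : ∀ i s r → Tracks s r →
  ∃ λ u → ∃ λ r2 → ∃ λ m → r ≡ u ʳ++ r2 × map (digit i) u ≡ map bitF (lookup s i) × map (digit i) r2 ≡ replicate m zero
split-track i s r T with T i
... | m , eq with unmap-ʳ++ (digit i) r _ _ eq
... | u , r2 , p , q , z = u , r2 , m , p , q , z

lookup-blank : ∀ (i : Stack) → lookup blankCell i ≡ zero
lookup-blank q0 = refl
lookup-blank q1 = refl
lookup-blank q2 = refl
lookup-blank q3 = refl

replicate-snoc : ∀ {A : Set} m (x : A) → replicate m x ++ x ∷ [] ≡ x ∷ replicate m x
replicate-snoc zero x = refl
replicate-snoc (suc m) x = cong (x ∷_) (replicate-snoc m x)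

ʳ++-++ : ∀ {A : Set} (xs ys zs : List A) → (xs ʳ++ ys) ++ zs ≡ xs ʳ++ (ys ++ zs)
ʳ++-++ [] ys zs = refl
ʳ++-++ (x ∷ xs) ys zs = ʳ++-++ xs (x ∷ ys) zs

tracks-blank : ∀ s r → Tracks s r → Tracks s (r ++ blankCell ∷ [])
tracks-blank s r T i with T i
... | m , eq = suc m , (begin
  map (digit i) (r ++ blankCell ∷ [])                                ≡⟨ map-++ (digit i) r _ ⟩
  map (digit i) r ++ lookup blankCell i ∷ []                         ≡⟨ cong₂ (λ a b → a ++ b ∷ []) eq (lookup-blank i) ⟩
  (map bitF (lookup s i) ʳ++ replicate m zero) ++ zero ∷ []          ≡⟨ ʳ++-++ (map bitF (lookup s i)) _ _ ⟩
  map bitF (lookup s i) ʳ++ (replicate m zero ++ zero ∷ [])          ≡⟨ cong (map bitF (lookup s i) ʳ++_) (replicate-snoc m zero) ⟩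
  map bitF (lookup s i) ʳ++ (zero ∷ replicate m zero)                ∎)
  where open ≡-Reasoning

-- The first free cell of a track may lie beyond the visited tape. A blank cell is then appended,
-- which changes neither the tape under `at` nor any stack, as it only lengthens the padding of each
-- track.
data SeekEnd (i : Stack) (s : Store) (r : List Cell) : Set where
  seekEnd : ∀ u r2 c cs m → r ≡ u ʳ++ r2 → at u r2 ≡ at u (c ∷ cs) → Tracks s (u ʳ++ c ∷ cs) →
            map (digit i) u ≡ map bitF (lookup s i) → digit i c ≡ zero → map (digit i) cs ≡ replicate m zero →
            SeekEnd i s r

seek-end : ∀ i s r → Tracks s r → SeekEnd i s r
seek-end i s r T with split-track i s r T
... | u , [] , m , refl , q , z =
  seekEnd u [] blankCell [] 0 refl refl (subst (Tracks s) (ʳ++-++ u [] _) (tracks-blank s _ T)) q (lookup-blank i) refl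
... | u , (c ∷ cs) , suc m , refl , q , z = seekEnd u (c ∷ cs) c cs m refl refl T q (∷-injectiveˡ z) (∷-injectiveʳ z)

tracks-update : ∀ i s bs u c cs x → Tracks s (u ʳ++ c ∷ cs) →
  Track i (s [ i ]≔ bs) (u ʳ++ (c [ i ]≔ x) ∷ cs) → Tracks (s [ i ]≔ bs) (u ʳ++ (c [ i ]≔ x) ∷ cs)
tracks-update i s bs u c cs x T Ti j with j Finₚ.≟ i
... | yes refl = Ti
... | no j≢i with T j
... | m , eq = m , trans (begin
  map (digit j) (u ʳ++ (c [ i ]≔ x) ∷ cs)                       ≡⟨ map-ʳ++ (digit j) u ⟩
  map (digit j) u ʳ++ (digit j (c [ i ]≔ x) ∷ map (digit j) cs) ≡⟨ cong (λ z → map (digit j) u ʳ++ (z ∷ _)) (Vecₚ.lookup∘update′ j≢i c x) ⟩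
  map (digit j) u ʳ++ (digit j c ∷ map (digit j) cs)            ≡⟨ map-ʳ++ (digit j) u ⟨
  map (digit j) (u ʳ++ c ∷ cs)                                  ∎)
  (trans eq (cong (λ z → map bitF z ʳ++ _) (sym (Vecₚ.lookup∘update′ j≢i s bs))))
  where open ≡-Reasoning

-- The way out and back over h cells, plus one step each for leaving `home`, for turning round and
-- for the exit.
opCost : ℕ → ℕ
opCost h = h + h + 3

δpush-seek : ∀ i b c b′ → digit i c ≡ bitF b′ → δpush i b q1 (cell c) ≡ (inj₁ q1 , cell c , mR)
δpush-seek i b c false eq rewrite eq = refl
δpush-seek i b c true  eq rewrite eq = refl

δpush-none : ∀ i b c → digit i c ≡ zero → δpush i b q1 (cell c) ≡ (inj₁ q2 , cell (c [ i ]≔ bitF b) , mL)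
δpush-none i b c eq rewrite eq = refl

length-track : ∀ {i s} u → map (digit i) u ≡ map bitF (lookup s i) → length u ≡ length (lookup s i)
length-track {i} {s} u eq = trans (sym (length-map (digit i) u)) (trans (cong length eq) (length-map bitF (lookup s i)))

map-ʳ++′ : ∀ {A B : Set} (f : A → B) xs {ys bs zs} → map f xs ≡ bs → map f ys ≡ zs → map f (xs ʳ++ ys) ≡ bs ʳ++ zs
map-ʳ++′ f xs refl refl = map-ʳ++ f xs

exec-push : ∀ i b s → Exec (push i b) s (opCost (length (lookup s i))) ((e0 , s [ i ]≔ (b ∷ lookup s i)) ∷ [])
exec-push i b s t (rep r refl T) with seek-end i s r T
... | seekEnd u r2 c cs m refl ateq T′ q z zs = outs-≤ (≤-reflexive cost)
  (step q0 d refl (home-right (u ʳ++ r2))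
    (seek q0 d i q1 (λ c → δpush-seek i b c) u [] r2 (lookup s i) q
      (subst (λ z → Outs (push i b) q1 z _ _) (sym (trans (cong (λ z → at z r2) (++-identityʳ u)) ateq))
        (step q0 d (δpush-none i b c z) (at-left u c (c [ i ]≔ bitF b) cs)
          (return q0 d q2 e0 (λ c → refl) refl u ((c [ i ]≔ bitF b) ∷ cs)
            (rep _ refl (tracks-update i s _ u c cs (bitF b) T′ (m ,
              trans (map-ʳ++′ (digit i) u q (cong₂ _∷_ (Vecₚ.lookup∘update i c (bitF b)) zs))
                (cong (λ y → map bitF y ʳ++ replicate m zero) (sym (Vecₚ.lookup∘update i s (b ∷ lookup s i)))))))))))) 
  where
  d = δpush i b
  arith : ∀ h → 1 + (h + (1 + (h + 1))) ≡ h + h + 3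
  arith = solve-∀
  cost : 1 + (length u + (1 + (length u + 1))) ≡ opCost (length (lookup s i))
  cost rewrite length-track {i} {s} u q = arith (length (lookup s i))

δpop-seek : ∀ i c b′ → digit i c ≡ bitF b′ → δpop i q1 (cell c) ≡ (inj₁ q1 , cell c , mR)
δpop-seek i c false eq rewrite eq = refl
δpop-seek i c true  eq rewrite eq = refl

δpop-none : ∀ i c → digit i c ≡ zero → δpop i q1 (cell c) ≡ (inj₁ q2 , cell c , mL)
δpop-none i c eq rewrite eq = refl

popState : Bool → Fin 5
popState false = q3
popState true  = q4

δpop-bit : ∀ i c b → digit i c ≡ bitF b → δpop i q2 (cell c) ≡ (inj₁ (popState b) , cell (c [ i ]≔ zero) , mL)
δpop-bit i c false eq rewrite eq = refl
δpop-bit i c true  eq rewrite eq = refl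

δpop-ret : ∀ i b c → δpop i (popState b) (cell c) ≡ (inj₁ (popState b) , cell c , mL)
δpop-ret i false c = refl
δpop-ret i true  c = refl

δpop-home : ∀ i b → δpop i (popState b) home ≡ (inj₂ (exB b) , home , mS)
δpop-home i false = refl
δpop-home i true  = refl

exec-pop-[] : ∀ i s → lookup s i ≡ [] → Exec (pop i) s (opCost 0) ((e0 , s) ∷ [])
exec-pop-[] i s eq t (rep r refl T) with seek-end i s r T
... | seekEnd (x ∷ u) r2 c cs m refl ateq T′ q z zs with () ← trans q (cong (map bitF) eq)
... | seekEnd [] r2 c cs m refl ateq T′ q z zs = step q0 d refl (home-right r2)
  (subst (λ z → Outs (pop i) q1 z _ _) (sym ateq)
    (step q0 d (δpop-none i c z) (at-left [] c c cs) (stop q0 d refl refl (rep _ refl T′))))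
  where
  d = δpop i

exec-pop-∷ : ∀ i s b bs → lookup s i ≡ b ∷ bs →
             Exec (pop i) s (opCost (length (lookup s i))) ((exB b , s [ i ]≔ bs) ∷ [])
exec-pop-∷ i s b bs eq t (rep r refl T) with seek-end i s r T
... | seekEnd [] r2 c cs m refl ateq T′ q z zs with () ← trans q (cong (map bitF) eq)
exec-pop-∷ i s b bs eq t (rep r refl T) | seekEnd (x ∷ u′) r2 c cs m refl ateq T′ q z zs = outs-≤ (≤-reflexive cost)
  (step q0 d refl (home-right ((x ∷ u′) ʳ++ r2))
    (seek q0 d i q1 (δpop-seek i) (x ∷ u′) [] r2 (lookup s i) q
      (subst (λ z → Outs (pop i) q1 z _ _) (sym (trans (cong (λ z → at z r2) (++-identityʳ (x ∷ u′))) ateq))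
        (step q0 d (δpop-none i c z) (at-left (x ∷ u′) c c cs)
          (step q0 d (δpop-bit i x b (∷-injectiveˡ q′)) (lf-left x (x [ i ]≔ zero) u′ (c ∷ cs))
            (return q0 d (popState b) (exB b) (δpop-ret i b) (δpop-home i b) u′ ((x [ i ]≔ zero) ∷ c ∷ cs)
              (rep _ refl (tracks-update i s bs u′ x (c ∷ cs) zero T′ (suc (suc m) ,
                trans (map-ʳ++′ (digit i) u′ (∷-injectiveʳ q′) (cong₂ _∷_ (Vecₚ.lookup∘update i x zero) (cong₂ _∷_ z zs)))
                  (cong (λ y → map bitF y ʳ++ replicate (suc (suc m)) zero) (sym (Vecₚ.lookup∘update i s bs)))))))))))) 
  where
  d = δpop i
  q′ : map (digit i) (x ∷ u′) ≡ map bitF (b ∷ bs)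
  q′ = trans q (cong (map bitF) eq)
  arith : ∀ h → 1 + ((1 + h) + (1 + (1 + (h + 1)))) ≡ suc h + suc h + 3
  arith = solve-∀
  cost : 1 + (length (x ∷ u′) + (1 + (1 + (length u′ + 1)))) ≡ opCost (length (lookup s i))
  cost rewrite sym (length-track {i} {s} (x ∷ u′) q) = arith (length u′)

≤-by : ∀ {a b} c → a + c ≡ b → a ≤ b
≤-by {a} c refl = m≤m+n a c

opCost-mono : ∀ {m n} → m ≤ n → opCost m ≤ opCost n
opCost-mono le = +-monoˡ-≤ 3 (+-mono-≤ le le)

-- k counts operations on stacks whose heights are at most B.
record Run (B : ℕ) (M : Mach) (s : Store) (k : ℕ) (e : Ex) (s′ : Store) : Set where
  constructor run
  field exec : Exec M s (k * opCost B) ((e , s′) ∷ [])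
open Run public

run-≤ : ∀ {B M s k k′ e s′} → k ≤ k′ → Run B M s k e s′ → Run B M s k′ e s′
run-≤ {B} le (run x) = run (exec-≤ (*-monoˡ-≤ (opCost B) le) x)

run-push : ∀ {B} i b s → length (lookup s i) ≤ B → Run B (push i b) s 1 e0 (s [ i ]≔ (b ∷ lookup s i))
run-push {B} i b s le = run (exec-≤ (≤-trans (opCost-mono le) (≤-reflexive (sym (*-identityˡ (opCost B))))) (exec-push i b s))

run-pop-[] : ∀ {B} i s → lookup s i ≡ [] → Run B (pop i) s 1 e0 s
run-pop-[] {B} i s eq = run (exec-≤ (≤-trans (opCost-mono {0} {B} z≤n) (≤-reflexive (sym (*-identityˡ (opCost B))))) (exec-pop-[] i s eq))

run-pop-∷ : ∀ {B} i s b bs → lookup s i ≡ b ∷ bs → length (b ∷ bs) ≤ B → Run B (pop i) s 1 (exB b) (s [ i ]≔ bs)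
run-pop-∷ {B} i s b bs eq le = run (exec-≤ (≤-trans (opCost-mono (≤-trans (≤-reflexive (cong length eq)) le)) (≤-reflexive (sym (*-identityˡ (opCost B))))) (exec-pop-∷ i s b bs eq))

run-skip : ∀ {B} e s → Run B (skipM e) s 1 e s
run-skip {B} e s = run λ { t (rep r refl T) → outs-≤ {n = 1} (≤-trans (s≤s z≤n) (≤-trans (m≤n+m 3 (B + B)) (m≤m+n _ _))) (det refl (out (rep r refl T))) }

run-bind : ∀ {B M N s k k′ e e′ s′ s″} → Run B M s k e s′ → Run B (N e) s′ k′ e′ s″ → Run B (bind M N) s (k + k′) e′ s″
run-bind {B} {M} {N} {k = k} {k′} {e′ = e′} {s″ = s″} (run x) (run y) =
  run (exec-≤ (≤-reflexive (sym (*-distribʳ-+ (opCost B) k k′))) (exec-bind M N x (y ∷ [])))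

seq : Mach → Mach → Mach
seq M N = bind M (λ _ → N)

opCost-pos : ∀ B → 1 ≤ opCost B
opCost-pos B = ≤-trans (s≤s z≤n) (m≤n+m 3 (B + B))

run-again : ∀ {B M s k k′ e s′ s″} → Run B M s k e1 s′ → Run B (loop M) s′ k′ e s″ → Run B (loop M) s (k + suc k′) e s″
run-again {B} {M} {k = k} {k′} {e} {s″ = s″} (run x) (run y) =
  run (exec-≤ (≤-trans (+-monoʳ-≤ (k * opCost B) (+-monoˡ-≤ (k′ * opCost B) (opCost-pos B))) (≤-reflexive (sym (*-distribʳ-+ (opCost B) k (suc k′)))))
    (exec-loop M x (y ∷ [])))

run-done : ∀ {B M s k s′} → Run B M s k e0 s′ → Run B (loop M) s (k + 1) e0 s′
run-done {B} {M} {k = k} {s′} (run x) =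
  run (exec-≤ (≤-trans (+-monoʳ-≤ (k * opCost B) (≤-trans (opCost-pos B) (≤-reflexive (sym (*-identityˡ (opCost B)))))) (≤-reflexive (sym (*-distribʳ-+ (opCost B) k 1))))
    (exec-loop M {m = 0} x (refl ∷ [])))

eachBody : Stack → (Bool → Mach) → Ex → Mach
eachBody i F e0 = skipM e0
eachBody i F e1 = seq (F false) (skipM e1)
eachBody i F e2 = seq (F true) (skipM e1)

each : Stack → (Bool → Mach) → Mach
each i F = loop (bind (pop i) (eachBody i F))

module _ {B : ℕ} {Y : Set} (i : Stack) (F : Bool → Mach) (S : List Bool → Y → Store) (st : Bool → Y → Y) (kF : ℕ)
  (look : ∀ ws y → lookup (S ws y) i ≡ ws) (upd : ∀ b ws y → S (b ∷ ws) y [ i ]≔ ws ≡ S ws y)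
  (μ : List Bool → Y → ℕ) (dec : ∀ b ws y → μ ws (st b y) ≤ μ (b ∷ ws) y) (len : ∀ ws y → length ws ≤ μ ws y)
  (body : ∀ b ws y → μ (b ∷ ws) y ≤ B → Run B (F b) (S ws y) kF e0 (S ws (st b y))) where

  -- The potential `μ` dominates the height of the consumed stack and never increases along the
  -- loop, so one inequality at the start secures the height condition of every iteration.
  run-each : ∀ ws y → μ ws y ≤ B →
             Run B (each i F) (S ws y) (length ws * (kF + 3) + 3) e0 (S [] (foldl (λ y b → st b y) y ws))
  run-each [] y le = run-done (run-bind (run-pop-[] i _ (look [] y)) (run-skip e0 _))
  run-each (b ∷ ws) y le = run-≤ (≤-reflexive (trans (arith kF (length ws * (kF + 3) + 3)) (sym (+-assoc (kF + 3) _ 3))))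
    (run-again (run-bind (run-pop-∷ i _ b ws (look (b ∷ ws) y) (≤-trans (len _ _) le))
      (subst (λ z → Run B (eachBody i F (exB b)) z _ e1 _) (sym (upd b ws y)) (sub b le)))
      (run-each ws (st b y) (≤-trans (dec b ws y) le)))
    where
    arith : ∀ k r → 1 + (k + 1) + suc r ≡ k + 3 + r
    arith = solve-∀
    sub : ∀ b → μ (b ∷ ws) y ≤ B → Run B (eachBody i F (exB b)) (S ws y) (kF + 1) e1 (S ws (st b y))
    sub false le = run-bind (body false ws y le) (run-skip e1 _)
    sub true  le = run-bind (body true ws y le) (run-skip e1 _)

-- Binary trees as stack contents

data D : Set where
  nil : D
  _∙_ : D → D → D
infixr 6 _∙_

-- Preorder is self-delimiting: a tree can be read off the top of a stack without knowing what lies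
-- below it.
ser : D → List Bool
ser nil     = false ∷ []
ser (a ∙ b) = true ∷ ser a ++ ser b

sz : D → ℕ
sz nil     = 1
sz (a ∙ b) = suc (sz a + sz b)

length-ser : ∀ d → length (ser d) ≡ sz d
length-ser nil     = refl
length-ser (a ∙ b) = cong suc (trans (length-++ (ser a)) (cong₂ _+_ (length-ser a) (length-ser b)))

sz-pos : ∀ d → 1 ≤ sz d
sz-pos nil     = s≤s z≤n
sz-pos (a ∙ b) = s≤s z≤n

length-ser++ : ∀ d v → length (ser d ++ v) ≡ sz d + length v
length-ser++ d v = trans (length-++ (ser d)) (cong (_+ length v) (length-ser d))

pattern sV = q0
pattern sX = q1
pattern sW = q2
pattern sC = q3

parkNode : Stack → Ex → Mach
parkNode i e0 = skipM e0
parkNode i e1 = seq (push sW false) (skipM e1)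
parkNode i e2 = seq (push sW true) (seq (push sC false) (seq (push sC false) (skipM e1)))

parkStep : Stack → Ex → Mach
parkStep i e0 = skipM e0
parkStep i e1 = bind (pop i) (parkNode i)
parkStep i e2 = skipM e0

parkLoop : Stack → Mach
parkLoop i = loop (bind (pop sC) (parkStep i))

-- The top tree of stack i moves to W, bit by bit and hence reversed; C holds one mark
-- for every subtree still to be read.
park : Stack → Mach
park i = seq (push sC false) (parkLoop i)

module _ (i : Stack) (S : (a w c : List Bool) → Store)
  (li : ∀ a w c → lookup (S a w c) i ≡ a) (lW : ∀ a w c → lookup (S a w c) sW ≡ w) (lC : ∀ a w c → lookup (S a w c) sC ≡ c)
  (ui : ∀ a w c a′ → S a w c [ i ]≔ a′ ≡ S a′ w c) (uW : ∀ a w c w′ → S a w c [ sW ]≔ w′ ≡ S a w′ c)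
  (uC : ∀ a w c c′ → S a w c [ sC ]≔ c′ ≡ S a w c′) (B : ℕ) where

  private
    popi : ∀ b a w c → length (b ∷ a) ≤ B → Run B (pop i) (S (b ∷ a) w c) 1 (exB b) (S a w c)
    popi b a w c le = subst (λ z → Run B (pop i) (S (b ∷ a) w c) 1 (exB b) z) (ui _ w c a) (run-pop-∷ i _ b a (li _ w c) le)
    popC : ∀ a w k → suc k ≤ B → Run B (pop sC) (S a w (replicate (suc k) false)) 1 e1 (S a w (replicate k false))
    popC a w k le = subst (λ z → Run B (pop sC) (S a w (replicate (suc k) false)) 1 e1 z) (uC a w _ _)
      (run-pop-∷ sC _ false _ (lC a w _) (≤-trans (≤-reflexive (cong suc (length-replicate k))) le))
    pushW : ∀ b a w c → length w ≤ B → Run B (push sW b) (S a w c) 1 e0 (S a (b ∷ w) c)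
    pushW b a w c le = subst (λ z → Run B (push sW b) (S a w c) 1 e0 z)
      (trans (cong (λ y → S a w c [ sW ]≔ (b ∷ y)) (lW a w c)) (uW a w c _))
      (run-push sW b _ (≤-trans (≤-reflexive (cong length (lW a w c))) le))
    pushC : ∀ a w k → k ≤ B → Run B (push sC false) (S a w (replicate k false)) 1 e0 (S a w (replicate (suc k) false))
    pushC a w k le = subst (λ z → Run B (push sC false) (S a w (replicate k false)) 1 e0 z)
      (trans (cong (λ y → S a w (replicate k false) [ sC ]≔ (false ∷ y)) (lC a w _)) (uC a w _ _))
      (run-push sC false _ (≤-trans (≤-reflexive (trans (cong length (lC a w _)) (length-replicate k))) le))

  -- The loop has no exit at the end of a subtree, so the remainder of its run is a hypothesis and
  -- the recursion passes it on. An inner node costs 7: two pops, three pushes, a skip and the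
  -- restart; a leaf costs less.
  parse : ∀ d R w k {K s″} → length R + length w + k + 2 * sz d ≤ B →
          Run B (parkLoop i) (S R (ser d ʳ++ w) (replicate k false)) K e0 s″ →
          Run B (parkLoop i) (S (ser d ++ R) w (replicate (suc k) false)) (7 * sz d + K) e0 s″
  parse nil R w k {K} le r = run-≤ (+-monoˡ-≤ K (≤-by {5} 2 refl))
    (run-again (run-bind (popC _ w k (≤-trans (≤-by (length R + length w + 1) (a1 (length R) (length w) k)) le))
      (run-bind (popi false R w _ (≤-trans (≤-by (length w + k + 1) (a2 (length R) (length w) k)) le))
        (run-bind (pushW false R w _ (≤-trans (≤-by (length R + k + 2) (a3 (length R) (length w) k)) le)) (run-skip e1 _)))) r)
    where
    a1 : ∀ R w k → suc k + (R + w + 1) ≡ R + w + k + 2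
    a1 = solve-∀
    a2 : ∀ R w k → suc R + (w + k + 1) ≡ R + w + k + 2
    a2 = solve-∀
    a3 : ∀ R w k → w + (R + k + 2) ≡ R + w + k + 2
    a3 = solve-∀
  parse (a ∙ b) R w k {K} le r
    rewrite ++-assoc (ser a) (ser b) R = run-≤ (≤-reflexive (a0 (sz a) (sz b) K))
    (run-again (run-bind (popC _ w k (≤-trans (≤-by _ (a1 (length R) (length w) k (sz a) (sz b))) le))
      (run-bind (popi true (ser a ++ ser b ++ R) w _ (≤-trans (≤-by (length w + k + sz a + sz b + 1) (trans (cong (λ z → suc z + _) lenA) (a2 (length R) (length w) k (sz a) (sz b)))) le))
        (run-bind (pushW true _ w _ (≤-trans (≤-by _ (a3 (length R) (length w) k (sz a) (sz b))) le))
          (run-bind (pushC _ _ k (≤-trans (≤-by _ (a4 (length R) (length w) k (sz a) (sz b))) le))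
            (run-bind (pushC _ _ (suc k) (≤-trans (≤-by _ (a1 (length R) (length w) k (sz a) (sz b))) le)) (run-skip e1 _))))))
      (parse a (ser b ++ R) (true ∷ w) (suc k)
        (≤-trans (≤-by (sz b) (trans (cong (λ z → z + suc (length w) + suc k + 2 * sz a + sz b) (length-ser++ b R)) (a5 (length R) (length w) k (sz a) (sz b)))) le)
        (parse b R (ser a ʳ++ true ∷ w) k
          (≤-trans (≤-by (sz a + 1) (trans (cong (λ z → length R + z + k + 2 * sz b + (sz a + 1)) (trans (length-ʳ++ (ser a)) (cong (_+ suc (length w)) (length-ser a)))) (a6 (length R) (length w) k (sz a) (sz b)))) le)
          (subst (λ z → Run B (parkLoop i) (S R z (replicate k false)) K e0 _) (++-ʳ++ (ser a)) r))))
    where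
    lenA : length (ser a ++ ser b ++ R) ≡ sz a + (sz b + length R)
    lenA = trans (length-ser++ a (ser b ++ R)) (cong (sz a +_) (length-ser++ b R))
    a0 : ∀ a b K → 1 + (1 + (1 + (1 + (1 + 1)))) + suc (7 * a + (7 * b + K)) ≡ 7 * suc (a + b) + K
    a0 = solve-∀
    a1 : ∀ R w k a b → suc k + (R + w + 2 * a + 2 * b + 1) ≡ R + w + k + 2 * suc (a + b)
    a1 = solve-∀
    a2 : ∀ R w k a b → suc (a + (b + R)) + (w + k + a + b + 1) ≡ R + w + k + 2 * suc (a + b)
    a2 = solve-∀
    a3 : ∀ R w k a b → w + (R + k + 2 * suc (a + b)) ≡ R + w + k + 2 * suc (a + b)
    a3 = solve-∀
    a4 : ∀ R w k a b → k + (R + w + 2 * suc (a + b)) ≡ R + w + k + 2 * suc (a + b)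
    a4 = solve-∀
    a5 : ∀ R w k a b → b + R + suc w + suc k + 2 * a + b ≡ R + w + k + 2 * suc (a + b)
    a5 = solve-∀
    a6 : ∀ R w k a b → R + (a + suc w) + k + 2 * b + (a + 1) ≡ R + w + k + 2 * suc (a + b)
    a6 = solve-∀

  run-park : ∀ d R w → length R + length w + 2 * sz d ≤ B →
             Run B (park i) (S (ser d ++ R) w []) (7 * sz d + 4) e0 (S R (ser d ʳ++ w) [])
  run-park d R w le = run-≤ (≤-reflexive (a0 (sz d))) (run-bind (pushC _ w 0 z≤n)
    (parse d R w 0 (≤-trans (≤-reflexive (cong (_+ 2 * sz d) (+-identityʳ (length R + length w)))) le)
      (run-done (run-bind (run-pop-[] sC _ (lC _ _ [])) (run-skip e0 _)))))
    where
    a0 : ∀ n → 1 + (7 * n + 3) ≡ 7 * n + 4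
    a0 = solve-∀

st2 : List Bool → List Bool → Store
st2 v x = v ∷ x ∷ [] ∷ [] ∷ []

moveM : Stack → Stack → Mach
moveM i j = seq (park i) (each sW (push j))

dupM : Mach
dupM = seq (park sV) (seq (each sW (λ b → seq (push sV b) (push sX b))) (moveM sX sV))

dropM : Mach
dropM = seq (park sV) (each sW (λ _ → skipM e0))

len-rev : ∀ d → length (ser d ʳ++ []) ≡ sz d
len-rev d = trans (length-ʳ++ (ser d)) (trans (+-identityʳ _) (length-ser d))

-- A common bound for the tree operations; the most expensive one, `dupM`, takes at most 37
-- operations per node.
treeCost : ℕ → ℕ
treeCost n = 40 * n

≤-lin : ∀ n a b → 1 ≤ n → a * n + b ≤ (a + b) * n
≤-lin n a b p = ≤-trans (+-monoʳ-≤ (a * n) (≤-trans (≤-reflexive (sym (*-identityʳ b))) (*-monoʳ-≤ b p))) (≤-reflexive (sym (*-distribʳ-+ n a b)))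

private
  parkV : ∀ {B} d R x → length R + length x + 4 * sz d ≤ B →
          Run B (park sV) (st2 (ser d ++ R) x) (7 * sz d + 4) e0 (R ∷ x ∷ (ser d ʳ++ []) ∷ [] ∷ [])
  parkV {B} d R x le = run-park sV (λ a w c → a ∷ x ∷ w ∷ c ∷ []) (λ _ _ _ → refl) (λ _ _ _ → refl) (λ _ _ _ → refl)
    (λ _ _ _ _ → refl) (λ _ _ _ _ → refl) (λ _ _ _ _ → refl) B d R [] (≤-trans (≤-by (length x + 2 * sz d) (a (length R) (length x) (sz d))) le)
    where
    a : ∀ R x n → R + 0 + 2 * n + (x + 2 * n) ≡ R + x + 4 * n
    a = solve-∀

  parkX : ∀ {B} d v R → length v + length R + 4 * sz d ≤ B →
          Run B (park sX) (st2 v (ser d ++ R)) (7 * sz d + 4) e0 (v ∷ R ∷ (ser d ʳ++ []) ∷ [] ∷ [])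
  parkX {B} d v R le = run-park sX (λ a w c → v ∷ a ∷ w ∷ c ∷ []) (λ _ _ _ → refl) (λ _ _ _ → refl) (λ _ _ _ → refl)
    (λ _ _ _ _ → refl) (λ _ _ _ _ → refl) (λ _ _ _ _ → refl) B d R [] (≤-trans (≤-by (length v + 2 * sz d) (a (length v) (length R) (sz d))) le)
    where
    a : ∀ v R n → R + 0 + 2 * n + (v + 2 * n) ≡ v + R + 4 * n
    a = solve-∀

  flushX : ∀ {B} d v x → length v + length x + 4 * sz d ≤ B →
           Run B (each sW (push sX)) (v ∷ x ∷ (ser d ʳ++ []) ∷ [] ∷ []) (sz d * 4 + 3) e0 (st2 v (ser d ++ x))
  flushX {B} d v x le = subst₂ (λ k y → Run B (each sW (push sX)) (v ∷ x ∷ (ser d ʳ++ []) ∷ [] ∷ []) (k * 4 + 3) e0 (st2 v y)) (len-rev d) (ʳ++-ʳ++ (ser d))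
    (run-each sW (push sX) (λ ws y → v ∷ y ∷ ws ∷ [] ∷ []) _∷_ 1 (λ _ _ → refl) (λ _ _ _ → refl)
      (λ ws y → length ws + length y) (λ b ws y → ≤-reflexive (+-suc (length ws) (length y))) (λ ws y → m≤m+n _ _)
      (λ b ws y le → run-push sX b _ (≤-trans (m≤n+m _ _) le)) (ser d ʳ++ []) x
      (≤-trans (≤-by (length v + 3 * sz d) (trans (cong (λ z → z + length x + (length v + 3 * sz d)) (len-rev d)) (a (length v) (length x) (sz d)))) le))
    where
    a : ∀ v x n → n + x + (v + 3 * n) ≡ v + x + 4 * n
    a = solve-∀

  flushV : ∀ {B} d v x → length v + length x + 4 * sz d ≤ B →
           Run B (each sW (push sV)) (v ∷ x ∷ (ser d ʳ++ []) ∷ [] ∷ []) (sz d * 4 + 3) e0 (st2 (ser d ++ v) x)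
  flushV {B} d v x le = subst₂ (λ k y → Run B (each sW (push sV)) (v ∷ x ∷ (ser d ʳ++ []) ∷ [] ∷ []) (k * 4 + 3) e0 (st2 y x)) (len-rev d) (ʳ++-ʳ++ (ser d))
    (run-each sW (push sV) (λ ws y → y ∷ x ∷ ws ∷ [] ∷ []) _∷_ 1 (λ _ _ → refl) (λ _ _ _ → refl)
      (λ ws y → length ws + length y) (λ b ws y → ≤-reflexive (+-suc (length ws) (length y))) (λ ws y → m≤m+n _ _)
      (λ b ws y le → run-push sV b _ (≤-trans (m≤n+m _ _) le)) (ser d ʳ++ []) v
      (≤-trans (≤-by (length x + 3 * sz d) (trans (cong (λ z → z + length v + (length x + 3 * sz d)) (len-rev d)) (a (length v) (length x) (sz d)))) le))
    where
    a : ∀ v x n → n + v + (x + 3 * n) ≡ v + x + 4 * n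
    a = solve-∀

  pushBoth : List Bool × List Bool → List Bool → List Bool × List Bool
  pushBoth = foldl (λ y b → b ∷ proj₁ y , b ∷ proj₂ y)

  pushBoth-spec : ∀ ws v x → pushBoth (v , x) ws ≡ (ws ʳ++ v , ws ʳ++ x)
  pushBoth-spec [] v x = refl
  pushBoth-spec (b ∷ ws) v x = pushBoth-spec ws (b ∷ v) (b ∷ x)

  flushBoth : ∀ {B} d v x → length v + length x + 4 * sz d ≤ B →
              Run B (each sW (λ b → seq (push sV b) (push sX b))) (v ∷ x ∷ (ser d ʳ++ []) ∷ [] ∷ []) (sz d * 5 + 3) e0
                (st2 (ser d ++ v) (ser d ++ x))
  flushBoth {B} d v x le = subst₂ (λ k y → Run B F (v ∷ x ∷ (ser d ʳ++ []) ∷ [] ∷ []) (k * 5 + 3) e0 (st2 (proj₁ y) (proj₂ y)))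
    (len-rev d) (trans (pushBoth-spec (ser d ʳ++ []) v x) (cong₂ _,_ (ʳ++-ʳ++ (ser d)) (ʳ++-ʳ++ (ser d))))
    (run-each sW _ (λ ws y → proj₁ y ∷ proj₂ y ∷ ws ∷ [] ∷ []) (λ b y → b ∷ proj₁ y , b ∷ proj₂ y) 2 (λ _ _ → refl) (λ _ _ _ → refl)
      (λ ws y → 2 * length ws + length (proj₁ y) + length (proj₂ y)) (λ b ws y → ≤-reflexive (a (length ws) (length (proj₁ y)) (length (proj₂ y))))
      (λ ws y → ≤-trans (m≤m+n _ _) (≤-trans (m≤m+n _ _) (m≤m+n _ _)))
      (λ b ws y le → run-bind (run-push sV b _ (≤-trans (≤-trans (m≤n+m (length (proj₁ y)) (2 * length (b ∷ ws))) (m≤m+n _ (length (proj₂ y)))) le)) (run-push sX b _ (≤-trans (m≤n+m _ _) le)))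
      (ser d ʳ++ []) (v , x)
      (≤-trans (≤-by (2 * sz d) (trans (cong (λ z → 2 * z + length v + length x + 2 * sz d) (len-rev d)) (a′ (length v) (length x) (sz d)))) le))
    where
    F : Mach
    F = each sW (λ b → seq (push sV b) (push sX b))
    a : ∀ w v x → 2 * w + suc v + suc x ≡ 2 * suc w + v + x
    a = solve-∀
    a′ : ∀ v x n → 2 * n + v + x + 2 * n ≡ v + x + 4 * n
    a′ = solve-∀

  flushNone : ∀ {B} d v x → length v + length x + 4 * sz d ≤ B →
              Run B (each sW (λ _ → skipM e0)) (v ∷ x ∷ (ser d ʳ++ []) ∷ [] ∷ []) (sz d * 4 + 3) e0 (st2 v x)
  flushNone {B} d v x le = subst (λ k → Run B (each sW (λ _ → skipM e0)) (v ∷ x ∷ (ser d ʳ++ []) ∷ [] ∷ []) (k * 4 + 3) e0 (st2 v x)) (len-rev d)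
    (run-each sW _ (λ ws _ → v ∷ x ∷ ws ∷ [] ∷ []) (λ _ y → y) 1 (λ _ _ → refl) (λ _ _ _ → refl)
      (λ ws _ → length ws) (λ b ws y → n≤1+n _) (λ ws y → ≤-refl)
      (λ b ws y le → run-skip e0 _) (ser d ʳ++ []) tt
      (≤-trans (≤-by (length v + length x + 3 * sz d) (trans (cong (_+ (length v + length x + 3 * sz d)) (len-rev d)) (a (length v) (length x) (sz d)))) le))
    where
    a : ∀ v x n → n + (v + x + 3 * n) ≡ v + x + 4 * n
    a = solve-∀

run-mvVX : ∀ {B} d v x → length v + length x + 4 * sz d ≤ B →
           Run B (moveM sV sX) (st2 (ser d ++ v) x) (treeCost (sz d)) e0 (st2 v (ser d ++ x))
run-mvVX d v x le = run-≤ (≤-trans (≤-reflexive (a (sz d))) (≤-trans (≤-lin (sz d) 11 7 (sz-pos d)) (*-monoˡ-≤ (sz d) (≤-by {18} 22 refl))))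
  (run-bind (parkV d v x le) (flushX d v x le))
  where
  a : ∀ n → 7 * n + 4 + (n * 4 + 3) ≡ 11 * n + 7
  a = solve-∀

run-mvXV : ∀ {B} d v x → length v + length x + 4 * sz d ≤ B →
           Run B (moveM sX sV) (st2 v (ser d ++ x)) (18 * sz d) e0 (st2 (ser d ++ v) x)
run-mvXV d v x le = run-≤ (≤-trans (≤-reflexive (a (sz d))) (≤-lin (sz d) 11 7 (sz-pos d)))
  (run-bind (parkX d v x le) (flushV d v x le))
  where
  a : ∀ n → 7 * n + 4 + (n * 4 + 3) ≡ 11 * n + 7
  a = solve-∀

run-dup : ∀ {B} d v x → length v + length x + 5 * sz d ≤ B →
          Run B dupM (st2 (ser d ++ v) x) (treeCost (sz d)) e0 (st2 (ser d ++ ser d ++ v) x)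
run-dup {B} d v x le = run-≤ (≤-trans (≤-reflexive (a (sz d))) (≤-trans (≤-lin (sz d) 30 7 (sz-pos d)) (*-monoˡ-≤ (sz d) (≤-by {37} 3 refl))))
  (run-bind (parkV d v x le′) (run-bind (flushBoth d v x le′)
    (run-mvXV d (ser d ++ v) x (≤-trans (≤-reflexive (trans (cong (λ z → z + length x + 4 * sz d) (length-ser++ d v)) (a″ (length v) (length x) (sz d)))) le))))
  where
  a : ∀ n → 7 * n + 4 + (n * 5 + 3 + 18 * n) ≡ 30 * n + 7
  a = solve-∀
  a″ : ∀ v x n → n + v + x + 4 * n ≡ v + x + 5 * n
  a″ = solve-∀
  le′ : length v + length x + 4 * sz d ≤ B
  le′ = ≤-trans (+-monoʳ-≤ (length v + length x) (*-monoˡ-≤ (sz d) (≤-by {4} 1 refl))) le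

run-drop : ∀ {B} d v x → length v + length x + 4 * sz d ≤ B →
           Run B dropM (st2 (ser d ++ v) x) (treeCost (sz d)) e0 (st2 v x)
run-drop d v x le = run-≤ (≤-trans (≤-reflexive (a (sz d))) (≤-trans (≤-lin (sz d) 11 7 (sz-pos d)) (*-monoˡ-≤ (sz d) (≤-by {18} 22 refl))))
  (run-bind (parkV d v x le) (flushNone d v x le))
  where
  a : ∀ n → 7 * n + 4 + (n * 4 + 3) ≡ 11 * n + 7
  a = solve-∀

pushAll : List Bool → Mach
pushAll []       = skipM e0
pushAll (b ∷ bs) = seq (pushAll bs) (push sV b)

run-pushAll : ∀ {B} bs v x → length bs + length v ≤ B →
              Run B (pushAll bs) (st2 v x) (length bs + 1) e0 (st2 (bs ++ v) x)
run-pushAll [] v x le = run-skip e0 _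
run-pushAll (b ∷ bs) v x le = run-≤ (≤-reflexive (+-comm (length bs + 1) 1))
  (run-bind (run-pushAll bs v x (≤-trans (n≤1+n _) le))
    (run-push sV b _ (≤-trans (≤-reflexive (length-++ bs)) (≤-trans (n≤1+n _) le))))

popAll : ℕ → Mach
popAll zero    = skipM e0
popAll (suc n) = bind (pop sV) (λ _ → popAll n)

run-popAll : ∀ {B} bs v x → length bs + length v ≤ B →
             Run B (popAll (length bs)) (st2 (bs ++ v) x) (length bs + 1) e0 (st2 v x)
run-popAll [] v x le = run-skip e0 _
run-popAll (b ∷ bs) v x le = run-bind (run-pop-∷ sV _ b (bs ++ v) refl (≤-trans (≤-reflexive (cong suc (length-++ bs))) le))
  (run-popAll bs v x (≤-trans (n≤1+n _) le))

-- Polynomial-time functions on structured data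

data Poly : Set where
  var         : Poly
  con         : ℕ → Poly
  _⊕_ _⊗_ _⊚_ : Poly → Poly → Poly
infixl 6 _⊕_
infixl 7 _⊗_
infixr 8 _⊚_

ev : Poly → ℕ → ℕ
ev var     n = n
ev (con c) n = c
ev (p ⊕ q) n = ev p n + ev q n
ev (p ⊗ q) n = ev p n * ev q n
ev (p ⊚ q) n = ev p (ev q n)

ev-mono : ∀ p {m n} → m ≤ n → ev p m ≤ ev p n
ev-mono var     le = le
ev-mono (con c) le = ≤-refl
ev-mono (p ⊕ q) le = +-mono-≤ (ev-mono p le) (ev-mono q le)
ev-mono (p ⊗ q) le = *-mono-≤ (ev-mono p le) (ev-mono q le)
ev-mono (p ⊚ q) le = ev-mono p (ev-mono q le)

record Enc (A : Set) : Set where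
  field enc : A → D
open Enc ⦃ ... ⦄ public

-- Both truth values get codes of the same size.
encBool : Bool → D
encBool false = nil ∙ nil ∙ nil
encBool true  = (nil ∙ nil) ∙ nil

encℕ : ℕ → D
encℕ zero    = nil
encℕ (suc n) = nil ∙ encℕ n

encList : ∀ {A : Set} → (A → D) → List A → D
encList f []       = nil
encList f (x ∷ xs) = f x ∙ encList f xs

instance
  Enc⊤ : Enc ⊤
  Enc⊤ .enc _ = nil
  EncBool : Enc Bool
  EncBool .enc = encBool
  Encℕ : Enc ℕ
  Encℕ .enc = encℕ
  Enc× : ∀ {A B : Set} → ⦃ Enc A ⦄ → ⦃ Enc B ⦄ → Enc (A × B)
  Enc× .enc (a , b) = enc a ∙ enc b
  EncList : ∀ {A : Set} → ⦃ Enc A ⦄ → Enc (List A)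
  EncList .enc = encList enc

size : ∀ {A : Set} → ⦃ Enc A ⦄ → A → ℕ
size a = sz (enc a)

-- One polynomial bounds the number of operations, the space above the given heights and the size of
-- the result. The contents below the argument are arbitrary, so a machine can run in the middle of
-- a larger computation.
record PT {A B : Set} ⦃ eA : Enc A ⦄ ⦃ eB : Enc B ⦄ (f : A → B) : Set₁ where
  field
    mach  : Mach
    bnd   : Poly
    runs  : ∀ a v x B → length v + length x + ev bnd (size a) ≤ B →
            Run B mach (st2 (ser (enc a) ++ v) x) (ev bnd (size a)) e0 (st2 (ser (enc (f a)) ++ v) x)
    small : ∀ a → size (f a) ≤ ev bnd (size a)
open PT public

-- Stack heights are measured as multiples of a scale m above the initial heights.
record Lim (m b i : ℕ) (l : List Bool) : Set where
  constructor lim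
  field lim≤ : length l ≤ b + i * m
open Lim public

record Sc (k a m : ℕ) : Set where
  constructor sc
  field sc≤ : k ≤ a * m
open Sc public

lim0 : ∀ {m l} → Lim m (length l) 0 l
lim0 {l = l} = lim (≤-reflexive (sym (+-identityʳ (length l))))

lim+ : ∀ {m b i l} d → sz d ≤ m → Lim m b i l → Lim m b (suc i) (ser d ++ l)
lim+ {m} {b} {i} {l} d le (lim h) = lim (≤-trans (≤-reflexive (length-ser++ d l)) (≤-trans (+-mono-≤ le h) (≤-reflexive (a m b (i * m)))))
  where
  a : ∀ m b k → m + (b + k) ≡ b + (m + k)
  a = solve-∀

-- In every use the coefficients are literals, so the comparison with 200 is settled by evaluation.
-- The number 200 is a generous constant that covers all the machines built below.
room : ∀ {m b c i j l v x k B} → Lim m b i v → Lim m c j x → Sc k l m → {T (i + j + l ≤ᵇ 200)} →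
       b + c + 200 * m ≤ B → length v + length x + k ≤ B
room {m} {b} {c} {i} {j} {l} (lim hv) (lim hx) (sc hk) {t} h = ≤-trans (+-mono-≤ (+-mono-≤ hv hx) hk)
  (≤-trans (≤-reflexive (a b c i j l m)) (≤-trans (+-monoʳ-≤ (b + c) (*-monoˡ-≤ m (≤ᵇ⇒≤ (i + j + l) 200 t))) h))
  where
  a : ∀ b c i j l m → b + i * m + (c + j * m) + l * m ≡ b + c + (i + j + l) * m
  a = solve-∀

none : ∀ {m} → Sc 0 0 m
none = sc z≤n

one : ∀ {k m} → k ≤ m → Sc k 1 m
one {m = m} le = sc (≤-trans le (≤-reflexive (sym (*-identityˡ m))))

infixr 4 _⊞_
_⊞_ : ∀ {m a b k l} → Sc k a m → Sc l b m → Sc (k + l) (a + b) m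
_⊞_ {m} {a} {b} (sc h) (sc h′) = sc (≤-trans (+-mono-≤ h h′) (≤-reflexive (sym (*-distribʳ-+ m a b))))

within : ∀ {m k a} → Sc k a m → {T (a ≤ᵇ 200)} → k ≤ 200 * m
within {m} {a = a} (sc h) {t} = ≤-trans h (*-monoˡ-≤ m (≤ᵇ⇒≤ a 200 t))

scale : ∀ {m n} k → n ≤ m → Sc (k * n) k m
scale k le = sc (*-monoʳ-≤ k le)

heightX : ∀ {m b c i j v x B} → Lim m b i v → Lim m c j x → {T (i + j + 0 ≤ᵇ 200)} → b + c + 200 * m ≤ B → length x ≤ B
heightX {v = v} hv hx {t} h = ≤-trans (≤-trans (m≤n+m _ (length v)) (m≤m+n _ 0)) (room hv hx none {t} h)

height : ∀ {m b c i j v x B} → Lim m b i v → Lim m c j x → {T (i + j + 0 ≤ᵇ 200)} → b + c + 200 * m ≤ B → length v ≤ B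
height hv hx {t} h = ≤-trans (≤-trans (m≤m+n _ _) (m≤m+n _ 0)) (room hv hx none {t} h)

module _ {A B : Set} ⦃ eA : Enc A ⦄ ⦃ eB : Enc B ⦄ where

  recodePT : (f : A → B) → (∀ a → enc (f a) ≡ enc a) → PT f
  recodePT f eq .mach = skipM e0
  recodePT f eq .bnd = var
  recodePT f eq .runs a v x B le rewrite eq a = run-≤ (sz-pos (enc a)) (run-skip e0 _)
  recodePT f eq .small a rewrite eq a = ≤-refl

  respPT : ∀ {f g : A → B} → (∀ a → f a ≡ g a) → PT f → PT g
  respPT eq p .mach = mach p
  respPT eq p .bnd = bnd p
  respPT eq p .runs a v x B le = subst (λ z → Run B (mach p) _ _ e0 (st2 (ser (enc z) ++ v) x)) (eq a) (runs p a v x B le)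
  respPT eq p .small a = subst (λ z → size z ≤ _) (eq a) (small p a)

  constPT : (b : B) → PT {A} (λ _ → b)
  constPT b .mach = seq dropM (pushAll (ser (enc b)))
  constPT b .bnd = con 200 ⊗ (var ⊕ con (size b))
  constPT b .runs a v x B le =
    run-≤ (within (scale 40 hn ⊞ (one (≤-trans (≤-reflexive (length-ser (enc b))) hb) ⊞ one (≤-trans (sz-pos (enc a)) hn))))
      (run-bind (run-drop (enc a) v x (room (lim0 {m} {v}) (lim0 {m} {x}) (scale 4 hn) le))
        (run-pushAll (ser (enc b)) v x (≤-trans (≤-reflexive (sym (length-++ (ser (enc b))))) (height (lim+ (enc b) hb (lim0 {m} {v})) (lim0 {m} {x}) le))))
    where
    m = size a + size b
    hn : size a ≤ m
    hn = m≤m+n _ _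
    hb : size b ≤ m
    hb = m≤n+m _ _
  constPT b .small a = ≤-trans (m≤n+m (size b) (size a)) (m≤m+n _ _)

idPT : ∀ {A : Set} ⦃ eA : Enc A ⦄ → PT {A} id
idPT = recodePT id (λ _ → refl)

module _ {A B C : Set} ⦃ eA : Enc A ⦄ ⦃ eB : Enc B ⦄ ⦃ eC : Enc C ⦄ where

  infixr 9 _∘ₚ_
  _∘ₚ_ : {g : B → C} {f : A → B} → PT g → PT f → PT (λ a → g (f a))
  (_∘ₚ_ {g} {f} pg pf) .mach = seq (mach pf) (mach pg)
  (_∘ₚ_ {g} {f} pg pf) .bnd = bnd pf ⊕ (bnd pg ⊚ bnd pf)
  (_∘ₚ_ {g} {f} pg pf) .runs a v x B le =
    run-≤ (+-monoʳ-≤ (ev (bnd pf) (size a)) hg)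
      (run-bind (runs pf a v x B (≤-trans (+-monoʳ-≤ (length v + length x) (m≤m+n _ _)) le))
        (runs pg (f a) v x B (≤-trans (+-monoʳ-≤ (length v + length x) (≤-trans hg (m≤n+m _ _))) le)))
    where
    hg : ev (bnd pg) (size (f a)) ≤ ev (bnd pg) (ev (bnd pf) (size a))
    hg = ev-mono (bnd pg) (small pf a)
  (_∘ₚ_ {g} {f} pg pf) .small a = ≤-trans (small pg (f a)) (≤-trans (ev-mono (bnd pg) (small pf a)) (m≤n+m _ _))

  infixr 4 _,ₚ_
  _,ₚ_ : {f : A → B} {g : A → C} → PT f → PT g → PT (λ a → f a , g a)
  (_,ₚ_ {f} {g} pf pg) .mach = seq dupM (seq (mach pf) (seq (moveM sV sX) (seq (mach pg) (seq (moveM sX sV) (push sV true)))))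
  (_,ₚ_ {f} {g} pf pg) .bnd = con 200 ⊗ (var ⊕ bnd pf ⊕ bnd pg)
  (_,ₚ_ {f} {g} pf pg) .runs a v x B le =
    run-≤ cost
      (run-bind (run-dup (enc a) v x (room (lim0 {m} {v}) (lim0 {m} {x}) (scale 5 hn) le))
      (run-bind (runs pf a (ser (enc a) ++ v) x B (room (lim+ (enc a) hn (lim0 {m} {v})) (lim0 {m} {x}) (one hF) le))
      (run-bind (run-mvVX (enc (f a)) _ x (room (lim+ (enc a) hn (lim0 {m} {v})) (lim0 {m} {x}) (scale 4 hf) le))
      (run-bind (runs pg a v _ B (room (lim0 {m} {v}) (lim+ (enc (f a)) hf (lim0 {m} {x})) (one hG) le))
      (run-bind (run-mvXV (enc (f a)) _ x (room (lim+ (enc (g a)) hg (lim0 {m} {v})) (lim0 {m} {x}) (scale 4 hf) le))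
        (subst (λ z → Run B (push sV true) (st2 (ser (enc (f a)) ++ ser (enc (g a)) ++ v) x) 1 e0 (st2 (true ∷ z) x)) (sym (++-assoc (ser (enc (f a))) _ v))
          (run-push sV true _ (height (lim+ (enc (f a)) hf (lim+ (enc (g a)) hg (lim0 {m} {v}))) (lim0 {m} {x}) le))))))))
    where
    m = size a + ev (bnd pf) (size a) + ev (bnd pg) (size a)
    hn : size a ≤ m
    hn = ≤-trans (m≤m+n _ _) (m≤m+n _ _)
    hF : ev (bnd pf) (size a) ≤ m
    hF = ≤-trans (m≤n+m _ (size a)) (m≤m+n _ _)
    hG : ev (bnd pg) (size a) ≤ m
    hG = m≤n+m _ _
    hf : size (f a) ≤ m
    hf = ≤-trans (small pf a) hF
    hg : size (g a) ≤ m
    hg = ≤-trans (small pg a) hG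
    cost : treeCost (size a) + (ev (bnd pf) (size a) + (treeCost (size (f a)) + (ev (bnd pg) (size a) + (18 * size (f a) + 1)))) ≤ 200 * m
    cost = within (scale 40 hn ⊞ (one hF ⊞ (scale 40 hf ⊞ (one hG ⊞ (scale 18 hf ⊞ one (≤-trans (sz-pos (enc a)) hn))))))
  (_,ₚ_ {f} {g} pf pg) .small a = ≤-trans (+-mono-≤ (sz-pos (enc a)) (+-mono-≤ (small pf a) (small pg a)))
    (≤-trans (≤-reflexive (sym (+-assoc (size a) _ _))) (m≤m+n _ _))

module _ {A B : Set} ⦃ eA : Enc A ⦄ ⦃ eB : Enc B ⦄ where

  fstPT : PT {A × B} proj₁
  fstPT .mach = bind (pop sV) (λ _ → seq (moveM sV sX) (seq dropM (moveM sX sV)))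
  fstPT .bnd = con 200 ⊗ var
  fstPT .runs (a , b) v x B le rewrite ++-assoc (ser (enc a)) (ser (enc b)) v =
    run-≤ (within (one hm ⊞ (scale 40 ha ⊞ (scale 40 hb ⊞ scale 18 ha))))
      (run-bind (run-pop-∷ sV _ true (ser (enc a) ++ ser (enc b) ++ v) refl
        (≤-trans (≤-reflexive (trans (cong suc (trans (length-ser++ (enc a) _) (cong (size a +_) (length-ser++ (enc b) v)))) (cong suc (sym (+-assoc (size a) _ _)))))
          (≤-trans (≤-by (length x) (ar m (length v) (length x))) (room (lim0 {m} {v}) (lim0 {m} {x}) (one ≤-refl) le))))
      (run-bind (run-mvVX (enc a) _ x (room (lim+ (enc b) hb (lim0 {m} {v})) (lim0 {m} {x}) (scale 4 ha) le))
      (run-bind (run-drop (enc b) v _ (room (lim0 {m} {v}) (lim+ (enc a) ha (lim0 {m} {x})) (scale 4 hb) le))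
        (run-mvXV (enc a) v x (room (lim0 {m} {v}) (lim0 {m} {x}) (scale 4 ha) le)))))
    where
    m = size (a , b)
    hm : 1 ≤ m
    hm = s≤s z≤n
    ha : size a ≤ m
    ha = ≤-trans (m≤m+n _ _) (n≤1+n _)
    hb : size b ≤ m
    hb = ≤-trans (m≤n+m _ (size a)) (n≤1+n _)
    ar : ∀ m v x → m + v + x ≡ v + x + m
    ar = solve-∀
  fstPT .small (a , b) = ≤-trans (m≤m+n _ _) (≤-trans (n≤1+n _) (m≤m+n _ _))

  sndPT : PT {A × B} proj₂
  sndPT .mach = bind (pop sV) (λ _ → dropM)
  sndPT .bnd = con 200 ⊗ var
  sndPT .runs (a , b) v x B le rewrite ++-assoc (ser (enc a)) (ser (enc b)) v =
    run-≤ (within (one hm ⊞ scale 40 ha))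
      (run-bind (run-pop-∷ sV _ true (ser (enc a) ++ ser (enc b) ++ v) refl
        (≤-trans (≤-reflexive (trans (cong suc (trans (length-ser++ (enc a) _) (cong (size a +_) (length-ser++ (enc b) v)))) (cong suc (sym (+-assoc (size a) _ _)))))
          (≤-trans (≤-by (length x) (ar m (length v) (length x))) (room (lim0 {m} {v}) (lim0 {m} {x}) (one ≤-refl) le))))
        (run-drop (enc a) _ x (room (lim+ (enc b) hb (lim0 {m} {v})) (lim0 {m} {x}) (scale 4 ha) le)))
    where
    m = size (a , b)
    hm : 1 ≤ m
    hm = s≤s z≤n
    ha : size a ≤ m
    ha = ≤-trans (m≤m+n _ _) (n≤1+n _)
    hb : size b ≤ m
    hb = ≤-trans (m≤n+m _ (size a)) (n≤1+n _)
    ar : ∀ m v x → m + v + x ≡ v + x + m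
    ar = solve-∀
  sndPT .small (a , b) = ≤-trans (m≤n+m _ (size a)) (≤-trans (n≤1+n _) (m≤m+n _ _))

module _ {A B : Set} ⦃ eA : Enc A ⦄ ⦃ eB : Enc B ⦄ where

  -- The codes of the truth values are 11000 and 10100: after the common first bit the second one
  -- decides, and three bits remain to be discarded.
  branchM : Mach → Mach → Ex → Mach
  branchM f g e0 = skipM e0
  branchM f g e1 = seq (popAll 3) g
  branchM f g e2 = seq (popAll 3) f

  ifPT : {c : A → Bool} {f g : A → B} → PT c → PT f → PT g → PT (λ a → if c a then f a else g a)
  ifPT {c} {f} {g} pc pf pg .mach =
    seq dupM (seq (mach pc) (bind (pop sV) (λ _ → bind (pop sV) (branchM (mach pf) (mach pg)))))
  ifPT {c} {f} {g} pc pf pg .bnd = con 200 ⊗ (con 10 ⊕ var ⊕ bnd pc ⊕ bnd pf ⊕ bnd pg)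
  ifPT {c} {f} {g} pc pf pg .runs a v x B le =
    run-≤ (within (scale 40 hn ⊞ (one hC ⊞ (one h1 ⊞ (one h1 ⊞ (scale 4 h1 ⊞ one ≤-refl))))))
      (run-bind (run-dup (enc a) v x (room (lim0 {m} {v}) (lim0 {m} {x}) (scale 5 hn) le))
      (run-bind (runs pc a (ser (enc a) ++ v) x B (room (lim+ (enc a) hn (lim0 {m} {v})) (lim0 {m} {x}) (one hC) le))
        (branch (c a) refl)))
    where
    N = 10 + size a + ev (bnd pc) (size a)
    m = N + ev (bnd pf) (size a) + ev (bnd pg) (size a)
    hN : N ≤ m
    hN = ≤-trans (m≤m+n _ _) (m≤m+n _ _)
    hC : ev (bnd pc) (size a) ≤ m
    hC = ≤-trans (m≤n+m _ (10 + size a)) hN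
    hn : size a ≤ m
    hn = ≤-trans (≤-trans (m≤n+m _ 10) (m≤m+n _ _)) hN
    h10 : 10 ≤ m
    h10 = ≤-trans (m≤m+n 10 _) hN
    h1 : 1 ≤ m
    h1 = ≤-trans (s≤s z≤n) h10
    hF : ev (bnd pf) (size a) ≤ m
    hF = ≤-trans (m≤n+m _ N) (m≤m+n _ _)
    hG : ev (bnd pg) (size a) ≤ m
    hG = m≤n+m _ _
    top : ∀ bs → length bs ≤ 10 → length (bs ++ ser (enc a) ++ v) ≤ B
    top bs h = ≤-trans (≤-trans (≤-reflexive (length-++ bs)) (≤-trans (+-monoˡ-≤ _ h) (≤-trans (m≤m+n _ (length x)) (≤-reflexive (ar (length (ser (enc a) ++ v)) (length x))))))
      (room (lim+ (enc a) hn (lim0 {m} {v})) (lim0 {m} {x}) (one h10) le)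
      where
      ar : ∀ l x → 10 + l + x ≡ l + x + 10
      ar = solve-∀
    branch : ∀ t → c a ≡ t → Run B (bind (pop sV) (λ _ → bind (pop sV) (branchM (mach pf) (mach pg)))) (st2 (ser (encBool t) ++ ser (enc a) ++ v) x)
             (1 + (1 + (4 + m))) e0 (st2 (ser (enc (if t then f a else g a)) ++ v) x)
    branch true eq = run-bind (run-pop-∷ sV _ true (true ∷ false ∷ false ∷ false ∷ ser (enc a) ++ v) refl (top (true ∷ true ∷ false ∷ false ∷ false ∷ []) (≤-by 5 refl)))
      (run-bind (run-pop-∷ sV _ true (false ∷ false ∷ false ∷ ser (enc a) ++ v) refl (top (true ∷ false ∷ false ∷ false ∷ []) (≤-by 6 refl)))
      (run-bind (run-popAll (false ∷ false ∷ false ∷ []) (ser (enc a) ++ v) x (top (true ∷ false ∷ false ∷ []) (≤-by 7 refl)))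
        (run-≤ hF (runs pf a v x B (room (lim0 {m} {v}) (lim0 {m} {x}) (one hF) le)))))
    branch false eq = run-bind (run-pop-∷ sV _ true (false ∷ true ∷ false ∷ false ∷ ser (enc a) ++ v) refl (top (true ∷ false ∷ true ∷ false ∷ false ∷ []) (≤-by 5 refl)))
      (run-bind (run-pop-∷ sV _ false (true ∷ false ∷ false ∷ ser (enc a) ++ v) refl (top (false ∷ true ∷ false ∷ false ∷ []) (≤-by 6 refl)))
      (run-bind (run-popAll (true ∷ false ∷ false ∷ []) (ser (enc a) ++ v) x (top (true ∷ false ∷ false ∷ []) (≤-by 7 refl)))
        (run-≤ hG (runs pg a v x B (room (lim0 {m} {v}) (lim0 {m} {x}) (one hG) le)))))
  ifPT {c} {f} {g} pc pf pg .small a = ≤-trans (pick (c a)) (m≤m+n _ _)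
    where
    pick : ∀ t → size (if t then f a else g a) ≤ 10 + size a + ev (bnd pc) (size a) + ev (bnd pf) (size a) + ev (bnd pg) (size a)
    pick true  = ≤-trans (small pf a) (≤-trans (m≤n+m _ (10 + size a + ev (bnd pc) (size a))) (m≤m+n _ _))
    pick false = ≤-trans (small pg a) (m≤n+m _ _)

-- A case distinction only asks whether the code is a leaf. If it is not, the same code is that of
-- the components `r`, so nothing has to be recoded.
data NilCons {E L R B : Set} ⦃ eL : Enc L ⦄ ⦃ eR : Enc R ⦄ (f : E → B) (g : E × R → B) (h : E × L → B) (e : E) (l : L) : Set where
  isNil  : enc l ≡ nil → h (e , l) ≡ f e → NilCons f g h e l
  isCons : ∀ r p q → enc l ≡ p ∙ q → enc r ≡ p ∙ q → h (e , l) ≡ g (e , r) → NilCons f g h e l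

module _ {E L R B : Set} ⦃ eE : Enc E ⦄ ⦃ eL : Enc L ⦄ ⦃ eR : Enc R ⦄ ⦃ eB : Enc B ⦄ where

  caseBr : Mach → Mach → Ex → Mach
  caseBr f g e0 = skipM e0
  caseBr f g e1 = seq (moveM sX sV) f
  caseBr f g e2 = seq (push sV true) (seq (moveM sX sV) (seq (push sV true) g))

  casePT : {f : E → B} {g : E × R → B} (h : E × L → B) → (∀ e l → NilCons f g h e l) → PT f → PT g → PT h
  casePT {f} {g} h view pf pg .mach =
    bind (pop sV) (λ _ → seq (moveM sV sX) (bind (pop sV) (caseBr (mach pf) (mach pg))))
  casePT {f} {g} h view pf pg .bnd = con 200 ⊗ (con 10 ⊕ var ⊕ bnd pf ⊕ bnd pg)
  casePT {f} {g} h view pf pg .runs (e , l) v x B le rewrite ++-assoc (ser (enc e)) (ser (enc l)) v =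
    run-≤ (within (one h1 ⊞ (scale 40 he ⊞ (one h1 ⊞ (one h1 ⊞ (scale 18 he ⊞ (one h1 ⊞ one ≤-refl)))))))
      (run-bind (run-pop-∷ sV _ true (ser (enc e) ++ ser (enc l) ++ v) refl whole)
      (run-bind (run-mvVX (enc e) _ x (room (lim+ (enc l) hl (lim0 {m} {v})) (lim0 {m} {x}) (scale 4 he) le))
        (branch (view e l))))
    where
    n = size (e , l)
    m = 10 + n + ev (bnd pf) n + ev (bnd pg) n
    hn : n ≤ m
    hn = ≤-trans (m≤n+m n 10) (≤-trans (m≤m+n (10 + n) _) (m≤m+n _ _))
    he′ : size e ≤ n
    he′ = ≤-trans (m≤m+n _ _) (n≤1+n _)
    he : size e ≤ m
    he = ≤-trans he′ hn
    hl : size l ≤ m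
    hl = ≤-trans (≤-trans (m≤n+m _ (size e)) (n≤1+n _)) hn
    h1 : 1 ≤ m
    h1 = s≤s z≤n
    hF : ev (bnd pf) n ≤ m
    hF = ≤-trans (m≤n+m _ (10 + n)) (m≤m+n _ _)
    hG : ev (bnd pg) n ≤ m
    hG = m≤n+m _ _
    hF′ : ev (bnd pf) (size e) ≤ m
    hF′ = ≤-trans (ev-mono (bnd pf) he′) hF
    whole : length (true ∷ ser (enc e) ++ ser (enc l) ++ v) ≤ B
    whole = ≤-trans (≤-reflexive (cong (suc ∘ length) (sym (++-assoc (ser (enc e)) (ser (enc l)) v))))
      (height (lim+ (enc (e , l)) hn (lim0 {m} {v})) (lim0 {m} {x}) le)
    branch : NilCons f g h e l → Run B (bind (pop sV) (caseBr (mach pf) (mach pg))) (st2 (ser (enc l) ++ v) (ser (enc e) ++ x))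
             (1 + (1 + (18 * size e + (1 + m)))) e0 (st2 (ser (enc (h (e , l))) ++ v) x)
    K = 1 + (1 + (18 * size e + (1 + m)))
    recast : ∀ {d c} → enc l ≡ d → h (e , l) ≡ c →
      Run B (bind (pop sV) (caseBr (mach pf) (mach pg))) (st2 (ser d ++ v) (ser (enc e) ++ x)) K e0 (st2 (ser (enc c) ++ v) x) →
      Run B (bind (pop sV) (caseBr (mach pf) (mach pg))) (st2 (ser (enc l) ++ v) (ser (enc e) ++ x)) K e0 (st2 (ser (enc (h (e , l))) ++ v) x)
    recast refl refl r = r
    branch (isNil eq₁ eq₂) = recast eq₁ eq₂ $
      run-≤ (s≤s (≤-trans (n≤1+n _) (s≤s (+-monoʳ-≤ (18 * size e) (n≤1+n m)))))
      (run-bind (run-pop-∷ sV _ false v refl (≤-trans (s≤s (m≤n+m (length v) (size e + 0))) (≤-trans (≤-reflexive (cong suc (lenEq (size e) (length v)))) whole′)))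
      (run-bind (run-mvXV (enc e) v x (room (lim0 {m} {v}) (lim0 {m} {x}) (scale 4 he) le))
        (run-≤ hF′ (runs pf e v x B (room (lim0 {m} {v}) (lim0 {m} {x}) (one hF′) le)))))
      where
      lenEq : ∀ a b → a + 0 + b ≡ a + b
      lenEq a b = cong (_+ b) (+-identityʳ a)
      whole′ : suc (size e + length v) ≤ B
      whole′ = ≤-trans (s≤s (+-monoʳ-≤ (size e) (m≤n+m (length v) (size l))))
        (≤-trans (≤-reflexive (cong suc (sym (trans (length-ser++ (enc e) _) (cong (size e +_) (length-ser++ (enc l) v)))))) whole)
    branch (isCons r p q eq₁ eq₂ eq₃) = recast eq₁ eq₃ $
      run-bind (run-pop-∷ sV _ true _ refl (height (lim+ (p ∙ q) hpq (lim0 {m} {v})) (lim0 {m} {x}) le))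
      (run-bind (run-push sV true _ (≤-trans (n≤1+n _) (height (lim+ (p ∙ q) hpq (lim0 {m} {v})) (lim0 {m} {x}) le)))
      (run-bind (run-mvXV (enc e) _ x (room (lim+ (p ∙ q) hpq (lim0 {m} {v})) (lim0 {m} {x}) (scale 4 he) le))
      (run-bind (run-push sV true _ (≤-trans (height (lim+ (enc e) he (lim+ (p ∙ q) hpq (lim0 {m} {v}))) (lim0 {m} {x}) le) ≤-refl))
        (run-≤ (≤-trans (≤-reflexive (cong (ev (bnd pg)) sizeEq)) hG)
          (subst (λ z → Run B (mach pg) (st2 z x) (ev (bnd pg) (size (e , r))) e0 (st2 (ser (enc (g (e , r))) ++ v) x))
            (trans (cong (λ z → true ∷ (ser (enc e) ++ ser z) ++ v) eq₂) (cong (true ∷_) (++-assoc (ser (enc e)) _ v)))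
            (runs pg (e , r) v x B (room (lim0 {m} {v}) (lim0 {m} {x}) (one (≤-trans (≤-reflexive (cong (ev (bnd pg)) sizeEq)) hG)) le)))))))
      where
      hpq : sz (p ∙ q) ≤ m
      hpq = subst (λ z → sz z ≤ m) eq₁ hl
      sizeEq : size (e , r) ≡ n
      sizeEq = cong (λ z → suc (size e + sz z)) (trans eq₂ (sym eq₁))
  casePT {f} {g} h view pf pg .small (e , l) = pick (view e l)
    where
    n = size (e , l)
    pick : NilCons f g h e l → size (h (e , l)) ≤ 200 * (10 + n + ev (bnd pf) n + ev (bnd pg) n)
    pick (isNil eq₁ eq₂) rewrite eq₂ = ≤-trans (small pf e) (≤-trans (ev-mono (bnd pf) (≤-trans (m≤m+n _ _) (n≤1+n _)))
      (≤-trans (≤-trans (m≤n+m _ (10 + n)) (m≤m+n _ (ev (bnd pg) n))) (m≤m+n _ _)))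
    pick (isCons r p q eq₁ eq₂ eq₃) rewrite eq₃ = ≤-trans (small pg (e , r))
      (≤-trans (≤-reflexive (cong (λ z → ev (bnd pg) (suc (size e + sz z))) (trans eq₂ (sym eq₁))))
      (≤-trans (m≤n+m _ (10 + n + ev (bnd pf) n)) (m≤m+n _ _)))

length≤size : ∀ {A : Set} ⦃ eA : Enc A ⦄ (xs : List A) → length xs ≤ size xs
length≤size [] = z≤n
length≤size (x ∷ xs) = s≤s (≤-trans (length≤size xs) (m≤n+m _ (size x)))

module _ {A X B : Set} ⦃ eA : Enc A ⦄ ⦃ eX : Enc X ⦄ ⦃ eB : Enc B ⦄ where

  foldBr : Mach → Ex → Mach
  foldBr f e0 = skipM e0
  foldBr f e1 = skipM e0
  foldBr f e2 = seq (moveM sX sV) (seq (push sV true) (seq f (skipM e1)))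

  foldLoop : Mach → Mach
  foldLoop f = loop (bind (pop sX) (foldBr f))

  -- Here `P` bounds the list, `Q` every accumulator on the way, `m` the cost of one call and `M`
  -- the available scale. The 23 units per element are 18 for moving it and 5 for the call and the
  -- single operations.
  run-foldLoop : {f : X × B → B} (pf : PT f) (P Q m M : ℕ) → 1 ≤ m → P ≤ m → Q ≤ m → ev (bnd pf) (1 + P + Q) ≤ m → m ≤ M →
    ∀ v x Bd → length v + length x + 200 * M ≤ Bd → ∀ xs b →
    (∀ ys zs → xs ≡ ys ++ zs → size (foldl (λ b x → f (x , b)) b ys) ≤ Q) → size xs ≤ P →
    Run Bd (foldLoop (mach pf)) (st2 (ser (enc b) ++ v) (ser (enc xs) ++ x)) (length xs * (23 * m) + 3) e0
      (st2 (ser (enc (foldl (λ b x → f (x , b)) b xs)) ++ v) x)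
  run-foldLoop {f} pf P Q m M m1 mP mQ mF mM v x Bd le [] b hQ hP =
    run-done (run-bind (run-pop-∷ sX _ false x refl (heightX (lim+ (enc b) (≤-trans (hQ [] [] refl) (≤-trans mQ mM)) (lim0 {M} {v})) (lim+ nil (≤-trans m1 mM) (lim0 {M} {x})) le))
      (run-skip e0 _))
  run-foldLoop {f} pf P Q m M m1 mP mQ mF mM v x Bd le (y ∷ xs) b hQ hP =
    run-≤ cost
    (run-again
      (run-bind (run-pop-∷ sX _ true _ refl (heightX (lim+ (enc b) hb (lim0 {M} {v})) (lim+ (enc (y ∷ xs)) (≤-trans hP (≤-trans mP mM)) (lim0 {M} {x})) le))
      (subst (λ z → Run Bd (foldBr (mach pf) e2) (st2 (ser (enc b) ++ v) z) (18 * size y + (1 + (ev (bnd pf) (1 + P + Q) + 1))) e1 (st2 (ser (enc (f (y , b))) ++ v) (ser (enc xs) ++ x)))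
        (sym (++-assoc (ser (enc y)) (ser (enc xs)) x))
        (run-bind (run-mvXV (enc y) _ _ (room (lim+ (enc b) hb (lim0 {M} {v})) (lim+ (enc xs) hxs (lim0 {M} {x})) (scale 4 hy) le))
        (run-bind (run-push sV true _ (height (lim+ (enc y) hy (lim+ (enc b) hb (lim0 {M} {v}))) (lim+ (enc xs) hxs (lim0 {M} {x})) le))
        (run-bind (run-≤ hF₁ (subst (λ z → Run Bd (mach pf) (st2 (true ∷ z) _) _ e0 (st2 (ser (enc (f (y , b))) ++ v) (ser (enc xs) ++ x)))
            (++-assoc (ser (enc y)) (ser (enc b)) v)
            (runs pf (y , b) v _ Bd (room (lim0 {M} {v}) (lim+ (enc xs) hxs (lim0 {M} {x})) (one (≤-trans hF₁ (≤-trans mF mM))) le))))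
          (run-skip e1 _))))))
      (run-foldLoop pf P Q m M m1 mP mQ mF mM v x Bd le xs (f (y , b))
        (λ ys zs eq → hQ (y ∷ ys) zs (cong (y ∷_) eq)) (≤-trans (≤-trans (m≤n+m _ (size y)) (n≤1+n _)) hP)))
    where
    hb : size b ≤ M
    hb = ≤-trans (hQ [] _ refl) (≤-trans mQ mM)
    hyP : size y ≤ P
    hyP = ≤-trans (≤-trans (m≤m+n _ _) (n≤1+n _)) hP
    hy : size y ≤ M
    hy = ≤-trans hyP (≤-trans mP mM)
    hxs : size xs ≤ M
    hxs = ≤-trans (≤-trans (m≤n+m _ (size y)) (n≤1+n _)) (≤-trans hP (≤-trans mP mM))
    hF₁ : ev (bnd pf) (size (y , b)) ≤ ev (bnd pf) (1 + P + Q)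
    hF₁ = ev-mono (bnd pf) (s≤s (+-mono-≤ hyP (hQ [] _ refl)))
    iter : 1 + (18 * size y + (1 + (ev (bnd pf) (1 + P + Q) + 1))) + 1 ≤ 23 * m
    iter = ≤-trans (sc≤ ((one m1 ⊞ (scale 18 (≤-trans hyP mP) ⊞ (one m1 ⊞ (one mF ⊞ one m1)))) ⊞ one m1)) (≤-reflexive refl)
    cost : 1 + (18 * size y + (1 + (ev (bnd pf) (1 + P + Q) + 1))) + suc (length xs * (23 * m) + 3) ≤ suc (length xs) * (23 * m) + 3
    cost = ≤-trans (≤-reflexive (ar (18 * size y + (1 + (ev (bnd pf) (1 + P + Q) + 1))) (length xs * (23 * m))))
      (+-monoˡ-≤ 3 (+-monoˡ-≤ (length xs * (23 * m)) iter))
      where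
      ar : ∀ k r → 1 + k + suc (r + 3) ≡ 1 + k + 1 + r + 3
      ar = solve-∀

  -- It suffices to bound the accumulator on the initial segments of the list.
  foldPT : {f : X × B → B} {i : A → List X × B} → PT f → PT i → (q : Poly) →
    (∀ a xs ys → proj₁ (i a) ≡ xs ++ ys → size (foldl (λ b x → f (x , b)) (proj₂ (i a)) xs) ≤ ev q (size a)) →
    PT (λ a → foldl (λ b x → f (x , b)) (proj₂ (i a)) (proj₁ (i a)))
  foldPT {f} {i} pf pi q hq .mach = seq (mach pi) (bind (pop sV) (λ _ → seq (moveM sV sX) (foldLoop (mach pf))))
  foldPT {f} {i} pf pi q hq .bnd = con 200 ⊗ ((con 10 ⊕ bnd pi ⊕ q ⊕ (bnd pf ⊚ (con 1 ⊕ bnd pi ⊕ q))) ⊗ (bnd pi ⊕ con 1))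
  foldPT {f} {i} pf pi q hq .runs a v x Bd le =
    run-≤ (within (one (≤-trans mP mM) ⊞ (one (≤-trans m1 mM) ⊞ (scale 40 hxs ⊞ (loopCost ⊞ one (≤-trans m3 mM))))))
      (run-bind (runs pi a v x Bd (room (lim0 {M} {v}) (lim0 {M} {x}) (one (≤-trans mP mM)) le))
      (run-bind (run-pop-∷ sV _ true _ refl (height (lim+ (enc (i a)) (≤-trans hi (≤-trans mP mM)) (lim0 {M} {v})) (lim0 {M} {x}) le))
      (subst (λ z → Run Bd (seq (moveM sV sX) (foldLoop (mach pf))) (st2 z x) (40 * size xs + (P * (23 * m) + 3)) e0 (st2 (ser (enc (foldl (λ b x → f (x , b)) b xs)) ++ v) x))
        (sym (++-assoc (ser (enc xs)) (ser (enc b)) v))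
        (run-bind (run-mvVX (enc xs) _ x (room (lim+ (enc b) hb (lim0 {M} {v})) (lim0 {M} {x}) (scale 4 hxs) le))
          (run-≤ (+-monoˡ-≤ 3 (*-monoˡ-≤ (23 * m) (≤-trans (length≤size xs) hxsP)))
            (run-foldLoop pf P (ev q (size a)) m M m1 mP mQ mF mM v x Bd le xs b (hq a) hxsP))))))
    where
    P = ev (bnd pi) (size a)
    N = 10 + P + ev q (size a)
    m = N + ev (bnd pf) (1 + P + ev q (size a))
    -- A list of size at most `P` has at most `P` elements, each at a cost of `23 * m`; the summand
    -- 1 leaves a positive scale even without elements.
    M = m * (P + 1)
    xs = proj₁ (i a)
    b = proj₂ (i a)
    mN : N ≤ m
    mN = m≤m+n _ _
    m1 : 1 ≤ m
    m1 = s≤s z≤n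
    m3 : 3 ≤ m
    m3 = s≤s (s≤s (s≤s z≤n))
    mP : P ≤ m
    mP = ≤-trans (≤-trans (m≤n+m P 10) (m≤m+n _ _)) mN
    mQ : ev q (size a) ≤ m
    mQ = ≤-trans (m≤n+m _ (10 + P)) mN
    mF : ev (bnd pf) (1 + P + ev q (size a)) ≤ m
    mF = m≤n+m _ N
    mM : m ≤ M
    mM = ≤-trans (≤-reflexive (sym (*-identityʳ m))) (*-monoʳ-≤ m (m≤n+m 1 P))
    hi : size (i a) ≤ P
    hi = small pi a
    hxsP : size xs ≤ P
    hxsP = ≤-trans (≤-trans (m≤m+n _ _) (n≤1+n _)) hi
    hxs : size xs ≤ M
    hxs = ≤-trans hxsP (≤-trans mP mM)
    hb : size b ≤ M
    hb = ≤-trans (≤-trans (≤-trans (m≤n+m _ (size xs)) (n≤1+n _)) hi) (≤-trans mP mM)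
    loopCost : Sc (P * (23 * m)) 23 M
    loopCost = sc (≤-trans (≤-by (23 * m) (ar P m)) ≤-refl)
      where
      ar : ∀ P m → P * (23 * m) + 23 * m ≡ 23 * (m * (P + 1))
      ar = solve-∀
  foldPT {f} {i} pf pi q hq .small a =
    ≤-trans (hq a (proj₁ (i a)) [] (sym (++-identityʳ _))) (≤-trans (m≤n+m _ (10 + P)) (≤-trans (m≤m+n _ (ev (bnd pf) (1 + P + ev q (size a))))
      (≤-trans (≤-trans (≤-reflexive (sym (*-identityʳ _))) (*-monoʳ-≤ (10 + P + ev q (size a) + ev (bnd pf) (1 + P + ev q (size a))) (m≤n+m 1 P))) (m≤m+n _ _))))
    where
    P = ev (bnd pi) (size a)

-- From polynomial expressions to bounds of the form `poly c k`

^-distribˡ-* : ∀ a b k → (a * b) ^ k ≡ a ^ k * b ^ k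
^-distribˡ-* a b zero = refl
^-distribˡ-* a b (suc k) = trans (cong (a * b *_) (^-distribˡ-* a b k)) (ar a b (a ^ k) (b ^ k))
  where
  ar : ∀ a b x y → a * b * (x * y) ≡ a * x * (b * y)
  ar = solve-∀

-- The base is `suc n` because its powers increase with the exponent at n = 0 too; this lets a sum
-- or product of two bounds be written with one exponent.
ev-≤-pow : ∀ p → ∃ λ c → ∃ λ k → ∀ n → ev p n ≤ c * suc n ^ k
ev-≤-pow var = 1 , 1 , λ n → ≤-trans (n≤1+n n) (≤-reflexive (sym (trans (*-identityˡ _) (*-identityʳ (suc n)))))
ev-≤-pow (con c) = c , 0 , λ n → ≤-reflexive (sym (*-identityʳ c))
ev-≤-pow (p ⊕ q) with ev-≤-pow p | ev-≤-pow q
... | c , k , h | d , l , g = c + d , k + l , λ n →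
  ≤-trans (+-mono-≤ (≤-trans (h n) (*-monoʳ-≤ c (^-monoʳ-≤ (suc n) (m≤m+n k l)))) (≤-trans (g n) (*-monoʳ-≤ d (^-monoʳ-≤ (suc n) (m≤n+m l k)))))
    (≤-reflexive (sym (*-distribʳ-+ _ c d)))
ev-≤-pow (p ⊗ q) with ev-≤-pow p | ev-≤-pow q
... | c , k , h | d , l , g = c * d , k + l , λ n →
  ≤-trans (*-mono-≤ (h n) (g n)) (≤-reflexive (trans (ar c d (suc n ^ k) (suc n ^ l)) (cong (c * d *_) (sym (^-distribˡ-+-* (suc n) k l)))))
  where
  ar : ∀ c d x y → c * x * (d * y) ≡ c * d * (x * y)
  ar = solve-∀
ev-≤-pow (p ⊚ q) with ev-≤-pow p | ev-≤-pow q
... | c , k , h | d , l , g = c * suc d ^ k , l * k , λ n →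
  ≤-trans (h (ev q n)) (≤-trans (*-monoʳ-≤ c (^-monoˡ-≤ k (inner n)))
    (≤-reflexive (trans (cong (c *_) (trans (^-distribˡ-* (suc d) (suc n ^ l) k) (cong (suc d ^ k *_) (^-*-assoc (suc n) l k)))) (sym (*-assoc c _ _)))))
  where
  inner : ∀ n → suc (ev q n) ≤ suc d * suc n ^ l
  inner n = +-mono-≤ (m^n>0 (suc n) l) (g n)

-- For positive n, `suc n` is at most 2 n, which costs the factor `2 ^ k`; at n = 0 the additive
-- constant of `poly` takes over.
ev-≤-poly : ∀ p → ∃ λ c → ∃ λ k → ∀ n → ev p n ≤ poly c k n
ev-≤-poly p with ev-≤-pow p
... | c , k , h = c * 2 ^ k , k , λ n → ≤-trans (h n) (le n)
  where
  le : ∀ n → c * suc n ^ k ≤ poly (c * 2 ^ k) k n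
  le zero = ≤-trans (≤-trans (≤-reflexive (trans (cong (c *_) (^-zeroˡ k)) (*-identityʳ c))) (≤-trans (≤-reflexive (sym (*-identityʳ c))) (*-monoʳ-≤ c (m^n>0 2 k)))) (m≤n+m _ _)
  le (suc n) = ≤-trans (≤-trans (*-monoʳ-≤ c (≤-trans (^-monoˡ-≤ k (s≤s (≤-trans (s≤s (m≤m+n n _)) (≤-reflexive (sym (+-suc n _)))))) (≤-reflexive (^-distribˡ-* 2 (suc n) k))))
    (≤-reflexive (sym (*-assoc c _ _)))) (m≤m+n _ _)

-- Conversion between bit strings and their codes

pushAllX : List Bool → Mach
pushAllX []       = skipM e0
pushAllX (b ∷ bs) = seq (pushAllX bs) (push sX b)

run-pushAllX : ∀ {B} bs v x → length bs + length x ≤ B →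
               Run B (pushAllX bs) (st2 v x) (length bs + 1) e0 (st2 v (bs ++ x))
run-pushAllX [] v x le = run-skip e0 _
run-pushAllX (b ∷ bs) v x le = run-≤ (≤-reflexive (+-comm (length bs + 1) 1))
  (run-bind (run-pushAllX bs v x (≤-trans (n≤1+n _) le))
    (run-push sX b _ (≤-trans (≤-reflexive (length-++ bs)) (≤-trans (n≤1+n _) le))))

-- The last bit of an input is farthest from `home` and is therefore the top of the first stack.
raw : BitString → Store
raw x = reverse x ∷ [] ∷ [] ∷ [] ∷ []

readM : Mach
readM = seq (pushAllX (ser nil)) (seq (each sV (λ b → pushAllX (true ∷ ser (enc b)))) (moveM sX sV))

length-serBool : (b : Bool) → length (ser (enc b)) ≡ 5
length-serBool false = refl
length-serBool true  = refl

size-bits : (x : BitString) → size x ≡ 6 * length x + 1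
size-bits [] = refl
size-bits (b ∷ x) = trans (cong₂ (λ u w → suc (u + w)) (trans (sym (length-ser (enc b))) (length-serBool b)) (size-bits x)) (ar (length x))
  where
  ar : ∀ n → suc (5 + (6 * n + 1)) ≡ 6 * suc n + 1
  ar = solve-∀

run-readM : ∀ {B} x → 60 * suc (length x) ≤ B → Run B readM (raw x) (200 * suc (length x)) e0 (st2 (ser (enc x)) [])
run-readM {B} x le =
  run-≤ (≤-trans (≤-reflexive (cong (λ z → 2 + (length (reverse x) * 10 + 3 + 18 * z)) (size-bits x)))
          (≤-trans (≤-reflexive (cong (λ z → 2 + (z * 10 + 3 + 18 * (6 * length x + 1))) (length-reverse x))) (≤-by (82 * length x + 177) (ar₁ (length x)))))
    (run-bind (run-pushAllX (ser nil) (reverse x) [] (≤-trans (s≤s z≤n) le))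
    (run-bind (run-each sV (λ b → pushAllX (true ∷ ser (enc b))) (λ ws y → ws ∷ y ∷ [] ∷ [] ∷ []) (λ b y → (true ∷ ser (enc b)) ++ y) 7
        (λ _ _ → refl) (λ _ _ _ → refl) (λ ws y → 6 * length ws + length y)
        (λ b ws y → ≤-reflexive (trans (cong (6 * length ws +_) (trans (length-++ (true ∷ ser (enc b)) {y}) (cong (λ z → suc z + length y) (length-serBool b)))) (ar₂ (length ws) (length y))))
        (λ ws y → ≤-trans (m≤m+n _ _) (m≤m+n (6 * length ws) _))
        (λ b ws y h → run-≤ (≤-reflexive (cong (λ z → suc z + 1) (length-serBool b)))
          (run-pushAllX (true ∷ ser (enc b)) ws y (≤-trans (≤-trans (≤-reflexive (cong (λ z → suc z + length y) (length-serBool b))) (≤-by (6 * length ws) (ar₃ (length ws) (length y)))) h)))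
        (reverse x) (ser nil)
        (≤-trans (≤-trans (≤-reflexive (cong (λ z → 6 * z + 1) (length-reverse x))) (≤-by (54 * length x + 59) (ar₄ (length x)))) le))
      (subst (λ z → Run B (moveM sX sV) (st2 [] z) (18 * size x) e0 (st2 (ser (enc x)) []))
        (trans (++-identityʳ _) (sym (built x)))
        (subst (λ z → Run B (moveM sX sV) (st2 [] (ser (enc x) ++ [])) (18 * size x) e0 (st2 z [])) (++-identityʳ _)
          (run-mvXV (enc x) [] [] (≤-trans (≤-reflexive (cong (4 *_) (size-bits x))) (≤-trans (≤-by (36 * length x + 56) (ar₅ (length x))) le)))))))
  where
  ar₁ : ∀ n → 2 + (n * 10 + 3 + 18 * (6 * n + 1)) + (82 * n + 177) ≡ 200 * suc n
  ar₁ = solve-∀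
  ar₂ : ∀ n y → 6 * n + (6 + y) ≡ 6 * suc n + y
  ar₂ = solve-∀
  ar₃ : ∀ n y → 6 + y + 6 * n ≡ 6 * suc n + y
  ar₃ = solve-∀
  ar₄ : ∀ n → 6 * n + 1 + (54 * n + 59) ≡ 60 * suc n
  ar₄ = solve-∀
  ar₅ : ∀ n → 4 * (6 * n + 1) + (36 * n + 56) ≡ 60 * suc n
  ar₅ = solve-∀
  built : ∀ x → foldl (λ y b → (true ∷ ser (enc b)) ++ y) (ser nil) (reverse x) ≡ ser (enc x)
  built x = trans (reverse-foldl _ _ x) (unfolded x)
    where
    unfolded : ∀ x → foldr (λ b y → (true ∷ ser (enc b)) ++ y) (ser nil) x ≡ ser (enc x)
    unfolded [] = refl
    unfolded (b ∷ x) = cong (λ z → true ∷ ser (enc b) ++ z) (unfolded x)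

unreadBit : Ex → Mach
unreadBit e0 = skipM e0
unreadBit e1 = seq (popAll 3) (seq (push sX false) (skipM e1))
unreadBit e2 = seq (popAll 3) (seq (push sX true) (skipM e1))

unreadStep : Ex → Mach
unreadStep e0 = skipM e0
unreadStep e1 = skipM e0
unreadStep e2 = bind (pop sV) (λ _ → bind (pop sV) unreadBit)

unreadLoop : Mach
unreadLoop = loop (bind (pop sV) unreadStep)

run-unreadLoop : ∀ {B} y x → size y + length x ≤ B →
                 Run B unreadLoop (st2 (ser (enc y)) x) (12 * suc (length y)) e0 (st2 [] (y ʳ++ x))
run-unreadLoop [] x le = run-≤ (≤-by 9 refl) (run-done (run-bind (run-pop-∷ sV _ false [] refl (≤-trans (s≤s z≤n) le)) (run-skip e0 _)))
run-unreadLoop {B} (b ∷ y) x le = run-≤ (≤-by 2 (ar (length y)))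
  (run-again (run-bind (run-pop-∷ sV _ true _ refl (≤-trans (≤-trans (≤-reflexive (length-ser (enc (b ∷ y)))) (m≤m+n _ (length x))) le)) (bit b (enough b le)))
    (run-unreadLoop y (b ∷ x) (≤-trans (≤-trans (≤-reflexive (+-suc (size y) (length x))) (s≤s (+-monoˡ-≤ (length x) (m≤n+m (size y) (size b))))) le)))
  where
  ar : ∀ n → 1 + (1 + (1 + (4 + (1 + 1)))) + suc (12 * suc n) + 2 ≡ 12 * suc (suc n)
  ar = solve-∀
  drop : ∀ {B} n m → suc (5 + n) + m ≤ B → m ≤ B
  drop n m h = ≤-trans (m≤n+m m (suc (5 + n))) h
  enough : ∀ b → size (b ∷ y) + length x ≤ B → suc (5 + size y) + length x ≤ B
  enough false h = h
  enough true  h = h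
  tall : suc (5 + size y) + length x ≤ B → ∀ k → {T (k ≤ᵇ 6)} → k + length (ser (enc y)) ≤ B
  tall h k {t} = ≤-trans (≤-trans (+-mono-≤ (≤ᵇ⇒≤ k 6 t) (≤-reflexive (length-ser (enc y)))) (m≤m+n _ (length x))) h
  bit : ∀ b → suc (5 + size y) + length x ≤ B → Run B (unreadStep e2) (st2 (ser (enc b) ++ ser (enc y)) x) (1 + (1 + (4 + (1 + 1)))) e1 (st2 (ser (enc y)) (b ∷ x))
  bit false h = run-bind (run-pop-∷ sV _ true _ refl (tall h 5))
    (run-bind (run-pop-∷ sV _ false _ refl (tall h 4)) (run-bind (run-popAll (true ∷ false ∷ false ∷ []) _ x (tall h 3))
    (run-bind (run-push sX false _ (drop (size y) (length x) h)) (run-skip e1 _))))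
  bit true h = run-bind (run-pop-∷ sV _ true _ refl (tall h 5))
    (run-bind (run-pop-∷ sV _ true _ refl (tall h 4)) (run-bind (run-popAll (false ∷ false ∷ false ∷ []) _ x (tall h 3))
    (run-bind (run-push sX true _ (drop (size y) (length x) h)) (run-skip e1 _))))

unreadM : Mach
unreadM = seq unreadLoop (seq (each sX (push sW)) (each sW (push sV)))

run-unreadM : ∀ {B} y → size y ≤ B → Run B unreadM (st2 (ser (enc y)) []) (20 * suc (length y)) e0 (raw y)
run-unreadM {B} y le =
  run-≤ (≤-trans (≤-reflexive (cong₂ (λ a b → 12 * suc (length y) + (a * 4 + 3 + (b * 4 + 3))) len (trans (cong length back) refl))) (≤-by 2 (ar (length y))))
    (run-bind (run-unreadLoop y [] (≤-trans (≤-reflexive (+-identityʳ _)) le))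
    (run-bind (run-each sX (push sW) (λ ws w → [] ∷ ws ∷ w ∷ [] ∷ []) _∷_ 1 (λ _ _ → refl) (λ _ _ _ → refl)
        (λ ws w → length ws + length w) (λ b ws w → ≤-reflexive (+-suc _ _)) (λ ws w → m≤m+n _ _)
        (λ b ws w h → run-push sW b _ (≤-trans (m≤n+m _ _) h)) (y ʳ++ []) []
        (≤-trans (≤-reflexive (trans (+-identityʳ _) len)) short))
      (subst (λ z → Run B (each sW (push sV)) ([] ∷ [] ∷ ((y ʳ++ []) ʳ++ []) ∷ [] ∷ []) (length ((y ʳ++ []) ʳ++ []) * 4 + 3) e0 ((z ʳ++ []) ∷ [] ∷ [] ∷ [] ∷ [])) back
        (run-each sW (push sV) (λ ws v → v ∷ [] ∷ ws ∷ [] ∷ []) _∷_ 1 (λ _ _ → refl) (λ _ _ _ → refl)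
        (λ ws w → length ws + length w) (λ b ws w → ≤-reflexive (+-suc _ _)) (λ ws w → m≤m+n _ _)
        (λ b ws w h → run-push sV b _ (≤-trans (m≤n+m _ _) h)) ((y ʳ++ []) ʳ++ []) []
        (≤-trans (≤-reflexive (trans (+-identityʳ _) (cong length back))) short)))))
  where
  len : length (y ʳ++ []) ≡ length y
  len = trans (length-ʳ++ y) (+-identityʳ _)
  back : (y ʳ++ []) ʳ++ [] ≡ y
  back = trans (ʳ++-ʳ++ y) (++-identityʳ y)
  short : length y ≤ B
  short = ≤-trans (length≤size y) le
  ar : ∀ n → 12 * suc n + (n * 4 + 3 + (n * 4 + 3)) + 2 ≡ 20 * suc n
  ar = solve-∀

-- From stack machines to Turing machines

codeCell : Cell → Fin 81
codeCell (a ∷ b ∷ c ∷ d ∷ []) = combine d (combine c (combine b a))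

unpack₃ : Fin 3 → Fin 3 → Fin 3 × Fin 3 → Cell
unpack₃ d c (b , a) = a ∷ b ∷ c ∷ d ∷ []

unpack₂ : Fin 3 → Fin 3 × Fin 9 → Cell
unpack₂ d (c , j) = unpack₃ d c (remQuot {3} 3 j)

unpack₁ : Fin 3 × Fin 27 → Cell
unpack₁ (d , j) = unpack₂ d (remQuot {3} 9 j)

decodeCell : Fin 81 → Cell
decodeCell i = unpack₁ (remQuot {3} 27 i)

decode-codeCell : ∀ c → decodeCell (codeCell c) ≡ c
decode-codeCell (a ∷ b ∷ c ∷ d ∷ []) =
  trans (cong unpack₁ (Finₚ.remQuot-combine {3} {27} d (combine c (combine b a))))
    (trans (cong (unpack₂ d) (Finₚ.remQuot-combine {3} {9} c (combine b a)))
      (cong (unpack₃ d c) (Finₚ.remQuot-combine {3} {3} b a)))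

-- The first stack is the least significant digit, so that blanks and input bits have
-- the codes prescribed for them.
codeSy : Sy → Sym 79
codeSy (cell c) = codeCell c ↑ˡ 1
codeSy home     = 81 ↑ʳ zero

decodeSy : Sym 79 → Sy
decodeSy i with splitAt 81 {1} i
... | inj₁ j = cell (decodeCell j)
... | inj₂ _ = home

decode-codeSy : ∀ s → decodeSy (codeSy s) ≡ s
decode-codeSy (cell c) rewrite Finₚ.splitAt-↑ˡ 81 (codeCell c) 1 = cong cell (decode-codeCell c)
decode-codeSy home = refl

bitCell : Bool → Cell
bitCell b = bitF b ∷ zero ∷ zero ∷ zero ∷ []

code-bitCell : ∀ b → codeSy (cell (bitCell b)) ≡ bitSym b
code-bitCell false = refl
code-bitCell true  = refl

codeTape : ATape → Tape 79
codeTape (atape l h r) = tape (map codeSy l) (codeSy h) (map codeSy r)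

code-move : ∀ m s t → codeTape (moveA m (writeA s t)) ≡ moveHead m (write (codeSy s) (codeTape t))
code-move mL s (atape [] h r)      = refl
code-move mL s (atape (_ ∷ l) h r) = refl
code-move mR s (atape l h [])      = refl
code-move mR s (atape l h (_ ∷ r)) = refl
code-move mS s (atape l h r)       = refl

headS-code : ∀ t → headS (codeTape t) ≡ codeSy (ahead t)
headS-code (atape l h r) = refl

inputCells : BitString → List Cell
inputCells [] = blankCell ∷ []
inputCells (b ∷ x) = map bitCell (b ∷ x)

raw-rep : ∀ x → Rep (raw x) (atape [] home (map cell (inputCells x)))
raw-rep x = rep (inputCells x) refl (tr x)
  where
  bits : ∀ x → map (digit sV) (map bitCell x) ≡ map bitF (reverse x) ʳ++ []
  bits x = trans (sym (map-∘ x)) (sym (trans (sym (map-ʳ++ bitF (reverse x))) (cong (map bitF) (trans (ʳ++-ʳ++ x) (++-identityʳ x)))))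
  zeros : ∀ (i : Fin 3) x → map (digit (suc i)) (map bitCell x) ≡ replicate (length x) zero
  zeros i [] = refl
  zeros q0 (b ∷ x) = cong (zero ∷_) (zeros q0 x)
  zeros q1 (b ∷ x) = cong (zero ∷_) (zeros q1 x)
  zeros q2 (b ∷ x) = cong (zero ∷_) (zeros q2 x)
  tr : ∀ x → Tracks (raw x) (inputCells x)
  tr [] q0 = 1 , refl
  tr [] q1 = 1 , refl
  tr [] q2 = 1 , refl
  tr [] q3 = 1 , refl
  tr (b ∷ x) q0 = 0 , bits (b ∷ x)
  tr (b ∷ x) q1 = length (b ∷ x) , zeros q0 (b ∷ x)
  tr (b ∷ x) q2 = length (b ∷ x) , zeros q1 (b ∷ x)
  tr (b ∷ x) q3 = length (b ∷ x) , zeros q2 (b ∷ x)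

code-input : ∀ x → moveHead mS (write (codeSy home) (moveHead mL (write (headS (inputTape x)) (inputTape {79} x)))) ≡
             codeTape (atape [] home (map cell (inputCells x)))
code-input [] = refl
code-input (b ∷ x) = cong (tape [] (codeSy home)) (cong₂ _∷_ (sym (code-bitCell b)) (codes x))
  where
  codes : ∀ x → map bitSym x ≡ map codeSy (map cell (map bitCell x))
  codes [] = refl
  codes (b ∷ x) = cong₂ _∷_ (sym (code-bitCell b)) (codes x)

readBits : List (Sym 79) → BitString
readBits [] = []
readBits (s ∷ ss) with symBit s
... | just b  = b ∷ readBits ss
... | nothing = []

mutual
  output-readBits : ∀ l h r → tapeOutput {79} (tape l h r) ≡ readBits (h ∷ r)
  output-readBits l h [] with symBit h
  ... | just b  = refl
  ... | nothing = refl
  output-readBits l h (a ∷ r) with symBit h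
  ... | nothing = refl
  ... | just b with symBit a
  ...   | nothing = refl
  -- With `a ∷ r` abstracted, the arguments of the local function are distinct variables, so
  -- unification can read the function off this call.
  ...   | just b′ with a ∷ r
  ...     | k = cong (λ z → b ∷ b′ ∷ z) (output-readBits′ l h k r)

  -- The left-hand side is the local function of tapeOutput, which has no name outside.
  output-readBits′ : ∀ l h k ss → _ ≡ readBits ss
  output-readBits′ l h k [] = refl
  output-readBits′ l h k (s ∷ ss) with symBit s
  ... | just b  = cong (b ∷_) (output-readBits′ l h k ss)
  ... | nothing = refl

code-right : ∀ r → ∃ λ h → ∃ λ r′ → moveHead mR (codeTape (atape [] home (map cell r))) ≡ tape (codeSy home ∷ []) h r′ ×
             readBits (h ∷ r′) ≡ readBits (map codeSy (map cell r))
code-right []      = blank , [] , refl , refl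
code-right (c ∷ r) = codeSy (cell c) , map codeSy (map cell r) , refl , refl

-- The other three stacks are empty, so the cells under the first stack carry the codes of plain
-- bits, and the next cell, if there is one, is blank and ends the output.
raw-output : ∀ y r → Tracks (raw y) r → readBits (map codeSy (map cell r)) ≡ y
raw-output y r T = reads y r (proj₁ (T q0)) (trans (proj₂ (T q0)) (trans (sym eq) refl))
    (zeros q0) (zeros q1) (zeros q2)
  where
  eq : map bitF y ++ replicate (proj₁ (T q0)) zero ≡ map bitF (reverse y) ʳ++ replicate (proj₁ (T q0)) zero
  eq = sym (trans (ʳ++-defn (map bitF (reverse y))) (cong (_++ replicate (proj₁ (T q0)) zero)
    (trans (sym (map-ʳ++ bitF (reverse y) {[]})) (cong (map bitF) (trans (ʳ++-ʳ++ y) (++-identityʳ y))))))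
  AllZero : (Fin 4) → List Cell → Set
  AllZero i r = All (λ c → digit i c ≡ zero) r
  rep-zero : ∀ i r m → map (digit i) r ≡ replicate m zero → AllZero i r
  rep-zero i [] m e = []
  rep-zero i (c ∷ r) (suc m) e = ∷-injectiveˡ e ∷ rep-zero i r m (∷-injectiveʳ e)
  zeros : ∀ (i : Fin 3) → AllZero (suc i) r
  zeros q0 = rep-zero q1 r _ (proj₂ (T q1))
  zeros q1 = rep-zero q2 r _ (proj₂ (T q2))
  zeros q2 = rep-zero q3 r _ (proj₂ (T q3))
  reads : ∀ y r m → map (digit q0) r ≡ map bitF y ++ replicate m zero → AllZero q1 r → AllZero q2 r → AllZero q3 r →
          readBits (map codeSy (map cell r)) ≡ y
  reads [] [] m e z₁ z₂ z₃ = refl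
  reads [] ((a ∷ b ∷ c ∷ d ∷ []) ∷ r) (suc m) e (refl ∷ z₁) (refl ∷ z₂) (refl ∷ z₃) with ∷-injectiveˡ e
  ... | refl = refl
  reads (false ∷ y) ((a ∷ b ∷ c ∷ d ∷ []) ∷ r) m e (refl ∷ z₁) (refl ∷ z₂) (refl ∷ z₃) with ∷-injectiveˡ e
  ... | refl = cong (false ∷_) (reads y r m (∷-injectiveʳ e) z₁ z₂ z₃)
  reads (true ∷ y) ((a ∷ b ∷ c ∷ d ∷ []) ∷ r) m e (refl ∷ z₁) (refl ∷ z₂) (refl ∷ z₃) with ∷-injectiveˡ e
  ... | refl = cong (true ∷_) (reads y r m (∷-injectiveʳ e) z₁ z₂ z₃)

pattern finalQ i = suc (suc (suc (suc i)))

embed : (M : Mach) → (Ex → Fin (4 + nQ M)) → Q M ⊎ Ex → Fin (4 + nQ M)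
embed M x (inj₁ q) = finalQ (encQ M q)
embed M x (inj₂ e) = x e

transfer : (M : Mach) → (Ex → Fin (4 + nQ M)) → (Q M ⊎ Ex) × Sy × Move → Fin (4 + nQ M) × Sym 79 × Move
transfer M x (q , s , m) = embed M x q , codeSy s , m

module DTMof (M : Mach) where
  fin : Ex → Fin (4 + nQ M)
  fin _ = suc (suc (suc zero))

  -- Of the four additional states two step to the left of the input and mark `home` there, one
  -- steps right onto the output after an exit, and one halts.
  δD : Fin (4 + nQ M) → Sym 79 → Fin (4 + nQ M) × Sym 79 × Move
  δD zero s                   = zero , s , mS
  δD (suc zero) s             = suc (suc zero) , s , mL
  δD (suc (suc zero)) s       = finalQ (encQ M (start M)) , codeSy home , mS
  δD (suc (suc (suc zero))) s = zero , s , mR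
  δD (finalQ i) s             = transfer M fin (δ M false (decQ M i) (decodeSy s))

  D₀ : DTM
  D₀ = record { nQ = 4 + nQ M ; extra = 79 ; start = suc zero ; halt = zero ; δ = δD }

  conf : Q M ⊎ Ex → ATape → DConfig D₀
  conf q t = dconf (embed M fin q) (codeTape t)

  step-δ : ∀ q t → dStep D₀ (conf (inj₁ q) t) ≡
    conf (proj₁ (δ M false q (ahead t))) (moveA (proj₂ (proj₂ (δ M false q (ahead t)))) (writeA (proj₁ (proj₂ (δ M false q (ahead t)))) t))
  step-δ q t rewrite headS-code t | decode-codeSy (ahead t) | dec-enc M q = cong (dconf _) (sym (code-move _ _ t))

  dRun-+ : ∀ a b c → dRun D₀ (a + b) c ≡ dRun D₀ b (dRun D₀ a c)
  dRun-+ zero b c = refl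
  dRun-+ (suc a) b c = dRun-+ a b (dStep D₀ c)

  dRun-halt : ∀ n t → dRun D₀ n (dconf zero t) ≡ dconf zero t
  dRun-halt zero t = refl
  dRun-halt (suc n) t = dRun-halt n t

  -- A deterministic run always takes the coin value `false`, so it follows the leftmost branch and
  -- ends in the first outcome of the list.
  record Ends (x : Q M ⊎ Ex) (t : ATape) (n : ℕ) (L : List Outcome) : Set where
    constructor ends
    field
      {e}    : Ex
      {s}    : Store
      {L′}   : List Outcome
      {t′}   : ATape
      {k}    : ℕ
      shape  : L ≡ (e , s) ∷ L′
      final  : Rep s t′
      short  : k ≤ n
      steps  : dRun D₀ k (conf x t) ≡ conf (inj₂ e) t′

  mutual
    ends-outs : ∀ {q t n L} → Outs M q t n L → Ends (inj₁ q) t n L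
    ends-outs {q} {t} (det eq r) with ends-cont r
    ... | ends {k = k} sh f k≤ st = ends sh f (s≤s k≤) (trans (cong (dRun D₀ k) (step-δ q t)) st)
    ends-outs {q} {t} (fork {L′ = L₂} ne r₁ r₂) with ends-cont r₁
    ... | ends {k = k} refl f k≤ st = ends refl f (s≤s k≤) (trans (cong (dRun D₀ k) (step-δ q t)) st)

    ends-cont : ∀ {x t n L} → Cont M x t n L → Ends x t n L
    ends-cont (go o)  = ends-outs o
    ends-cont (out r) = ends refl r z≤n refl

  polyTime : (f : BitString → BitString) (p : Poly) (e : Ex) →
             (∀ x → Exec M (raw x) (ev p (length x)) ((e , raw (f x)) ∷ [])) → PolyTimeComputable f
  -- Two steps are spent before the simulation and one after it.
  polyTime f p e ex with ev-≤-poly (p ⊕ con 3)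
  ... | c , k , le = D₀ , c , k , result
    where
    result : ∀ x → DConfig.dstate (dRun D₀ (poly c k ∣ x ∣ₛ) (dInit D₀ x)) ≡ zero ×
             tapeOutput (DConfig.dtape (dRun D₀ (poly c k ∣ x ∣ₛ) (dInit D₀ x))) ≡ f x
    result x with ends-outs (ex x _ (raw-rep x))
    ... | ends {k = j} refl (rep r refl T) j≤ st with code-right r
    ... | h , r′ , eq , eq′ = cong DConfig.dstate total , trans (cong (tapeOutput ∘ DConfig.dtape) total)
        (trans (output-readBits (codeSy home ∷ []) h r′) (trans eq′ (raw-output (f x) r T)))
      where
      time : 2 + (j + (1 + (poly c k (length x) ∸ (2 + (j + 1))))) ≡ poly c k (length x)
      time = trans (ar j (poly c k (length x) ∸ (2 + (j + 1)))) (m+[n∸m]≡n {2 + (j + 1)}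
        (≤-trans (≤-trans (+-monoʳ-≤ 2 (+-monoˡ-≤ 1 j≤)) (≤-reflexive (ar′ (ev p (length x))))) (le (length x))))
        where
        ar : ∀ j z → 2 + (j + (1 + z)) ≡ 2 + (j + 1) + z
        ar = solve-∀
        ar′ : ∀ j → 2 + (j + 1) ≡ j + 3
        ar′ = solve-∀
      total : dRun D₀ (poly c k (length x)) (dInit D₀ x) ≡ dconf zero (tape (codeSy home ∷ []) h r′)
      total = begin
        dRun D₀ (poly c k (length x)) (dInit D₀ x)       ≡⟨ cong (λ z → dRun D₀ z (dInit D₀ x)) (sym time) ⟩
        dRun D₀ (j + (1 + rest)) (dRun D₀ 2 (dInit D₀ x)) ≡⟨ cong (λ z → dRun D₀ (j + (1 + rest)) (dconf (finalQ (encQ M (start M))) z)) (code-input x) ⟩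
        dRun D₀ (j + (1 + rest)) (conf (inj₁ (start M)) t₀) ≡⟨ dRun-+ j (1 + rest) _ ⟩
        dRun D₀ (1 + rest) (dRun D₀ j (conf (inj₁ (start M)) t₀)) ≡⟨ cong (dRun D₀ (1 + rest)) st ⟩
        dRun D₀ rest (dconf zero _)                        ≡⟨ dRun-halt rest _ ⟩
        dconf zero _                                       ≡⟨ cong (dconf zero) eq ⟩
        dconf zero (tape (codeSy home ∷ []) h r′)          ∎
        where
        open ≡-Reasoning
        t₀ : ATape
        t₀ = atape [] home (map cell (inputCells x))
        rest : ℕ
        rest = poly c k (length x) ∸ (2 + (j + 1))

PT⇒PolyTime : {f : BitString → BitString} → PT f → PolyTimeComputable f
PT⇒PolyTime {f} pf = DTMof.polyTime M f time e0 λ x → exec (big x)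
  where
  M : Mach
  M = seq readM (seq (mach pf) unreadM)
  n′ space ops time : Poly
  n′ = con 6 ⊗ var ⊕ con 1
  space = con 60 ⊗ (con 1 ⊕ var) ⊕ bnd pf ⊚ n′
  ops = con 200 ⊗ (con 1 ⊕ var) ⊕ (bnd pf ⊚ n′ ⊕ con 20 ⊗ (con 1 ⊕ bnd pf ⊚ n′))
  time = ops ⊗ (space ⊕ space ⊕ con 3)
  big : ∀ x → Run (ev space (length x)) M (raw x) (ev ops (length x)) e0 (raw (f x))
  big x = run-bind (run-readM x (m≤m+n _ _))
    (run-bind (subst₂ (λ s s′ → Run B (mach pf) (st2 s []) b e0 (st2 s′ [])) (++-identityʳ _) (++-identityʳ _)
      (subst (λ z → Run B (mach pf) _ z e0 _) sz≡ (runs pf x [] [] B (≤-trans (≤-reflexive sz≡) (m≤n+m _ _)))))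
      (run-≤ (*-monoʳ-≤ 20 (s≤s (≤-trans (length≤size (f x)) fx))) (run-unreadM (f x) (≤-trans fx (m≤n+m _ _)))))
    where
    B b : ℕ
    B = ev space (length x)
    b = ev (bnd pf) (6 * length x + 1)
    sz≡ : ev (bnd pf) (size x) ≡ b
    sz≡ = cong (ev (bnd pf)) (size-bits x)
    fx : size (f x) ≤ b
    fx = ≤-trans (small pf x) (≤-reflexive sz≡)

-- Sums over the successors of a configuration

sum-++′ : ∀ xs ys → sum (xs ++ ys) ≡ sum xs + sum ys
sum-++′ [] ys = refl
sum-++′ (x ∷ xs) ys = trans (cong (x +_) (sum-++′ xs ys)) (sym (+-assoc x _ _))

sum-concatMap : ∀ {A B : Set} (g : B → ℕ) (f : A → List B) xs →
                sum (map g (concatMap f xs)) ≡ sum (map (λ x → sum (map g (f x))) xs)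
sum-concatMap g f [] = refl
sum-concatMap g f (x ∷ xs) = trans (cong sum (map-++ g (f x) _))
  (trans (sum-++′ (map g (f x)) _) (cong (sum (map g (f x)) +_) (sum-concatMap g f xs)))

sum-cong : ∀ {A : Set} {f g : A → ℕ} → (∀ x → f x ≡ g x) → ∀ xs → sum (map f xs) ≡ sum (map g xs)
sum-cong h xs = cong sum (map-cong h xs)

sum-+ : ∀ {A : Set} (f g : A → ℕ) xs → sum (map (λ x → f x + g x) xs) ≡ sum (map f xs) + sum (map g xs)
sum-+ f g [] = refl
sum-+ f g (x ∷ xs) = trans (cong (f x + g x +_) (sum-+ f g xs)) (ar (f x) (g x) (sum (map f xs)) (sum (map g xs)))
  where
  ar : ∀ a b c d → a + b + (c + d) ≡ a + c + (b + d)
  ar = solve-∀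

sum-zero : ∀ {A : Set} {f : A → ℕ} → (∀ x → f x ≡ 0) → ∀ xs → sum (map f xs) ≡ 0
sum-zero h [] = refl
sum-zero h (x ∷ xs) = cong₂ _+_ (h x) (sum-zero h xs)

when : Bool → ℕ → ℕ
when b n = if b then n else 0

sum-when : ∀ {A : Set} b (f : A → ℕ) xs → sum (map (λ x → when b (f x)) xs) ≡ when b (sum (map f xs))
sum-when true  f xs = refl
sum-when false f xs = sum-zero (λ _ → refl) xs

map-allFin-suc : ∀ {n} {A : Set} (f : Fin (suc n) → A) → map f (allFin (suc n)) ≡ f zero ∷ map (λ i → f (suc i)) (allFin n)
map-allFin-suc {n} f = cong (f zero ∷_) (trans (map-tabulate suc f) (sym (map-tabulate id (λ i → f (suc i)))))

sum-allFin : ∀ {n} (j : Fin n) (f : Fin n → ℕ) → sum (map (λ i → when (does (i Fin.≟ j)) (f i)) (allFin n)) ≡ f j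
sum-allFin {suc n} zero f = trans (cong sum (map-allFin-suc (λ i → when (does (i Fin.≟ zero)) (f i))))
  (trans (cong (f zero +_) (sum-zero (λ _ → refl) (allFin n))) (+-identityʳ _))
sum-allFin {suc n} (suc j) f = trans (cong sum (map-allFin-suc (λ i → when (does (i Fin.≟ suc j)) (f i)))) (sum-allFin j (λ i → f (suc i)))

eqMove : Move → Move → Bool
eqMove mL mL = true
eqMove mR mR = true
eqMove mS mS = true
eqMove _  _  = false

eqMove-sound : ∀ m m′ → eqMove m m′ ≡ true → m ≡ m′
eqMove-sound mL mL _ = refl
eqMove-sound mR mR _ = refl
eqMove-sound mS mS _ = refl

sum-allMoves : ∀ m (f : Move → ℕ) → sum (map (λ m′ → when (eqMove m′ m) (f m′)) allMoves) ≡ f m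
sum-allMoves mL f = +-identityʳ _
sum-allMoves mR f = +-identityʳ _
sum-allMoves mS f = +-identityʳ _

Act : ℕ → ℕ → Set
Act n e = Fin n × Sym e × Move

eqAct : ∀ {n e} → Act n e → Act n e → Bool
eqAct (q , s , m) (q′ , s′ , m′) = does (q Fin.≟ q′) ∧ does (s Fin.≟ s′) ∧ eqMove m m′

eqAct-sound : ∀ {n e} (a b : Act n e) → eqAct a b ≡ true → a ≡ b
eqAct-sound (q , s , m) (q′ , s′ , m′) eq with q Fin.≟ q′ | s Fin.≟ s′
eqAct-sound (q , s , m) (q′ , s′ , m′) eq | yes refl | yes refl = cong (λ z → q , s , z) (eqMove-sound m m′ eq)

sumAct : ∀ {n e} → (Act n e → ℕ) → ℕ
sumAct {n} {e} f = sum (map (λ q → sum (map (λ s → sum (map (λ m → f (q , s , m)) allMoves)) (allFin (3 + e)))) (allFin n))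

sumAct-cong : ∀ {n e} {f g : Act n e → ℕ} → (∀ a → f a ≡ g a) → sumAct f ≡ sumAct g
sumAct-cong {n} {e} h = sum-cong (λ q → sum-cong (λ s → sum-cong (λ m → h (q , s , m)) allMoves) (allFin (3 + e))) (allFin n)

sumAct-+ : ∀ {n e} (f g : Act n e → ℕ) → sumAct (λ a → f a + g a) ≡ sumAct f + sumAct g
sumAct-+ {n} {e} f g = trans (sum-cong (λ q → trans (sum-cong (λ s → sum-+ (λ m → f (q , s , m)) (λ m → g (q , s , m)) allMoves) (allFin (3 + e)))
  (sum-+ (λ s → sum (map (λ m → f (q , s , m)) allMoves)) (λ s → sum (map (λ m → g (q , s , m)) allMoves)) (allFin (3 + e)))) (allFin n))
  (sum-+ (λ q → sum (map (λ s → sum (map (λ m → f (q , s , m)) allMoves)) (allFin (3 + e)))) (λ q → sum (map (λ s → sum (map (λ m → g (q , s , m)) allMoves)) (allFin (3 + e)))) (allFin n))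

when-∧ : ∀ a b n → when (a ∧ b) n ≡ when a (when b n)
when-∧ true  b n = refl
when-∧ false b n = refl

sumAct-eq : ∀ {n e} (a : Act n e) (f : Act n e → ℕ) → sumAct (λ b → when (eqAct b a) (f b)) ≡ f a
sumAct-eq {n} {e} (q₀ , s₀ , m₀) f = trans (sum-cong inner (allFin n)) (sum-allFin q₀ (λ q → f (q , s₀ , m₀)))
  where
  innermost : ∀ q s → sum (map (λ m → when (does (q Fin.≟ q₀) ∧ does (s Fin.≟ s₀) ∧ eqMove m m₀) (f (q , s , m))) allMoves)
            ≡ when (does (q Fin.≟ q₀)) (when (does (s Fin.≟ s₀)) (f (q , s , m₀)))
  innermost q s = trans (sum-cong (λ m → trans (when-∧ bq (bs ∧ eqMove m m₀) (f (q , s , m))) (cong (when bq) (when-∧ bs (eqMove m m₀) (f (q , s , m))))) allMoves)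
    (trans (sum-when bq (λ m → when bs (when (eqMove m m₀) (f (q , s , m)))) allMoves)
      (cong (when bq) (trans (sum-when bs (λ m → when (eqMove m m₀) (f (q , s , m))) allMoves) (cong (when bs) (sum-allMoves m₀ (λ m → f (q , s , m)))))))
    where
    bq bs : Bool
    bq = does (q Fin.≟ q₀)
    bs = does (s Fin.≟ s₀)
  inner : ∀ q → sum (map (λ s → sum (map (λ m → when (eqAct (q , s , m) (q₀ , s₀ , m₀)) (f (q , s , m))) allMoves)) (allFin (3 + e)))
        ≡ when (does (q Fin.≟ q₀)) (f (q , s₀ , m₀))
  inner q = trans (sum-cong (innermost q) (allFin (3 + e)))
    (trans (sum-when (does (q Fin.≟ q₀)) (λ s → when (does (s Fin.≟ s₀)) (f (q , s , m₀))) (allFin (3 + e)))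
      (cong (when (does (q Fin.≟ q₀))) (sum-allFin s₀ (λ s → f (q , s , m₀)))))

module _ {n e : ℕ} where
  actsM : (Act n e → Bool) → Fin n → Sym e → Move → List (Act n e)
  actsM p q s m = if p (q , s , m) then (q , s , m) ∷ [] else []

  actsS : (Act n e → Bool) → Fin n → Sym e → List (Act n e)
  actsS p q s = concatMap (actsM p q s) allMoves

  actsQ : (Act n e → Bool) → Fin n → List (Act n e)
  actsQ p q = concatMap (actsS p q) (allFin (3 + e))

  -- The nesting is that of `nSucc`, so that the successors are literally the image of this list.
  acts : (Act n e → Bool) → List (Act n e)
  acts p = concatMap (actsQ p) (allFin n)

map-concatMap : ∀ {A B C : Set} (g : B → C) (f : A → List B) xs → map g (concatMap f xs) ≡ concatMap (λ x → map g (f x)) xs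
map-concatMap g f [] = refl
map-concatMap g f (x ∷ xs) = trans (map-++ g (f x) _) (cong (map g (f x) ++_) (map-concatMap g f xs))

map-acts : ∀ {n e} {C : Set} (g : Act n e → C) (p : Act n e → Bool) →
  map g (acts p) ≡ concatMap (λ q → concatMap (λ s → concatMap (λ m → if p (q , s , m) then g (q , s , m) ∷ [] else []) allMoves) (allFin (3 + e))) (allFin n)
map-acts {n} {e} g p = trans (map-concatMap g (actsQ p) (allFin n)) (concatMap-cong (λ q → trans (map-concatMap g (actsS p q) (allFin (3 + e)))
  (concatMap-cong (λ s → trans (map-concatMap g (actsM p q s) allMoves) (concatMap-cong (λ m → sub (p (q , s , m)) (q , s , m)) allMoves)) (allFin (3 + e)))) (allFin n))
  where
  sub : ∀ b a → map g (if b then a ∷ [] else []) ≡ (if b then g a ∷ [] else [])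
  sub true  a = refl
  sub false a = refl

sum-acts : ∀ {n e} (g : Act n e → ℕ) (p : Act n e → Bool) → sum (map g (acts p)) ≡ sumAct (λ a → when (p a) (g a))
sum-acts {n} {e} g p = trans (sum-concatMap g (actsQ p) (allFin n)) (sum-cong (λ q → trans (sum-concatMap g (actsS p q) (allFin (3 + e)))
  (sum-cong (λ s → trans (sum-concatMap g (actsM p q s) allMoves) (sum-cong (λ m → sub (p (q , s , m)) (q , s , m)) allMoves)) (allFin (3 + e)))) (allFin n))
  where
  sub : ∀ b a → sum (map g (if b then a ∷ [] else [])) ≡ when b (g a)
  sub true  a = +-identityʳ _
  sub false a = refl

all-acts : ∀ {n e} {P : Act n e → Set} {p : Act n e → Bool} → (∀ a → p a ≡ true → P a) → All P (acts p)
all-acts {n} {e} {P} {p} h = cm {f = actsQ p} (λ q → cm {f = actsS p q} (λ s → cm {f = actsM p q s} (λ m → sub (p (q , s , m)) (q , s , m) (h (q , s , m))) allMoves) (allFin (3 + e))) (allFin n)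
  where
  cm : ∀ {A B : Set} {P : B → Set} {f : A → List B} → (∀ x → All P (f x)) → ∀ xs → All P (concatMap f xs)
  cm h [] = []
  cm h (x ∷ xs) = ++⁺ (h x) (cm h xs)
  sub : ∀ b a → (b ≡ true → P a) → All P (if b then a ∷ [] else [])
  sub true  a h = h refl ∷ []
  sub false a h = []

module _ (N : NTM) where
  open NTM N renaming (nQ to nN; δ to δN)

  moveTo : Tape extra → Act nN extra → NConfig N
  moveTo t (q , s , m) = nconf q (moveHead m (write s t))

  rules : Fin nN → Sym extra → List (Act nN extra)
  rules q s = acts (λ a → δN q s (proj₁ a) (proj₁ (proj₂ a)) (proj₂ (proj₂ a)))

  nSucc-rules : ∀ q t → nSucc N (nconf q t) ≡ map (moveTo t) (rules q (headS t))
  nSucc-rules q t = sym (map-acts (moveTo t) (λ a → δN q (headS t) (proj₁ a) (proj₁ (proj₂ a)) (proj₂ (proj₂ a))))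

  allB-All : ∀ {A : Set} (p : A → Bool) {xs} → All (λ x → p x ≡ true) xs → allB N p xs ≡ true
  allB-All p [] = refl
  allB-All p (h ∷ hs) rewrite h = allB-All p hs

  accPaths-suc : ∀ n q t → isAccept N (nconf q t) ≡ false → isReject N (nconf q t) ≡ false →
                 accPaths N (suc n) (nconf q t) ≡ sum (map (accPaths N n) (map (moveTo t) (rules q (headS t))))
  accPaths-suc n q t na nr with isAccept N (nconf q t) | isReject N (nconf q t)
  ... | false | false = cong (λ z → sum (map (accPaths N n) z)) (nSucc-rules q t)

pattern haltQ i = suc (suc (suc (suc (suc i))))

module Coin (N : NTM) (F : Bool → Fin (NTM.nQ N) → Sym (NTM.extra N) → Act (NTM.nQ N) (NTM.extra N))
  (δ-F : ∀ q s a → NTM.δ N q s (proj₁ a) (proj₁ (proj₂ a)) (proj₂ (proj₂ a)) ≡ eqAct a (F false q s) ∨ eqAct a (F true q s)) where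
  open NTM N using (extra) renaming (nQ to nN)

  δ-at : Fin nN → Tape extra → Act nN extra → Bool
  δ-at q t a = NTM.δ N q (headS t) (proj₁ a) (proj₁ (proj₂ a)) (proj₂ (proj₂ a))

  next : Bool → Fin nN → Tape extra → NConfig N
  next c q t = moveTo N t (F c q (headS t))

  accPaths-det : ∀ n q t → isAccept N (nconf q t) ≡ false → isReject N (nconf q t) ≡ false →
                 F false q (headS t) ≡ F true q (headS t) → accPaths N (suc n) (nconf q t) ≡ accPaths N n (next false q t)
  accPaths-det n q t na nr eq = trans (accPaths-suc N n q t na nr) (begin
    sum (map (accPaths N n) (map (moveTo N t) (rules N q (headS t))))            ≡⟨ cong sum (sym (map-∘ (rules N q (headS t)))) ⟩
    sum (map (λ a → accPaths N n (moveTo N t a)) (rules N q (headS t)))          ≡⟨ trans (sum-acts (λ a → accPaths N n (moveTo N t a)) (δ-at q t)) (sumAct-cong (λ a → cong (λ z → when z (accPaths N n (moveTo N t a))) (δ-F q (headS t) a))) ⟩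
    sumAct (λ a → when (eqAct a A ∨ eqAct a (F true q (headS t))) (accPaths N n (moveTo N t a))) ≡⟨ sumAct-cong (λ a → cong (λ z → when (eqAct a A ∨ eqAct a z) (accPaths N n (moveTo N t a))) (sym eq)) ⟩
    sumAct (λ a → when (eqAct a A ∨ eqAct a A) (accPaths N n (moveTo N t a)))    ≡⟨ sumAct-cong (λ a → cong (λ z → when z (accPaths N n (moveTo N t a))) (idem (eqAct a A))) ⟩
    sumAct (λ a → when (eqAct a A) (accPaths N n (moveTo N t a)))                ≡⟨ sumAct-eq A (λ a → accPaths N n (moveTo N t a)) ⟩
    accPaths N n (moveTo N t A)                                                   ∎)
    where
    open ≡-Reasoning
    A : Act (nN) extra
    A = F false q (headS t)
    idem : ∀ b → b ∨ b ≡ b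
    idem true  = refl
    idem false = refl

  -- The two singletons of admissible actions are disjoint by hypothesis, which makes the sum over
  -- their union additive; equal actions would be counted once.
  accPaths-fork : ∀ n q t → isAccept N (nconf q t) ≡ false → isReject N (nconf q t) ≡ false →
                  F false q (headS t) ≢ F true q (headS t) →
                  accPaths N (suc n) (nconf q t) ≡ accPaths N n (next false q t) + accPaths N n (next true q t)
  accPaths-fork n q t na nr ne = trans (accPaths-suc N n q t na nr) (begin
    sum (map (accPaths N n) (map (moveTo N t) (rules N q (headS t))))            ≡⟨ cong sum (sym (map-∘ (rules N q (headS t)))) ⟩
    sum (map G (rules N q (headS t)))                                              ≡⟨ trans (sum-acts G (δ-at q t)) (sumAct-cong (λ a → cong (λ z → when z (G a)) (δ-F q (headS t) a))) ⟩
    sumAct (λ a → when (eqAct a A ∨ eqAct a A′) (G a))                             ≡⟨ sumAct-cong (λ a → splits a) ⟩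
    sumAct (λ a → when (eqAct a A) (G a) + when (eqAct a A′) (G a))                ≡⟨ sumAct-+ (λ a → when (eqAct a A) (G a)) (λ a → when (eqAct a A′) (G a)) ⟩
    sumAct (λ a → when (eqAct a A) (G a)) + sumAct (λ a → when (eqAct a A′) (G a)) ≡⟨ cong₂ _+_ (sumAct-eq A G) (sumAct-eq A′ G) ⟩
    G A + G A′                                                                      ∎)
    where
    open ≡-Reasoning
    A A′ : Act (nN) extra
    A = F false q (headS t)
    A′ = F true q (headS t)
    G : Act (nN) extra → ℕ
    G a = accPaths N n (moveTo N t a)
    splits : ∀ a → when (eqAct a A ∨ eqAct a A′) (G a) ≡ when (eqAct a A) (G a) + when (eqAct a A′) (G a)
    splits a with eqAct a A in p | eqAct a A′ in p′
    ... | true  | true  = ⊥-elim (ne (trans (sym (eqAct-sound a A p)) (eqAct-sound a A′ p′)))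
    ... | true  | false = sym (+-identityʳ _)
    ... | false | _     = refl

  halts-step : ∀ n q t → haltsWithin N n (next false q t) ≡ true → haltsWithin N n (next true q t) ≡ true →
               haltsWithin N (suc n) (nconf q t) ≡ true
  halts-step n q t h h′ = trans (cong (isTerminal N (nconf q t) ∨_) (trans (cong (allB N (haltsWithin N n)) (nSucc-rules N q t))
    (allB-All N (haltsWithin N n) (map⁺ (all-acts (λ a h → each-ok a (trans (sym (δ-F q (headS t) a)) h))))))) (∨-zeroʳ _)
    where
    each-ok : ∀ a → eqAct a (F false q (headS t)) ∨ eqAct a (F true q (headS t)) ≡ true → haltsWithin N n (moveTo N t a) ≡ true
    each-ok a eq with eqAct a (F false q (headS t)) in p
    ... | true  = trans (cong (λ z → haltsWithin N n (moveTo N t z)) (eqAct-sound a _ p)) h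
    ... | false = trans (cong (λ z → haltsWithin N n (moveTo N t z)) (eqAct-sound a _ eq)) h′

  record Counts (n : ℕ) (c : NConfig N) (k : ℕ) : Set where
    constructor _,ᶜ_
    field
      accepting : accPaths N n c ≡ k
      halting   : haltsWithin N n c ≡ true
  open Counts public

  counts-det : ∀ {n q t k} → isAccept N (nconf q t) ≡ false → isReject N (nconf q t) ≡ false → F false q (headS t) ≡ F true q (headS t) →
               Counts n (next false q t) k → Counts (suc n) (nconf q t) k
  counts-det {n} {q} {t} na nr eq (h ,ᶜ h′) = trans (accPaths-det n q t na nr eq) h ,ᶜ
    halts-step n q t h′ (trans (cong (λ z → haltsWithin N n (moveTo N t z)) (sym eq)) h′)

  counts-fork : ∀ {n q t k l} → isAccept N (nconf q t) ≡ false → isReject N (nconf q t) ≡ false → F false q (headS t) ≢ F true q (headS t) →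
                Counts n (next false q t) k → Counts n (next true q t) l → Counts (suc n) (nconf q t) (k + l)
  counts-fork {n} {q} {t} na nr ne (h ,ᶜ h′) (g ,ᶜ g′) = trans (accPaths-fork n q t na nr ne) (cong₂ _+_ h g) ,ᶜ halts-step n q t h′ g′


module NTMof (M : Mach) where
  fin : Ex → Fin (5 + nQ M)
  fin e0 = suc zero
  fin e1 = q4
  fin e2 = zero

  -- The three exits lead to three states, so that coin branches stay distinct.
  place : Q M ⊎ Ex → Fin (5 + nQ M)
  place (inj₁ q) = haltQ (encQ M q)
  place (inj₂ e) = fin e

  codeAct : (Q M ⊎ Ex) × Sy × Move → Act (5 + nQ M) 79
  codeAct (x , s , m) = place x , codeSy s , m

  place-inj : ∀ {x y} → place x ≡ place y → x ≡ y
  place-inj {inj₁ q}  {inj₁ q′} eq = cong inj₁ (trans (sym (dec-enc M q)) (trans (cong (decQ M) (down eq)) (dec-enc M q′)))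
    where
    down : ∀ {n} {i j : Fin n} → (Fin (5 + n) ∋ haltQ i) ≡ haltQ j → i ≡ j
    down refl = refl
  place-inj {inj₁ _}  {inj₂ e0} ()
  place-inj {inj₁ _}  {inj₂ e1} ()
  place-inj {inj₁ _}  {inj₂ e2} ()
  place-inj {inj₂ e0} {inj₁ _}  ()
  place-inj {inj₂ e1} {inj₁ _}  ()
  place-inj {inj₂ e2} {inj₁ _}  ()
  place-inj {inj₂ e0} {inj₂ e0} eq = refl
  place-inj {inj₂ e1} {inj₂ e1} eq = refl
  place-inj {inj₂ e2} {inj₂ e2} eq = refl
  place-inj {inj₂ e0} {inj₂ e1} ()
  place-inj {inj₂ e0} {inj₂ e2} ()
  place-inj {inj₂ e1} {inj₂ e0} ()
  place-inj {inj₂ e1} {inj₂ e2} ()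
  place-inj {inj₂ e2} {inj₂ e0} ()
  place-inj {inj₂ e2} {inj₂ e1} ()

  codeAct-inj : ∀ {x y} → codeAct x ≡ codeAct y → x ≡ y
  codeAct-inj {x , s , m} {x′ , s′ , m′} eq = cong₂ _,_ (place-inj (cong proj₁ eq)) (cong₂ _,_
    (trans (sym (decode-codeSy s)) (trans (cong decodeSy (cong (proj₁ ∘ proj₂) eq)) (decode-codeSy s′))) (cong (proj₂ ∘ proj₂) eq))

  F : Bool → Fin (5 + nQ M) → Sym 79 → Act (5 + nQ M) 79
  F c zero s                   = zero , s , mS
  F c (suc zero) s             = suc zero , s , mS
  F c (suc (suc zero)) s       = suc (suc (suc zero)) , s , mL
  F c (suc (suc (suc zero))) s = haltQ (encQ M (start M)) , codeSy home , mS
  F c q4 s                     = suc zero , s , mS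
  F c (haltQ i) s             = codeAct (δ M c (decQ M i) (decodeSy s))

  N₀ : NTM
  N₀ = record
    { nQ = 5 + nQ M ; extra = 79 ; start = suc (suc zero) ; accept = zero ; reject = suc zero
    ; δ = λ q s q′ s′ m → eqAct (q′ , s′ , m) (F false q s) ∨ eqAct (q′ , s′ , m) (F true q s) }

  open Coin N₀ F (λ q s a → refl)

  conf : Q M ⊎ Ex → ATape → NConfig N₀
  conf q t = nconf (place q) (codeTape t)

  next-δ : ∀ c q t → next c (haltQ (encQ M q)) (codeTape t) ≡
    conf (proj₁ (δ M c q (ahead t))) (moveA (proj₂ (proj₂ (δ M c q (ahead t)))) (writeA (proj₁ (proj₂ (δ M c q (ahead t)))) t))
  next-δ c q t rewrite headS-code t | decode-codeSy (ahead t) | dec-enc M q = cong (nconf _) (sym (code-move _ _ t))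

  F-δ : ∀ c q t → F c (haltQ (encQ M q)) (headS (codeTape t)) ≡ codeAct (δ M c q (ahead t))
  F-δ c q t rewrite headS-code t | decode-codeSy (ahead t) | dec-enc M q = refl

  accs : Outcome → ℕ
  accs (e0 , _) = 0
  accs (e1 , _) = 0
  accs (e2 , _) = 1


  counts-accept : ∀ n t → Counts n (nconf zero t) 1
  counts-accept zero    t = refl ,ᶜ refl
  counts-accept (suc n) t = refl ,ᶜ refl

  counts-reject : ∀ n t → Counts n (nconf (suc zero) t) 0
  counts-reject zero    t = refl ,ᶜ refl
  counts-reject (suc n) t = refl ,ᶜ refl

  mutual
    -- The surplus `suc j` pays for the extra step from exit `e1` to the rejecting state, and it
    -- lets branches of different lengths share one time bound.
    counts-outs : ∀ {q t n L} → Outs M q t n L → ∀ j → Counts (n + suc j) (conf (inj₁ q) t) (sum (map accs L))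
    counts-outs {q} {t} {L = L} (det {n} eq r) j = counts-det {n + suc j} refl refl
      (trans (F-δ false q t) (trans (cong codeAct eq) (sym (F-δ true q t))))
      (subst (λ z → Counts (n + suc j) z (sum (map accs L))) (sym (next-δ false q t)) (counts-cont r j))
    counts-outs {q} {t} (fork {n} {L} {L′} ne r r′) j = subst (Counts (suc n + suc j) _)
      (trans (sym (sum-++′ (map accs L) _)) (cong sum (sym (map-++ accs L L′))))
      (counts-fork {n + suc j} refl refl (λ eq → ne (codeAct-inj (trans (sym (F-δ false q t)) (trans eq (F-δ true q t)))))
        (subst (λ z → Counts (n + suc j) z _) (sym (next-δ false q t)) (counts-cont r j))
        (subst (λ z → Counts (n + suc j) z _) (sym (next-δ true q t)) (counts-cont r′ j)))

    counts-cont : ∀ {x t n L} → Cont M x t n L → ∀ j → Counts (n + suc j) (conf x t) (sum (map accs L))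
    counts-cont (go o) j = counts-outs o j
    counts-cont {t = t} {n} (out {e = e0} r) j = counts-reject (n + suc j) (codeTape t)
    counts-cont {t = t} {n} (out {e = e1} r) j rewrite +-suc n j = counts-det {n + j} refl refl refl (counts-reject (n + j) _)
    counts-cont {t = t} {n} (out {e = e2} r) j = counts-accept (n + suc j) (codeTape t)

  sharpP : (f : BitString → ℕ) (p : Poly) →
           (∀ x → ∃ λ L → Exec M (raw x) (ev p (length x)) L × f x ≡ sum (map accs L)) → SharpP f
  sharpP f p ex with ev-≤-poly (p ⊕ con 3)
  ... | c , k , le = N₀ , c , k , (λ x → halting (result x)) , (λ x → sym (accepting (result x)))
    where
    result : ∀ x → Counts (poly c k ∣ x ∣ₛ) (nInit N₀ x) (f x)
    result x with ex x
    ... | L , exec-x , eq = subst₂ (λ n m → Counts n (nInit N₀ x) m) time (sym eq)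
      (counts-det {suc (n + suc j)} refl refl refl
        (counts-det {n + suc j} refl refl refl
          (subst (λ z → Counts (n + suc j) (nconf (haltQ (encQ M (start M))) z) (sum (map accs L))) (sym (code-input x))
            (counts-outs (exec-x _ (raw-rep x)) j))))
      where
      n j : ℕ
      n = ev p (length x)
      j = poly c k (length x) ∸ (n + 3)
      ar : ∀ n j → 2 + (n + suc j) ≡ n + 3 + j
      ar = solve-∀
      time : 2 + (n + suc j) ≡ poly c k (length x)
      time = trans (ar n j) (m+[n∸m]≡n {n + 3} (le (length x)))

-- Counting accepted words

noBits : BitString
noBits = []

guesses : (BitString × BitString → Bool) → BitString → ℕ → BitString → ℕ
guesses V x zero    y = when (V (y , x)) 1
guesses V x (suc n) y = guesses V x n (false ∷ y) + guesses V x n (true ∷ y)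

verdict : Ex → Mach
verdict e0 = skipM e0
verdict e1 = skipM e0
verdict e2 = skipM e2

-- A pair code starts with its node bit. Replacing this bit by two node bits and the code of `b`
-- turns `(y , x)` into `(b ∷ y , x)` at the top of the stack.
addBit : Bool → Mach
addBit b = bind (pop sV) (λ _ → seq (pushAll (true ∷ true ∷ ser (enc b))) (skipM e1))

coinCase : Ex → Mach
coinCase e0 = addBit false
coinCase e1 = addBit true
coinCase e2 = skipM e0

exec-coin : ∀ s → Exec coinM s 1 ((e0 , s) ∷ (e1 , s) ∷ [])
exec-coin s t (rep r refl T) = fork (λ ()) (out (rep r refl T)) (out (rep r refl T))

exec-then : ∀ {B M N s k e s′ m L} → Run B M s k e s′ → Exec (N e) s′ m L → Exec (bind M N) s (k * opCost B + m) L
exec-then {M = M} {N} {L = L} r x = subst (Exec (bind M N) _ _) (++-identityʳ L) (exec-bind M N (exec r) (x ∷ []))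

acc : Outcome → ℕ
acc (e0 , _) = 0
acc (e1 , _) = 0
acc (e2 , _) = 1

module Guess {V : BitString × BitString → Bool} (pV : PT V) where

  ver : Mach
  ver = seq (mach pV) (bind (pop sV) (λ _ → bind (pop sV) verdict))

  -- The second stack holds in unary the number of bits still to be guessed: a leaf starts the
  -- verification, a node a coin toss and, through exit `e1`, the next round.
  bodyCase : Ex → Mach
  bodyCase e0 = skipM e0
  bodyCase e1 = ver
  bodyCase e2 = bind (pop sX) (λ _ → bind coinM coinCase)

  body guessM : Mach
  body = bind (pop sX) bodyCase
  guessM = loop body

  verEx : Bool → Ex
  verEx true  = e2
  verEx false = e0

  run-ver : ∀ {B} y x → ev (bnd pV) (size (y , x)) + 6 ≤ B →
            ∃ λ s → Run B ver (st2 (ser (enc (y , x))) []) (ev (bnd pV) (size (y , x)) + 3) (verEx (V (y , x))) s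
  run-ver {B} y x le = final (V (y , x)) (subst₂ (λ s s′ → Run B (mach pV) (st2 s []) (ev (bnd pV) (size (y , x))) e0 (st2 s′ [])) (++-identityʳ _) (++-identityʳ _)
      (runs pV (y , x) [] [] B (≤-trans (m≤m+n _ 6) le)))
    where
    le₅ : ∀ k → {T (k ≤ᵇ 6)} → k ≤ B
    le₅ k {t} = ≤-trans (≤-trans (≤ᵇ⇒≤ k 6 t) (m≤n+m 6 _)) le
    final : ∀ v → Run B (mach pV) (st2 (ser (enc (y , x))) []) (ev (bnd pV) (size (y , x))) e0 (st2 (ser (enc v)) []) →
            ∃ λ s → Run B ver (st2 (ser (enc (y , x))) []) (ev (bnd pV) (size (y , x)) + 3) (verEx v) s
    final true r  = _ , run-bind r (run-bind (run-pop-∷ sV _ true _ refl (le₅ 5)) (run-bind (run-pop-∷ sV _ true _ refl (le₅ 4)) (run-skip e2 _)))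
    final false r = _ , run-bind r (run-bind (run-pop-∷ sV _ true _ refl (le₅ 5)) (run-bind (run-pop-∷ sV _ false _ refl (le₅ 4)) (run-skip e0 _)))

  length-pair : ∀ (y x : BitString) → length (ser (enc (y , x))) ≡ size (y , x)
  length-pair y x = length-ser (enc (y , x))

  size-cons : ∀ b (y x : BitString) → size (b ∷ y , x) ≡ 6 + size (y , x)
  size-cons b y x = cong (λ z → suc (suc z + size y + size x)) (trans (sym (length-ser (enc b))) (length-serBool b))

  run-addBit : ∀ {B} b y x X → 6 + size (y , x) ≤ B →
               Run B (addBit b) (st2 (ser (enc (y , x))) X) 10 e1 (st2 (ser (enc (b ∷ y , x))) X)
  run-addBit {B} b y x X le = run-bind (run-pop-∷ sV _ true _ refl (≤-trans (≤-reflexive (length-pair y x)) (≤-trans (m≤n+m _ 6) le)))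
    (run-bind (subst₂ (λ k s → Run B (pushAll (true ∷ true ∷ ser (enc b))) (st2 (ser (enc y) ++ ser (enc x)) X) k e0 (st2 (true ∷ true ∷ s) X))
      (cong (λ z → suc (suc z) + 1) (length-serBool b)) (sym (++-assoc (ser (enc b)) _ _))
      (run-pushAll (true ∷ true ∷ ser (enc b)) _ X (≤-trans (≤-reflexive (trans (cong (λ z → suc (suc z) + length (ser (enc y) ++ ser (enc x))) (length-serBool b)) (cong (6 +_) (length-pair y x)))) le)))
      (run-skip e1 _))

  module _ (x : BitString) (S B : ℕ) (spc : ev (bnd pV) S + S + 6 ≤ B) where
    κ p : ℕ
    κ = opCost B
    p = ev (bnd pV) S

    Goal : ℕ → BitString → Set
    Goal n y = ∃ λ L → Exec guessM (st2 (ser (enc (y , x))) (ser (encℕ n))) ((20 * n + (p + 5)) * κ) L × guesses V x n y ≡ sum (map acc L)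

    space : ∀ {k} → k ≤ S + 6 → k ≤ B
    space le = ≤-trans le (≤-trans (≤-trans (m≤n+m (S + 6) p) (≤-reflexive (sym (+-assoc p S 6)))) spc)

    length-encℕ : ∀ n → length (ser (encℕ n)) ≡ 2 * n + 1
    length-encℕ zero = refl
    length-encℕ (suc n) = trans (cong (2 +_) (length-encℕ n)) (ar n)
      where
      ar : ∀ n → 2 + (2 * n + 1) ≡ 2 * suc n + 1
      ar = solve-∀

    guess : ∀ n y → size (y , x) + 6 * n ≤ S → Goal n y
    guess zero y le with run-ver y x (≤-trans (+-monoˡ-≤ 6 (ev-mono (bnd pV) leS)) (≤-trans (≤-by S (ar p S)) spc))
      where
      leS : size (y , x) ≤ S
      leS = ≤-trans (m≤m+n _ 0) le
      ar : ∀ p S → p + 6 + S ≡ p + S + 6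
      ar = solve-∀
    ... | s , r = (verEx (V (y , x)) , s) ∷ [] , last (V (y , x)) refl , value (V (y , x))
      where
      leS : size (y , x) ≤ S
      leS = ≤-trans (m≤m+n _ 0) le
      base : Exec body (st2 (ser (enc (y , x))) (ser (encℕ 0))) ((1 + (p + 3)) * κ) ((verEx (V (y , x)) , s) ∷ [])
      base = exec (run-bind (run-pop-∷ sX _ false [] refl (space (≤-trans (s≤s z≤n) (m≤n+m 6 S)))) (run-≤ (+-monoˡ-≤ 3 (ev-mono (bnd pV) leS)) r))
      one-more : (1 + (p + 3)) * κ + 1 ≤ (p + 5) * κ
      one-more = ≤-trans (+-monoʳ-≤ ((1 + (p + 3)) * κ) (opCost-pos B)) (≤-reflexive (ar p κ))
        where
        ar : ∀ p κ → (1 + (p + 3)) * κ + κ ≡ (p + 5) * κ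
        ar = solve-∀
      last : ∀ v → V (y , x) ≡ v → Exec guessM (st2 (ser (enc (y , x))) (ser (encℕ 0))) ((p + 5) * κ) ((verEx (V (y , x)) , s) ∷ [])
      last true eq = exec-≤ one-more (exec-loop body {m = 0} base (subst (λ z → Again body 0 (verEx z , s) ((verEx (V (y , x)) , s) ∷ [])) (sym eq) (cong (λ z → (verEx z , s) ∷ []) eq) ∷ []))
      last false eq = exec-≤ one-more (exec-loop body {m = 0} base (subst (λ z → Again body 0 (verEx z , s) ((verEx (V (y , x)) , s) ∷ [])) (sym eq) (cong (λ z → (verEx z , s) ∷ []) eq) ∷ []))
      value : ∀ v → when v 1 ≡ acc (verEx v , s) + 0
      value true  = refl
      value false = refl
    guess (suc n) y le with guess n (false ∷ y) (le′ false) | guess n (true ∷ y) (le′ true)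
      where
      ar : ∀ z n → 6 + z + 6 * n ≡ z + 6 * suc n
      ar = solve-∀
      le′ : ∀ b → size (b ∷ y , x) + 6 * n ≤ S
      le′ b = ≤-trans (≤-reflexive (trans (cong (_+ 6 * n) (size-cons b y x)) (ar (size (y , x)) n))) le
    ... | L₀ , x₀ , eq₀ | L₁ , x₁ , eq₁ = L₀ ++ L₁ ++ [] ,
      exec-≤ cost (exec-loop body two (x₀ ∷ x₁ ∷ [])) ,
      trans (cong₂ _+_ eq₀ eq₁) (trans (sym (sum-++′ (map acc L₀) _)) (cong sum (trans (sym (map-++ acc L₀ L₁)) (cong (λ z → map acc (L₀ ++ z)) (sym (++-identityʳ L₁))))))
      where
      X : List Bool
      X = ser (encℕ n)
      spaceX : length X + 2 ≤ S + 6
      spaceX = ≤-trans (≤-trans (≤-reflexive (cong (_+ 2) (length-encℕ n))) (≤-by (4 * n + 9 + size (y , x)) (ar n (size (y , x))))) (+-monoˡ-≤ 6 le)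
        where
        ar : ∀ n z → 2 * n + 1 + 2 + (4 * n + 9 + z) ≡ z + 6 * suc n + 6
        ar = solve-∀
      size≤ : 6 + size (y , x) ≤ B
      size≤ = space (≤-trans (≤-reflexive (+-comm 6 (size (y , x)))) (+-monoˡ-≤ 6 (≤-trans (m≤m+n (size (y , x)) (6 * suc n)) le)))
      tossed : Exec (bind coinM coinCase) (st2 (ser (enc (y , x))) X) (1 + 10 * κ)
        ((e1 , st2 (ser (enc (false ∷ y , x))) X) ∷ (e1 , st2 (ser (enc (true ∷ y , x))) X) ∷ [])
      tossed = exec-bind coinM coinCase (exec-coin _) (exec (run-addBit false y x X size≤) ∷ exec (run-addBit true y x X size≤) ∷ [])
      two : Exec body (st2 (ser (enc (y , x))) (ser (encℕ (suc n)))) (1 * κ + (1 * κ + (1 + 10 * κ)))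
        ((e1 , st2 (ser (enc (false ∷ y , x))) X) ∷ (e1 , st2 (ser (enc (true ∷ y , x))) X) ∷ [])
      two = exec-bind (pop sX) bodyCase (exec (run-pop-∷ sX _ true _ refl (space (≤-trans (≤-reflexive (+-comm 2 _)) spaceX))))
        (exec-bind (pop sX) _ (exec (run-pop-∷ sX _ false X refl (space (≤-trans (≤-trans (n≤1+n _) (≤-reflexive (+-comm 2 _))) spaceX)))) (tossed ∷ []) ∷ [])
      cost : 1 * κ + (1 * κ + (1 + 10 * κ)) + suc ((20 * n + (p + 5)) * κ) ≤ (20 * suc n + (p + 5)) * κ
      cost = ≤-trans (≤-trans (≤-reflexive (ar κ ((20 * n + (p + 5)) * κ)))
        (+-monoˡ-≤ _ (+-monoʳ-≤ (12 * κ) (≤-trans (≤-by 6 refl) (*-monoʳ-≤ 8 (opCost-pos B)))))) (≤-reflexive (ar′ κ n p))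
        where
        ar : ∀ κ r → 1 * κ + (1 * κ + (1 + 10 * κ)) + suc r ≡ 12 * κ + 2 + r
        ar = solve-∀
        ar′ : ∀ κ n p → 12 * κ + 8 * κ + (20 * n + (p + 5)) * κ ≡ (20 * suc n + (p + 5)) * κ
        ar′ = solve-∀

  module _ {W : BitString → ℕ} (pre : PT {BitString} {ℕ × BitString × BitString} (λ x → W x , (noBits , x))) where
    whole : Mach
    whole = seq readM (seq (mach pre) (bind (pop sV) (λ _ → seq (moveM sV sX) guessM)))

    assemble : ∀ x b p B → ev (bnd pre) (size x) ≡ b → ev (bnd pV) (10 * b) ≡ p → 60 * suc (length x) + 10 * b ≤ B → p + 10 * b + 6 ≤ B →
               ∃ λ L → Exec whole (raw x) ((200 * suc (length x) + (b + (1 + (40 * b + (20 * b + (p + 5)))))) * opCost B) L × guesses V x (W x) [] ≡ sum (map acc L)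
    assemble x b p B pre≡ refl h₁ h₂ = build (guess x (10 * b) B h₂ (W x) [] fits)
      where
      κ₀ : ℕ
      κ₀ = opCost B
      ar : ∀ a b c d e κ → (a + (b + (c + (d + e)))) * κ ≡ a * κ + (b * κ + (c * κ + (d * κ + e * κ)))
      ar = solve-∀
      init≤ : size (W x , (noBits , x)) ≤ b
      init≤ = ≤-trans (small pre x) (≤-reflexive pre≡)
      W-size : size (W x) ≤ b
      W-size = ≤-trans (≤-trans (m≤m+n _ _) (n≤1+n _)) init≤
      rest-size : size (noBits , x) ≤ b
      rest-size = ≤-trans (≤-trans (m≤n+m _ (size (W x))) (n≤1+n _)) init≤
      ten : 10 * b ≤ B
      ten = ≤-trans (m≤n+m (10 * b) (60 * suc (length x))) h₁
      W≤ : ∀ n → n ≤ sz (encℕ n)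
      W≤ zero = z≤n
      W≤ (suc n) = s≤s (≤-trans (W≤ n) (n≤1+n _))
      -- Each guessed bit enlarges the code of the pair by 6; the pair and the number of guesses are
      -- both at most `b`, so `7 * b` would suffice.
      fits : size (noBits , x) + 6 * W x ≤ 10 * b
      fits = ≤-trans (+-mono-≤ (≤-trans (≤-trans (m≤n+m (size (noBits , x)) (size (W x))) (n≤1+n _)) init≤) (*-monoʳ-≤ 6 (≤-trans (W≤ (W x)) (≤-trans (≤-trans (m≤m+n _ _) (n≤1+n _)) init≤))))
        (≤-by (3 * b) (ar₁ b))
        where
        ar₁ : ∀ b → b + 6 * b + 3 * b ≡ 10 * b
        ar₁ = solve-∀
      run₁ : Run B readM (raw x) (200 * suc (length x)) e0 (st2 (ser (enc x)) [])
      run₁ = run-readM x (≤-trans (m≤m+n (60 * suc (length x)) (10 * b)) h₁)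
      run₂ : Run B (mach pre) (st2 (ser (enc x)) []) b e0 (st2 (ser (enc (W x , (noBits , x)))) [])
      run₂ = subst₂ (λ s s′ → Run B (mach pre) (st2 s []) b e0 (st2 s′ [])) (++-identityʳ _) (++-identityʳ _)
        (subst (λ z → Run B (mach pre) (st2 (ser (enc x) ++ []) []) z e0 (st2 (ser (enc (W x , (noBits , x))) ++ []) [])) pre≡
          (runs pre x [] [] B (≤-trans (≤-reflexive pre≡) (≤-trans (m≤m+n b _) ten))))
      run₃ : Run B (pop sV) (st2 (ser (enc (W x , (noBits , x)))) []) 1 e2 (st2 (ser (enc (W x)) ++ ser (enc (noBits , x))) [])
      run₃ = run-pop-∷ sV _ true _ refl (≤-trans (≤-reflexive (length-ser (enc (W x , (noBits , x))))) (≤-trans (≤-trans init≤ (m≤m+n b _)) ten))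
      run₄ : Run B (moveM sV sX) (st2 (ser (enc (W x)) ++ ser (enc (noBits , x))) []) (40 * b) e0 (st2 (ser (enc (noBits , x))) (ser (enc (W x))))
      run₄ = run-≤ (*-monoʳ-≤ 40 W-size) (subst (λ z → Run B (moveM sV sX) (st2 (ser (enc (W x)) ++ ser (enc (noBits , x))) []) (40 * size (W x)) e0 (st2 (ser (enc (noBits , x))) z)) (++-identityʳ _)
        (run-mvVX (enc (W x)) _ [] (≤-trans (+-mono-≤ (≤-reflexive (trans (+-identityʳ _) (length-ser (enc (noBits , x))))) ≤-refl)
          (≤-trans (+-mono-≤ rest-size (*-monoʳ-≤ 4 W-size)) (≤-trans (≤-by (5 * b) (ar₅ b)) ten)))))
        where
        ar₅ : ∀ b → b + 4 * b + 5 * b ≡ 10 * b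
        ar₅ = solve-∀
      total : ∀ {a d L} → Run B readM (raw x) a e0 (st2 (ser (enc x)) []) →
              Run B (moveM sV sX) (st2 (ser (enc (W x)) ++ ser (enc (noBits , x))) []) d e0 (st2 (ser (enc (noBits , x))) (ser (enc (W x)))) →
              Exec guessM (st2 (ser (enc (noBits , x))) (ser (enc (W x)))) ((20 * W x + (p + 5)) * κ₀) L →
              Exec whole (raw x) (a * κ₀ + (b * κ₀ + (1 * κ₀ + (d * κ₀ + (20 * b + (p + 5)) * κ₀)))) L
      total r₁ r₄ ex = exec-then r₁ (exec-then run₂ (exec-then run₃ (exec-then r₄
        (exec-≤ (*-monoˡ-≤ κ₀ (+-monoˡ-≤ (p + 5) (*-monoʳ-≤ 20 (≤-trans (W≤ (W x)) W-size)))) ex))))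
      build : Goal x (10 * b) B h₂ (W x) [] →
        ∃ λ L → Exec whole (raw x) ((200 * suc (length x) + (b + (1 + (40 * b + (20 * b + (p + 5)))))) * opCost B) L × guesses V x (W x) [] ≡ sum (map acc L)
      build (L , ex , eq) = L , exec-≤ (≤-reflexive (sym (ar (200 * suc (length x)) b 1 (40 * b) (20 * b + (p + 5)) κ₀))) (total run₁ run₄ ex) , eq

    private
      spaceP timeP : Poly → Poly → Poly
      spaceP b p = con 60 ⊗ (con 1 ⊕ var) ⊕ con 10 ⊗ b ⊕ (p ⊕ con 10 ⊗ b ⊕ con 6)
      timeP b p = (con 200 ⊗ (con 1 ⊕ var) ⊕ (b ⊕ (con 1 ⊕ (con 40 ⊗ b ⊕ (con 20 ⊗ b ⊕ (p ⊕ con 5)))))) ⊗ (spaceP b p ⊕ spaceP b p ⊕ con 3)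

      assembleP : ∀ x b p → ev (bnd pre) (size x) ≡ ev b (length x) → ev (bnd pV) (10 * ev b (length x)) ≡ ev p (length x) →
        ∃ λ L → Exec whole (raw x) (ev (timeP b p) (length x)) L × guesses V x (W x) [] ≡ sum (map acc L)
      assembleP x b p h h′ = assemble x (ev b (length x)) (ev p (length x)) (ev (spaceP b p) (length x)) h h′ (m≤m+n (60 * suc (length x) + 10 * ev b (length x)) _) (m≤n+m (ev p (length x) + 10 * ev b (length x) + 6) (60 * suc (length x) + 10 * ev b (length x)))

    prepared-sharpP : (f : BitString → ℕ) → (∀ x → f x ≡ guesses V x (W x) []) → SharpP f
    prepared-sharpP f hf = NTMof.sharpP whole f (timeP bP pP) result
      where
      bP pP : Poly
      bP = bnd pre ⊚ (con 6 ⊗ var ⊕ con 1)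
      pP = bnd pV ⊚ (con 10 ⊗ bP)
      result : ∀ x → ∃ λ L → Exec whole (raw x) (ev (timeP bP pP) (length x)) L × f x ≡ sum (map (NTMof.accs whole) L)
      result x = relabel (assembleP x bP pP (cong (ev (bnd pre)) (size-bits x)) refl)
        where
        same : ∀ o → acc o ≡ NTMof.accs whole o
        same (e0 , _) = refl
        same (e1 , _) = refl
        same (e2 , _) = refl
        relabel : (∃ λ L → Exec whole (raw x) (ev (timeP bP pP) (length x)) L × guesses V x (W x) [] ≡ sum (map acc L)) →
                  ∃ λ L → Exec whole (raw x) (ev (timeP bP pP) (length x)) L × f x ≡ sum (map (NTMof.accs whole) L)
        relabel (L , ex , eq) = L , ex , trans (hf x) (trans eq (cong sum (map-cong same L)))

  guessing-sharpP : {W : BitString → ℕ} → PT W → (f : BitString → ℕ) → (∀ x → f x ≡ guesses V x (W x) []) → SharpP f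
  guessing-sharpP pW = prepared-sharpP (pW ,ₚ (constPT [] ,ₚ idPT))

-- Polynomial-time list functions and arithmetic

fst′ₚ : ∀ {A B C : Set} ⦃ eA : Enc A ⦄ ⦃ eB : Enc B ⦄ ⦃ eC : Enc C ⦄ {f : A → B × C} → PT f → PT (λ a → proj₁ (f a))
fst′ₚ p = fstPT ∘ₚ p

snd′ₚ : ∀ {A B C : Set} ⦃ eA : Enc A ⦄ ⦃ eB : Enc B ⦄ ⦃ eC : Enc C ⦄ {f : A → B × C} → PT f → PT (λ a → proj₂ (f a))
snd′ₚ p = sndPT ∘ₚ p

infixr 5 _∷ₚ_
_∷ₚ_ : ∀ {A X : Set} ⦃ eA : Enc A ⦄ ⦃ eX : Enc X ⦄ {f : A → X} {g : A → List X} → PT f → PT g → PT (λ a → f a ∷ g a)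
_∷ₚ_ {X = X} p q = recodePT {X × List X} (λ z → proj₁ z ∷ proj₂ z) (λ _ → refl) ∘ₚ (p ,ₚ q)

sucₚ : ∀ {A : Set} ⦃ eA : Enc A ⦄ {f : A → ℕ} → PT f → PT (λ a → suc (f a))
sucₚ p = recodePT {⊤ × ℕ} (λ z → suc (proj₂ z)) (λ _ → refl) ∘ₚ (constPT tt ,ₚ p)

caseListₚ : ∀ {E X B : Set} ⦃ eE : Enc E ⦄ ⦃ eX : Enc X ⦄ ⦃ eB : Enc B ⦄ {f : E → B} {g : E × (X × List X) → B} (h : E × List X → B) →
            (∀ e → h (e , []) ≡ f e) → (∀ e x xs → h (e , x ∷ xs) ≡ g (e , (x , xs))) → PT f → PT g → PT h
caseListₚ {E} {X} {f = f} {g} h h₀ h₁ = casePT h view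
  where
  view : ∀ e l → NilCons f g h e l
  view e []       = isNil refl (h₀ e)
  view e (x ∷ xs) = isCons (x , xs) _ _ refl refl (h₁ e x xs)

caseℕₚ : ∀ {E B : Set} ⦃ eE : Enc E ⦄ ⦃ eB : Enc B ⦄ {f : E → B} {g : E × ℕ → B} (h : E × ℕ → B) →
         (∀ e → h (e , 0) ≡ f e) → (∀ e n → h (e , suc n) ≡ g (e , n)) → PT f → PT g → PT h
caseℕₚ {E} {f = f} {g} h h₀ h₁ pf pg = casePT h view pf (pg ∘ₚ (fstPT ,ₚ snd′ₚ sndPT))
  where
  view : ∀ e l → NilCons {R = ⊤ × ℕ} f (λ z → g (proj₁ z , proj₂ (proj₂ z))) h e l
  view e zero    = isNil refl (h₀ e)
  view e (suc n) = isCons (tt , n) _ _ refl refl (h₁ e n)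

units : ℕ → List ⊤
units n = replicate n tt

unitsₚ : PT units
unitsₚ = recodePT units same
  where
  same : ∀ n → encList (enc {⊤}) (units n) ≡ encℕ n
  same zero    = refl
  same (suc n) = cong (nil ∙_) (same n)

iter : ∀ {B : Set} → ℕ → (B → B) → B → B
iter zero    f b = b
iter (suc n) f b = iter n f (f b)

module _ {A X E B : Set} ⦃ eA : Enc A ⦄ ⦃ eX : Enc X ⦄ ⦃ eE : Enc E ⦄ ⦃ eB : Enc B ⦄ {f : X × (E × B) → B} {xs : A → List X} {e : A → E} {b : A → B} where

  private
    F : A → B → X → B
    F a b x = f (x , (e a , b))

    carry : ∀ a ys c → foldl (λ (p : E × B) x → proj₁ p , f (x , p)) (e a , c) ys ≡ (e a , foldl (F a) c ys)
    carry a [] c = refl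
    carry a (y ∷ ys) c = carry a ys (f (y , (e a , c)))

  -- The machine for the step function sees only the element and the accumulator, so the parameter
  -- `e` travels inside the accumulator.
  foldBoundₚ : PT f → PT xs → PT e → PT b → (q : Poly) → (∀ a ys zs → xs a ≡ ys ++ zs → size (foldl (F a) (b a) ys) ≤ ev q (size a)) →
               PT (λ a → foldl (F a) (b a) (xs a))
  foldBoundₚ pf pxs pe pb q hq =
    respPT (λ a → cong proj₂ (carry a (xs a) (b a)))
      (snd′ₚ (foldPT {f = λ z → proj₁ (proj₂ z) , f z} (fst′ₚ sndPT ,ₚ pf) (pxs ,ₚ (pe ,ₚ pb)) (con 1 ⊕ bnd pe ⊕ q)
        (λ a ys zs eq → subst (λ z → size z ≤ 1 + ev (bnd pe) (size a) + ev q (size a)) (sym (carry a ys (b a)))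
          (s≤s (+-mono-≤ (small pe a) (hq a ys zs eq))))))

  -- Each step enlarges the accumulator by an amount independent of the accumulator. This excludes
  -- repeated doubling and bounds the whole fold polynomially.
  foldₚ : PT f → PT xs → PT e → PT b → (q : Poly) → (∀ x e b → size (f (x , (e , b))) ≤ size b + ev q (size x + size e)) →
          PT (λ a → foldl (F a) (b a) (xs a))
  foldₚ pf pxs pe pb q h = foldBoundₚ pf pxs pe pb (bnd pb ⊕ bnd pxs ⊗ (q ⊚ (bnd pxs ⊕ bnd pe)))
    (λ a ys zs eq → ≤-trans (grow a ys (b a)) (+-mono-≤ (small pb a)
      (*-mono-≤ (≤-trans (≤-trans (length≤size ys) (prefix ys zs)) (≤-trans (≤-reflexive (cong size (sym eq))) (small pxs a)))
        (ev-mono q (+-mono-≤ (≤-trans (prefix ys zs) (≤-trans (≤-reflexive (cong size (sym eq))) (small pxs a))) (small pe a))))))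
    where
    prefix : ∀ (ys zs : List X) → size ys ≤ size (ys ++ zs)
    prefix [] zs = sz-pos _
    prefix (y ∷ ys) zs = s≤s (+-monoʳ-≤ (size y) (prefix ys zs))
    grow : ∀ a ys c → size (foldl (F a) c ys) ≤ size c + length ys * ev q (size ys + size (e a))
    grow a [] c = ≤-reflexive (sym (+-identityʳ _))
    grow a (y ∷ ys) c = ≤-trans (grow a ys (F a c y)) (≤-trans (+-mono-≤ (h y (e a) c) ≤-refl)
      (≤-trans (≤-reflexive (+-assoc (size c) _ _)) (+-monoʳ-≤ (size c) (+-mono-≤
        (ev-mono q (+-monoˡ-≤ (size (e a)) (≤-trans (m≤m+n (size y) (size ys)) (n≤1+n _))))
        (*-monoʳ-≤ (length ys) (ev-mono q (+-monoˡ-≤ (size (e a)) (≤-trans (m≤n+m (size ys) (size y)) (n≤1+n _)))))))))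

iter-units : ∀ {B : Set} (f : B → B) n b → foldl (λ b _ → f b) b (units n) ≡ iter n f b
iter-units f zero b = refl
iter-units f (suc n) b = iter-units f n (f b)

iterₚ : ∀ {A E B : Set} ⦃ eA : Enc A ⦄ ⦃ eE : Enc E ⦄ ⦃ eB : Enc B ⦄ {f : E × B → B} {n : A → ℕ} {e : A → E} {b : A → B} →
        PT f → PT n → PT e → PT b → (q : Poly) → (∀ e b → size (f (e , b)) ≤ size b + ev q (size e)) →
        PT (λ a → iter (n a) (λ b → f (e a , b)) (b a))
iterₚ {f = f} {n} {e} {b} pf pn pe pb q h = respPT (λ a → iter-units (λ b → f (e a , b)) (n a) (b a))
  (foldₚ {X = ⊤} (pf ∘ₚ sndPT) (unitsₚ ∘ₚ pn) pe pb q (λ x e b → ≤-trans (h e b) (+-monoʳ-≤ (size b) (ev-mono q (n≤1+n _)))))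

size-ℕ : ∀ n → size n ≡ 2 * n + 1
size-ℕ zero = refl
size-ℕ (suc n) = trans (cong (2 +_) (size-ℕ n)) (ar n)
  where
  ar : ∀ n → 2 + (2 * n + 1) ≡ 2 * suc n + 1
  ar = solve-∀

n≤size : ∀ n → n ≤ size n
n≤size n = ≤-trans (≤-by (n + 1) (ar n)) (≤-reflexive (sym (size-ℕ n)))
  where
  ar : ∀ n → n + (n + 1) ≡ 2 * n + 1
  ar = solve-∀

size-mono : ∀ {m n} → m ≤ n → size m ≤ size n
size-mono {m} {n} le = ≤-trans (≤-reflexive (size-ℕ m)) (≤-trans (+-monoˡ-≤ 1 (*-monoʳ-≤ 2 le)) (≤-reflexive (sym (size-ℕ n))))

size-+ : ∀ m n → size (m + n) ≤ size n + size m
size-+ zero n = m≤m+n _ _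
size-+ (suc m) n = ≤-trans (s≤s (s≤s (size-+ m n))) (≤-reflexive (sym (trans (+-suc (size n) _) (cong suc (+-suc (size n) _)))))

isZero : ℕ → Bool
isZero zero    = true
isZero (suc _) = false

size-ʳ++ : ∀ {X : Set} ⦃ eX : Enc X ⦄ (xs ys : List X) → size (xs ʳ++ ys) + 1 ≡ size xs + size ys
size-ʳ++ [] ys = +-comm (size ys) 1
size-ʳ++ (x ∷ xs) ys = trans (size-ʳ++ xs (x ∷ ys)) (ar (size x) (size xs) (size ys))
  where
  ar : ∀ x xs ys → xs + suc (x + ys) ≡ suc (x + xs) + ys
  ar = solve-∀

module _ {A : Set} ⦃ eA : Enc A ⦄ where

  infixl 6 _+ₚ_

  _+ₚ_ : {m n : A → ℕ} → PT m → PT n → PT (λ a → m a + n a)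
  _+ₚ_ {m} {n} pm pn = respPT (λ a → add (m a) (n a))
    (iterₚ {E = ⊤} {f = λ z → suc (proj₂ z)} (sucₚ sndPT) pm (constPT tt) pn (con 2) (λ e b → ≤-reflexive (+-comm 2 (size b))))
    where
    add : ∀ m n → iter m suc n ≡ m + n
    add zero n = refl
    add (suc m) n = trans (add m (suc n)) (+-suc m n)

  predₚ : {m : A → ℕ} → PT m → PT (λ a → pred (m a))
  predₚ pm = caseℕₚ {E = ⊤} (λ z → pred (proj₂ z)) (λ _ → refl) (λ _ _ → refl) (constPT 0) sndPT ∘ₚ (constPT tt ,ₚ pm)

  isZeroₚ : {m : A → ℕ} → PT m → PT (λ a → isZero (m a))
  isZeroₚ pm = caseℕₚ {E = ⊤} (λ z → isZero (proj₂ z)) (λ _ → refl) (λ _ _ → refl) (constPT true) (constPT false) ∘ₚ (constPT tt ,ₚ pm)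

  notₚ : {b : A → Bool} → PT b → PT (λ a → not (b a))
  notₚ {b} pb = respPT (λ a → same (b a)) (ifPT pb (constPT false) (constPT true))
    where
    same : ∀ b → (if b then false else true) ≡ not b
    same true  = refl
    same false = refl

  infixr 6 _∧ₚ_
  _∧ₚ_ : {b c : A → Bool} → PT b → PT c → PT (λ a → b a ∧ c a)
  _∧ₚ_ {b} {c} pb pc = respPT (λ a → same (b a) (c a)) (ifPT pb pc (constPT false))
    where
    same : ∀ b c → (if b then c else false) ≡ b ∧ c
    same true  c = refl
    same false c = refl

module _ {A : Set} ⦃ eA : Enc A ⦄ where

  infixl 6 _∸ₚ_
  infixl 7 _*ₚ_

  _*ₚ_ : {m n : A → ℕ} → PT m → PT n → PT (λ a → m a * n a)
  _*ₚ_ {m} {n} pm pn = respPT (λ a → trans (mul (m a) (n a) 0) (+-identityʳ _))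
    (iterₚ {E = ℕ} {f = λ z → proj₁ z + proj₂ z} (fstPT +ₚ sndPT) pm pn (constPT 0) var (λ e b → size-+ e b))
    where
    mul : ∀ m n b → iter m (n +_) b ≡ m * n + b
    mul zero n b = refl
    mul (suc m) n b = trans (mul m n (n + b)) (ar n (m * n) b)
      where
      ar : ∀ n k b → k + (n + b) ≡ n + k + b
      ar = solve-∀

  _∸ₚ_ : {m n : A → ℕ} → PT m → PT n → PT (λ a → m a ∸ n a)
  _∸ₚ_ {m} {n} pm pn = respPT (λ a → monus (n a) (m a))
    (iterₚ {E = ⊤} {f = λ z → pred (proj₂ z)} (predₚ sndPT) pn (constPT tt) pm (con 0) (λ e b → ≤-trans (size-mono (pred[n]≤n {b})) (m≤m+n _ 0)))
    where
    monus : ∀ n m → iter n pred m ≡ m ∸ n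
    monus zero m = refl
    monus (suc n) zero = trans (monus n 0) (0∸n≡0 n)
    monus (suc n) (suc m) = monus n m

  ≤ᵇₚ : {m n : A → ℕ} → PT m → PT n → PT (λ a → m a ≤ᵇ n a)
  ≤ᵇₚ {m} {n} pm pn = respPT (λ a → same (m a) (n a)) (isZeroₚ (pm ∸ₚ pn))
    where
    same : ∀ m n → isZero (m ∸ n) ≡ (m ≤ᵇ n)
    same zero n = cong isZero (0∸n≡0 n)
    same (suc m) zero = refl
    same (suc zero) (suc n) = cong isZero (0∸n≡0 n)
    same (suc (suc m)) (suc n) = same (suc m) n

  reverseₚ : ∀ {X : Set} ⦃ eX : Enc X ⦄ {xs : A → List X} → PT xs → PT (λ a → reverse (xs a))
  reverseₚ {X} pxs = foldₚ {E = ⊤} {f = λ z → proj₁ z ∷ proj₂ (proj₂ z)} (fstPT ∷ₚ snd′ₚ sndPT) pxs (constPT tt) (constPT []) (var ⊕ con 1)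
    (λ x e b → ≤-trans (≤-by 1 (ar (size x) (size b))) ≤-refl)
    where
    ar : ∀ x b → suc (x + b) + 1 ≡ b + (x + 1 + 1)
    ar = solve-∀

  infixr 5 _ʳ++ₚ_
  _ʳ++ₚ_ : ∀ {X : Set} ⦃ eX : Enc X ⦄ {xs ys : A → List X} → PT xs → PT ys → PT (λ a → xs a ʳ++ ys a)
  _ʳ++ₚ_ {X} pxs pys = foldₚ {E = ⊤} {f = λ z → proj₁ z ∷ proj₂ (proj₂ z)} (fstPT ∷ₚ snd′ₚ sndPT) pxs (constPT tt) pys (var ⊕ con 1)
    (λ x e b → ≤-trans (≤-by 1 (ar (size x) (size b))) ≤-refl)
    where
    ar : ∀ x b → suc (x + b) + 1 ≡ b + (x + 1 + 1)
    ar = solve-∀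

  nullₚ : ∀ {X : Set} ⦃ eX : Enc X ⦄ {xs : A → List X} → PT xs → PT (λ a → null (xs a))
  nullₚ {X} pxs = caseListₚ {E = ⊤} {X = X} (λ z → null (proj₂ z)) (λ _ → refl) (λ _ _ _ → refl) (constPT true) (constPT false) ∘ₚ (constPT tt ,ₚ pxs)

  lengthₚ : ∀ {X : Set} ⦃ eX : Enc X ⦄ {xs : A → List X} → PT xs → PT (λ a → length (xs a))
  lengthₚ {X} {xs} pxs = respPT (λ a → trans (count (xs a) 0) (+-identityʳ _)) (foldₚ {E = ⊤} {f = λ z → suc (proj₂ (proj₂ z))} (sucₚ (snd′ₚ sndPT)) pxs (constPT tt) (constPT 0) (con 2)
    (λ x e b → ≤-reflexive (+-comm 2 (size b))))
    where
    count : ∀ (xs : List X) n → foldl (λ b _ → suc b) n xs ≡ length xs + n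
    count [] n = refl
    count (x ∷ xs) n = trans (count xs (suc n)) (+-suc _ _)

module _ {A : Set} ⦃ eA : Enc A ⦄ where

  infixr 5 _++ₚ_
  _++ₚ_ : ∀ {X : Set} ⦃ eX : Enc X ⦄ {xs ys : A → List X} → PT xs → PT ys → PT (λ a → xs a ++ ys a)
  _++ₚ_ {xs = xs} {ys} pxs pys = respPT (λ a → trans (ʳ++-ʳ++ (xs a)) refl) (reverseₚ pxs ʳ++ₚ pys)

  concatMapₚ : ∀ {X E Y : Set} ⦃ eX : Enc X ⦄ ⦃ eE : Enc E ⦄ ⦃ eY : Enc Y ⦄ {f : X × E → List Y} {xs : A → List X} {e : A → E} →
               PT f → PT xs → PT e → PT (λ a → concatMap (λ x → f (x , e a)) (xs a))
  concatMapₚ {X} {E} {Y} {f} {xs} {e} pf pxs pe = respPT (λ a → cm (e a) (xs a) [])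
    (reverseₚ (foldₚ {f = λ z → f (proj₁ z , proj₁ (proj₂ z)) ʳ++ proj₂ (proj₂ z)} ((pf ∘ₚ (fstPT ,ₚ fst′ₚ sndPT)) ʳ++ₚ snd′ₚ sndPT) pxs pe (constPT [])
      (bnd pf ⊚ (con 1 ⊕ var)) (λ x e b → ≤-trans (≤-trans (m≤m+n _ 1) (≤-reflexive (size-ʳ++ (f (x , e)) b)))
        (≤-trans (≤-reflexive (+-comm (size (f (x , e))) (size b))) (+-monoʳ-≤ (size b) (small pf (x , e)))))))
    where
    cm : ∀ e (xs : List X) (ys : List Y) → reverse (foldl (λ b x → f (x , e) ʳ++ b) ys xs) ≡ reverse ys ++ concatMap (λ x → f (x , e)) xs
    cm e [] ys = sym (++-identityʳ _)
    cm e (x ∷ xs) ys = trans (cm e xs (f (x , e) ʳ++ ys)) (trans (cong (_++ concatMap (λ x → f (x , e)) xs) (trans (ʳ++-ʳ++ (f (x , e))) (trans (ʳ++-defn ys) (cong (reverse ys ++_) (++-identityʳ _)))))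
      (++-assoc (reverse ys) _ _))

  mapₚ : ∀ {X E Y : Set} ⦃ eX : Enc X ⦄ ⦃ eE : Enc E ⦄ ⦃ eY : Enc Y ⦄ {f : X × E → Y} {xs : A → List X} {e : A → E} →
         PT f → PT xs → PT e → PT (λ a → map (λ x → f (x , e a)) (xs a))
  mapₚ {X} {f = f} {xs} {e} pf pxs pe = respPT (λ a → same (e a) (xs a)) (concatMapₚ {f = λ z → f z ∷ []} (pf ∷ₚ constPT []) pxs pe)
    where
    same : ∀ e (xs : List X) → concatMap (λ x → f (x , e) ∷ []) xs ≡ map (λ x → f (x , e)) xs
    same e [] = refl
    same e (x ∷ xs) = cong (f (x , e) ∷_) (same e xs)

  replicateₚ : ∀ {X : Set} ⦃ eX : Enc X ⦄ {n : A → ℕ} {x : A → X} → PT n → PT x → PT (λ a → replicate (n a) (x a))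
  replicateₚ {X} {n} {x} pn px = respPT (λ a → same (n a) (x a)) (mapₚ {f = λ z → proj₂ z} sndPT (unitsₚ ∘ₚ pn) px)
    where
    same : ∀ n (x : X) → map (λ _ → x) (units n) ≡ replicate n x
    same zero x = refl
    same (suc n) x = cong (x ∷_) (same n x)

upFrom : ℕ → ℕ → List ℕ
upFrom s zero    = []
upFrom s (suc n) = s ∷ upFrom (suc s) n

private
  count : ℕ × List ℕ → ℕ × List ℕ
  count (k , l) = suc k , k ∷ l

  downs : ℕ → List ℕ
  downs zero    = []
  downs (suc n) = n ∷ downs n

  count-units : ∀ ys k → foldl (λ b (_ : ⊤) → count b) (k , downs k) ys ≡ (length ys + k , downs (length ys + k))
  count-units [] k = refl
  count-units (_ ∷ ys) k = trans (count-units ys (suc k)) (cong (λ z → z , downs z) (+-suc (length ys) k))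

  size-downs : ∀ k → size (downs k) ≤ suc k * size (suc k)
  size-downs zero = s≤s z≤n
  size-downs (suc k) = ≤-trans (s≤s (+-mono-≤ (≤-refl {size k}) (size-downs k)))
    (+-mono-≤ {suc (size k)} (≤-trans (n≤1+n (suc (size k))) (≤-trans (n≤1+n _) (n≤1+n _))) (*-monoʳ-≤ (suc k) (size-mono (n≤1+n (suc k)))))

  downs-upFrom : ∀ n r → downs n ʳ++ upFrom n r ≡ upFrom 0 (n + r)
  downs-upFrom zero r = refl
  downs-upFrom (suc n) r = trans (downs-upFrom n (suc r)) (cong (upFrom 0) (+-suc n r))

upFrom₀ₚ : ∀ {A : Set} ⦃ eA : Enc A ⦄ {n : A → ℕ} → PT n → PT (λ a → upFrom 0 (n a))
upFrom₀ₚ {A} {n} pn = respPT (λ a → trans (cong (reverse ∘ proj₂) (trans (count-units (units (n a)) 0) (cong (λ z → z , downs z) (trans (+-identityʳ _) (length-replicate (n a))))))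
    (trans (downs-upFrom (n a) 0) (cong (upFrom 0) (+-identityʳ _))))
  (reverseₚ (snd′ₚ (foldBoundₚ {X = ⊤} {E = ⊤} {f = λ z → count (proj₂ (proj₂ z))} {xs = λ a → units (n a)} {e = λ _ → tt} {b = λ _ → 0 , []}
    (sucₚ (fst′ₚ (snd′ₚ sndPT)) ,ₚ (fst′ₚ (snd′ₚ sndPT) ∷ₚ snd′ₚ (snd′ₚ sndPT))) (unitsₚ ∘ₚ pn) (constPT tt) (constPT (0 , [])) q bound)))
  where
  q : Poly
  q = con 1 ⊕ bnd pn ⊕ (con 1 ⊕ bnd pn) ⊗ (con 2 ⊕ bnd pn)
  bound : ∀ a ys zs → units (n a) ≡ ys ++ zs → size (foldl (λ b (_ : ⊤) → count b) (0 , []) ys) ≤ ev q (size a)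
  bound a ys zs eq = ≤-trans (≤-reflexive (cong size (trans (count-units ys 0) (cong (λ z → z , downs z) (+-identityʳ _)))))
    (s≤s (+-mono-≤ (≤-trans (size-mono le) (small pn a)) (≤-trans (size-downs (length ys))
      (*-mono-≤ (s≤s (≤-trans le (≤-trans (n≤size (n a)) (small pn a)))) (s≤s (s≤s (≤-trans (size-mono le) (small pn a))))))))
    where
    le : length ys ≤ n a
    le = ≤-trans (m≤m+n _ (length zs)) (≤-reflexive (trans (sym (length-++ ys)) (trans (cong length (sym eq)) (length-replicate (n a)))))

mapAccum : ∀ {S X Y : Set} → (X → S → S × Y) → S → List X → S × List Y
mapAccum f s []       = s , []
mapAccum f s (x ∷ xs) = proj₁ (mapAccum f (proj₁ (f x s)) xs) , proj₂ (f x s) ∷ proj₂ (mapAccum f (proj₁ (f x s)) xs)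

mapAccumₚ : ∀ {A S X Y E : Set} ⦃ eA : Enc A ⦄ ⦃ eS : Enc S ⦄ ⦃ eX : Enc X ⦄ ⦃ eY : Enc Y ⦄ ⦃ eE : Enc E ⦄
            {f : X × (E × S) → S × Y} {s : A → S} {xs : A → List X} {e : A → E} → PT f → PT s → PT xs → PT e →
            (q : Poly) → (∀ x e s → size (f (x , (e , s))) ≤ size s + ev q (size x + size e)) →
            PT (λ a → mapAccum (λ x s → f (x , (e a , s))) (s a) (xs a))
mapAccumₚ {A} {S} {X} {Y} {E} {f} {s} {xs} {e} pf ps pxs pe q h = respPT (λ a → same (e a) (xs a) (s a) [])
    (fst′ₚ folded ,ₚ reverseₚ (snd′ₚ folded))
  where
  F : X × (E × (S × List Y)) → S × List Y
  F (x , (e , (s , ys))) = proj₁ (f (x , (e , s))) , proj₂ (f (x , (e , s))) ∷ ys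
  inner : PT {X × (E × (S × List Y))} (λ z → f (proj₁ z , (proj₁ (proj₂ z) , proj₁ (proj₂ (proj₂ z)))))
  inner = pf ∘ₚ (fstPT ,ₚ (fst′ₚ sndPT ,ₚ fst′ₚ (snd′ₚ sndPT)))
  folded : PT (λ a → foldl (λ b x → F (x , (e a , b))) (s a , []) (xs a))
  folded = foldₚ {f = F} (fst′ₚ inner ,ₚ (snd′ₚ inner ∷ₚ snd′ₚ (snd′ₚ sndPT))) pxs pe (ps ,ₚ constPT []) (q ⊕ con 1)
    (λ { x e (s , ys) → ≤-trans (≤-reflexive (ar (size (proj₁ (f (x , (e , s))))) (size (proj₂ (f (x , (e , s))))) (size ys)))
      (≤-trans (s≤s (+-monoˡ-≤ (size ys) (h x e s))) (≤-trans (≤-by 1 (ar′ (size s) (ev q (size x + size e)) (size ys))) ≤-refl)) })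
    where
    ar : ∀ a b c → suc (a + suc (b + c)) ≡ suc (suc (a + b) + c)
    ar a b c = cong suc (trans (+-suc a (b + c)) (cong suc (sym (+-assoc a b c))))
    ar′ : ∀ s q y → suc (s + q + y) + 1 ≡ suc (s + y) + (q + 1)
    ar′ = solve-∀
  same : ∀ e xs s ys → (let r = foldl (λ b x → F (x , (e , b))) (s , ys) xs in proj₁ r , reverse (proj₂ r)) ≡
    (proj₁ (mapAccum (λ x s → f (x , (e , s))) s xs) , reverse ys ++ proj₂ (mapAccum (λ x s → f (x , (e , s))) s xs))
  same e [] s ys = cong (s ,_) (sym (++-identityʳ _))
  same e (x ∷ xs) s ys = trans (same e xs _ _) (cong (_ ,_) (trans (cong (_++ _) (unfold-reverse _ ys)) (++-assoc (reverse ys) _ _)))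

-- Numbers as bit lists and their subtraction

bit : Bool → ℕ
bit b = if b then 1 else 0

val : List Bool → ℕ
val []       = 0
val (b ∷ bs) = 2 * val bs + bit b

readMSB : ℕ → BitString → ℕ
readMSB = foldl (λ acc b → 2 * acc + bit b)

mutual
  bitsToℕ-readMSB : ∀ bs → bitsToℕ bs ≡ readMSB 0 bs
  bitsToℕ-readMSB [] = refl
  -- Abstracting the bit value gives the local function of `bitsToℕ` variables as arguments, which
  -- identifies it with the underscore below.
  bitsToℕ-readMSB (b ∷ bs) with (if b then 1 else 0)
  ... | k = bitsToℕ-readMSB′ k bs

  bitsToℕ-readMSB′ : ∀ acc bs → _ ≡ readMSB acc bs
  bitsToℕ-readMSB′ acc [] = refl
  bitsToℕ-readMSB′ acc (b ∷ bs) = bitsToℕ-readMSB′ (2 * acc + (if b then 1 else 0)) bs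

readMSB-reverse : ∀ bs → readMSB 0 (reverse bs) ≡ val bs
readMSB-reverse bs = trans (reverse-foldl _ 0 bs) (folded bs)
  where
  folded : ∀ bs → foldr (λ b acc → 2 * acc + bit b) 0 bs ≡ val bs
  folded [] = refl
  folded (b ∷ bs) = cong (λ z → 2 * z + bit b) (folded bs)

bitsToℕ-reverse : ∀ bs → bitsToℕ (reverse bs) ≡ val bs
bitsToℕ-reverse bs = trans (bitsToℕ-readMSB (reverse bs)) (readMSB-reverse bs)

anyBit : List Bool → Bool
anyBit = foldl _∨_ false

module _ {A : Set} ⦃ eA : Enc A ⦄ where

  infixr 6 _∨ₚ_
  _∨ₚ_ : {b c : A → Bool} → PT b → PT c → PT (λ a → b a ∨ c a)
  _∨ₚ_ {b} {c} pb pc = respPT (λ a → same (b a) (c a)) (ifPT pb (constPT true) pc)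
    where
    same : ∀ b c → (if b then true else c) ≡ b ∨ c
    same true  c = refl
    same false c = refl


size-Bool : ∀ (b c : Bool) → size b ≡ size c
size-Bool false false = refl
size-Bool false true  = refl
size-Bool true  false = refl
size-Bool true  true  = refl

module _ {A : Set} ⦃ eA : Enc A ⦄ where
  anyBitₚ : {bs : A → List Bool} → PT bs → PT (λ a → anyBit (bs a))
  anyBitₚ {bs} pbs = foldₚ {E = ⊤} {f = λ z → proj₂ (proj₂ z) ∨ proj₁ z} (snd′ₚ sndPT ∨ₚ fstPT) pbs (constPT tt) (constPT false) (con 0)
    (λ x e b → ≤-trans (≤-reflexive (size-Bool (b ∨ x) b)) (m≤m+n _ 0))

anyBit-∨ : ∀ b bs → foldl _∨_ b bs ≡ b ∨ anyBit bs
anyBit-∨ b [] = sym (∨-identityʳ b)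
anyBit-∨ b (c ∷ bs) = trans (anyBit-∨ (b ∨ c) bs) (trans (∨-assoc b c (anyBit bs)) (cong (b ∨_) (sym (anyBit-∨ c bs))))

anyBit-val : ∀ bs → anyBit bs ≡ not (isZero (val bs))
anyBit-val [] = refl
anyBit-val (b ∷ bs) = trans (anyBit-∨ b bs) (trans (cong (b ∨_) (anyBit-val bs)) (combineBit b (val bs)))
  where
  combineBit : ∀ b v → b ∨ not (isZero v) ≡ not (isZero (2 * v + bit b))
  combineBit true  v rewrite +-comm (2 * v) 1 = refl
  combineBit false zero = refl
  combineBit false (suc v) = refl

headBit : List Bool → Bool
headBit []      = false
headBit (b ∷ _) = b

tailBits : List Bool → List Bool
tailBits []       = []
tailBits (_ ∷ bs) = bs

module _ {A : Set} ⦃ eA : Enc A ⦄ where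
  headBitₚ : {bs : A → List Bool} → PT bs → PT (λ a → headBit (bs a))
  headBitₚ pbs = caseListₚ {E = ⊤} {X = Bool} (λ z → headBit (proj₂ z)) (λ _ → refl) (λ _ _ _ → refl) (constPT false) (fst′ₚ sndPT) ∘ₚ (constPT tt ,ₚ pbs)

  tailBitsₚ : {bs : A → List Bool} → PT bs → PT (λ a → tailBits (bs a))
  tailBitsₚ pbs = caseListₚ {E = ⊤} {X = Bool} (λ z → tailBits (proj₂ z)) (λ _ → refl) (λ _ _ _ → refl) (constPT []) (snd′ₚ sndPT) ∘ₚ (constPT tt ,ₚ pbs)

size-tailBits : ∀ bs → size (tailBits bs) ≤ size bs
size-tailBits [] = ≤-refl
size-tailBits (b ∷ bs) = ≤-trans (m≤n+m _ (size b)) (n≤1+n _)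

_⊻_ : Bool → Bool → Bool
true  ⊻ b = not b
false ⊻ b = b

borrow : Bool → Bool → Bool → Bool
borrow x y β = if x then y ∧ β else y ∨ β

subStep : Bool → List Bool × Bool → (List Bool × Bool) × Bool
subStep x (ys , β) = (tailBits ys , borrow x (headBit ys) β) , x ⊻ (headBit ys ⊻ β)

subtract : List Bool → List Bool → (List Bool × Bool) × List Bool
subtract xs ys = mapAccum subStep (ys , false) xs

monusBits : List Bool → List Bool → List Bool
monusBits xs ys = if proj₂ (proj₁ (subtract xs ys)) ∨ anyBit (proj₁ (proj₁ (subtract xs ys)))
                  then map (λ _ → false) xs else proj₂ (subtract xs ys)

val-uncons : ∀ ys → val ys ≡ 2 * val (tailBits ys) + bit (headBit ys)
val-uncons [] = refl
val-uncons (_ ∷ _) = refl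

digit-sub : ∀ x y β → bit (x ⊻ (y ⊻ β)) + bit y + bit β ≡ bit x + 2 * bit (borrow x y β)
digit-sub false false false = refl
digit-sub false false true  = refl
digit-sub false true  false = refl
digit-sub false true  true  = refl
digit-sub true  false false = refl
digit-sub true  false true  = refl
digit-sub true  true  false = refl
digit-sub true  true  true  = refl

-- The leftover of the subtrahend and the final borrow are weighted with the next
-- power of two, so that both sides stay natural numbers.
subtract-val : ∀ xs ys β → let r = mapAccum subStep (ys , β) xs in
  val (proj₂ r) + val ys + bit β ≡ val xs + 2 ^ length xs * (val (proj₁ (proj₁ r)) + bit (proj₂ (proj₁ r)))
subtract-val [] ys β = sym (+-identityʳ _)
subtract-val (x ∷ xs) ys β = begin
  2 * R + d + val ys + bit β                           ≡⟨ cong (λ z → 2 * R + d + z + bit β) (val-uncons ys) ⟩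
  2 * R + d + (2 * t + bit h) + bit β                  ≡⟨ ar₁ R d t (bit h) (bit β) ⟩
  2 * (R + t) + (d + bit h + bit β)                    ≡⟨ cong (2 * (R + t) +_) (digit-sub x h β) ⟩
  2 * (R + t) + (bit x + 2 * bit (borrow x h β))       ≡⟨ ar₂ R t (bit x) (bit (borrow x h β)) ⟩
  2 * (R + t + bit (borrow x h β)) + bit x             ≡⟨ cong (λ z → 2 * z + bit x) (subtract-val xs (tailBits ys) (borrow x h β)) ⟩
  2 * (val xs + 2 ^ length xs * L) + bit x             ≡⟨ ar₃ (val xs) (2 ^ length xs) L (bit x) ⟩
  2 * val xs + bit x + 2 * 2 ^ length xs * L           ∎
  where
  open ≡-Reasoning
  h : Bool
  h = headBit ys
  r = mapAccum subStep (tailBits ys , borrow x h β) xs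
  R d t L : ℕ
  R = val (proj₂ r)
  d = bit (x ⊻ (h ⊻ β))
  t = val (tailBits ys)
  L = val (proj₁ (proj₁ r)) + bit (proj₂ (proj₁ r))
  ar₁ : ∀ R d t h β → 2 * R + d + (2 * t + h) + β ≡ 2 * (R + t) + (d + h + β)
  ar₁ = solve-∀
  ar₂ : ∀ R t x b → 2 * (R + t) + (x + 2 * b) ≡ 2 * (R + t + b) + x
  ar₂ = solve-∀
  ar₃ : ∀ v p L x → 2 * (v + p * L) + x ≡ 2 * v + x + 2 * p * L
  ar₃ = solve-∀

length-mapAccum : ∀ {S X Y : Set} (f : X → S → S × Y) s xs → length (proj₂ (mapAccum f s xs)) ≡ length xs
length-mapAccum f s [] = refl
length-mapAccum f s (x ∷ xs) = cong suc (length-mapAccum f _ xs)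

val<2^ : ∀ bs → val bs < 2 ^ length bs
val<2^ [] = s≤s z≤n
val<2^ (b ∷ bs) = ≤-trans (s≤s (+-monoʳ-≤ (2 * val bs) (bit≤1 b))) (≤-trans (≤-reflexive (ar (val bs))) (*-monoʳ-≤ 2 (val<2^ bs)))
  where
  bit≤1 : ∀ b → bit b ≤ 1
  bit≤1 false = z≤n
  bit≤1 true  = s≤s z≤n
  ar : ∀ v → suc (2 * v + 1) ≡ 2 * suc v
  ar = solve-∀

val-zeros : ∀ (xs : List Bool) → val (map (λ _ → false) xs) ≡ 0
val-zeros [] = refl
val-zeros (_ ∷ xs) = cong (λ z → 2 * z + 0) (val-zeros xs)

-- A final borrow or a nonzero leftover weighs at least `2 ^ length xs`, more than the difference
-- digits can hold, and so forces `val xs` below `val ys`. Without both, the equation of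
-- `subtract-val` is an exact subtraction.
monusBits-val : ∀ xs ys → val (monusBits xs ys) ≡ val xs ∸ val ys
monusBits-val xs ys = pick (proj₂ (proj₁ r)) (anyBit (proj₁ (proj₁ r))) refl refl
  where
  r = subtract xs ys
  L : ℕ
  L = val (proj₁ (proj₁ r)) + bit (proj₂ (proj₁ r))
  eq : val (proj₂ r) + val ys ≡ val xs + 2 ^ length xs * L
  eq = trans (sym (+-identityʳ _)) (subtract-val xs ys false)
  under : 1 ≤ L → val xs ∸ val ys ≡ 0
  under pos = m≤n⇒m∸n≡0 (+-cancelˡ-≤ (val (proj₂ r)) (val xs) (val ys) (≤-trans (+-monoˡ-≤ (val xs) (≤-trans (<⇒≤ (val<2^ (proj₂ r)))
    (≤-trans (≤-reflexive (cong (2 ^_) (length-mapAccum subStep _ xs))) (≤-trans (≤-reflexive (sym (*-identityʳ _))) (*-monoʳ-≤ (2 ^ length xs) pos)))))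
    (≤-reflexive (trans (+-comm (2 ^ length xs * L) (val xs)) (sym eq)))))
  some : ∀ bs → anyBit bs ≡ true → 1 ≤ val bs
  some bs h = positive (val bs) (trans (sym (anyBit-val bs)) h)
    where
    positive : ∀ v → not (isZero v) ≡ true → 1 ≤ v
    positive (suc v) _ = s≤s z≤n
  nought : ∀ bs → anyBit bs ≡ false → val bs ≡ 0
  nought bs h = zeroed (val bs) (trans (sym (anyBit-val bs)) h)
    where
    zeroed : ∀ v → not (isZero v) ≡ false → v ≡ 0
    zeroed zero _ = refl
  pick : ∀ β a → proj₂ (proj₁ r) ≡ β → anyBit (proj₁ (proj₁ r)) ≡ a → val (if β ∨ a then map (λ _ → false) xs else proj₂ r) ≡ val xs ∸ val ys
  pick true a h h′ = trans (val-zeros xs) (sym (under (≤-trans (≤-reflexive (cong bit (sym h))) (m≤n+m _ _))))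
  pick false true h h′ = trans (val-zeros xs) (sym (under (≤-trans (some (proj₁ (proj₁ r)) h′) (m≤m+n _ _))))
  pick false false h h′ = trans (sym (m+n∸n≡m _ (val ys))) (cong (_∸ val ys) (trans eq (trans (cong (λ z → val xs + 2 ^ length xs * z)
    (cong₂ _+_ (nought (proj₁ (proj₁ r)) h′) (cong bit h))) (trans (cong (val xs +_) (*-zeroʳ (2 ^ length xs))) (+-identityʳ _)))))

module _ {A : Set} ⦃ eA : Enc A ⦄ where
  xorₚ : {b c : A → Bool} → PT b → PT c → PT (λ a → b a ⊻ c a)
  xorₚ {b} {c} pb pc = respPT (λ a → same (b a) (c a)) (ifPT pb (notₚ pc) pc)
    where
    same : ∀ b c → (if b then not c else c) ≡ b ⊻ c
    same true  c = refl
    same false c = refl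

subStepₚ : PT {Bool × (⊤ × (List Bool × Bool))} (λ z → subStep (proj₁ z) (proj₂ (proj₂ z)))
subStepₚ = (tailBitsₚ ys ,ₚ ifPT fstPT (headBitₚ ys ∧ₚ β) (headBitₚ ys ∨ₚ β)) ,ₚ xorₚ fstPT (xorₚ (headBitₚ ys) β)
  where
  ys : PT {Bool × (⊤ × (List Bool × Bool))} (λ z → proj₁ (proj₂ (proj₂ z)))
  ys = fst′ₚ (snd′ₚ sndPT)
  β : PT {Bool × (⊤ × (List Bool × Bool))} (λ z → proj₂ (proj₂ (proj₂ z)))
  β = snd′ₚ (snd′ₚ sndPT)

size-subtract-step : ∀ x (s : List Bool × Bool) → size (subStep x s) ≤ size s + 6
size-subtract-step x (ys , β) = ≤-trans (s≤s (+-mono-≤ (s≤s (+-mono-≤ (size-tailBits ys) (≤-reflexive (size-Bool (borrow x (headBit ys) β) β))))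
  (≤-reflexive (size-Bool (x ⊻ (headBit ys ⊻ β)) false)))) (≤-reflexive (sym (+-suc (size (ys , β)) 5)))

module _ {A : Set} ⦃ eA : Enc A ⦄ where
  monusBitsₚ : {xs ys : A → List Bool} → PT xs → PT ys → PT (λ a → monusBits (xs a) (ys a))
  monusBitsₚ {xs} {ys} pxs pys = ifPT (snd′ₚ (fst′ₚ sub) ∨ₚ anyBitₚ (fst′ₚ (fst′ₚ sub)))
      (mapₚ {X = Bool} {E = ⊤} {f = λ _ → false} (constPT false) pxs (constPT tt)) (snd′ₚ sub)
    where
    sub : PT (λ a → subtract (xs a) (ys a))
    sub = mapAccumₚ {E = ⊤} subStepₚ (pys ,ₚ constPT false) pxs (constPT tt) (con 6) (λ x e s → size-subtract-step x s)

size-monusBits : ∀ xs ys → size (monusBits xs ys) ≡ size xs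
size-monusBits xs ys = trans (size-bits (monusBits xs ys)) (trans (cong (λ z → 6 * z + 1) (same (proj₂ (proj₁ (subtract xs ys)) ∨ anyBit (proj₁ (proj₁ (subtract xs ys))))))
  (sym (size-bits xs)))
  where
  same : ∀ t → length (if t then map (λ _ → false) xs else proj₂ (subtract xs ys)) ≡ length xs
  same true  = length-map _ xs
  same false = length-mapAccum subStep _ xs

-- The current number is accumulated with its last bit first, and the numbers read
-- so far with the last one first.
PState : Set
PState = Bool × (BitString × (List Bool × List (List Bool)))

parseBits : Bool × (Bool × (BitString × (List Bool × List (List Bool)))) → PState
parseBits (a , (b , (str , (cur , res)))) =
  if a then (if b then (true , (str , (true ∷ cur , res))) else (false , ([] , (cur , res))))
       else (if b then (true , (str , ([] , cur ∷ res))) else (true , (str , (false ∷ cur , res))))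

parseStep : PState → PState
parseStep (ok , ([] , s))          = ok , ([] , s)
parseStep (ok , (_ ∷ [] , s))      = false , ([] , s)
parseStep (ok , (a ∷ b ∷ str , s)) = parseBits (a , (b , (str , s)))

-- A step consumes two bits, empties the string on malformed input, and idles once the string is
-- empty; hence `length x` iterations are always enough.
parseList : BitString → Bool × List (List Bool)
parseList x = let r = iter (length x) parseStep (true , (x , ([] , []))) in
  proj₁ r ∧ null (proj₁ (proj₂ (proj₂ r))) , proj₂ (proj₂ (proj₂ r))

Parses : Maybe (List ℕ) → List (List Bool) → PState → Set
Parses m res r = if proj₁ r ∧ null (proj₁ (proj₂ (proj₂ r)))
  then (Σ (List ℕ) λ l → m ≡ just l × map val (proj₂ (proj₂ (proj₂ r))) ≡ l ʳ++ map val res) else m ≡ nothing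

iter-done : ∀ n ok s → iter n parseStep (ok , ([] , s)) ≡ (ok , ([] , s))
iter-done zero ok s = refl
iter-done (suc n) ok s = iter-done n ok s

parses-number : ∀ m cur res r → Parses m (cur ∷ res) r → Parses (Data.Maybe.map (bitsToℕ (reverse cur) ∷_) m) res r
parses-number m cur res r h with proj₁ r ∧ null (proj₁ (proj₂ (proj₂ r)))
... | false = cong (Data.Maybe.map _) h
... | true with h
...   | l , eq , eq′ = bitsToℕ (reverse cur) ∷ l , cong (Data.Maybe.map _) eq , trans eq′ (cong (λ z → l ʳ++ z ∷ map val res) (sym (bitsToℕ-reverse cur)))

mutual
  parse-spec : ∀ n x res → length x ≤ n → Parses (decodeList x) res (iter n parseStep (true , (x , ([] , res))))
  parse-spec n [] res le rewrite iter-done n true ([] , res) = [] , refl , refl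
  parse-spec (suc n) (_ ∷ []) res le rewrite iter-done n false ([] , res) = refl
  parse-spec (suc n) (false ∷ false ∷ r) res (s≤s le) with false List.∷ []
  ... | k = parse-spec′ n k r res (≤-trans (n≤1+n _) le)
  parse-spec (suc n) (true ∷ true ∷ r) res (s≤s le) with true List.∷ []
  ... | k = parse-spec′ n k r res (≤-trans (n≤1+n _) le)
  parse-spec (suc n) (false ∷ true ∷ r) res (s≤s le) =
    parses-number (decodeList r) [] res (iter n parseStep (true , (r , ([] , [] ∷ res)))) (parse-spec n r ([] ∷ res) (≤-trans (n≤1+n _) le))
  parse-spec (suc n) (true ∷ false ∷ r) res le rewrite iter-done n false ([] , res) = refl

  parse-spec′ : ∀ n cur x res → length x ≤ n → Parses _ res (iter n parseStep (true , (x , (cur , res))))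
  parse-spec′ n [] [] res le rewrite iter-done n true ([] , res) = [] , refl , refl
  parse-spec′ n (b ∷ cur) [] res le rewrite iter-done n true (b ∷ cur , res) = refl
  parse-spec′ (suc n) cur (_ ∷ []) res le rewrite iter-done n false (cur , res) = refl
  parse-spec′ (suc n) cur (false ∷ false ∷ r) res (s≤s le) = parse-spec′ n (false ∷ cur) r res (≤-trans (n≤1+n _) le)
  parse-spec′ (suc n) cur (true ∷ true ∷ r) res (s≤s le) = parse-spec′ n (true ∷ cur) r res (≤-trans (n≤1+n _) le)
  parse-spec′ (suc n) cur (false ∷ true ∷ r) res (s≤s le) =
    parses-number (decodeList r) cur res (iter n parseStep (true , (r , ([] , cur ∷ res)))) (parse-spec n r (cur ∷ res) (≤-trans (n≤1+n _) le))
  parse-spec′ (suc n) cur (true ∷ false ∷ r) res le rewrite iter-done n false (cur , res) = refl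

size-parseStep : ∀ s → size (parseStep s) ≤ size s + 20
size-parseStep (ok , ([] , s)) = m≤m+n _ _
size-parseStep (ok , (a ∷ [] , s)) = ≤-trans (s≤s (+-mono-≤ (≤-reflexive (size-Bool false ok)) (s≤s (+-monoˡ-≤ (size s) (s≤s z≤n))))) (m≤m+n _ _)
size-parseStep (ok , (a ∷ b ∷ str , (cur , res))) = go′ a b
  where
  wrap : ∀ (t : Bool) (u : BitString × (List Bool × List (List Bool))) → size u ≤ size (a ∷ b ∷ str , (cur , res)) + 20 → size (t , u) ≤ size (ok , (a ∷ b ∷ str , (cur , res))) + 20
  wrap t u le = ≤-trans (s≤s (+-mono-≤ (≤-reflexive (size-Bool t ok)) le)) (≤-reflexive (cong suc (sym (+-assoc (size ok) _ 20))))
  str≤ : size str ≤ size (a ∷ b ∷ str)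
  str≤ = ≤-trans (≤-trans (m≤n+m _ (size b)) (n≤1+n _)) (≤-trans (m≤n+m _ (size a)) (n≤1+n _))
  pushed : ∀ t → size (str , (t ∷ cur , res)) ≤ size (a ∷ b ∷ str , (cur , res)) + 20
  pushed t = ≤-trans (s≤s (+-mono-≤ str≤ (s≤s (+-monoˡ-≤ (size res) (s≤s (+-monoˡ-≤ (size cur) (≤-reflexive (size-Bool t false))))))))
    (≤-by 14 (ar (size (a ∷ b ∷ str)) (size cur) (size res)))
    where
    ar : ∀ s c r → suc (s + suc (suc (5 + c) + r)) + 14 ≡ suc (s + suc (c + r)) + 20
    ar = solve-∀
  closed : size (str , (noBits , cur ∷ res)) ≤ size (a ∷ b ∷ str , (cur , res)) + 20
  closed = ≤-trans (s≤s (+-monoˡ-≤ _ str≤)) (≤-by 18 (ar (size (a ∷ b ∷ str)) (size cur) (size res)))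
    where
    ar : ∀ s c r → suc (s + suc (1 + suc (c + r))) + 18 ≡ suc (s + suc (c + r)) + 20
    ar = solve-∀
  failed : size (noBits , (cur , res)) ≤ size (a ∷ b ∷ str , (cur , res)) + 20
  failed = ≤-trans (s≤s (+-monoˡ-≤ (size (cur , res)) (sz-pos (enc (a ∷ b ∷ str))))) (m≤m+n (size (a ∷ b ∷ str , (cur , res))) 20)
  go′ : ∀ a′ b′ → size (parseBits (a′ , (b′ , (str , (cur , res))))) ≤ size (ok , (a ∷ b ∷ str , (cur , res))) + 20
  go′ true  true  = wrap true (str , (true ∷ cur , res)) (pushed true)
  go′ true  false = wrap false (noBits , (cur , res)) failed
  go′ false true  = wrap true (str , (noBits , cur ∷ res)) closed
  go′ false false = wrap true (str , (false ∷ cur , res)) (pushed false)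

parseBitsₚ : PT parseBits
parseBitsₚ = ifPT a
    (ifPT b (constPT true ,ₚ (str ,ₚ ((constPT true ∷ₚ cur) ,ₚ res))) (constPT false ,ₚ (constPT [] ,ₚ (cur ,ₚ res))))
    (ifPT b (constPT true ,ₚ (str ,ₚ (constPT [] ,ₚ (cur ∷ₚ res)))) (constPT true ,ₚ (str ,ₚ ((constPT false ∷ₚ cur) ,ₚ res))))
  where
  I : Set
  I = Bool × (Bool × (BitString × (List Bool × List (List Bool))))
  a : PT {I} proj₁
  a = fstPT
  b : PT {I} (λ z → proj₁ (proj₂ z))
  b = fst′ₚ sndPT
  str : PT {I} (λ z → proj₁ (proj₂ (proj₂ z)))
  str = fst′ₚ (snd′ₚ sndPT)
  cur : PT {I} (λ z → proj₁ (proj₂ (proj₂ (proj₂ z))))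
  cur = fst′ₚ (snd′ₚ (snd′ₚ sndPT))
  res : PT {I} (λ z → proj₂ (proj₂ (proj₂ (proj₂ z))))
  res = snd′ₚ (snd′ₚ (snd′ₚ sndPT))

parseStepₚ : PT parseStep
parseStepₚ = outer ∘ₚ ((fstPT ,ₚ snd′ₚ sndPT) ,ₚ fst′ₚ sndPT)
  where
  S : Set
  S = List Bool × List (List Bool)
  h₂ : (S × Bool) × List Bool → PState
  h₂ ((s , a) , str′) = parseStep (true , (a ∷ str′ , s))
  inner : PT h₂
  inner = caseListₚ {E = S × Bool} {X = Bool} {f = λ z → false , ([] , proj₁ z)} {g = λ z → parseBits (proj₂ (proj₁ z) , (proj₁ (proj₂ z) , (proj₂ (proj₂ z) , proj₁ (proj₁ z))))}
    h₂ (λ _ → refl) (λ _ _ _ → refl) (constPT false ,ₚ (constPT [] ,ₚ fstPT))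
    (parseBitsₚ ∘ₚ (snd′ₚ fstPT ,ₚ (fst′ₚ sndPT ,ₚ (snd′ₚ sndPT ,ₚ fst′ₚ fstPT))))
  h₁ : (Bool × S) × List Bool → PState
  h₁ ((ok , s) , str) = parseStep (ok , (str , s))
  same : ∀ e a str → h₁ (e , a ∷ str) ≡ h₂ ((proj₂ e , a) , str)
  same (ok , s) a []      = refl
  same (ok , s) a (_ ∷ _) = refl
  outer : PT h₁
  outer = caseListₚ {E = Bool × S} {X = Bool} {f = λ z → proj₁ z , ([] , proj₂ z)} {g = λ z → h₂ ((proj₂ (proj₁ z) , proj₁ (proj₂ z)) , proj₂ (proj₂ z))}
    h₁ (λ _ → refl) same (fstPT ,ₚ (constPT [] ,ₚ sndPT)) (inner ∘ₚ ((snd′ₚ fstPT ,ₚ fst′ₚ sndPT) ,ₚ snd′ₚ sndPT))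

parseListₚ : ∀ {A : Set} ⦃ eA : Enc A ⦄ {x : A → BitString} → PT x → PT (λ a → parseList (x a))
parseListₚ {x = x} px = (fst′ₚ final ∧ₚ nullₚ (fst′ₚ (snd′ₚ (snd′ₚ final)))) ,ₚ snd′ₚ (snd′ₚ (snd′ₚ final))
  where
  final : PT (λ a → iter (length (x a)) parseStep (true , (x a , ([] , []))))
  final = iterₚ {E = ⊤} {f = λ z → parseStep (proj₂ z)} (parseStepₚ ∘ₚ sndPT) (lengthₚ px) (constPT tt)
    (constPT true ,ₚ (px ,ₚ constPT ([] , []))) (con 20) (λ _ b → size-parseStep b)

-- The index as a number of words

-- rest is the quota minus the weight already collected, w the weight of the player
-- whose index is computed: the coalition is pivotal iff rest > 0 and rest ≤ w.
pivotal : ℕ → ℕ → ℕ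
pivotal rest w = when (not (isZero rest) ∧ isZero (rest ∸ w)) 1

-- The player m (counted from 1) belongs to no coalition; m = 0 once it has passed.
-- The factors count the ways to insert each other player into a linear order of the
-- players on its side of the pivotal one, which produces the two factorials.
score : List ℕ → (m s r rest w : ℕ) → ℕ
score []       zero          s r rest w = pivotal rest w
score []       (suc m)       s r rest w = 0
score (v ∷ ws) zero          s r rest w = suc s * score ws 0 (suc s) r (rest ∸ v) w + suc r * score ws 0 s (suc r) rest w
score (v ∷ ws) (suc zero)    s r rest w = score ws 0 s r rest v
score (v ∷ ws) (suc (suc m)) s r rest w = suc s * score ws (suc m) (suc s) r (rest ∸ v) w + suc r * score ws (suc m) s (suc r) rest w

sum-subsets : ∀ n (f : Subset (suc n) → ℕ) →
  sum (map f (allSubsets (suc n))) ≡ sum (map (λ S → f (false ∷ S)) (allSubsets n)) + sum (map (λ S → f (true ∷ S)) (allSubsets n))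
sum-subsets n f = trans (cong sum (map-++ f (map (false ∷_) (allSubsets n)) _)) (trans (sum-++′ (map f (map (false ∷_) (allSubsets n))) _)
  (cong₂ (λ a b → sum a + sum b) (sym (map-∘ (allSubsets n))) (sym (map-∘ (allSubsets n)))))

card≤ : ∀ {n} (S : Subset n) → ∣ S ∣ ≤ n
card≤ = ∣p∣≤n

module _ (w : ℕ) where
  after : (ws : List ℕ) (s r rest : ℕ) → Subset (length ws) → ℕ
  after ws s r rest S = (s + ∣ S ∣) ! * (r + (length ws ∸ ∣ S ∣)) ! * pivotal (rest ∸ weightOf (Vec.fromList ws) S) w

  -- The factorials of the players already placed are carried as a prefactor: the insertion factor
  -- `suc s` or `suc r` turns one of them into the next factorial, so the induction needs no
  -- division.
  score-after : ∀ ws s r rest → s ! * r ! * score ws 0 s r rest w ≡ sum (map (after ws s r rest) (allSubsets (length ws)))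
  score-after [] s r rest = sym (trans (+-identityʳ _) (cong₂ (λ a b → a ! * b ! * pivotal rest w) (+-identityʳ s) (+-identityʳ r)))
  score-after (v ∷ ws) s r rest = begin
    s ! * r ! * (suc s * score ws 0 (suc s) r (rest ∸ v) w + suc r * score ws 0 s (suc r) rest w)
      ≡⟨ ar (s !) (r !) (suc s) (suc r) (score ws 0 (suc s) r (rest ∸ v) w) (score ws 0 s (suc r) rest w) ⟩
    s ! * (suc r * r !) * score ws 0 s (suc r) rest w + suc s * s ! * r ! * score ws 0 (suc s) r (rest ∸ v) w
      ≡⟨ cong₂ _+_ (score-after ws s (suc r) rest) (score-after ws (suc s) r (rest ∸ v)) ⟩
    sum (map (after ws s (suc r) rest) Ss) + sum (map (after ws (suc s) r (rest ∸ v)) Ss)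
      ≡⟨ cong₂ _+_ (sum-cong outS Ss) (sum-cong inS Ss) ⟩
    sum (map (λ S → after (v ∷ ws) s r rest (false ∷ S)) Ss) + sum (map (λ S → after (v ∷ ws) s r rest (true ∷ S)) Ss)
      ≡⟨ sum-subsets (length ws) (after (v ∷ ws) s r rest) ⟨
    sum (map (after (v ∷ ws) s r rest) (allSubsets (suc (length ws)))) ∎
    where
    open ≡-Reasoning
    Ss : List (Subset (length ws))
    Ss = allSubsets (length ws)
    ar : ∀ s r a b x y → s * r * (a * x + b * y) ≡ s * (b * r) * y + a * s * r * x
    ar = solve-∀
    outS : ∀ S → after ws s (suc r) rest S ≡ after (v ∷ ws) s r rest (false ∷ S)
    outS S = cong (λ z → (s + ∣ S ∣) ! * z ! * pivotal (rest ∸ weightOf (Vec.fromList ws) S) w)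
      (trans (sym (+-suc r _)) (cong (r +_) (sym (+-∸-assoc 1 (card≤ S)))))
    inS : ∀ S → after ws (suc s) r (rest ∸ v) S ≡ after (v ∷ ws) s r rest (true ∷ S)
    inS S = cong₂ (λ y z → y ! * (r + (length ws ∸ ∣ S ∣)) ! * pivotal z w) (sym (+-suc s _)) (∸-+-assoc rest v _)

before : (ws : List ℕ) (s r rest : ℕ) → Fin (length ws) → Subset (length ws) → ℕ
before ws s r rest i S = if lookup S i then 0 else
  (s + ∣ S ∣) ! * (r + (length ws ∸ ∣ S ∣ ∸ 1)) ! * pivotal (rest ∸ weightOf (Vec.fromList ws) S) (lookup (Vec.fromList ws) i)

-- The same absorption of factors into factorials, up to the pivotal player. That player brings no
-- factor of its own, which accounts for the `∸ 1` in the second factorial.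
score-before : ∀ ws (i : Fin (length ws)) s r rest w → s ! * r ! * score ws (suc (Fin.toℕ i)) s r rest w ≡
               sum (map (before ws s r rest i) (allSubsets (length ws)))
score-before (v ∷ ws) zero s r rest w = begin
  s ! * r ! * score ws 0 s r rest v                              ≡⟨ score-after v ws s r rest ⟩
  sum (map (after v ws s r rest) Ss)                             ≡⟨ sum-cong outS Ss ⟩
  sum (map (λ S → before (v ∷ ws) s r rest zero (false ∷ S)) Ss) ≡⟨ +-identityʳ _ ⟨
  sum (map (λ S → before (v ∷ ws) s r rest zero (false ∷ S)) Ss) + 0
    ≡⟨ cong (sum (map (λ S → before (v ∷ ws) s r rest zero (false ∷ S)) Ss) +_) (sum-zero (λ _ → refl) Ss) ⟨
  sum (map (λ S → before (v ∷ ws) s r rest zero (false ∷ S)) Ss) + sum (map (λ S → before (v ∷ ws) s r rest zero (true ∷ S)) Ss)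
    ≡⟨ sum-subsets (length ws) (before (v ∷ ws) s r rest zero) ⟨
  sum (map (before (v ∷ ws) s r rest zero) (allSubsets (suc (length ws)))) ∎
  where
  open ≡-Reasoning
  Ss : List (Subset (length ws))
  Ss = allSubsets (length ws)
  outS : ∀ S → after v ws s r rest S ≡ before (v ∷ ws) s r rest zero (false ∷ S)
  outS S = cong (λ z → (s + ∣ S ∣) ! * (r + z) ! * pivotal (rest ∸ weightOf (Vec.fromList ws) S) v)
    (sym (cong (_∸ 1) (+-∸-assoc 1 (card≤ S))))
score-before (v ∷ ws) (suc i) s r rest w = begin
  s ! * r ! * (suc s * score ws (suc (Fin.toℕ i)) (suc s) r (rest ∸ v) w + suc r * score ws (suc (Fin.toℕ i)) s (suc r) rest w)
    ≡⟨ ar (s !) (r !) (suc s) (suc r) (score ws (suc (Fin.toℕ i)) (suc s) r (rest ∸ v) w) (score ws (suc (Fin.toℕ i)) s (suc r) rest w) ⟩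
  s ! * (suc r * r !) * score ws (suc (Fin.toℕ i)) s (suc r) rest w + suc s * s ! * r ! * score ws (suc (Fin.toℕ i)) (suc s) r (rest ∸ v) w
    ≡⟨ cong₂ _+_ (score-before ws i s (suc r) rest w) (score-before ws i (suc s) r (rest ∸ v) w) ⟩
  sum (map (before ws s (suc r) rest i) Ss) + sum (map (before ws (suc s) r (rest ∸ v) i) Ss)
    ≡⟨ cong₂ _+_ (sum-cong outS Ss) (sum-cong inS Ss) ⟩
  sum (map (λ S → before (v ∷ ws) s r rest (suc i) (false ∷ S)) Ss) + sum (map (λ S → before (v ∷ ws) s r rest (suc i) (true ∷ S)) Ss)
    ≡⟨ sum-subsets (length ws) (before (v ∷ ws) s r rest (suc i)) ⟨
  sum (map (before (v ∷ ws) s r rest (suc i)) (allSubsets (suc (length ws)))) ∎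
  where
  open ≡-Reasoning
  Ss : List (Subset (length ws))
  Ss = allSubsets (length ws)
  ar : ∀ s r a b x y → s * r * (a * x + b * y) ≡ s * (b * r) * y + a * s * r * x
  ar = solve-∀
  missing : ∀ {n} (S : Subset n) (i : Fin n) → lookup S i ≡ false → ∣ S ∣ < n
  missing (false ∷ S) zero refl = s≤s (card≤ S)
  missing (true ∷ S) (suc i) eq = s≤s (missing S i eq)
  missing (false ∷ S) (suc i) eq = ≤-trans (missing S i eq) (n≤1+n _)
  outS : ∀ S → before ws s (suc r) rest i S ≡ before (v ∷ ws) s r rest (suc i) (false ∷ S)
  outS S with lookup S i in eq
  ... | true  = refl
  ... | false = cong (λ z → (s + ∣ S ∣) ! * z ! * pivotal (rest ∸ weightOf (Vec.fromList ws) S) (lookup (Vec.fromList ws) i)) (begin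
    suc r + (length ws ∸ ∣ S ∣ ∸ 1)   ≡⟨ +-suc r _ ⟨
    r + suc (length ws ∸ ∣ S ∣ ∸ 1)   ≡⟨ cong (r +_) (suc-∸1 (m<n⇒0<n∸m (missing S i eq))) ⟩
    r + (length ws ∸ ∣ S ∣)           ≡⟨ cong (λ z → r + (z ∸ 1)) (+-∸-assoc 1 (card≤ S)) ⟨
    r + (suc (length ws) ∸ ∣ S ∣ ∸ 1) ∎)
    where
    suc-∸1 : ∀ {n} → 1 ≤ n → suc (n ∸ 1) ≡ n
    suc-∸1 (s≤s _) = refl
  inS : ∀ S → before ws (suc s) r (rest ∸ v) i S ≡ before (v ∷ ws) s r rest (suc i) (true ∷ S)
  inS S with lookup S i
  ... | true  = refl
  ... | false = cong₂ (λ y z → y ! * (r + (length ws ∸ ∣ S ∣ ∸ 1)) ! * pivotal z (lookup (Vec.fromList ws) i)) (sym (+-suc s _)) (∸-+-assoc rest v _)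

weight-⊥ : ∀ {n} (ws : Vec ℕ n) (S : Subset n) → weightOf ws (S ∪ Data.Fin.Subset.⊥) ≡ weightOf ws S
weight-⊥ [] [] = refl
weight-⊥ (w ∷ ws) (true ∷ S)  = cong (w +_) (weight-⊥ ws S)
weight-⊥ (w ∷ ws) (false ∷ S) = weight-⊥ ws S

weight-add : ∀ {n} (ws : Vec ℕ n) (S : Subset n) i → lookup S i ≡ false → weightOf ws (S ∪ ⁅ i ⁆) ≡ weightOf ws S + lookup ws i
weight-add (w ∷ ws) (false ∷ S) zero refl = trans (cong (w +_) (weight-⊥ ws S)) (+-comm w _)
weight-add (w ∷ ws) (true ∷ S) (suc i) eq = trans (cong (w +_) (weight-add ws S i eq)) (sym (+-assoc w _ _))
weight-add (w ∷ ws) (false ∷ S) (suc i) eq = weight-add ws S i eq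

≤ᵇ-isZero : ∀ m n → (m ≤ᵇ n) ≡ isZero (m ∸ n)
≤ᵇ-isZero zero n = cong isZero (sym (0∸n≡0 n))
≤ᵇ-isZero (suc m) zero = refl
≤ᵇ-isZero (suc zero) (suc n) = cong isZero (sym (0∸n≡0 n))
≤ᵇ-isZero (suc (suc m)) (suc n) = ≤ᵇ-isZero (suc m) n

succ-pivotal : ∀ {n} (ws : Vec ℕ n) q (S : Subset n) i → lookup S i ≡ false →
  succG ws q (S ∪ ⁅ i ⁆) ∸ succG ws q S ≡ pivotal (q ∸ weightOf ws S) (lookup ws i)
succ-pivotal ws q S i eq rewrite weight-add ws S i eq | ≤ᵇ-isZero q (weightOf ws S) | ≤ᵇ-isZero q (weightOf ws S + lookup ws i)
  | sym (∸-+-assoc q (weightOf ws S) (lookup ws i)) with q ∸ weightOf ws S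
... | zero rewrite 0∸n≡0 (lookup ws i) = refl
... | suc d with isZero (suc d ∸ lookup ws i)
...   | true  = refl
...   | false = refl

SSraw-score : ∀ ws q (i : Fin (length ws)) → SSraw (length ws) (Vec.fromList ws) q i ≡ score ws (suc (Fin.toℕ i)) 0 0 q 0
SSraw-score ws q i = trans (sum-cong same (allSubsets (length ws))) (trans (sym (score-before ws i 0 0 q 0)) (+-identityʳ _))
  where
  same : ∀ S → (if lookup S i then 0 else (∣ S ∣ !) * ((length ws ∸ ∣ S ∣ ∸ 1) !) *
           (succG (Vec.fromList ws) q (S ∪ ⁅ i ⁆) ∸ succG (Vec.fromList ws) q S)) ≡ before ws 0 0 q i S
  same S with lookup S i in eq
  ... | true  = refl
  ... | false = cong (∣ S ∣ ! * (length ws ∸ ∣ S ∣ ∸ 1) ! *_) (succ-pivotal (Vec.fromList ws) q S i eq)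

-- Gives invalid player numbers the value 0, as `SSstar` demands, and shows that such a number may
-- be replaced by any other that is too large.
score-late : ∀ ws m s r rest w → length ws < m → score ws m s r rest w ≡ 0
score-late [] (suc m) s r rest w lt = refl
score-late (v ∷ ws) (suc (suc m)) s r rest w (s≤s lt)
  rewrite score-late ws (suc m) (suc s) r (rest ∸ v) w lt | score-late ws (suc m) s (suc r) rest w lt | *-zeroʳ s | *-zeroʳ r = refl

-- Counting one-hot words

sumBits : ℕ → (BitString → ℕ) → ℕ
sumBits zero    f = f []
sumBits (suc n) f = sumBits n (λ z → f (false ∷ z)) + sumBits n (λ z → f (true ∷ z))

sumBits-0 : ∀ n {f : BitString → ℕ} → (∀ z → f z ≡ 0) → sumBits n f ≡ 0
sumBits-0 zero    h = h []
sumBits-0 (suc n) h = cong₂ _+_ (sumBits-0 n (λ z → h (false ∷ z))) (sumBits-0 n (λ z → h (true ∷ z)))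

guesses-sumBits : ∀ (U : BitString → BitString → Bool) x n y →
  guesses (λ p → U (proj₂ p) (reverse (proj₁ p))) x n y ≡ sumBits n (λ z → when (U x (y ʳ++ z)) 1)
guesses-sumBits U x zero    y = refl
guesses-sumBits U x (suc n) y = cong₂ _+_ (guesses-sumBits U x n (false ∷ y)) (guesses-sumBits U x n (true ∷ y))

DState : Set
DState = (ℕ × Bool) × (Bool × BitString)

-- Reads a one-hot word; the mark must occur among the first c positions.
digitStep : DState → DState
digitStep ((c , found) , (ok , []))     = (c , found) , (ok , [])
digitStep ((c , found) , (ok , b ∷ ys)) = ((if b then c else pred c) , found ∨ b) , (ok ∧ not (b ∧ (found ∨ isZero c)) , ys)

digits : ℕ → ℕ → Bool → Bool × BitString → Bool × BitString
digits n c found p = let r = iter n digitStep ((c , found) , p) in proj₂ (proj₁ r) ∧ proj₁ (proj₂ r) , proj₂ (proj₂ r)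

∧-false : ∀ b → b ∧ false ≡ false
∧-false true  = refl
∧-false false = refl

digits-dead : ∀ n c found z → proj₁ (digits n c found (false , z)) ≡ false
digits-dead zero c found z = ∧-false found
digits-dead (suc n) c found [] = digits-dead n c found []
digits-dead (suc n) c found (b ∷ z) = digits-dead n _ _ z

module _ (G : Bool × BitString → ℕ) (dead : ∀ y → G (false , y) ≡ 0) where

  sum-dead : ∀ n k c found → sumBits k (λ z → G (digits n c found (false , z))) ≡ 0
  sum-dead n k c found = sumBits-0 k (λ z → trans (cong (λ b → G (b , proj₂ (digits n c found (false , z)))) (digits-dead n c found z)) (dead _))

  -- Once the mark has been read only the zero word keeps the state alive, so the remaining `n` bits
  -- multiply the sum by 1.
  sum-found : ∀ n m c → sumBits (n + m) (λ z → G (digits n c true (true , z))) ≡ sumBits m (λ z → G (true , z))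
  sum-found zero m c = refl
  sum-found (suc n) m c = trans (cong₂ _+_ (sum-found n m (pred c)) (sum-dead n (n + m) c true)) (+-identityʳ _)

  -- A one-hot word with its mark among the first `c` positions either starts with the mark, and is
  -- then unique, or starts with 0 and has its mark among the next `c ∸ 1`. All other words lead to
  -- dead states, which contribute 0.
  sum-digits : ∀ n m c → c ≤ n → sumBits (n + m) (λ z → G (digits n c false (true , z))) ≡ c * sumBits m (λ z → G (true , z))
  sum-digits zero m zero le = sumBits-0 m dead
  sum-digits (suc n) m zero le = cong₂ _+_ (sum-digits n m 0 z≤n) (sum-dead n (n + m) 0 true)
  sum-digits (suc n) m (suc c) (s≤s le) = trans (cong₂ _+_ (sum-digits n m c le) (sum-found n m (suc c))) (+-comm (c * _) _)

VState : Set
VState = Bool × (ℕ × (BitString × (ℕ × (ℕ × (List Bool × List Bool)))))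

-- d is the outcome of reading the digit of this player.
selfStep inStep outStep : Bool × BitString → List Bool → VState → VState
selfStep d v (ok , (m , (ys , (s , (r , (rest , w)))))) = proj₁ d , (pred m , (proj₂ d , (s , (r , (rest , v)))))
inStep   d v (ok , (m , (ys , (s , (r , (rest , w)))))) = proj₁ d , (pred m , (proj₂ d , (suc s , (r , (monusBits rest v , w)))))
outStep  d v (ok , (m , (ys , (s , (r , (rest , w)))))) = proj₁ d , (pred m , (proj₂ d , (s , (suc r , (rest , w)))))

-- Each player consumes a bit for its side and a word of `n` bits for its insertion place. At
-- `m = 1` the player is the pivotal one: starting with `found` set and demanding a side bit 0
-- leaves only the zero word, so it contributes the factor 1.
playerStep : ℕ → List Bool → VState → VState
playerStep n v st@(ok , (m , (ys , (s , (r , _))))) =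
  if isZero (pred m) ∧ not (isZero m) then selfStep (digits n 0 true (ok ∧ not (headBit ys) , tailBits ys)) v st
  else (if headBit ys then inStep (digits n (suc s) false (ok , tailBits ys)) v st
        else outStep (digits n (suc r) false (ok , tailBits ys)) v st)

accepted : VState → Bool
accepted (ok , (m , (ys , (s , (r , (rest , w)))))) = ok ∧ (isZero m ∧ (anyBit rest ∧ not (anyBit (monusBits rest w))))

runPlayers : ℕ → List (List Bool) → VState → VState
runPlayers n vs st = foldl (λ st v → playerStep n v st) st vs

player-dead : ∀ n v s → proj₁ (playerStep n v (false , s)) ≡ false
player-dead n v (m , (ys , (s , (r , _)))) with isZero (pred m) ∧ not (isZero m) | headBit ys
... | true  | _     = digits-dead n 0 true (tailBits ys)
... | false | true  = digits-dead n (suc s) false (tailBits ys)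
... | false | false = digits-dead n (suc r) false (tailBits ys)

run-dead : ∀ n vs st → proj₁ st ≡ false → accepted (runPlayers n vs st) ≡ false
run-dead n [] (.false , s) refl = refl
run-dead n (v ∷ vs) (.false , s) refl = run-dead n vs _ (player-dead n v s)

accepted-pivotal : ∀ rest w → when (anyBit rest ∧ not (anyBit (monusBits rest w))) 1 ≡ pivotal (val rest) (val w)
accepted-pivotal rest w rewrite anyBit-val rest | anyBit-val (monusBits rest w) | monusBits-val rest w =
  cong (λ z → when (not (isZero (val rest)) ∧ z) 1) (not-involutive _)

tally : ℕ → List (List Bool) → VState → ℕ
tally n vs st = when (accepted (runPlayers n vs st)) 1

tally-dead : ∀ n vs s → tally n vs (false , s) ≡ 0
tally-dead n vs s = cong (λ b → when b 1) (run-dead n vs (false , s) refl)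

-- The hypothesis keeps the number of insertion places, `suc s` or `suc r`, within the word length
-- `n` as long as a player is left. One word length for all players makes the witness length
-- independent of the guesses.
tally-score : ∀ n vs m s r rest w → s + r + length vs ≤ n →
  sumBits (length vs * suc n) (λ z → tally n vs (true , (m , (z , (s , (r , (rest , w))))))) ≡ score (map val vs) m s r (val rest) (val w)
tally-score n [] zero s r rest w le = accepted-pivotal rest w
tally-score n [] (suc m) s r rest w le = refl
tally-score n (v ∷ vs) zero s r rest w le = trans (cong₂ _+_
    (trans (sum-digits Gout (λ y → tally-dead n vs _) n _ (suc r) r≤) (cong (suc r *_) (tally-score n vs 0 s (suc r) rest w le-out)))
    (trans (sum-digits Gin (λ y → tally-dead n vs _) n _ (suc s) s≤) (cong (suc s *_) (trans (tally-score n vs 0 (suc s) r (monusBits rest v) w le-in)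
      (cong (λ z → score (map val vs) 0 (suc s) r z (val w)) (monusBits-val rest v))))))
  (+-comm (suc r * score (map val vs) 0 s (suc r) (val rest) (val w)) _)
  where
  Gout Gin : Bool × BitString → ℕ
  Gout d = tally n vs (proj₁ d , (0 , (proj₂ d , (s , (suc r , (rest , w))))))
  Gin  d = tally n vs (proj₁ d , (0 , (proj₂ d , (suc s , (r , (monusBits rest v , w))))))
  le-out : s + suc r + length vs ≤ n
  le-out = ≤-trans (≤-reflexive (trans (cong (_+ length vs) (+-suc s r)) (sym (+-suc (s + r) _)))) le
  le-in : suc s + r + length vs ≤ n
  le-in = ≤-trans (≤-reflexive (sym (+-suc (s + r) _))) le
  r≤ : suc r ≤ n
  r≤ = ≤-trans (≤-trans (m≤n+m (suc r) s) (m≤m+n _ _)) le-out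
  s≤ : suc s ≤ n
  s≤ = ≤-trans (≤-trans (m≤m+n (suc s) r) (m≤m+n _ _)) le-in
tally-score n (v ∷ vs) (suc zero) s r rest w le = trans (cong₂ _+_
    (trans (sum-found G (λ y → tally-dead n vs _) n _ 0) (tally-score n vs 0 s r rest v (≤-trans (≤-trans (n≤1+n _) (≤-reflexive (sym (+-suc (s + r) _)))) le)))
    (sum-dead G (λ y → tally-dead n vs _) n (n + length vs * suc n) 0 true))
  (+-identityʳ _)
  where
  G : Bool × BitString → ℕ
  G d = tally n vs (proj₁ d , (0 , (proj₂ d , (s , (r , (rest , v))))))
tally-score n (v ∷ vs) (suc (suc m)) s r rest w le = trans (cong₂ _+_
    (trans (sum-digits Gout (λ y → tally-dead n vs _) n _ (suc r) r≤) (cong (suc r *_) (tally-score n vs (suc m) s (suc r) rest w le-out)))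
    (trans (sum-digits Gin (λ y → tally-dead n vs _) n _ (suc s) s≤) (cong (suc s *_) (trans (tally-score n vs (suc m) (suc s) r (monusBits rest v) w le-in)
      (cong (λ z → score (map val vs) (suc m) (suc s) r z (val w)) (monusBits-val rest v))))))
  (+-comm (suc r * score (map val vs) (suc m) s (suc r) (val rest) (val w)) _)
  where
  Gout Gin : Bool × BitString → ℕ
  Gout d = tally n vs (proj₁ d , (suc m , (proj₂ d , (s , (suc r , (rest , w))))))
  Gin  d = tally n vs (proj₁ d , (suc m , (proj₂ d , (suc s , (r , (monusBits rest v , w))))))
  le-out : s + suc r + length vs ≤ n
  le-out = ≤-trans (≤-reflexive (trans (cong (_+ length vs) (+-suc s r)) (sym (+-suc (s + r) _)))) le
  le-in : suc s + r + length vs ≤ n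
  le-in = ≤-trans (≤-reflexive (sym (+-suc (s + r) _))) le
  r≤ : suc r ≤ n
  r≤ = ≤-trans (≤-trans (m≤n+m (suc r) s) (m≤m+n _ _)) le-out
  s≤ : suc s ≤ n
  s≤ = ≤-trans (≤-trans (m≤m+n (suc s) r) (m≤m+n _ _)) le-in

-- The player number comes in binary and may be exponentially large, while the verifier counts in
-- unary. Cutting it off just above the number of players keeps it small and preserves the score.
capNat : ℕ → List Bool → ℕ
capNat N bs = foldl (λ u b → (u + u + bit b) ⊓ N) 0 (reverse bs)

capNat-val : ∀ N bs → capNat N bs ≡ val bs ⊓ N
capNat-val N bs = trans (reverse-foldl _ 0 bs) (caps bs)
  where
  double-cap : ∀ v b → (v ⊓ N + v ⊓ N + b) ⊓ N ≡ (2 * v + b) ⊓ N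
  double-cap v b with ≤-total v N
  ... | inj₁ le rewrite m≤n⇒m⊓n≡m le = cong (λ z → (v + z + b) ⊓ N) (sym (+-identityʳ v))
  ... | inj₂ ge rewrite m≥n⇒m⊓n≡n ge = trans (m≥n⇒m⊓n≡n (≤-trans (m≤m+n N N) (m≤m+n _ b))) (sym (m≥n⇒m⊓n≡n (≤-trans ge (≤-trans (m≤m+n v _) (m≤m+n _ b)))))
  caps : ∀ bs → foldr (λ b u → (u + u + bit b) ⊓ N) 0 bs ≡ val bs ⊓ N
  caps [] = refl
  caps (b ∷ bs) = trans (cong (λ z → (z + z + bit b) ⊓ N) (caps bs)) (double-cap (val bs) (bit b))

Game : Set
Game = Bool × (List Bool × (List Bool × List (List Bool)))

gameOf : Bool × List (List Bool) → Game
gameOf (ok , [])           = false , ([] , ([] , []))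
gameOf (ok , _ ∷ [])       = false , ([] , ([] , []))
gameOf (ok , i ∷ q ∷ rws)  = ok , (i , (q , reverse rws))

startState : Game → BitString → VState
startState (ok , (i , (q , ws))) z = let iu = capNat (suc (length ws)) i in ok ∧ not (isZero iu) , (iu , (z , (0 , (0 , (q , [])))))

verify : Game → BitString → Bool
verify g z = accepted (runPlayers (length (proj₂ (proj₂ (proj₂ g)))) (proj₂ (proj₂ (proj₂ g))) (startState g z))

witnessLength : Game → ℕ
witnessLength (_ , (_ , (_ , ws))) = length ws * suc (length ws)

gameScore : Game → ℕ
gameScore (ok , (i , (q , ws))) = when (ok ∧ not (isZero (val i))) (score (map val ws) (val i) 0 0 (val q) 0)

verify-score : ∀ g → sumBits (witnessLength g) (λ z → when (verify g z) 1) ≡ gameScore g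
verify-score (ok , (i , (q , ws))) rewrite capNat-val (suc (length ws)) i = byCase ok (val i) refl
  where
  n : ℕ
  n = length ws
  dead : ∀ iu → sumBits (n * suc n) (λ z → when (accepted (runPlayers n ws (false , (iu , (z , (0 , (0 , (q , [])))))))) 1) ≡ 0
  dead iu = sumBits-0 (n * suc n) (λ z → tally-dead n ws _)
  capped : ∀ v → score (map val ws) (v ⊓ suc n) 0 0 (val q) 0 ≡ score (map val ws) v 0 0 (val q) 0
  capped v with ≤-total v (suc n)
  ... | inj₁ le rewrite m≤n⇒m⊓n≡m le = refl
  ... | inj₂ ge rewrite m≥n⇒m⊓n≡n ge = trans (score-late (map val ws) (suc n) 0 0 (val q) 0 (s≤s (≤-reflexive (length-map val ws))))
    (sym (score-late (map val ws) v 0 0 (val q) 0 (≤-trans (s≤s (≤-reflexive (length-map val ws))) ge)))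
  byCase : ∀ ok v → v ≡ val i → sumBits (n * suc n) (λ z → when (accepted (runPlayers n ws (ok ∧ not (isZero (v ⊓ suc n)) , (v ⊓ suc n , (z , (0 , (0 , (q , []))))))) ) 1)
         ≡ when (ok ∧ not (isZero v)) (score (map val ws) v 0 0 (val q) 0)
  byCase false v eq = dead (v ⊓ suc n)
  byCase true zero eq = dead 0
  byCase true (suc v) eq = trans (tally-score n ws (suc (v ⊓ n)) 0 0 q [] ≤-refl) (capped (suc v))

-- Agreement with the decoding of instances

instanceValue : Maybe Instance → ℕ
instanceValue nothing                 = 0
instanceValue (just (n , ws , q , i)) = SSraw n ws q i

SSstar-nothing : ∀ x → decodeList x ≡ nothing → SSstar x ≡ 0
SSstar-nothing x eq rewrite eq = refl

SSstar-just : ∀ x l → decodeList x ≡ just l → SSstar x ≡ instanceValue (decodeInstance l)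
SSstar-just x l eq rewrite eq with decodeInstance l
... | nothing = refl
... | just _  = refl

reversedValue : List ℕ → ℕ
reversedValue (i ∷ q ∷ rws) = instanceValue (mkInstance (reverse rws) q i)
reversedValue _             = 0

instanceValue-reversed : ∀ l rl → reverse l ≡ rl → instanceValue (decodeInstance l) ≡ reversedValue rl
instanceValue-reversed l [] eq rewrite eq = refl
instanceValue-reversed l (_ ∷ []) eq rewrite eq = refl
instanceValue-reversed l (i ∷ q ∷ rws) eq rewrite eq = refl

mkInstance-score : ∀ ws q i → instanceValue (mkInstance ws q i) ≡ when (not (isZero i)) (score ws i 0 0 q 0)
mkInstance-score ws q zero = refl
mkInstance-score ws q (suc j) with j <? length ws
... | yes j<n = trans (SSraw-score ws q (Fin.fromℕ< j<n)) (cong (λ z → score ws (suc z) 0 0 q 0) (Finₚ.toℕ-fromℕ< j<n))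
... | no  j≮n = sym (score-late ws (suc j) 0 0 q 0 (s≤s (≮⇒≥ j≮n)))

reversed-gameScore : ∀ rres → reversedValue (map val rres) ≡ gameScore (gameOf (true , rres))
reversed-gameScore [] = refl
reversed-gameScore (_ ∷ []) = refl
reversed-gameScore (i ∷ q ∷ rws) = trans (mkInstance-score (reverse (map val rws)) (val q) (val i))
  (cong (λ z → when (not (isZero (val i))) (score z (val i) 0 0 (val q) 0)) (sym (reverse-map val rws)))

gameOf-bad : ∀ rres → gameScore (gameOf (false , rres)) ≡ 0
gameOf-bad [] = refl
gameOf-bad (_ ∷ []) = refl
gameOf-bad (_ ∷ _ ∷ _) = refl

SSstar-gameScore : ∀ x → SSstar x ≡ gameScore (gameOf (parseList x))
SSstar-gameScore x = connect (proj₁ (parseList x)) refl (parse-spec (length x) x [] ≤-refl)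
  where
  R : PState
  R = iter (length x) parseStep (true , (x , ([] , [])))
  connect : ∀ b → proj₁ (parseList x) ≡ b → (if proj₁ (parseList x) then (Σ (List ℕ) λ l → decodeList x ≡ just l × map val (proj₂ (parseList x)) ≡ l ʳ++ []) else decodeList x ≡ nothing) →
            SSstar x ≡ gameScore (gameOf (parseList x))
  connect b eq h with proj₁ (parseList x)
  connect .true refl (l , eq , eq′) | true = trans (SSstar-just x l eq) (trans (instanceValue-reversed l (map val (proj₂ (parseList x))) (sym eq′)) (reversed-gameScore (proj₂ (parseList x))))
  connect .false refl eq | false = trans (SSstar-nothing x eq) (sym (gameOf-bad (proj₂ (parseList x))))

-- The verifier in polynomial time

size-digitStep : ∀ d → size (digitStep d) ≤ size d
size-digitStep ((c , found) , (ok , []))     = ≤-refl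
size-digitStep ((c , found) , (ok , b ∷ ys)) = s≤s (+-mono-≤ (s≤s (+-mono-≤ (le b) (≤-reflexive (size-Bool (found ∨ b) found))))
  (s≤s (+-mono-≤ (≤-reflexive (size-Bool (ok ∧ not (b ∧ (found ∨ isZero c))) ok)) (≤-trans (m≤n+m _ (size b)) (n≤1+n _)))))
  where
  le : ∀ b → size (if b then c else pred c) ≤ size c
  le true  = ≤-refl
  le false = size-mono (pred[n]≤n {c})

digitStepₚ : PT digitStep
digitStepₚ = stepped ∘ₚ ((fstPT ,ₚ fst′ₚ sndPT) ,ₚ snd′ₚ sndPT)
  where
  h : ((ℕ × Bool) × Bool) × BitString → DState
  h ((cf , ok) , ys) = digitStep (cf , (ok , ys))
  G : Set
  G = ((ℕ × Bool) × Bool) × (Bool × BitString)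
  c : PT {G} (λ z → proj₁ (proj₁ (proj₁ z)))
  c = fst′ₚ (fst′ₚ fstPT)
  found : PT {G} (λ z → proj₂ (proj₁ (proj₁ z)))
  found = snd′ₚ (fst′ₚ fstPT)
  ok : PT {G} (λ z → proj₂ (proj₁ z))
  ok = snd′ₚ fstPT
  b : PT {G} (λ z → proj₁ (proj₂ z))
  b = fst′ₚ sndPT
  stepped : PT h
  stepped = caseListₚ {E = (ℕ × Bool) × Bool} {X = Bool} h (λ _ → refl) (λ _ _ _ → refl) (fstPT ,ₚ (sndPT ,ₚ constPT []))
    ((ifPT b c (predₚ c) ,ₚ (found ∨ₚ b)) ,ₚ ((ok ∧ₚ notₚ (b ∧ₚ (found ∨ₚ isZeroₚ c))) ,ₚ snd′ₚ sndPT))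

suffix-digits : ∀ n s → size (proj₂ (proj₂ (iter n digitStep s))) ≤ size (proj₂ (proj₂ s))
suffix-digits zero s = ≤-refl
suffix-digits (suc n) ((c , found) , (ok , []))     = suffix-digits n ((c , found) , (ok , []))
suffix-digits (suc n) ((c , found) , (ok , b ∷ ys)) = ≤-trans (suffix-digits n (digitStep ((c , found) , (ok , b ∷ ys)))) (≤-trans (m≤n+m _ (size b)) (n≤1+n _))

size-digits : ∀ n c found ok ys → size (proj₂ (digits n c found (ok , tailBits ys))) ≤ size ys
size-digits n c found ok ys = ≤-trans (suffix-digits n ((c , found) , (ok , tailBits ys))) (size-tailBits ys)

module _ {A : Set} ⦃ eA : Enc A ⦄ where
  digitsₚ : {n c : A → ℕ} {found : A → Bool} {p : A → Bool × BitString} → PT n → PT c → PT found → PT p →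
            PT (λ a → digits (n a) (c a) (found a) (p a))
  digitsₚ {n} {c} {found} {p} pn pc pf pp = (snd′ₚ (fst′ₚ r) ∧ₚ fst′ₚ (snd′ₚ r)) ,ₚ snd′ₚ (snd′ₚ r)
    where
    r : PT (λ a → iter (n a) digitStep ((c a , found a) , p a))
    r = iterₚ {E = ⊤} {f = λ z → digitStep (proj₂ z)} (digitStepₚ ∘ₚ sndPT) pn (constPT tt) ((pc ,ₚ pf) ,ₚ pp) (con 0)
      (λ _ b → ≤-trans (size-digitStep b) (m≤m+n _ 0))

  module _ {s : A → VState} (ps : PT s) where
    okₚ : PT (λ a → proj₁ (s a))
    okₚ = fst′ₚ ps
    mₚ : PT (λ a → proj₁ (proj₂ (s a)))
    mₚ = fst′ₚ (snd′ₚ ps)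
    ysₚ : PT (λ a → proj₁ (proj₂ (proj₂ (s a))))
    ysₚ = fst′ₚ (snd′ₚ (snd′ₚ ps))
    inₚ : PT (λ a → proj₁ (proj₂ (proj₂ (proj₂ (s a)))))
    inₚ = fst′ₚ (snd′ₚ (snd′ₚ (snd′ₚ ps)))
    outₚ : PT (λ a → proj₁ (proj₂ (proj₂ (proj₂ (proj₂ (s a))))))
    outₚ = fst′ₚ (snd′ₚ (snd′ₚ (snd′ₚ (snd′ₚ ps))))
    restₚ : PT (λ a → proj₁ (proj₂ (proj₂ (proj₂ (proj₂ (proj₂ (s a)))))))
    restₚ = fst′ₚ (snd′ₚ (snd′ₚ (snd′ₚ (snd′ₚ (snd′ₚ ps)))))
    wₚ : PT (λ a → proj₂ (proj₂ (proj₂ (proj₂ (proj₂ (proj₂ (s a)))))))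
    wₚ = snd′ₚ (snd′ₚ (snd′ₚ (snd′ₚ (snd′ₚ (snd′ₚ ps)))))

playerStepₚ : PT {List Bool × (ℕ × VState)} (λ z → playerStep (proj₁ (proj₂ z)) (proj₁ z) (proj₂ (proj₂ z)))
playerStepₚ = ifPT (isZeroₚ (predₚ (mₚ st)) ∧ₚ notₚ (isZeroₚ (mₚ st)))
    (fst′ₚ dSelf ,ₚ (predₚ (mₚ st) ,ₚ (snd′ₚ dSelf ,ₚ (inₚ st ,ₚ (outₚ st ,ₚ (restₚ st ,ₚ fstPT))))))
    (ifPT (headBitₚ (ysₚ st))
      (fst′ₚ dIn ,ₚ (predₚ (mₚ st) ,ₚ (snd′ₚ dIn ,ₚ (sucₚ (inₚ st) ,ₚ (outₚ st ,ₚ (monusBitsₚ (restₚ st) fstPT ,ₚ wₚ st))))))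
      (fst′ₚ dOut ,ₚ (predₚ (mₚ st) ,ₚ (snd′ₚ dOut ,ₚ (inₚ st ,ₚ (sucₚ (outₚ st) ,ₚ (restₚ st ,ₚ wₚ st)))))))
  where
  I : Set
  I = List Bool × (ℕ × VState)
  st : PT {I} (λ z → proj₂ (proj₂ z))
  st = snd′ₚ sndPT
  n : PT {I} (λ z → proj₁ (proj₂ z))
  n = fst′ₚ sndPT
  dSelf = digitsₚ n (constPT 0) (constPT true) ((okₚ st ∧ₚ notₚ (headBitₚ (ysₚ st))) ,ₚ tailBitsₚ (ysₚ st))
  dIn  = digitsₚ n (sucₚ (inₚ st)) (constPT false) (okₚ st ,ₚ tailBitsₚ (ysₚ st))
  dOut = digitsₚ n (sucₚ (outₚ st)) (constPT false) (okₚ st ,ₚ tailBitsₚ (ysₚ st))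

size-playerStep : ∀ v n st → size (playerStep n v st) ≤ size st + (2 + (size v + size n))
size-playerStep v n (ok , (m , (ys , (s , (r , (rest , w)))))) = cases (isZero (pred m) ∧ not (isZero m)) (headBit ys)
  where
  tuple : ∀ (b : Bool) (m′ : ℕ) (ys′ : BitString) (s′ r′ : ℕ) (rest′ w′ : List Bool) {x} → size m′ ≤ size m → size ys′ ≤ size ys →
          size s′ + size r′ + size rest′ + size w′ ≤ size s + size r + size rest + size w + x →
          size {VState} (b , (m′ , (ys′ , (s′ , (r′ , (rest′ , w′)))))) ≤ size {VState} (ok , (m , (ys , (s , (r , (rest , w)))))) + x
  tuple b m′ ys′ s′ r′ rest′ w′ {x} hm hy h = ≤-trans (≤-reflexive (flat (size b) (size m′) (size ys′) (size s′) (size r′) (size rest′) (size w′)))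
    (≤-trans (+-mono-≤ (+-mono-≤ (+-mono-≤ (+-monoʳ-≤ 6 (≤-reflexive (size-Bool b ok))) hm) hy) h)
      (≤-reflexive (trans (sym (+-assoc (6 + size ok + size m + size ys) _ x)) (cong (_+ x) (sym (flat (size ok) (size m) (size ys) (size s) (size r) (size rest) (size w)))))))
    where
    flat : ∀ b m y s r t w → suc (b + suc (m + suc (y + suc (s + suc (r + suc (t + w)))))) ≡ 6 + b + m + y + (s + r + t + w)
    flat = solve-∀
  pm : size (pred m) ≤ size m
  pm = size-mono (pred[n]≤n {m})
  cases : ∀ a b → size (if a then selfStep (digits n 0 true (ok ∧ not (headBit ys) , tailBits ys)) v (ok , (m , (ys , (s , (r , (rest , w))))))
       else (if b then inStep (digits n (suc s) false (ok , tailBits ys)) v (ok , (m , (ys , (s , (r , (rest , w))))))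
        else outStep (digits n (suc r) false (ok , tailBits ys)) v (ok , (m , (ys , (s , (r , (rest , w)))))))) ≤
        size {VState} (ok , (m , (ys , (s , (r , (rest , w)))))) + (2 + (size v + size n))
  cases true b = tuple _ (pred m) _ s r rest v pm (size-digits n 0 true (ok ∧ not (headBit ys)) ys)
    (≤-trans (+-monoʳ-≤ (size s + size r + size rest) (m≤n+m (size v) (size w + 2))) (≤-by (size n) (ar (size s + size r + size rest) (size w) (size v) (size n))))
    where
    ar : ∀ a w v n → a + (w + 2 + v) + n ≡ a + w + (2 + (v + n))
    ar = solve-∀
  cases false true = tuple _ (pred m) _ (suc s) r (monusBits rest v) w pm (size-digits n (suc s) false ok ys)
    (≤-by (size v + size n) (trans (cong (λ z → suc (suc (size s)) + size r + z + size w + (size v + size n)) (size-monusBits rest v)) (ar (size s) (size r) (size rest) (size w) (size v) (size n))))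
    where
    ar : ∀ s r t w v n → suc (suc s) + r + t + w + (v + n) ≡ s + r + t + w + (2 + (v + n))
    ar = solve-∀
  cases false false = tuple _ (pred m) _ s (suc r) rest w pm (size-digits n (suc r) false ok ys)
    (≤-by (size v + size n) (ar (size s) (size r) (size rest) (size w) (size v) (size n)))
    where
    ar : ∀ s r t w v n → s + suc (suc r) + t + w + (v + n) ≡ s + r + t + w + (2 + (v + n))
    ar = solve-∀

module _ {A : Set} ⦃ eA : Enc A ⦄ where
  bitₚ : {b : A → Bool} → PT b → PT (λ a → bit (b a))
  bitₚ pb = ifPT pb (constPT 1) (constPT 0)

  ⊓ₚ : {m n : A → ℕ} → PT m → PT n → PT (λ a → m a ⊓ n a)
  ⊓ₚ {m} {n} pm pn = respPT (λ a → same (m a) (n a)) (ifPT (≤ᵇₚ pm pn) pm pn)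
    where
    same : ∀ m n → (if m ≤ᵇ n then m else n) ≡ m ⊓ n
    same m n with m ≤ᵇ n in eq
    ... | true  = sym (m≤n⇒m⊓n≡m (≤ᵇ⇒≤ m n (subst T (sym eq) tt)))
    ... | false = sym (m≥n⇒m⊓n≡n (<⇒≤ (≰⇒> (λ le → subst T eq (≤⇒≤ᵇ le)))))

module _ {A : Set} ⦃ eA : Enc A ⦄ where
  capNatₚ : {N : A → ℕ} {bs : A → List Bool} → PT N → PT bs → PT (λ a → capNat (N a) (bs a))
  capNatₚ pN pbs = foldₚ {E = ℕ} {f = λ z → (proj₂ (proj₂ z) + proj₂ (proj₂ z) + bit (proj₁ z)) ⊓ proj₁ (proj₂ z)}
    (⊓ₚ (snd′ₚ sndPT +ₚ snd′ₚ sndPT +ₚ bitₚ fstPT) (fst′ₚ sndPT)) (reverseₚ pbs) pN (constPT 0) var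
    (λ x e b → ≤-trans (size-mono (m⊓n≤n (b + b + bit x) e)) (≤-trans (m≤n+m (size e) (size x)) (m≤n+m (size x + size e) (size b))))

gameOfₚ : PT gameOf
gameOfₚ = caseListₚ {E = Bool} {X = List Bool} {f = λ _ → false , ([] , ([] , []))} {g = λ z → h₂ ((proj₁ z , proj₁ (proj₂ z)) , proj₂ (proj₂ z))}
  gameOf (λ _ → refl) same (constPT (false , ([] , ([] , [])))) (inner ∘ₚ ((fstPT ,ₚ fst′ₚ sndPT) ,ₚ snd′ₚ sndPT))
  where
  h₂ : (Bool × List Bool) × List (List Bool) → Game
  h₂ ((ok , i) , l) = gameOf (ok , i ∷ l)
  same : ∀ ok i l → gameOf (ok , i ∷ l) ≡ h₂ ((ok , i) , l)
  same ok i l = refl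
  inner : PT h₂
  inner = caseListₚ {E = Bool × List Bool} {X = List Bool} {f = λ _ → false , ([] , ([] , []))}
    {g = λ z → proj₁ (proj₁ z) , (proj₂ (proj₁ z) , (proj₁ (proj₂ z) , reverse (proj₂ (proj₂ z))))}
    h₂ (λ _ → refl) (λ _ _ _ → refl) (constPT (false , ([] , ([] , [])))) (fst′ₚ fstPT ,ₚ (snd′ₚ fstPT ,ₚ (fst′ₚ sndPT ,ₚ reverseₚ (snd′ₚ sndPT))))

verifyₚ : PT {Game × BitString} (λ z → verify (proj₁ z) (proj₂ z))
verifyₚ = okₚ end ∧ₚ (isZeroₚ (mₚ end) ∧ₚ (anyBitₚ (restₚ end) ∧ₚ notₚ (anyBitₚ (monusBitsₚ (restₚ end) (wₚ end)))))
  where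
  I : Set
  I = Game × BitString
  ws : PT {I} (λ z → proj₂ (proj₂ (proj₂ (proj₁ z))))
  ws = snd′ₚ (snd′ₚ (snd′ₚ fstPT))
  iu : PT {I} (λ z → capNat (suc (length (proj₂ (proj₂ (proj₂ (proj₁ z)))))) (proj₁ (proj₂ (proj₁ z))))
  iu = capNatₚ (sucₚ (lengthₚ ws)) (fst′ₚ (snd′ₚ fstPT))
  begun : PT {I} (λ z → startState (proj₁ z) (proj₂ z))
  begun = (fst′ₚ fstPT ∧ₚ notₚ (isZeroₚ iu)) ,ₚ (iu ,ₚ (sndPT ,ₚ (constPT 0 ,ₚ (constPT 0 ,ₚ (fst′ₚ (snd′ₚ (snd′ₚ fstPT)) ,ₚ constPT [])))))
  end : PT {I} (λ z → runPlayers (length (proj₂ (proj₂ (proj₂ (proj₁ z))))) (proj₂ (proj₂ (proj₂ (proj₁ z)))) (startState (proj₁ z) (proj₂ z)))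
  end = foldₚ {E = ℕ} {f = λ z → playerStep (proj₁ (proj₂ z)) (proj₁ z) (proj₂ (proj₂ z))} playerStepₚ ws (lengthₚ ws) begun (con 2 ⊕ var)
    (λ v n st → size-playerStep v n st)

SSstar-sharpP : SharpP SSstar
SSstar-sharpP = Guess.guessing-sharpP {V = λ p → U (proj₂ p) (reverse (proj₁ p))} Uₚ Wₚ SSstar
  (λ x → trans (SSstar-gameScore x) (trans (sym (verify-score (gameOf (parseList x)))) (sym (guesses-sumBits U x (witnessLength (gameOf (parseList x))) []))))
  where
  U : BitString → BitString → Bool
  U x z = verify (gameOf (parseList x)) z
  Uₚ : PT (λ (p : BitString × BitString) → U (proj₂ p) (reverse (proj₁ p)))
  Uₚ = verifyₚ ∘ₚ ((gameOfₚ ∘ₚ parseListₚ sndPT) ,ₚ reverseₚ fstPT)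
  Wₚ : PT (λ x → witnessLength (gameOf (parseList x)))
  Wₚ = (lengthₚ ws *ₚ sucₚ (lengthₚ ws)) ∘ₚ (gameOfₚ ∘ₚ parseListₚ idPT)
    where
    ws : PT {Game} (λ z → proj₂ (proj₂ (proj₂ z)))
    ws = snd′ₚ (snd′ₚ sndPT)

-- Index of a game built from exclusive tiles

subsum : List ℕ → (ℕ → ℕ → ℕ) → ℕ
subsum []       f = f 0 0
subsum (w ∷ ws) f = subsum ws f + subsum ws (λ k v → f (suc k) (w + v))

subsum-cong : ∀ ws {f g : ℕ → ℕ → ℕ} → (∀ k v → f k v ≡ g k v) → subsum ws f ≡ subsum ws g
subsum-cong [] h = h 0 0
subsum-cong (w ∷ ws) h = cong₂ _+_ (subsum-cong ws h) (subsum-cong ws (λ k v → h (suc k) (w + v)))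

subsum-0 : ∀ ws {f : ℕ → ℕ → ℕ} → (∀ k v → f k v ≡ 0) → subsum ws f ≡ 0
subsum-0 [] h = h 0 0
subsum-0 (w ∷ ws) h = cong₂ _+_ (subsum-0 ws h) (subsum-0 ws (λ k v → h (suc k) (w + v)))

subsum-++ : ∀ us ws f → subsum (us ++ ws) f ≡ subsum us (λ k v → subsum ws (λ k′ v′ → f (k + k′) (v + v′)))
subsum-++ [] ws f = refl
subsum-++ (u ∷ us) ws f = cong₂ _+_ (subsum-++ us ws f) (trans (subsum-++ us ws (λ k v → f (suc k) (u + v)))
  (subsum-cong us (λ k v → subsum-cong ws (λ k′ v′ → cong (f (suc (k + k′))) (sym (+-assoc u v v′))))))

subsum-scale : ∀ B ws f → subsum (map (B *_) ws) f ≡ subsum ws (λ k v → f k (B * v))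
subsum-scale B [] f = cong (f 0) (sym (*-zeroʳ B))
subsum-scale B (w ∷ ws) f = cong₂ _+_ (subsum-scale B ws f) (trans (subsum-scale B ws (λ k v → f (suc k) (B * w + v)))
  (subsum-cong ws (λ k v → cong (f (suc k)) (sym (*-distribˡ-+ B w v)))))

subsum-when : ∀ b ws f → subsum ws (λ k v → when b (f k v)) ≡ when b (subsum ws f)
subsum-when true  ws f = refl
subsum-when false ws f = subsum-0 ws (λ _ _ → refl)

sum-allSubsets : ∀ (ws : List ℕ) (f : ℕ → ℕ → ℕ) →
  sum (map (λ S → f ∣ S ∣ (weightOf (Vec.fromList ws) S)) (allSubsets (length ws))) ≡ subsum ws f
sum-allSubsets [] f = +-identityʳ _
sum-allSubsets (w ∷ ws) f = trans (sum-subsets (length ws) (λ S → f ∣ S ∣ (weightOf (Vec.fromList (w ∷ ws)) S)))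
  (cong₂ _+_ (sum-allSubsets ws f) (sum-allSubsets ws (λ k v → f (suc k) (w + v))))

≡ᵇ-≢ : ∀ {m n} → m ≢ n → (m ≡ᵇ n) ≡ false
≡ᵇ-≢ {m} {n} ne with m ≡ᵇ n in eq
... | true  = ⊥-elim (ne (≡ᵇ⇒≡ m n (subst T (sym eq) tt)))
... | false = refl

≡ᵇ-≡ : ∀ {m n} → m ≡ n → (m ≡ᵇ n) ≡ true
≡ᵇ-≡ {zero} refl = refl
≡ᵇ-≡ {suc m} refl = ≡ᵇ-≡ {m} refl

≡ᵇ-cong : ∀ {m n m′ n′} → (m ≡ n → m′ ≡ n′) → (m′ ≡ n′ → m ≡ n) → (m ≡ᵇ n) ≡ (m′ ≡ᵇ n′)
≡ᵇ-cong {m} {n} to from with m ≟ n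
... | yes eq = trans (≡ᵇ-≡ eq) (sym (≡ᵇ-≡ (to eq)))
... | no  ne = trans (≡ᵇ-≢ ne) (sym (≡ᵇ-≢ (λ eq → ne (from eq))))

digit-unique : ∀ B a b x y → a < B → b < B → a + B * x ≡ b + B * y → a ≡ b × x ≡ y
digit-unique B a b zero zero _ _ eq = trans (sym (trans (cong (a +_) (*-zeroʳ B)) (+-identityʳ a))) (trans eq (trans (cong (b +_) (*-zeroʳ B)) (+-identityʳ b))) , refl
digit-unique B a b zero (suc y) a< b< eq = ⊥-elim (<⇒≱ a< (≤-trans (≤-trans (m≤m+n B (B * y)) (≤-trans (≤-reflexive (sym (*-suc B y))) (m≤n+m _ b)))
  (≤-reflexive (trans (sym eq) (trans (cong (a +_) (*-zeroʳ B)) (+-identityʳ a))))))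
digit-unique B a b (suc x) zero a< b< eq = ⊥-elim (<⇒≱ b< (≤-trans (≤-trans (m≤m+n B (B * x)) (≤-trans (≤-reflexive (sym (*-suc B x))) (m≤n+m _ a)))
  (≤-reflexive (trans eq (trans (cong (b +_) (*-zeroʳ B)) (+-identityʳ b))))))
digit-unique B a b (suc x) (suc y) a< b< eq with digit-unique B a b x y a< b< (+-cancelˡ-≡ B _ _ (trans (sym (pull a x)) (trans eq (pull b y))))
  where
  pull : ∀ a x → a + B * suc x ≡ B + (a + B * x)
  pull a x = trans (cong (a +_) (*-suc B x)) (ar a B (B * x))
    where
    ar : ∀ a b c → a + (b + c) ≡ b + (a + c)
    ar = solve-∀
... | p , q = p , cong suc q

digit-≡ᵇ : ∀ B a b x y → a < B → b < B → (a + B * x ≡ᵇ b + B * y) ≡ (a ≡ᵇ b) ∧ (x ≡ᵇ y)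
digit-≡ᵇ B a b x y a< b< with a ≟ b
... | yes refl rewrite ≡ᵇ-≡ {a} refl = ≡ᵇ-cong (λ eq → proj₂ (digit-unique B a a x y a< b< eq)) (cong (λ z → a + B * z))
... | no ne rewrite ≡ᵇ-≢ ne = ≡ᵇ-≢ (λ eq → ne (proj₁ (digit-unique B a b x y a< b< eq)))

-- A subset sum in which lowest digits and higher parts are added separately, so that the condition
-- on the lowest digit can be isolated before the parts are joined.
pairsum : List (ℕ × ℕ) → (ℕ → ℕ → ℕ → ℕ) → ℕ
pairsum []             f = f 0 0 0
pairsum ((d , h) ∷ ps) f = pairsum ps f + pairsum ps (λ k e i → f (suc k) (d + e) (h + i))

pairsum-cong : ∀ ps {f g : ℕ → ℕ → ℕ → ℕ} → (∀ k d h → f k d h ≡ g k d h) → pairsum ps f ≡ pairsum ps g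
pairsum-cong [] h = h 0 0 0
pairsum-cong ((d , i) ∷ ps) h = cong₂ _+_ (pairsum-cong ps h) (pairsum-cong ps (λ k e j → h (suc k) (d + e) (i + j)))

pairsum-0 : ∀ ps {f : ℕ → ℕ → ℕ → ℕ} → (∀ k d h → f k d h ≡ 0) → pairsum ps f ≡ 0
pairsum-0 [] h = h 0 0 0
pairsum-0 ((d , i) ∷ ps) h = cong₂ _+_ (pairsum-0 ps h) (pairsum-0 ps (λ k e j → h (suc k) (d + e) (i + j)))

pairsum-bounded : ∀ D ps {f g : ℕ → ℕ → ℕ → ℕ} → All (λ p → proj₁ p ≤ D) ps → (∀ k d h → d ≤ length ps * D → f k d h ≡ g k d h) → pairsum ps f ≡ pairsum ps g
pairsum-bounded D [] [] h = h 0 0 0 z≤n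
pairsum-bounded D ((d , i) ∷ ps) (p ∷ al) h = cong₂ _+_ (pairsum-bounded D ps al (λ k e j le → h k e j (≤-trans le (m≤n+m _ D))))
  (pairsum-bounded D ps al (λ k e j le → h (suc k) (d + e) (i + j) (+-mono-≤ p le)))

subsum-pairs : ∀ B ps f → subsum (map (λ p → proj₁ p + B * proj₂ p) ps) f ≡ pairsum ps (λ k d h → f k (d + B * h))
subsum-pairs B [] f = cong (f 0) (sym (*-zeroʳ B))
subsum-pairs B ((d , h) ∷ ps) f = cong₂ _+_ (subsum-pairs B ps f) (trans (subsum-pairs B ps (λ k v → f (suc k) (d + B * h + v)))
  (pairsum-cong ps (λ k e i → cong (f (suc k)) (ar B d h e i))))
  where
  ar : ∀ B d h e i → d + B * h + (e + B * i) ≡ d + e + B * (h + i)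
  ar = solve-∀

module Select (κ : ℕ) where
  -- With keys and offsets at most κ, an offset alone stays below this number while two complements
  -- `D₀ ∸ key τ` exceed it; that is why it is twice κ plus one.
  D₀ : ℕ
  D₀ = suc (κ + κ)

  Big : List (ℕ × ℕ) → Set
  Big = All (λ p → suc κ ≤ proj₁ p)

  over : ∀ x ps → D₀ < x → ∀ (G : ℕ → ℕ → ℕ) → pairsum ps (λ k d h → when (x + d ≡ᵇ D₀) (G k h)) ≡ 0
  over x ps lt G = pairsum-0 ps (λ k d h → cong (λ b → when b (G k h)) (≡ᵇ-≢ (λ eq → <⇒≱ lt (≤-trans (m≤m+n x d) (≤-reflexive eq)))))

  over-D₀ : ∀ {x d} → suc κ ≤ x → suc κ ≤ d → D₀ < x + d
  over-D₀ p q = ≤-trans (≤-reflexive (cong suc (sym (+-suc κ κ)))) (+-mono-≤ p q)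

  shift-when : ∀ x d ps (G : ℕ → ℕ → ℕ) h → pairsum ps (λ k e i → when (x + (d + e) ≡ᵇ D₀) (G (suc k) (h + i))) ≡
               pairsum ps (λ k e i → when (x + d + e ≡ᵇ D₀) (G (suc k) (h + i)))
  shift-when x d ps G h = pairsum-cong ps (λ k e i → cong (λ z → when (z ≡ᵇ D₀) (G (suc k) (h + i))) (sym (+-assoc x d e)))

  -- As `x` is already more than half of `D₀`, any further item overshoots; and without one the sum
  -- is `x`, which misses `D₀`.
  wrong : ∀ x ps → suc κ ≤ x → x ≢ D₀ → Big ps → ∀ (G : ℕ → ℕ → ℕ) → pairsum ps (λ k d h → when (x + d ≡ᵇ D₀) (G k h)) ≡ 0
  wrong x [] le ne [] G = cong (λ b → when b (G 0 0)) (≡ᵇ-≢ (λ eq → ne (trans (sym (+-identityʳ x)) eq)))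
  wrong x ((d , h) ∷ ps) le ne (p ∷ al) G = cong₂ _+_ (wrong x ps le ne al G)
    (trans (shift-when x d ps G h) (over (x + d) ps (over-D₀ le p) (λ k i → G (suc k) (h + i))))

  right′ : ∀ ps → Big ps → ∀ (G : ℕ → ℕ → ℕ) → pairsum ps (λ k d h → when (D₀ + d ≡ᵇ D₀) (G k h)) ≡ G 0 0
  right′ [] [] G = cong (λ b → when b (G 0 0)) (≡ᵇ-≡ (+-identityʳ D₀))
  right′ ((d , h) ∷ ps) (p ∷ al) G = trans (cong₂ _+_ (right′ ps al G)
    (trans (shift-when D₀ d ps G h) (over (D₀ + d) ps (over-D₀ (s≤s (m≤m+n κ κ)) p) (λ k i → G (suc k) (h + i))))) (+-identityʳ _)

  -- Exactly one pair is selected, since each digit D₀ − key exceeds half of D₀.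
  select : ∀ {Tile : Set} (key : Tile → ℕ) (high : Tile → ℕ) ts → All (λ τ → key τ ≤ κ) ts → ∀ c → c ≤ κ → ∀ (G : ℕ → ℕ → ℕ) →
    pairsum (map (λ τ → D₀ ∸ key τ , high τ) ts) (λ k d h → when (c + d ≡ᵇ D₀) (G k h)) ≡ sum (map (λ τ → when (key τ ≡ᵇ c) (G 1 (high τ))) ts)
  select key high [] [] c c≤ G = cong (λ b → when b (G 0 0)) (≡ᵇ-≢ (λ eq → <⇒≱ (s≤s (≤-trans c≤ (m≤m+n κ κ))) (≤-reflexive (trans (sym eq) (+-identityʳ c)))))
  select {Tile} key high (τ ∷ ts) (k≤ ∷ al) c c≤ G = trans (+-comm (pairsum ps (λ k d h → when (c + d ≡ᵇ D₀) (G k h))) _) (cong₂ _+_ (trans (shift-when c (D₀ ∸ key τ) ps G (high τ)) chosen) (select key high ts al c c≤ G))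
    where
    ps : List (ℕ × ℕ)
    ps = map (λ τ → D₀ ∸ key τ , high τ) ts
    big : ∀ k → k ≤ κ → suc κ ≤ D₀ ∸ k
    big k le = ≤-trans (≤-reflexive (sym (m+n∸n≡m (suc κ) κ))) (∸-monoʳ-≤ D₀ le)
    bigs : ∀ {ts : List Tile} → All (λ τ → key τ ≤ κ) ts → Big (map (λ τ → D₀ ∸ key τ , high τ) ts)
    bigs [] = []
    bigs (p ∷ al) = big _ p ∷ bigs al
    back : key τ + (D₀ ∸ key τ) ≡ D₀
    back = m+[n∸m]≡n (≤-trans k≤ (≤-trans (m≤m+n κ κ) (n≤1+n _)))
    chosen : pairsum ps (λ k e i → when (c + (D₀ ∸ key τ) + e ≡ᵇ D₀) (G (suc k) (high τ + i))) ≡ when (key τ ≡ᵇ c) (G 1 (high τ))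
    chosen with key τ ≟ c
    ... | yes refl rewrite ≡ᵇ-≡ {key τ} refl | back = trans (right′ ps (bigs al) (λ k i → G (suc k) (high τ + i))) (cong (G 1) (+-identityʳ (high τ)))
    ... | no ne rewrite ≡ᵇ-≢ ne = wrong (c + (D₀ ∸ key τ)) ps (≤-trans (big _ k≤) (m≤n+m _ c))
      (λ eq → ne (+-cancelʳ-≡ (D₀ ∸ key τ) (key τ) c (trans back (sym eq)))) (bigs al) (λ k i → G (suc k) (high τ + i))

-- One step of the queue machine uses one digit in base B; the tiles of step j are
-- scaled by B ^ j.
module Tiles {Tile : Set} (key : Tile → ℕ) (right down : Tile → ℕ) (tiles : List Tile) (κ B P′ : ℕ) (keys≤ : All (λ τ → key τ ≤ κ) tiles)
  (B> : κ + length tiles * suc (κ + κ) < B) (D₀<B : suc (κ + κ) < B) (Tf : ℕ) where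
  open Select κ

  -- When the digit of the current step has been split off, the next state belongs to the lowest
  -- digit and the written letter to digit `P′`, just behind the `P′` letters that remain in the
  -- queue.
  high : Tile → ℕ
  high τ = right τ + down τ * B ^ P′

  items : ℕ → List ℕ
  items zero    = []
  items (suc m) = map (λ τ → (D₀ ∸ key τ) + B * high τ) tiles ++ map (B *_) (items m)

  target : ℕ → ℕ → ℕ
  target zero    t = t
  target (suc m) t = D₀ + B * target m t

  queueVal : List ℕ → ℕ
  queueVal []      = 0
  queueVal (a ∷ q) = a + B * queueVal q

  runsTo : ℕ → ℕ → List ℕ → ℕ
  runsTo zero    s q       = when (s + queueVal q ≡ᵇ Tf) 1
  runsTo (suc m) s []      = 0
  runsTo (suc m) s (a ∷ q) = sum (map (λ τ → when (key τ ≡ᵇ s + a) (runsTo m (right τ) (q ++ down τ ∷ []))) tiles)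

  queueVal-snoc : ∀ q b → queueVal (q ++ b ∷ []) ≡ queueVal q + b * B ^ length q
  queueVal-snoc [] b = trans (cong (b +_) (*-zeroʳ B)) (trans (+-identityʳ b) (sym (*-identityʳ b)))
  queueVal-snoc (a ∷ q) b = trans (cong (λ z → a + B * z) (queueVal-snoc q b)) (ar a B (queueVal q) b (B ^ length q))
    where
    ar : ∀ a B v b p → a + B * (v + b * p) ≡ a + B * v + b * (B * p)
    ar = solve-∀

  -- Small: the digit formed by the state and the front of the queue stays below κ
  -- along every run.
  module _ (Small : ℕ → List ℕ → Set) (small-key : ∀ {s a q} → Small s (a ∷ q) → s + a ≤ κ)
    (small-step : ∀ {s a q} → Small s (a ∷ q) → All (λ τ → Small (right τ) (q ++ down τ ∷ [])) tiles) where

    -- The lowest digit comes out as `D₀` only if exactly one tile with key `s + a` is chosen. What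
    -- remains after dividing by `B` is the same equation for the successor configuration. The
    -- weight `g` is arbitrary and shifted by one in each step, since every step uses up one item;
    -- it later becomes the factorials.
    subsum-items : ∀ m s q (g : ℕ → ℕ) → length q ≡ suc P′ → Small s q →
      subsum (items m) (λ k v → when (s + queueVal q + v ≡ᵇ target m Tf) (g k)) ≡ g m * runsTo m s q
    subsum-items zero s q g len sm = trans (cong (λ z → when (z ≡ᵇ Tf) (g 0)) (+-identityʳ (s + queueVal q))) (scaled (s + queueVal q ≡ᵇ Tf))
      where
      scaled : ∀ b → when b (g 0) ≡ g 0 * when b 1
      scaled true  = sym (*-identityʳ (g 0))
      scaled false = sym (*-zeroʳ (g 0))
    subsum-items (suc m) s (a ∷ q) g len sm = begin
      subsum (map weight tiles ++ map (B *_) (items m)) (λ k v → when (E + v ≡ᵇ T₁) (g k))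
        ≡⟨ subsum-++ (map weight tiles) (map (B *_) (items m)) _ ⟩
      subsum (map weight tiles) (λ k v → subsum (map (B *_) (items m)) (λ k′ v′ → when (E + (v + v′) ≡ᵇ T₁) (g (k + k′))))
        ≡⟨ subsum-cong (map weight tiles) (λ k v → subsum-scale B (items m) (λ k′ v′ → when (E + (v + v′) ≡ᵇ T₁) (g (k + k′)))) ⟩
      subsum (map weight tiles) F
        ≡⟨ cong (λ l → subsum l F) (map-∘ tiles) ⟩
      subsum (map (λ p → proj₁ p + B * proj₂ p) ps) F
        ≡⟨ subsum-pairs B ps F ⟩
      pairsum ps (λ k d h → F k (d + B * h))
        ≡⟨ pairsum-bounded D₀ ps small-digits separate ⟩
      pairsum ps (λ k d h → when (s + a + d ≡ᵇ D₀) (G k h))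
        ≡⟨ select key high tiles keys≤ (s + a) (small-key sm) G ⟩
      sum (map (λ τ → when (key τ ≡ᵇ s + a) (G 1 (high τ))) tiles)
        ≡⟨ continue tiles (small-step sm) ⟩
      g (suc m) * runsTo (suc m) s (a ∷ q) ∎
      where
      open ≡-Reasoning
      T₁ E : ℕ
      T₁ = target (suc m) Tf
      E = s + queueVal (a ∷ q)
      weight : Tile → ℕ
      weight τ = (D₀ ∸ key τ) + B * high τ
      ps : List (ℕ × ℕ)
      ps = map (λ τ → D₀ ∸ key τ , high τ) tiles
      F : ℕ → ℕ → ℕ
      F k v = subsum (items m) (λ k′ v′ → when (E + (v + B * v′) ≡ᵇ T₁) (g (k + k′)))
      G : ℕ → ℕ → ℕ
      G k h = subsum (items m) (λ k′ v′ → when (queueVal q + h + v′ ≡ᵇ target m Tf) (g (k + k′)))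
      small-digits : All (λ p → proj₁ p ≤ D₀) ps
      small-digits = below tiles
        where
        below : ∀ ts → All (λ p → proj₁ p ≤ D₀) (map (λ τ → D₀ ∸ key τ , high τ) ts)
        below [] = []
        below (τ ∷ ts) = m∸n≤m D₀ (key τ) ∷ below ts
      regroup : ∀ d h v′ → E + (d + B * h + B * v′) ≡ s + a + d + B * (queueVal q + h + v′)
      regroup d h v′ = ar s a B (queueVal q) d h v′
        where
        ar : ∀ s a B v d h w → s + (a + B * v) + (d + B * h + B * w) ≡ s + a + d + B * (v + h + w)
        ar = solve-∀
      separate : ∀ k d h → d ≤ length ps * D₀ → F k (d + B * h) ≡ when (s + a + d ≡ᵇ D₀) (G k h)
      separate k d h d≤ = trans (subsum-cong (items m) (λ k′ v′ → trans
          (cong (λ z → when z (g (k + k′))) (trans (cong (_≡ᵇ T₁) (regroup d h v′)) (digit-≡ᵇ B (s + a + d) D₀ (queueVal q + h + v′) (target m Tf) low D₀<B)))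
          (when-∧ (s + a + d ≡ᵇ D₀) _ _)))
        (subsum-when (s + a + d ≡ᵇ D₀) (items m) _)
        where
        -- No carry arises: at most `length tiles` digits, each at most `D₀`, join a digit of size
        -- at most κ, and `B` exceeds the total.
        low : s + a + d < B
        low = ≤-trans (s≤s (+-mono-≤ (small-key sm) (≤-trans d≤ (≤-reflexive (cong (_* D₀) (length-map _ tiles)))))) B>
      len′ : length q ≡ P′
      len′ = cong pred len
      advance : ∀ τ → queueVal q + high τ ≡ right τ + queueVal (q ++ down τ ∷ [])
      advance τ = trans (ar (queueVal q) (right τ) (down τ * B ^ P′)) (cong (right τ +_)
        (trans (cong (λ z → queueVal q + down τ * B ^ z) (sym len′)) (sym (queueVal-snoc q (down τ)))))
        where
        ar : ∀ v r d → v + (r + d) ≡ r + (v + d)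
        ar = solve-∀
      continue : ∀ ts → All (λ τ → Small (right τ) (q ++ down τ ∷ [])) ts →
        sum (map (λ τ → when (key τ ≡ᵇ s + a) (G 1 (high τ))) ts) ≡ g (suc m) * sum (map (λ τ → when (key τ ≡ᵇ s + a) (runsTo m (right τ) (q ++ down τ ∷ []))) ts)
      continue [] [] = sym (*-zeroʳ (g (suc m)))
      continue (τ ∷ ts) (st ∷ sts) = trans (cong₂ _+_ (trans (cong (when (key τ ≡ᵇ s + a)) next) (pull (key τ ≡ᵇ s + a) _)) (continue ts sts))
        (sym (*-distribˡ-+ (g (suc m)) (when (key τ ≡ᵇ s + a) (runsTo m (right τ) (q ++ down τ ∷ []))) _))
        where
        pull : ∀ b x → when b (g (suc m) * x) ≡ g (suc m) * when b x
        pull true  x = refl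
        pull false x = sym (*-zeroʳ (g (suc m)))
        next : G 1 (high τ) ≡ g (suc m) * runsTo m (right τ) (q ++ down τ ∷ [])
        next = trans (subsum-cong (items m) (λ k v → cong (λ z → when (z + v ≡ᵇ target m Tf) (g (suc k))) (advance τ)))
          (subsum-items m (right τ) (q ++ down τ ∷ []) (λ k → g (suc k)) (trans (length-++ q) (trans (+-comm (length q) 1) len)) st)

-- Binary notation and division

bin : ℕ → ℕ → BitString
bin zero    m       = []
bin (suc f) zero    = []
bin (suc f) (suc m) = bin f (suc m / 2) ++ ((suc m % 2 ≡ᵇ 1) ∷ [])

mutual
  toBin-bin : ∀ n → toBin n ≡ bin n n
  toBin-bin zero = refl
  -- The abstraction of `suc n` separates the parameter of the local function of `toBin` from its
  -- running arguments, so that the underscore below can be solved.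
  toBin-bin (suc n) with suc n / 2 | suc n % 2 ≡ᵇ 1 | suc n
  ... | m | b | k = cong (_++ b ∷ []) (toBin-bin′ k n m)

  toBin-bin′ : ∀ k f m → _ ≡ bin f m
  toBin-bin′ k zero    m       = refl
  toBin-bin′ k (suc f) zero    = refl
  toBin-bin′ k (suc f) (suc m) = cong (_++ (suc m % 2 ≡ᵇ 1) ∷ []) (toBin-bin′ k f (suc m / 2))

half≤ : ∀ m → suc m / 2 ≤ m
half≤ m = s≤s⁻¹ (m/n<m (suc m) 2 (s≤s (s≤s z≤n)))

bin-fuel : ∀ f f′ m → m ≤ f → m ≤ f′ → bin f m ≡ bin f′ m
bin-fuel zero    zero     m       le le′ = refl
bin-fuel zero    (suc f′) zero    le le′ = refl
bin-fuel (suc f) zero     zero    le le′ = refl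
bin-fuel (suc f) (suc f′) zero    le le′ = refl
bin-fuel (suc f) (suc f′) (suc m) (s≤s le) (s≤s le′) = cong (_++ _) (bin-fuel f f′ (suc m / 2) (≤-trans (half≤ m) le) (≤-trans (half≤ m) le′))

bit-mod : ∀ m → bit (m % 2 ≡ᵇ 1) ≡ m % 2
bit-mod m with m % 2 | m%n<n m 2
... | 0 | _ = refl
... | 1 | _ = refl
... | suc (suc _) | s≤s (s≤s ())

readMSB-snoc : ∀ acc xs b → readMSB acc (xs ++ b ∷ []) ≡ 2 * readMSB acc xs + bit b
readMSB-snoc acc [] b = refl
readMSB-snoc acc (x ∷ xs) b = readMSB-snoc (2 * acc + bit x) xs b

readMSB-bin : ∀ f m → m ≤ f → readMSB 0 (bin f m) ≡ m
readMSB-bin zero zero le = refl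
readMSB-bin (suc f) zero le = refl
readMSB-bin (suc f) (suc m) (s≤s le) = trans (readMSB-snoc 0 (bin f (suc m / 2)) _) (trans (cong₂ (λ a b → 2 * a + b) (readMSB-bin f (suc m / 2) (≤-trans (half≤ m) le)) (bit-mod (suc m)))
  (trans (trans (+-comm _ (suc m % 2)) (cong (suc m % 2 +_) (*-comm 2 (suc m / 2)))) (sym (m≡m%n+[m/n]*n (suc m) 2))))

readMSB-toBin : ∀ m → readMSB 0 (toBin m) ≡ m
readMSB-toBin m = trans (cong (readMSB 0) (toBin-bin m)) (readMSB-bin m m ≤-refl)

toBin-append : ∀ v b → 1 ≤ 2 * v + bit b → toBin (2 * v + bit b) ≡ toBin v ++ b ∷ []
toBin-append v b pos = append (2 * v + bit b) refl pos
  where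
  odd : (2 * v + bit b) % 2 ≡ bit b
  odd = trans (cong (_% 2) (trans (+-comm (2 * v) (bit b)) (cong (bit b +_) (*-comm 2 v)))) (trans ([m+kn]%n≡m%n (bit b) v 2) (small-bit b))
    where
    small-bit : ∀ b → bit b % 2 ≡ bit b
    small-bit true  = refl
    small-bit false = refl
  half : (2 * v + bit b) / 2 ≡ v
  half = *-cancelʳ-≡ _ v 2 (+-cancelˡ-≡ (bit b) _ _ (trans (cong (_+ (2 * v + bit b) / 2 * 2) (sym odd)) (trans (sym (m≡m%n+[m/n]*n (2 * v + bit b) 2)) (trans (+-comm (2 * v) (bit b)) (cong (bit b +_) (*-comm 2 v))))))
  bit-eq : ∀ b → (bit b ≡ᵇ 1) ≡ b
  bit-eq true  = refl
  bit-eq false = refl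
  append : ∀ m → m ≡ 2 * v + bit b → 1 ≤ m → toBin m ≡ toBin v ++ b ∷ []
  append (suc k) eq pos = trans (toBin-bin (suc k)) (cong₂ (λ xs c → xs ++ c ∷ [])
    (trans (cong (bin k) half′) (trans (bin-fuel k v v (≤-trans (≤-reflexive (sym half′)) (half≤ k)) ≤-refl) (sym (toBin-bin v))))
    (trans (cong (λ z → z % 2 ≡ᵇ 1) eq) (trans (cong (_≡ᵇ 1) odd) (bit-eq b))))
    where
    half′ : suc k / 2 ≡ v
    half′ = trans (cong (_/ 2) eq) half

toBin-readMSB : ∀ v bs → 1 ≤ v → toBin (readMSB v bs) ≡ toBin v ++ bs
toBin-readMSB v [] pos = sym (++-identityʳ _)
toBin-readMSB v (b ∷ bs) pos = trans (toBin-readMSB (2 * v + bit b) bs pos′) (trans (cong (_++ bs) (toBin-append v b pos′)) (++-assoc (toBin v) _ bs))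
  where
  pos′ : 1 ≤ 2 * v + bit b
  pos′ = ≤-trans pos (≤-trans (m≤m+n v _) (m≤m+n (2 * v) _))

strip : BitString → BitString
strip []           = []
strip (false ∷ bs) = strip bs
strip (true ∷ bs)  = true ∷ bs

strip-readMSB : ∀ bs → readMSB 0 (strip bs) ≡ readMSB 0 bs
strip-readMSB []           = refl
strip-readMSB (false ∷ bs) = strip-readMSB bs
strip-readMSB (true ∷ bs)  = refl

toBin-strip : ∀ bs → toBin (readMSB 0 (strip bs)) ≡ strip bs
toBin-strip []           = refl
toBin-strip (false ∷ bs) = toBin-strip bs
toBin-strip (true ∷ bs)  = toBin-readMSB 1 bs (s≤s z≤n)

readMSB<2^ : ∀ bs → readMSB 0 bs < 2 ^ length bs
readMSB<2^ bs = subst₂ (λ a l → a < 2 ^ l) (trans (sym (readMSB-reverse (reverse bs))) (cong (readMSB 0) (reverse-involutive bs))) (length-reverse bs) (val<2^ (reverse bs))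

stripStep : List Bool → Bool → List Bool
stripStep acc b = if null acc ∧ not b then [] else b ∷ acc

strip-fold : ∀ bs → reverse (foldl stripStep [] bs) ≡ strip bs
strip-fold [] = refl
strip-fold (false ∷ bs) = strip-fold bs
strip-fold (true ∷ bs) = trans (kept bs true []) refl
  where
  kept : ∀ bs a acc → reverse (foldl stripStep (a ∷ acc) bs) ≡ (a ∷ acc) ʳ++ bs
  kept [] a acc = refl
  kept (b ∷ bs) a acc = kept bs b (a ∷ acc)

module _ {A : Set} ⦃ eA : Enc A ⦄ where
  stripₚ : {bs : A → List Bool} → PT bs → PT (λ a → strip (bs a))
  stripₚ {bs} p = respPT (λ a → strip-fold (bs a)) (reverseₚ (foldₚ {X = Bool} {E = ⊤} {B = List Bool} {f = λ z → stripStep (proj₂ (proj₂ z)) (proj₁ z)}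
    (ifPT (nullₚ (snd′ₚ sndPT) ∧ₚ notₚ fstPT) (constPT []) (fstPT ∷ₚ snd′ₚ sndPT)) p (constPT tt) (constPT []) (con 6) (λ x _ b → grow x b)))
    where
    grow : ∀ x b → size (stripStep b x) ≤ size b + 6
    grow false [] = m≤m+n 1 6
    grow true [] = ≤-refl
    grow x (c ∷ b) = ≤-trans (≤-reflexive (cong (λ z → suc (z + size (c ∷ b))) (size-Bool x false))) (≤-reflexive (+-comm 6 _))

-- The clamp has no effect on reachable remainders; it makes their size bounded for
-- arbitrary states.
divStep : ℕ → Bool → ℕ → ℕ × Bool
divStep d b r = if d ≤ᵇ r + r + bit b then (((r + r + bit b) ∸ d) ⊓ d , true) else ((r + r + bit b) ⊓ d , false)

divBits : ℕ → BitString → BitString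
divBits d y = proj₂ (mapAccum (divStep d) 0 y)

divStep-spec : ∀ d b r → r < d → let (r′ , q) = divStep d b r in d * bit q + r′ ≡ r + r + bit b × r′ < d
divStep-spec d b r r<d with d ≤ᵇ r + r + bit b in eq
... | true = trans (cong₂ _+_ (*-identityʳ d) clamp) (m+[n∸m]≡n le) , subst (_< d) (sym clamp) small-rem
  where
  le : d ≤ r + r + bit b
  le = ≤ᵇ⇒≤ d _ (subst T (sym eq) tt)
  bit≤1 : ∀ b → bit b ≤ 1
  bit≤1 true  = ≤-refl
  bit≤1 false = z≤n
  small-rem : r + r + bit b ∸ d < d
  small-rem = +-cancelˡ-< d _ d (≤-trans (s≤s (≤-trans (≤-reflexive (m+[n∸m]≡n le)) (+-monoʳ-≤ (r + r) (bit≤1 b))))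
    (≤-trans (≤-reflexive (ar r)) (+-mono-≤ r<d r<d)))
    where
    ar : ∀ r → suc (r + r + 1) ≡ suc r + suc r
    ar = solve-∀
  clamp : (r + r + bit b ∸ d) ⊓ d ≡ r + r + bit b ∸ d
  clamp = m≤n⇒m⊓n≡m (<⇒≤ small-rem)
... | false = trans (cong (_+ (r + r + bit b) ⊓ d) (*-zeroʳ d)) clamp , subst (_< d) (sym clamp) lt
  where
  lt : r + r + bit b < d
  lt = ≰⇒> (λ le → subst T eq (≤⇒≤ᵇ le))
  clamp : (r + r + bit b) ⊓ d ≡ r + r + bit b
  clamp = m≤n⇒m⊓n≡m (<⇒≤ lt)

-- The invariant of long division: quotient `acc` and remainder `r` so far stand for the prefix
-- `d * acc + r`, and every further bit preserves this.
divide-spec : ∀ d y acc r → r < d → let p = mapAccum (divStep d) r y in d * readMSB acc (proj₂ p) + proj₁ p ≡ readMSB (d * acc + r) y × proj₁ p < d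
divide-spec d [] acc r r<d = refl , r<d
divide-spec d (b ∷ y) acc r r<d = trans (proj₁ ih) (cong (λ z → readMSB z y) step-eq) , proj₂ ih
  where
  r′ : ℕ
  r′ = proj₁ (divStep d b r)
  q : Bool
  q = proj₂ (divStep d b r)
  ih = divide-spec d y (2 * acc + bit q) r′ (proj₂ (divStep-spec d b r r<d))
  step-eq : d * (2 * acc + bit q) + r′ ≡ 2 * (d * acc + r) + bit b
  step-eq = trans (ar₁ d acc (bit q) r′) (trans (cong (2 * (d * acc) +_) (proj₁ (divStep-spec d b r r<d))) (ar₂ (d * acc) r (bit b)))
    where
    ar₁ : ∀ d a q r → d * (2 * a + q) + r ≡ 2 * (d * a) + (d * q + r)
    ar₁ = solve-∀
    ar₂ : ∀ a r b → 2 * a + (r + r + b) ≡ 2 * (a + r) + b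
    ar₂ = solve-∀

-- The defining inequalities of the integer quotient; in this form successive divisions compose to
-- the division by the product.
Floor : ℕ → ℕ → ℕ → Set
Floor d m q = d * q ≤ m × m < d * suc q

floor-divBits : ∀ d y → 1 ≤ d → Floor d (readMSB 0 y) (readMSB 0 (divBits d y))
floor-divBits d y pos with divide-spec d y 0 0 pos
... | eq , r<d = ≤-trans (m≤m+n _ _) (≤-reflexive eq′) , ≤-trans (s≤s (≤-reflexive (sym eq′))) (≤-trans (≤-reflexive (sym (+-suc _ _)))
  (≤-trans (+-monoʳ-≤ (d * readMSB 0 (divBits d y)) r<d) (≤-reflexive (trans (+-comm _ d) (sym (*-suc d _))))))
  where
  eq′ : d * readMSB 0 (divBits d y) + proj₁ (mapAccum (divStep d) 0 y) ≡ readMSB 0 y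
  eq′ = trans eq (cong (λ z → readMSB z y) (trans (+-identityʳ (d * 0)) (*-zeroʳ d)))

floor-compose : ∀ d e m p q → Floor d m p → Floor e p q → Floor (d * e) m q
floor-compose d e m p q (l , u) (l′ , u′) = ≤-trans (≤-trans (≤-reflexive (*-assoc d e q)) (*-monoʳ-≤ d l′)) l ,
  ≤-trans u (≤-trans (*-monoʳ-≤ d u′) (≤-reflexive (sym (*-assoc d e (suc q)))))

-- The factorial is applied one factor at a time. It is too large to be written in unary, whereas
-- each of its factors and every remainder are small.
divSeq : ℕ → BitString → BitString
divSeq n y = foldl (λ z i → divBits (suc i) z) y (upFrom 0 n)

floor-divSeq : ∀ n y → Floor (n !) (readMSB 0 y) (readMSB 0 (divSeq n y))
floor-divSeq n y = go′ n 0 y 1 (≤-reflexive (*-identityˡ _) , ≤-reflexive (sym (*-identityˡ _))) refl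
  where
  go′ : ∀ k s z d → Floor d (readMSB 0 y) (readMSB 0 z) → d ≡ s ! → Floor ((s + k) !) (readMSB 0 y) (readMSB 0 (foldl (λ z i → divBits (suc i) z) z (upFrom s k)))
  go′ zero s z d fl refl = subst (λ k → Floor (k !) (readMSB 0 y) (readMSB 0 z)) (sym (+-identityʳ s)) fl
  go′ (suc k) s z d fl refl = subst (λ l → Floor (l !) (readMSB 0 y) (readMSB 0 (foldl (λ z i → divBits (suc i) z) (divBits (suc s) z) (upFrom (suc s) k)))) (sym (+-suc s k))
    (go′ k (suc s) (divBits (suc s) z) (s ! * suc s) (floor-compose (s !) (suc s) _ (readMSB 0 z) _ fl (floor-divBits (suc s) z (s≤s z≤n))) (*-comm (s !) (suc s)))

size-divBits : ∀ d y → size (divBits d y) ≡ size y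
size-divBits d y = trans (size-bits (divBits d y)) (trans (cong (λ l → 6 * l + 1) (length-mapAccum (divStep d) 0 y)) (sym (size-bits y)))

size-divSeq : ∀ n y → size (divSeq n y) ≡ size y
size-divSeq n y = go′ (upFrom 0 n) y
  where
  go′ : ∀ l z → size (foldl (λ z i → divBits (suc i) z) z l) ≡ size z
  go′ [] z = refl
  go′ (i ∷ l) z = trans (go′ l _) (size-divBits (suc i) z)

divStepₚ : PT {Bool × (ℕ × ℕ)} (λ z → divStep (proj₁ (proj₂ z)) (proj₁ z) (proj₂ (proj₂ z)))
divStepₚ = ifPT (≤ᵇₚ d twice) (⊓ₚ (twice ∸ₚ d) d ,ₚ constPT true) (⊓ₚ twice d ,ₚ constPT false)
  where
  I : Set
  I = Bool × (ℕ × ℕ)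
  d : PT {I} (λ z → proj₁ (proj₂ z))
  d = fst′ₚ sndPT
  r : PT {I} (λ z → proj₂ (proj₂ z))
  r = snd′ₚ sndPT
  twice : PT {I} (λ z → proj₂ (proj₂ z) + proj₂ (proj₂ z) + bit (proj₁ z))
  twice = r +ₚ r +ₚ bitₚ fstPT

size-divStep : ∀ b d r → size (divStep d b r) ≤ size r + (6 + (size b + size d))
size-divStep b d r with d ≤ᵇ r + r + bit b
... | true  = ≤-trans (s≤s (+-monoˡ-≤ 5 (size-mono (m⊓n≤n (r + r + bit b ∸ d) d)))) (≤-by (size b + size r) (ar (size d) (size b) (size r)))
  where
  ar : ∀ d b r → suc (d + 5) + (b + r) ≡ r + (6 + (b + d))
  ar = solve-∀
... | false = ≤-trans (s≤s (+-monoˡ-≤ 5 (size-mono (m⊓n≤n (r + r + bit b) d)))) (≤-by (size b + size r) (ar (size d) (size b) (size r)))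
  where
  ar : ∀ d b r → suc (d + 5) + (b + r) ≡ r + (6 + (b + d))
  ar = solve-∀

module _ {A : Set} ⦃ eA : Enc A ⦄ where
  divBitsₚ : {d : A → ℕ} {y : A → BitString} → PT d → PT y → PT (λ a → divBits (d a) (y a))
  divBitsₚ pd py = snd′ₚ (mapAccumₚ {S = ℕ} {X = Bool} {Y = Bool} {E = ℕ} divStepₚ (constPT 0) py pd (con 6 ⊕ var) (λ x e s → size-divStep x e s))

module _ {A : Set} ⦃ eA : Enc A ⦄ where
  divSeqₚ : {n : A → ℕ} {y : A → BitString} → PT n → PT y → PT (λ a → divSeq (n a) (y a))
  divSeqₚ pn py = foldₚ {X = ℕ} {E = ⊤} {B = BitString} {f = λ z → divBits (suc (proj₁ z)) (proj₂ (proj₂ z))} (divBitsₚ (sucₚ fstPT) (snd′ₚ sndPT)) (upFrom₀ₚ pn) (constPT tt) py (con 0)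
    (λ x _ b → ≤-trans (≤-reflexive (size-divBits (suc x) b)) (m≤m+n _ 0))

-- Bit strings for the numbers of a game

n<2^n : ∀ n → n < 2 ^ n
n<2^n zero    = s≤s z≤n
n<2^n (suc n) = ≤-trans (+-mono-≤ (m^n>0 2 n) (n<2^n n)) (≤-reflexive (cong (2 ^ n +_) (sym (+-identityʳ _))))

-- Numbers are kept with the least significant bit first and may be padded with zero bits, which
-- `decodeList` accepts; so blocks of fixed width can be used without normalisation.
encNum : List Bool → BitString
encNum bs = concatMap (λ b → b ∷ b ∷ []) (reverse bs) ++ false ∷ true ∷ []

iter-pairs : ∀ ms n cur res rest → iter (length ms + n) parseStep (true , (concatMap (λ b → b ∷ b ∷ []) ms ++ rest , (cur , res))) ≡
             iter n parseStep (true , (rest , (ms ʳ++ cur , res)))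
iter-pairs [] n cur res rest = refl
iter-pairs (true ∷ ms)  n cur res rest = iter-pairs ms n (true ∷ cur) res rest
iter-pairs (false ∷ ms) n cur res rest = iter-pairs ms n (false ∷ cur) res rest

iter-num : ∀ bs n res rest → iter (length bs + suc n) parseStep (true , (encNum bs ++ rest , ([] , res))) ≡ iter n parseStep (true , (rest , ([] , bs ∷ res)))
iter-num bs n res rest = begin
  iter (length bs + suc n) parseStep (true , (encNum bs ++ rest , ([] , res)))
    ≡⟨ cong₂ (λ k s → iter (k + suc n) parseStep (true , (s , ([] , res)))) (sym (length-reverse bs)) (++-assoc (concatMap (λ b → b ∷ b ∷ []) (reverse bs)) _ rest) ⟩
  iter (length (reverse bs) + suc n) parseStep (true , (concatMap (λ b → b ∷ b ∷ []) (reverse bs) ++ (false ∷ true ∷ rest) , ([] , res)))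
    ≡⟨ iter-pairs (reverse bs) (suc n) [] res (false ∷ true ∷ rest) ⟩
  iter n parseStep (true , (rest , ([] , (reverse bs ʳ++ []) ∷ res)))
    ≡⟨ cong (λ z → iter n parseStep (true , (rest , ([] , z ∷ res)))) (reverse-involutive bs) ⟩
  iter n parseStep (true , (rest , ([] , bs ∷ res))) ∎
  where open ≡-Reasoning

numSteps : List (List Bool) → ℕ
numSteps []       = 0
numSteps (bs ∷ L) = suc (length bs) + numSteps L

iter-nums : ∀ L n res → iter (numSteps L + n) parseStep (true , (concatMap encNum L , ([] , res))) ≡ iter n parseStep (true , ([] , ([] , L ʳ++ res)))
iter-nums [] n res = refl
iter-nums (bs ∷ L) n res = trans (cong (λ k → iter k parseStep (true , (encNum bs ++ concatMap encNum L , ([] , res)))) (ar (length bs) (numSteps L) n))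
  (trans (iter-num bs (numSteps L + n) res (concatMap encNum L)) (iter-nums L n (bs ∷ res)))
  where
  ar : ∀ l s n → suc l + s + n ≡ l + suc (s + n)
  ar = solve-∀

length-encNums : ∀ L → length (concatMap encNum L) ≡ numSteps L + numSteps L
length-encNums [] = refl
length-encNums (bs ∷ L) = trans (length-++ (encNum bs)) (trans (cong₂ _+_ (trans (length-++ (concatMap (λ b → b ∷ b ∷ []) (reverse bs))) (cong (_+ 2) (doubled (reverse bs)))) (length-encNums L))
  (trans (cong (λ z → z + z + 2 + (numSteps L + numSteps L)) (length-reverse bs)) (ar (length bs) (numSteps L))))
  where
  doubled : ∀ (ms : List Bool) → length (concatMap (λ b → b ∷ b ∷ []) ms) ≡ length ms + length ms
  doubled [] = refl
  doubled (b ∷ ms) = cong suc (trans (cong suc (doubled ms)) (sym (+-suc _ _)))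
  ar : ∀ l s → l + l + 2 + (s + s) ≡ suc l + s + (suc l + s)
  ar = solve-∀

parseList-encNums : ∀ L → parseList (concatMap encNum L) ≡ (true , reverse L)
parseList-encNums L = cong (λ r → proj₁ r ∧ null (proj₁ (proj₂ (proj₂ r))) , proj₂ (proj₂ (proj₂ r)))
  (trans (cong (λ n → iter n parseStep (true , (concatMap encNum L , ([] , [])))) (length-encNums L))
    (trans (iter-nums L (numSteps L) []) (iter-done (numSteps L) true ([] , L ʳ++ []))))

halve : ℕ → ℕ × Bool
halve zero    = 0 , false
halve (suc n) = if proj₂ (halve n) then (suc (proj₁ (halve n)) , false) else (proj₁ (halve n) , true)

halve-spec : ∀ n → 2 * proj₁ (halve n) + bit (proj₂ (halve n)) ≡ n
halve-spec zero = refl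
halve-spec (suc n) with halve n | halve-spec n
... | h , true  | eq = trans (ar h) (cong suc eq)
  where
  ar : ∀ h → 2 * suc h + 0 ≡ suc (2 * h + 1)
  ar = solve-∀
... | h , false | eq = trans (+-suc (2 * h) 0) (cong suc eq)

lsb : ℕ → ℕ → List Bool
lsb zero    x = []
lsb (suc b) x = proj₂ (halve x) ∷ lsb b (proj₁ (halve x))

length-lsb : ∀ b x → length (lsb b x) ≡ b
length-lsb zero x = refl
length-lsb (suc b) x = cong suc (length-lsb b _)

val-lsb : ∀ b x → x < 2 ^ b → val (lsb b x) ≡ x
val-lsb zero zero lt = refl
val-lsb zero (suc x) (s≤s ())
val-lsb (suc b) x lt = trans (cong (λ z → 2 * z + bit (proj₂ (halve x))) (val-lsb b (proj₁ (halve x))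
  (*-cancelˡ-< 2 (proj₁ (halve x)) (2 ^ b) (≤-trans (s≤s (≤-trans (m≤m+n _ _) (≤-reflexive (halve-spec x)))) lt)))) (halve-spec x)

val-++ : ∀ xs ys → val (xs ++ ys) ≡ val xs + 2 ^ length xs * val ys
val-++ [] ys = sym (+-identityʳ _)
val-++ (x ∷ xs) ys = trans (cong (λ z → 2 * z + bit x) (val-++ xs ys)) (ar (val xs) (2 ^ length xs) (val ys) (bit x))
  where
  ar : ∀ v p y b → 2 * (v + p * y) + b ≡ 2 * v + b + 2 * p * y
  ar = solve-∀

-- A player of weight 1 is pivotal only if exactly 1 is missing. The quota is odd and the coalition
-- even, so this happens for one weight, namely `2 * q`.
pivotal-double : ∀ q v → pivotal (1 + 2 * q ∸ 2 * v) 1 ≡ when (q ≡ᵇ v) 1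
pivotal-double zero zero = refl
pivotal-double zero (suc v) rewrite 0∸n≡0 (v + 1 * suc v) = refl
pivotal-double (suc q) zero = cong (λ z → pivotal z 1) (ar q)
  where
  ar : ∀ q → 1 + 2 * suc q ≡ suc (suc (suc (2 * q)))
  ar = solve-∀
pivotal-double (suc q) (suc v) = trans (cong₂ (λ a b → pivotal (a ∸ b) 1) (ar q) (*-suc 2 v)) (pivotal-double q v)
  where
  ar : ∀ q → 1 + 2 * suc q ≡ 2 + (1 + 2 * q)
  ar = solve-∀

module _ {A : Set} ⦃ eA : Enc A ⦄ where
  concatₚ : {bs : A → List (List Bool)} → PT bs → PT (λ a → concat (bs a))
  concatₚ {bs} p = respPT (λ a → cong concat (map-id (bs a))) (concatMapₚ {X = List Bool} {E = ⊤} {Y = Bool} {f = λ z → proj₁ z} fstPT p (constPT tt))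

  powₚ : {f : A → ℕ} → PT f → ∀ k → PT (λ a → f a ^ k)
  powₚ p zero    = constPT 1
  powₚ p (suc k) = p *ₚ powₚ p k

module _ {A : Set} ⦃ eA : Enc A ⦄ where
  encNumₚ : {bs : A → List Bool} → PT bs → PT (λ a → encNum (bs a))
  encNumₚ p = concatMapₚ {X = Bool} {E = ⊤} {Y = Bool} {f = λ z → proj₁ z ∷ proj₁ z ∷ []} (fstPT ∷ₚ (fstPT ∷ₚ constPT [])) (reverseₚ p) (constPT tt)
    ++ₚ constPT (false ∷ true ∷ [])

-- Bounds on path counts and the growth of factorials

length-acts : ∀ {n e} (p : Act n e → Bool) → length (acts p) ≤ n * ((3 + e) * 3)
length-acts {n} {e} p = ≤-trans (cm (actsQ p) ((3 + e) * 3) (λ q → ≤-trans (cm (actsS p q) 3 (λ s → cm (actsM p q s) 1 (λ m → atMost (p (q , s , m)) _) allMoves) (allFin (3 + e)))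
    (≤-reflexive (cong (_* 3) (len (3 + e))))) (allFin n)) (≤-reflexive (cong (_* ((3 + e) * 3)) (len n)))
  where
  len : ∀ n → length (allFin n) ≡ n
  len n = length-tabulate id
  cm : ∀ {A B : Set} (f : A → List B) k → (∀ x → length (f x) ≤ k) → ∀ xs → length (concatMap f xs) ≤ length xs * k
  cm f k h [] = z≤n
  cm f k h (x ∷ xs) = ≤-trans (≤-reflexive (length-++ (f x))) (+-mono-≤ (h x) (cm f k h xs))
  atMost : ∀ b (a : Act n e) → length (if b then a ∷ [] else []) ≤ 1
  atMost true  a = ≤-refl
  atMost false a = z≤n

module _ (N : NTM) where
  open NTM N using () renaming (nQ to nN; extra to ex)

  accPaths-≤ : ∀ t (c : NConfig N) → accPaths N t c ≤ (nN * ((3 + ex) * 3)) ^ t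
  accPaths-≤ t (nconf q tp) = bound t q tp
    where
    R : ℕ
    R = nN * ((3 + ex) * 3)
    R-pos : ∀ (q : Fin nN) → 1 ≤ R
    R-pos q = *-mono-≤ (≤-trans (s≤s z≤n) (Finₚ.toℕ<n q)) (s≤s z≤n)
    pow-pos : ∀ t (q : Fin nN) → 1 ≤ R ^ t
    pow-pos zero q = ≤-refl
    pow-pos (suc t) q = *-mono-≤ (R-pos q) (pow-pos t q)
    sum≤ : ∀ {A : Set} (f : A → ℕ) k → (∀ x → f x ≤ k) → ∀ xs → sum (map f xs) ≤ length xs * k
    sum≤ f k h [] = z≤n
    sum≤ f k h (x ∷ xs) = +-mono-≤ (h x) (sum≤ f k h xs)
    bound : ∀ t q tp → accPaths N t (nconf q tp) ≤ R ^ t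
    expand : ∀ t q tp → sum (map (accPaths N t) (nSucc N (nconf q tp))) ≤ R * R ^ t
    expand t q tp = ≤-trans (≤-reflexive (cong (λ l → sum (map (accPaths N t) l)) (nSucc-rules N q tp)))
      (≤-trans (sum≤ (accPaths N t) (R ^ t) (λ { (nconf q tp) → bound t q tp }) (map (moveTo N tp) (rules N q (headS tp))))
        (*-monoˡ-≤ (R ^ t) (≤-trans (≤-reflexive (length-map (moveTo N tp) (rules N q (headS tp)))) (length-acts {nN} {ex} (λ a → NTM.δ N q (headS tp) (proj₁ a) (proj₁ (proj₂ a)) (proj₂ (proj₂ a)))))))
    bound zero q tp with isAccept N (nconf q tp) | isReject N (nconf q tp)
    ... | true  | _     = ≤-refl
    ... | false | true  = z≤n
    ... | false | false = z≤n
    bound (suc t) q tp with isAccept N (nconf q tp) | isReject N (nconf q tp)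
    ... | true  | _     = pow-pos (suc t) q
    ... | false | true  = z≤n
    ... | false | false = expand t q tp

-- Each of the `b` new factors is at least `suc a`. This single estimate gives both the gap between
-- successive factors and the exponential lower bound on nonzero values.
!-grows : ∀ a b → a ! * suc a ^ b ≤ (a + b) !
!-grows a zero = ≤-reflexive (trans (*-identityʳ (a !)) (cong _! (sym (+-identityʳ a))))
!-grows a (suc b) = ≤-trans (≤-reflexive (ar (a !) (suc a) (suc a ^ b))) (≤-trans (*-mono-≤ (s≤s (m≤m+n a b)) (!-grows a b)) (≤-reflexive (cong _! (sym (+-suc a b)))))
  where
  ar : ∀ f a p → f * (a * p) ≡ a * (f * p)
  ar = solve-∀

!-mono : ∀ {m n} → m ≤ n → m ! ≤ n !
!-mono {m} {n} le = ≤-trans (≤-trans (≤-reflexive (sym (*-identityʳ (m !)))) (*-monoʳ-≤ (m !) (m^n>0 (suc m) (n ∸ m))))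
  (≤-trans (!-grows m (n ∸ m)) (≤-reflexive (cong _! (m+[n∸m]≡n le))))

!-pos : ∀ n → 1 ≤ n !
!-pos n = !-mono {0} {n} z≤n

anyBit-readMSB : ∀ acc bs → foldl _∨_ (not (isZero acc)) bs ≡ not (isZero (readMSB acc bs))
anyBit-readMSB acc [] = refl
anyBit-readMSB acc (b ∷ bs) = trans (cong (λ c → foldl _∨_ c bs) (shifted acc b)) (anyBit-readMSB (2 * acc + bit b) bs)
  where
  shifted : ∀ acc b → not (isZero acc) ∨ b ≡ not (isZero (2 * acc + bit b))
  shifted zero true  = refl
  shifted zero false = refl
  shifted (suc acc) b = refl

upFrom-++ : ∀ s j k → upFrom s (j + k) ≡ upFrom s j ++ upFrom (s + j) k
upFrom-++ s zero k = cong (λ z → upFrom z k) (sym (+-identityʳ s))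
upFrom-++ s (suc j) k = cong (s ∷_) (trans (upFrom-++ (suc s) j k) (cong (λ z → upFrom (suc s) j ++ upFrom z k) (sym (+-suc s j))))

floor-exact : ∀ d m h q → m ≡ d * h → Floor d m q → q ≡ h
floor-exact d m h q eq (le , lt) = ≤-antisym
  (s≤s⁻¹ (*-cancelˡ-< d q (suc h) (≤-<-trans le (≤-<-trans (≤-reflexive eq) (*-monoʳ-< d {{d≢0 d lt}} ≤-refl)))))
  (s≤s⁻¹ (*-cancelˡ-< d h (suc q) (≤-<-trans (≤-reflexive (sym eq)) lt)))
  where
  d≢0 : ∀ d → m < d * suc q → NonZero d
  d≢0 (suc d) lt = _

floor-zero : ∀ d m q → m < d → Floor d m q → q ≡ 0
floor-zero d m zero    lt _        = refl
floor-zero d m (suc q) lt (le , _) = ⊥-elim (<⇒≱ lt (≤-trans (≤-trans (m≤m+n d (d * q)) (≤-reflexive (sym (*-suc d q)))) le))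

-- The queue machine of a Turing machine

module Reduction (N : NTM) where
  open NTM N using () renaming (nQ to nN; extra to ex; start to startN; accept to acceptN; reject to rejectN)

  ns : ℕ
  ns = 3 + ex

  Head : Set
  Head = Fin ns × Fin nN

  Cl : Set
  Cl = Fin ns ⊎ Head

  -- The state of the queue machine holds the cell to be written next; after a move to
  -- the right it also remembers that the next cell gets the head.
  St : Set
  St = Cl ⊎ (Head ⊎ ⊤)

  pattern plain s  = inj₁ s
  pattern headC hd = inj₂ hd
  pattern buf c    = inj₁ c
  pattern pend hd  = inj₂ (inj₁ hd)
  pattern wipe     = inj₂ (inj₂ tt)

  -- The buffered cell `y` is the left neighbour of the head. Holding every letter back for one step
  -- is what makes a left move possible although the queue is traversed only to the right.
  afterRule : Fin ns → Act nN ex → Cl × St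
  afterRule y (q′ , s′ , mL) = headC (y , q′) , buf (plain s′)
  afterRule y (q′ , s′ , mS) = plain y , buf (headC (s′ , q′))
  afterRule y (q′ , s′ , mR) = plain y , pend (s′ , q′)

  -- Acceptance starts to blank the queue, deterministically and for all steps that remain; so each
  -- accepting path gives one run, and all of these have the same length and end. Rejection offers
  -- no transition and ends the run without a count.
  headTrans : Fin ns → Fin ns → Fin nN → Bool → Bool → List (Cl × St)
  headTrans y s q true  _     = (plain zero , wipe) ∷ []
  headTrans y s q false true  = []
  headTrans y s q false false = map (afterRule y) (rules N q s)

  qtrans : St → Cl → List (Cl × St)
  qtrans wipe            a                = (plain zero , wipe) ∷ []
  qtrans (pend (s , q))  (plain x)        = (plain s , buf (headC (x , q))) ∷ []
  qtrans (pend _)        (headC _)        = []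
  qtrans (buf y)         (plain x)        = (y , buf (plain x)) ∷ []
  qtrans (buf (headC _)) (headC _)        = []
  qtrans (buf (plain y)) (headC (s , q))  = headTrans y s q (does (q Fin.≟ acceptN)) (does (q Fin.≟ rejectN))

  module Runs (final : St → List Cl → Bool) where
    qruns : ℕ → St → List Cl → ℕ
    qruns zero    σ q       = when (final σ q) 1
    qruns (suc m) σ []      = 0
    qruns (suc m) σ (a ∷ q) = sum (map (λ p → qruns m (proj₂ p) (q ++ proj₁ p ∷ [])) (qtrans σ a))

    lastOf : Fin ns → List (Fin ns) → Fin ns
    lastOf y []      = y
    lastOf y (x ∷ u) = lastOf x u

    initOf : Fin ns → List (Fin ns) → List (Fin ns)
    initOf y []      = []
    initOf y (x ∷ u) = y ∷ initOf x u

    init-last : ∀ y u → initOf y u ++ lastOf y u ∷ [] ≡ y ∷ u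
    init-last y []      = refl
    init-last y (x ∷ u) = cong (y ∷_) (init-last x u)

    length-init : ∀ y u → length (initOf y u) ≡ length u
    length-init y [] = refl
    length-init y (x ∷ u) = cong suc (length-init x u)

    one-succ : ∀ m p a σ q → qtrans σ a ≡ p ∷ [] → qruns (suc m) σ (a ∷ q) ≡ qruns m (proj₂ p) (q ++ proj₁ p ∷ [])
    one-succ m p a σ q eq rewrite eq = +-identityʳ _

    copy : ∀ u y rest m → qruns (length u + m) (buf (plain y)) (map plain u ++ rest) ≡ qruns m (buf (plain (lastOf y u))) (rest ++ map plain (initOf y u))
    copy [] y rest m = cong (qruns m (buf (plain y))) (sym (++-identityʳ rest))
    copy (x ∷ u) y rest m = trans (one-succ (length u + m) (plain y , buf (plain x)) (plain x) (buf (plain y)) (map plain u ++ rest) refl)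
      (trans (cong (qruns (length u + m) (buf (plain x))) (++-assoc (map plain u) rest _))
      (trans (copy u x (rest ++ plain y ∷ []) m) (cong (qruns m (buf (plain (lastOf x u)))) (++-assoc rest (plain y ∷ []) _))))

    -- The normal form before a step of the machine: the head is at the front of the queue, and its
    -- left neighbour on the cycle is in the buffer instead of at the rear.
    launch : ℕ → Fin nN → Fin ns → Fin ns → List (Fin ns) → ℕ
    launch m q h z Z = qruns m (buf (plain (lastOf z Z))) (headC (h , q) ∷ map plain (initOf z Z))

    turn : ∀ m h q x W → qruns (suc (length W + m)) (buf (headC (h , q))) (map plain (x ∷ W)) ≡ launch m q h x W
    turn m h q x W = trans (one-succ (length W + m) (headC (h , q) , buf (plain x)) (plain x) (buf (headC (h , q))) (map plain W) refl)
      (copy W x (headC (h , q) ∷ []) m)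

    module Simulate (P′ : ℕ) (final-wipe : final wipe (replicate (suc P′) (plain zero)) ≡ true) where
      P : ℕ
      P = suc P′

      wiping : ∀ m k q → length q + k ≡ P → length q ≤ m → qruns m wipe (q ++ replicate k (plain zero)) ≡ 1
      wiping zero k [] eq le rewrite eq = cong (λ b → when b 1) final-wipe
      wiping (suc m) (suc k) [] eq le = trans (one-succ m (plain zero , wipe) (plain zero) wipe (replicate k (plain zero)) refl)
        (trans (cong (qruns m wipe) (replicate-snoc k (plain zero))) (wiping m (suc k) [] eq z≤n))
      wiping (suc m) k (a ∷ q) eq (s≤s le) = trans (one-succ m (plain zero , wipe) a wipe (q ++ replicate k (plain zero)) refl)
        (trans (cong (qruns m wipe) (trans (++-assoc q _ _) (cong (q ++_) (replicate-snoc k (plain zero))))) (wiping m (suc k) q (trans (+-suc _ k) eq) le))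

      take-steps : ∀ k b m → k + b ≤ m → ∃ λ m′ → m ≡ k + m′ × b ≤ m′
      take-steps k b m le = m ∸ k , sym (m+[n∸m]≡n (≤-trans (m≤m+n k b) le)) , ≤-trans (≤-reflexive (sym (m+n∸m≡n k b))) (∸-monoˡ-≤ k le)

      -- A move to the right is the slowest one and takes `P + 2` queue steps; the final `P + 1` pay
      -- for recognising acceptance and blanking the queue.
      budget : ℕ → ℕ
      budget t = t * (P + 2) + (P + 1)

      -- Behind the head the cycle consists of the right part of the tape, a gap of `g` blanks and
      -- the left part. A step uses up at most one blank of the gap, so `t ≤ g` keeps the two ends
      -- apart. The queue length is arbitrary time-invariant data, as the head only rotates it.
      Simulates : ℕ → NConfig N → Set
      Simulates t (nconf q (tape l h r)) = ∀ g z Z m → z ∷ Z ≡ r ++ replicate g zero ++ reverse l → t ≤ g → length Z ≡ P′ →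
        budget t ≤ m → launch m q h z Z ≡ accPaths N t (nconf q (tape l h r))

      stepped : ∀ t l h r → ((c : NConfig N) → haltsWithin N t c ≡ true → Simulates t c) →
        ∀ g z Z m → z ∷ Z ≡ r ++ replicate g zero ++ reverse l → suc t ≤ g → length Z ≡ P′ → budget (suc t) ≤ suc m →
        ∀ a → haltsWithin N t (moveTo N (tape l h r) a) ≡ true →
        qruns m (proj₂ (afterRule (lastOf z Z) a)) (map plain (initOf z Z) ++ proj₁ (afterRule (lastOf z Z) a) ∷ []) ≡ accPaths N t (moveTo N (tape l h r) a)
      stepped t l h r ih g z Z m ring t<g len enough (q′ , s′ , mL) hs with take-steps P′ (budget t) m
        (≤-trans (≤-by 2 (ar (t * (P + 2)) P′)) (≤-trans (≤-reflexive refl) (s≤s⁻¹ enough)))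
        where
        ar : ∀ t P′ → P′ + (t + (suc P′ + 1)) + 2 ≡ P′ + 2 + t + (suc P′ + 1)
        ar = solve-∀
      ... | m′ , refl , b≤ = trans (cong (λ k → qruns (k + m′) (buf (plain s′)) (map plain (initOf z Z) ++ headC (lastOf z Z , q′) ∷ [])) (sym (trans (length-init z Z) len)))
        (trans (copy (initOf z Z) s′ (headC (lastOf z Z , q′) ∷ []) m′) (moved g l t<g hs ring))
        where
        moved : ∀ g l → suc t ≤ g → haltsWithin N t (moveTo N (tape l h r) (q′ , s′ , mL)) ≡ true → z ∷ Z ≡ r ++ replicate g zero ++ reverse l →
                launch m′ q′ (lastOf z Z) s′ (initOf z Z) ≡ accPaths N t (moveTo N (tape l h r) (q′ , s′ , mL))
        -- At the left end the last blank of the gap becomes the scanned cell; in exchange the gap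
        -- shrinks by one.
        moved (suc g′) [] (s≤s t≤g′) hs ring with ∷ʳ-injective (initOf z Z) (r ++ replicate g′ zero)
              (trans (init-last z Z) (trans ring (trans (cong (r ++_) (trans (++-identityʳ _) (sym (replicate-snoc g′ zero)))) (sym (++-assoc r _ _)))))
        ...   | eu , ey = trans (cong (λ y → launch m′ q′ y s′ (initOf z Z)) ey)
          (ih (nconf q′ (tape [] zero (s′ ∷ r))) hs g′ s′ (initOf z Z) m′ (cong (s′ ∷_) (trans eu (cong (r ++_) (sym (++-identityʳ _))))) t≤g′ (trans (length-init z Z) len) b≤)
        moved g (a ∷ l) t<g hs ring with ∷ʳ-injective (initOf z Z) (r ++ replicate g zero ++ reverse l)
              (trans (init-last z Z) (trans ring (trans (cong (λ w → r ++ replicate g zero ++ w) (unfold-reverse a l))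
                (trans (cong (r ++_) (sym (++-assoc (replicate g zero) _ _))) (sym (++-assoc r _ _))))))
        ...   | eu , ey = trans (cong (λ y → launch m′ q′ y s′ (initOf z Z)) ey)
          (ih (nconf q′ (tape l a (s′ ∷ r))) hs g s′ (initOf z Z) m′ (cong (s′ ∷_) eu) (<⇒≤ t<g) (trans (length-init z Z) len) b≤)
      stepped t l h r ih g z Z m ring t<g len enough (q′ , s′ , mS) hs with take-steps (suc P′) (budget t) m
        (≤-trans (≤-by 1 (ar (t * (P + 2)) P′)) (s≤s⁻¹ enough))
        where
        ar : ∀ t P′ → suc P′ + (t + (suc P′ + 1)) + 1 ≡ P′ + 2 + t + (suc P′ + 1)
        ar = solve-∀
      ... | m′ , refl , b≤ = trans (cong₂ (λ k w → qruns (suc (k + m′)) (buf (headC (s′ , q′))) w) (sym len)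
          (trans (sym (map-++ plain (initOf z Z) _)) (cong (map plain) (init-last z Z))))
        (trans (turn m′ s′ q′ z Z) (ih (nconf q′ (tape l s′ r)) hs g z Z m′ ring (<⇒≤ t<g) len b≤))
      stepped t l h r ih g z Z m ring t<g len enough (q′ , s′ , mR) hs with take-steps (suc (suc P′)) (budget t) m
        (≤-trans (≤-reflexive (ar (t * (P + 2)) P′)) (s≤s⁻¹ enough))
        where
        ar : ∀ t P′ → suc (suc P′) + (t + (suc P′ + 1)) ≡ P′ + 2 + t + (suc P′ + 1)
        ar = solve-∀
      ... | m′ , refl , b≤ = trans (cong (qruns (suc (suc P′) + m′) (pend (s′ , q′))) (trans (sym (map-++ plain (initOf z Z) _)) (cong (map plain) (init-last z Z))))
        (trans (one-succ (suc P′ + m′) (plain s′ , buf (headC (z , q′))) (plain z) (pend (s′ , q′)) (map plain Z) refl)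
        (trans (cong (qruns (suc (P′ + m′)) (buf (headC (z , q′)))) (sym (map-++ plain Z _))) (onward Z len (moved g r t<g hs ring))))
        where
        moved : ∀ g r → suc t ≤ g → haltsWithin N t (moveTo N (tape l h r) (q′ , s′ , mR)) ≡ true → z ∷ Z ≡ r ++ replicate g zero ++ reverse l →
                ∀ x W → x ∷ W ≡ Z ++ s′ ∷ [] → length W ≡ P′ → launch m′ q′ z x W ≡ accPaths N t (moveTo N (tape l h r) (q′ , s′ , mR))
        -- At the right end the first blank of the gap becomes the scanned cell.
        moved (suc g′) [] (s≤s t≤g′) hs ring x W eq lenW = trans (cong (λ y → launch m′ q′ y x W) (∷-injectiveˡ ring))
          (ih (nconf q′ (tape (s′ ∷ l) zero [])) hs g′ x W m′ (trans eq (trans (cong (_++ s′ ∷ []) (∷-injectiveʳ ring)) (trans (++-assoc (replicate g′ zero) _ _) (cong (replicate g′ zero ++_) (sym (unfold-reverse s′ l)))))) t≤g′ lenW b≤)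
        moved g (a ∷ r) t<g hs ring x W eq lenW = trans (cong (λ y → launch m′ q′ y x W) (∷-injectiveˡ ring))
          (ih (nconf q′ (tape (s′ ∷ l) a r)) hs g x W m′ (trans eq (trans (cong (_++ s′ ∷ []) (∷-injectiveʳ ring)) (trans (++-assoc r _ _) (cong (r ++_) (trans (++-assoc (replicate g zero) _ _) (cong (replicate g zero ++_) (sym (unfold-reverse s′ l)))))))) (<⇒≤ t<g) lenW b≤)
        onward : ∀ Z → length Z ≡ P′ → (∀ x W → x ∷ W ≡ Z ++ s′ ∷ [] → length W ≡ P′ → launch m′ q′ z x W ≡ accPaths N t (moveTo N (tape l h r) (q′ , s′ , mR))) →
          qruns (suc (P′ + m′)) (buf (headC (z , q′))) (map plain (Z ++ s′ ∷ [])) ≡ accPaths N t (moveTo N (tape l h r) (q′ , s′ , mR))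
        onward [] refl k = trans (turn m′ z q′ s′ []) (k s′ [] refl refl)
        onward (x ∷ Z) refl k = trans (cong (λ n → qruns (suc (n + m′)) (buf (headC (z , q′))) (map plain (x ∷ Z ++ s′ ∷ []))) (sym lenW))
          (trans (turn m′ z q′ x (Z ++ s′ ∷ [])) (k x (Z ++ s′ ∷ []) refl lenW))
          where
          lenW : length (Z ++ s′ ∷ []) ≡ suc (length Z)
          lenW = trans (length-++ Z) (+-comm (length Z) 1)

      halts-succ : ∀ t q tp → haltsWithin N (suc t) (nconf q tp) ≡ true → isAccept N (nconf q tp) ≡ false → isReject N (nconf q tp) ≡ false →
                   All (λ a → haltsWithin N t (moveTo N tp a) ≡ true) (rules N q (headS tp))
      halts-succ t q tp hs na nr rewrite na | nr | nSucc-rules N q tp = collect (rules N q (headS tp)) hs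
        where
        every : ∀ as → allB N (haltsWithin N t) (map (moveTo N tp) as) ≡ true → All (λ a → haltsWithin N t (moveTo N tp a) ≡ true) as
        every [] h = []
        every (a ∷ as) h with haltsWithin N t (moveTo N tp a) in eq
        ... | true = eq ∷ every as h
        collect : ∀ as → null (map (moveTo N tp) as) ∨ allB N (haltsWithin N t) (map (moveTo N tp) as) ≡ true → All (λ a → haltsWithin N t (moveTo N tp a) ≡ true) as
        collect [] h = []
        collect (a ∷ as) h = every (a ∷ as) h

      no-rules : ∀ q tp → haltsWithin N 0 (nconf q tp) ≡ true → isAccept N (nconf q tp) ≡ false → isReject N (nconf q tp) ≡ false → rules N q (headS tp) ≡ []
      no-rules q tp hs na nr rewrite na | nr | nSucc-rules N q tp with rules N q (headS tp)
      ... | [] = refl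

      accPaths-accept : ∀ t c → isAccept N c ≡ true → accPaths N t c ≡ 1
      accPaths-accept zero c eq rewrite eq = refl
      accPaths-accept (suc t) c eq rewrite eq = refl

      accPaths-reject : ∀ t c → isAccept N c ≡ false → isReject N c ≡ true → accPaths N t c ≡ 0
      accPaths-reject zero c eq eq′ rewrite eq | eq′ = refl
      accPaths-reject (suc t) c eq eq′ rewrite eq | eq′ = refl

      accPaths-zero : ∀ c → isAccept N c ≡ false → isReject N c ≡ false → accPaths N 0 c ≡ 0
      accPaths-zero c eq eq′ rewrite eq | eq′ = refl

      accepts : ∀ t q l h r z Z m → length Z ≡ P′ → budget t ≤ suc m → isAccept N (nconf q (tape l h r)) ≡ true →
                launch (suc m) q h z Z ≡ accPaths N t (nconf q (tape l h r))
      accepts t q l h r z Z m len enough acc = trans (cong (λ b → sum (map cont (headTrans (lastOf z Z) h q b (does (q Fin.≟ rejectN))))) acc)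
        (trans (+-identityʳ _) (trans (wiping m 1 (map plain (initOf z Z)) (trans (+-comm _ 1) (cong suc len′)) (≤-trans (≤-reflexive len′) P′≤)) (sym (accPaths-accept t (nconf q (tape l h r)) acc))))
        where
        cont : Cl × St → ℕ
        cont p = qruns m (proj₂ p) (map plain (initOf z Z) ++ proj₁ p ∷ [])
        len′ : length (map plain (initOf z Z)) ≡ P′
        len′ = trans (length-map plain (initOf z Z)) (trans (length-init z Z) len)
        P′≤ : P′ ≤ m
        P′≤ = ≤-trans (m≤m+n P′ 1) (s≤s⁻¹ (≤-trans (m≤n+m (P + 1) (t * (P + 2))) enough))

      simulate : ∀ t c → haltsWithin N t c ≡ true → Simulates t c
      simulate t (nconf q (tape l h r)) hs g z Z zero ring t≤g len enough = ⊥-elim (<⇒≱ (≤-trans (s≤s z≤n) (m≤n+m (P + 1) (t * (P + 2)))) enough)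
      simulate t (nconf q (tape l h r)) hs g z Z (suc m) ring t≤g len enough = byState _ _ refl refl
        where
        c : NConfig N
        c = nconf q (tape l h r)
        y : Fin ns
        y = lastOf z Z
        cont : Cl × St → ℕ
        cont p = qruns m (proj₂ p) (map plain (initOf z Z) ++ proj₁ p ∷ [])
        onRules : ∀ t → haltsWithin N t c ≡ true → t ≤ g → budget t ≤ suc m → isAccept N c ≡ false → isReject N c ≡ false →
                  sum (map cont (map (afterRule y) (rules N q h))) ≡ accPaths N t c
        -- With no time left, halting in a state that is neither accepting nor rejecting means being
        -- stuck: there are no tiles, and both counts vanish.
        onRules zero hs t≤g enough na nr = trans (cong (λ as → sum (map cont (map (afterRule y) as))) (no-rules q (tape l h r) hs na nr)) (sym (accPaths-zero c na nr))
        onRules (suc t) hs t≤g enough na nr = trans (pointwise (halts-succ t q (tape l h r) hs na nr)) (sym (accPaths-suc N t q (tape l h r) na nr))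
          where
          pointwise : ∀ {as} → All (λ a → haltsWithin N t (moveTo N (tape l h r) a) ≡ true) as →
                      sum (map cont (map (afterRule y) as)) ≡ sum (map (accPaths N t) (map (moveTo N (tape l h r)) as))
          pointwise [] = refl
          pointwise {a ∷ as} (p ∷ ps) = cong₂ _+_ (stepped t l h r (simulate t) g z Z m ring t≤g len enough a p) (pointwise ps)
        byState : ∀ b b′ → isAccept N c ≡ b → isReject N c ≡ b′ → launch (suc m) q h z Z ≡ accPaths N t c
        byState true b′ acc rej = accepts t q l h r z Z m len enough acc
        byState false true acc rej = trans (cong₂ (λ b b′ → sum (map cont (headTrans y h q b b′))) acc rej) (sym (accPaths-reject t c acc rej))
        byState false false acc rej = trans (cong₂ (λ b b′ → sum (map cont (headTrans y h q b b′))) acc rej) (onRules t hs t≤g enough acc rej)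

  -- Numbering of letters and states, and the tiles

  nC nS : ℕ
  nC = ns + ns * nN
  nS = nC + (ns * nN + 1)

  codeHead : Head → Fin (ns * nN)
  codeHead (s , q) = combine s q

  decodeHead : Fin (ns * nN) → Head
  decodeHead = remQuot nN

  -- Plain cells come first, so the blank has number 0. An all-blank queue then has value 0, and the
  -- final configuration is described by its state alone.
  codeCl : Cl → Fin nC
  codeCl = enc⊎ id codeHead

  decodeCl : Fin nC → Cl
  decodeCl = dec⊎ id decodeHead

  decode-codeHead : ∀ hd → decodeHead (codeHead hd) ≡ hd
  decode-codeHead (s , q) = Finₚ.remQuot-combine s q

  decode-codeCl : ∀ a → decodeCl (codeCl a) ≡ a
  decode-codeCl = dec-enc⊎ id codeHead id decodeHead (λ _ → refl) decode-codeHead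

  codeSt : St → Fin nS
  codeSt = enc⊎ codeCl (enc⊎ codeHead (λ _ → zero {0}))

  decodeSt : Fin nS → St
  decodeSt = dec⊎ decodeCl (dec⊎ decodeHead (λ _ → tt))

  decode-codeSt : ∀ σ → decodeSt (codeSt σ) ≡ σ
  decode-codeSt = dec-enc⊎ codeCl _ decodeCl _ decode-codeCl (dec-enc⊎ codeHead (λ _ → zero {0}) decodeHead (λ _ → tt) decode-codeHead (λ _ → refl))

  cellNo : Cl → ℕ
  cellNo a = Fin.toℕ (codeCl a)

  -- A multiple of `nC`, so that adding the number of the front letter loses no information: the sum
  -- determines state and letter.
  stateNo : St → ℕ
  stateNo σ = nC * Fin.toℕ (codeSt σ)

  Tile : Set
  Tile = Fin nS × (Fin nC × (Cl × St))

  tilesAt : Fin nS → Fin nC → List Tile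
  tilesAt i j = map (λ p → i , (j , p)) (qtrans (decodeSt i) (decodeCl j))

  tilesOf : Fin nS → List Tile
  tilesOf i = concatMap (tilesAt i) (allFin nC)

  tiles : List Tile
  tiles = concatMap tilesOf (allFin nS)

  key nextNo outNo : Tile → ℕ
  key (i , (j , _)) = nC * Fin.toℕ i + Fin.toℕ j
  nextNo (_ , (_ , (b , σ))) = stateNo σ
  outNo (_ , (_ , (b , σ))) = cellNo b

  κ : ℕ
  κ = nC * nS

  key-bound : ∀ (i : Fin nS) (j : Fin nC) → nC * Fin.toℕ i + Fin.toℕ j ≤ κ
  key-bound i j = ≤-trans (+-monoʳ-≤ (nC * Fin.toℕ i) (<⇒≤ (Finₚ.toℕ<n j)))
    (≤-trans (≤-reflexive (trans (+-comm (nC * Fin.toℕ i) nC) (sym (*-suc nC (Fin.toℕ i))))) (*-monoʳ-≤ nC (Finₚ.toℕ<n i)))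

  state-bound : ∀ σ → stateNo σ ≤ κ
  state-bound σ = ≤-trans (m≤m+n _ _) (key-bound (codeSt σ) zero)

  cell-bound : ∀ a → cellNo a ≤ κ
  cell-bound a = ≤-trans (m≤n+m _ (nC * Fin.toℕ (codeSt (wipe)))) (key-bound (codeSt wipe) (codeCl a))

  key-≡ᵇ : ∀ (i i′ : Fin nS) (j j′ : Fin nC) x → when (nC * Fin.toℕ i + Fin.toℕ j ≡ᵇ nC * Fin.toℕ i′ + Fin.toℕ j′) x ≡
           when (does (i Fin.≟ i′)) (when (does (j Fin.≟ j′)) x)
  key-≡ᵇ i i′ j j′ x with i Fin.≟ i′ | j Fin.≟ j′
  ... | yes refl | yes refl rewrite ≡ᵇ-≡ {nC * Fin.toℕ i + Fin.toℕ j} refl = refl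
  ... | yes refl | no ne = cong (λ b → when b x) (≡ᵇ-≢ (λ eq → ne (Finₚ.toℕ-injective (+-cancelˡ-≡ (nC * Fin.toℕ i) _ _ eq))))
  ... | no ne | _ = cong (λ b → when b x) (≡ᵇ-≢ (λ eq → ne (Finₚ.toℕ-injective (proj₂ (digit-unique nC (Fin.toℕ j) (Fin.toℕ j′) (Fin.toℕ i) (Fin.toℕ i′)
    (Finₚ.toℕ<n j) (Finₚ.toℕ<n j′) (trans (+-comm (Fin.toℕ j) _) (trans eq (+-comm _ (Fin.toℕ j′)))))))))

  -- The key determines state and letter, so the condition picks from all tiles exactly the
  -- transitions available in this situation, with their multiplicities.
  sum-tiles : ∀ (F : Cl × St → ℕ) σ a → sum (map (λ τ → when (key τ ≡ᵇ stateNo σ + cellNo a) (F (proj₂ (proj₂ τ)))) tiles) ≡ sum (map F (qtrans σ a))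
  sum-tiles F σ a = begin
    sum (map f tiles)                                                             ≡⟨ sum-concatMap f tilesOf (allFin nS) ⟩
    sum (map (λ i → sum (map f (tilesOf i))) (allFin nS))                         ≡⟨ sum-cong inner (allFin nS) ⟩
    sum (map (λ i → when (does (i Fin.≟ codeSt σ)) (S i (codeCl a))) (allFin nS)) ≡⟨ sum-allFin (codeSt σ) (λ i → S i (codeCl a)) ⟩
    S (codeSt σ) (codeCl a)                                                       ≡⟨ cong₂ (λ u w → sum (map F (qtrans u w))) (decode-codeSt σ) (decode-codeCl a) ⟩
    sum (map F (qtrans σ a))                                                      ∎
    where
    open ≡-Reasoning
    f : Tile → ℕ
    f τ = when (key τ ≡ᵇ stateNo σ + cellNo a) (F (proj₂ (proj₂ τ)))
    S : Fin nS → Fin nC → ℕ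
    S i j = sum (map F (qtrans (decodeSt i) (decodeCl j)))
    at-ij : ∀ i j → sum (map f (tilesAt i j)) ≡ when (does (i Fin.≟ codeSt σ)) (when (does (j Fin.≟ codeCl a)) (S i j))
    at-ij i j = trans (cong sum (sym (map-∘ (qtrans (decodeSt i) (decodeCl j)))))
      (trans (sum-when (nC * Fin.toℕ i + Fin.toℕ j ≡ᵇ stateNo σ + cellNo a) F (qtrans (decodeSt i) (decodeCl j))) (key-≡ᵇ i (codeSt σ) j (codeCl a) (S i j)))
    inner : ∀ i → sum (map f (tilesOf i)) ≡ when (does (i Fin.≟ codeSt σ)) (S i (codeCl a))
    inner i = trans (sum-concatMap f (tilesAt i) (allFin nC)) (trans (sum-cong (at-ij i) (allFin nC))
      (trans (sum-when (does (i Fin.≟ codeSt σ)) (λ j → when (does (j Fin.≟ codeCl a)) (S i j)) (allFin nC))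
        (cong (when (does (i Fin.≟ codeSt σ))) (sum-allFin (codeCl a) (S i)))))

  D₀ : ℕ
  D₀ = suc (κ + κ)

  -- The width depends on the machine alone and is thus a constant of the reduction; all that
  -- matters about it is the two lower bounds, which exclude carries.
  abstract
    β : ℕ
    β = κ + length tiles * D₀ + D₀

    β-tiles : κ + length tiles * D₀ ≤ β
    β-tiles = m≤m+n (κ + length tiles * D₀) D₀

    β-digit : D₀ ≤ β
    β-digit = m≤n+m D₀ (κ + length tiles * D₀)

  -- A power of two, so that digits are blocks of `β` bits: weights and quota are written by
  -- concatenation, and the reduction performs no arithmetic on large numbers.
  B : ℕ
  B = 2 ^ β

  D₀<B : D₀ < B
  D₀<B = ≤-trans (s≤s β-digit) (n<2^n β)

  Tf : ℕ
  Tf = stateNo wipe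

  all-keys : All (λ τ → key τ ≤ κ) tiles
  all-keys = universal (λ { (i , (j , _)) → key-bound i j }) tiles

  module Len (P″ : ℕ) where
    P′ : ℕ
    P′ = suc P″

    open Tiles key nextNo outNo tiles κ B P′ all-keys (≤-trans (s≤s β-tiles) (n<2^n β)) D₀<B Tf public

    -- Comparing numbers is a safe test of acceptance, because from the initial configuration only
    -- blanked queues reach it: on a machine that halts in time all other runs have died before.
    final : St → List Cl → Bool
    final σ q = stateNo σ + queueVal (map cellNo q) ≡ᵇ Tf

    open Runs final public

    blanks-value : ∀ n → queueVal (map cellNo (replicate n (plain zero))) ≡ 0
    blanks-value zero    = refl
    blanks-value (suc n) = trans (cong (B *_) (blanks-value n)) (*-zeroʳ B)

    open Simulate P′ (≡ᵇ-≡ (trans (cong (stateNo wipe +_) (blanks-value (suc P′))) (+-identityʳ _))) public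

    runsTo-qruns : ∀ m σ q → runsTo m (stateNo σ) (map cellNo q) ≡ qruns m σ q
    runsTo-qruns zero σ q = refl
    runsTo-qruns (suc m) σ [] = refl
    runsTo-qruns (suc m) σ (a ∷ q) = trans (sum-cong (λ τ → cong (when (key τ ≡ᵇ stateNo σ + cellNo a)) (next τ)) tiles)
      (sum-tiles (λ p → qruns m (proj₂ p) (q ++ proj₁ p ∷ [])) σ a)
      where
      next : ∀ τ → runsTo m (nextNo τ) (map cellNo q ++ outNo τ ∷ []) ≡ qruns m (proj₂ (proj₂ (proj₂ τ))) (q ++ proj₁ (proj₂ (proj₂ τ)) ∷ [])
      next (_ , (_ , (b , σ′))) = trans (cong (runsTo m (stateNo σ′)) (sym (map-++ cellNo q (b ∷ [])))) (runsTo-qruns m σ′ (q ++ b ∷ []))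

    Coded : ℕ → List ℕ → Set
    Coded s q = Σ St λ σ → Σ (List Cl) λ c → s ≡ stateNo σ × q ≡ map cellNo c

    coded-key : ∀ {s a q} → Coded s (a ∷ q) → s + a ≤ κ
    coded-key (σ , (c ∷ _) , refl , refl) = key-bound (codeSt σ) (codeCl c)

    coded-step : ∀ {s a q} → Coded s (a ∷ q) → All (λ τ → Coded (nextNo τ) (q ++ outNo τ ∷ [])) tiles
    coded-step (σ , (_ ∷ c) , refl , refl) = universal (λ { (_ , (_ , (b , σ′))) → σ′ , c ++ b ∷ [] , refl , sym (map-++ cellNo c (b ∷ [])) }) tiles

    subsum-qruns : ∀ m σ q (g : ℕ → ℕ) → length q ≡ suc P′ →
      subsum (items m) (λ k v → when (stateNo σ + queueVal (map cellNo q) + v ≡ᵇ target m Tf) (g k)) ≡ g m * qruns m σ q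
    subsum-qruns m σ q g len = trans (subsum-items Coded coded-key coded-step m (stateNo σ) (map cellNo q) g (trans (length-map cellNo q) len) (σ , q , refl , refl))
      (cong (g m *_) (runsTo-qruns m σ q))

  block : ℕ → List Bool
  block = lsb β

  weightBlocks : Tile → ℕ → ℕ → List (List Bool)
  weightBlocks τ P″ j = replicate j (block 0) ++ (block (D₀ ∸ key τ) ∷ (block (nextNo τ) ∷ (replicate P″ (block 0) ++ (block (outNo τ) ∷ []))))

  weightBits : Tile → ℕ → ℕ → List Bool
  weightBits τ P″ j = false ∷ concat (weightBlocks τ P″ j)

  headSym : BitString → Sym (NTM.extra N)
  headSym []      = zero
  headSym (b ∷ _) = bitSym b

  frontNo : BitString → ℕ
  frontNo x = stateNo (buf (plain zero)) + cellNo (headC (headSym x , startN))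

  bitNo : Bool → ℕ
  bitNo b = cellNo (plain (bitSym b))

  -- The target minus the number of the initial configuration. No digit of the latter exceeds `D₀`,
  -- so the subtraction is digitwise and without borrow; blanks and positions beyond the queue leave
  -- `D₀` as it is.
  quotaBlocks : BitString → ℕ → List (List Bool)
  quotaBlocks x J = block (D₀ ∸ frontNo x) ∷ (map (λ b → block (D₀ ∸ bitNo b)) (tailBits x) ++
    (replicate (J ∸ suc (length (tailBits x))) (block D₀) ++ (block Tf ∷ [])))

  quotaBits : BitString → ℕ → List Bool
  quotaBits x J = true ∷ concat (quotaBlocks x J)

  itemBits : ℕ → ℕ → List (List Bool)
  itemBits P″ J = concatMap (λ j → map (λ τ → weightBits τ P″ j) tiles) (upFrom 0 J)

  -- The first entry is the weight 1 of the distinguished player, the last one its number 1, counted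
  -- from 1.
  gameNumbers : BitString → ℕ → ℕ → List (List Bool)
  gameNumbers x P″ J = (true ∷ []) ∷ (itemBits P″ J ++ (quotaBits x J ∷ ((true ∷ []) ∷ [])))

  module Values (P″ : ℕ) where
    open Len P″ public

    Width : List Bool → Set
    Width b = length b ≡ β

    val-concat : ∀ {bs} → All Width bs → val (concat bs) ≡ queueVal (map val bs)
    val-concat [] = refl
    val-concat {b ∷ bs} (w ∷ ws) = trans (val-++ b (concat bs)) (cong₂ (λ l v → val b + 2 ^ l * v) w (val-concat ws))

    block-value : ∀ {d} → d ≤ D₀ → val (block d) ≡ d
    block-value le = val-lsb β _ (≤-trans (s≤s le) D₀<B)

    κ≤D₀ : κ ≤ D₀
    κ≤D₀ = ≤-trans (m≤m+n κ κ) (n≤1+n _)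

    block-width : ∀ d → Width (block d)
    block-width d = length-lsb β d

    widths-replicate : ∀ n d → All Width (replicate n (block d))
    widths-replicate zero d = []
    widths-replicate (suc n) d = block-width d ∷ widths-replicate n d

    queueVal-zeros : ∀ n rest → queueVal (map val (replicate n (block 0) ++ rest)) ≡ B ^ n * queueVal (map val rest)
    queueVal-zeros zero rest = sym (+-identityʳ _)
    queueVal-zeros (suc n) rest = trans (cong₂ (λ a b → a + B * b) (block-value z≤n) (queueVal-zeros n rest)) (sym (*-assoc B (B ^ n) _))

    weight-value : ∀ τ j → val (weightBits τ P″ j) ≡ 2 * (B ^ j * ((D₀ ∸ key τ) + B * high τ))
    weight-value τ@(i , (jj , (b , σ))) j = trans (+-identityʳ _) (cong (2 *_) (trans (val-concat (++⁺ (widths-replicate j 0) (block-width _ ∷ (block-width _ ∷ ++⁺ (widths-replicate P″ 0) (block-width _ ∷ [])))))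
      (trans (queueVal-zeros j _) (cong (B ^ j *_) (cong₂ (λ a b → a + B * b) (block-value (m∸n≤m D₀ (key τ)))
        (trans (cong₂ (λ a b → a + B * b) (block-value (≤-trans (state-bound σ) κ≤D₀)) (trans (queueVal-zeros P″ _) (cong (B ^ P″ *_) (trans (cong₂ _+_ (block-value (≤-trans (cell-bound b) κ≤D₀)) (*-zeroʳ B)) (+-identityʳ _)))))
          (ar (nextNo τ) B (B ^ P″) (outNo τ))))))))
      where
      ar : ∀ r B p d → r + B * (p * d) ≡ r + d * (B * p)
      ar = solve-∀

    items-values : ∀ s m → map val (concatMap (λ j → map (λ τ → weightBits τ P″ j) tiles) (upFrom s m)) ≡ map (2 *_) (map (B ^ s *_) (items m))
    items-values s zero = refl
    items-values s (suc m) = begin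
      map val (map (λ τ → weightBits τ P″ s) tiles ++ later)
        ≡⟨ map-++ val (map (λ τ → weightBits τ P″ s) tiles) later ⟩
      map val (map (λ τ → weightBits τ P″ s) tiles) ++ map val later
        ≡⟨ cong₂ _++_ (trans (sym (map-∘ tiles)) (trans (map-cong (λ τ → weight-value τ s) tiles) (trans (map-∘ tiles) (cong (map (2 *_)) (map-∘ tiles)))))
             (trans (items-values (suc s) m) (cong (map (2 *_)) (trans (map-cong (λ v → trans (cong (_* v) (*-comm B (B ^ s))) (*-assoc (B ^ s) B v)) (items m)) (map-∘ (items m))))) ⟩
      map (2 *_) (map (B ^ s *_) (map weight tiles)) ++ map (2 *_) (map (B ^ s *_) (map (B *_) (items m)))
        ≡⟨ map-++ (2 *_) (map (B ^ s *_) (map weight tiles)) _ ⟨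
      map (2 *_) (map (B ^ s *_) (map weight tiles) ++ map (B ^ s *_) (map (B *_) (items m)))
        ≡⟨ cong (map (2 *_)) (map-++ (B ^ s *_) (map weight tiles) _) ⟨
      map (2 *_) (map (B ^ s *_) (items (suc m))) ∎
      where
      open ≡-Reasoning
      weight : Tile → ℕ
      weight τ = (D₀ ∸ key τ) + B * high τ
      later : List (List Bool)
      later = concatMap (λ j → map (λ τ → weightBits τ P″ j) tiles) (upFrom (suc s) m)

    length-items : ∀ m → length (items m) ≡ m * length tiles
    length-items zero = refl
    length-items (suc m) = trans (length-++ (map (λ τ → (D₀ ∸ key τ) + B * high τ) tiles)) (cong₂ _+_ (length-map _ tiles) (trans (length-map (B *_) (items m)) (length-items m)))

    complement : ∀ cs ds → All (_≤ D₀) cs → queueVal cs + queueVal (map (D₀ ∸_) cs ++ ds) ≡ target (length cs) (queueVal ds)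
    complement [] ds [] = refl
    complement (c ∷ cs) ds (le ∷ les) = trans (ar c B (queueVal cs) (D₀ ∸ c) (queueVal (map (D₀ ∸_) cs ++ ds)))
      (cong₂ (λ a b → a + B * b) (m+[n∸m]≡n le) (complement cs ds les))
      where
      ar : ∀ c B v d w → c + B * v + (d + B * w) ≡ c + d + B * (v + w)
      ar = solve-∀

    target-+ : ∀ m n t → target m (target n t) ≡ target (m + n) t
    target-+ zero n t = refl
    target-+ (suc m) n t = cong (λ z → D₀ + B * z) (target-+ m n t)

    tail-value : ∀ n → queueVal (replicate n D₀ ++ Tf ∷ []) ≡ target n Tf
    tail-value zero = trans (cong (Tf +_) (*-zeroʳ B)) (+-identityʳ Tf)
    tail-value (suc n) = cong (λ z → D₀ + B * z) (tail-value n)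

  -- Choice of the parameters, correctness of the reduction and decoding

  module Recovery (c₀ k₀ : ℕ) where
    ρ : ℕ
    ρ = nN * (ns * 3)

    -- The padding has room for the input and for `time n` blanks, so the cycle never wraps around;
    -- its summand `ρ` makes `steps n` at least `ρ`, as the growth estimate needs. The product in
    -- `steps` covers the budget of the simulation and also increases fast enough with `n`.
    time pad width steps : ℕ → ℕ
    time n = poly c₀ k₀ n
    pad n = time n + n + ρ
    width n = suc (suc (pad n))
    steps n = (time n + 2) * (width n + 2)

    φ : BitString → BitString
    φ x = concatMap encNum (gameNumbers x (pad (length x)) (steps (length x)))

    length-tail : ∀ (x : BitString) → length (tailBits x) ≤ length x
    length-tail []      = z≤n
    length-tail (_ ∷ x) = n≤1+n _

    module _ (halts : ∀ x → haltsWithin N (poly c₀ k₀ ∣ x ∣ₛ) (nInit N x) ≡ true) where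

      uncons-snoc : (fin : St → List Cl → Bool) → ∀ u (y : Fin ns) → ∃ λ z → ∃ λ Z → z ∷ Z ≡ u ++ y ∷ [] × Runs.initOf fin z Z ≡ u × Runs.lastOf fin z Z ≡ y
      uncons-snoc fin [] y = y , [] , refl , refl , refl
      uncons-snoc fin (z ∷ u) y = z , u ++ y ∷ [] , refl ,
        ∷ʳ-injective _ _ (Runs.init-last fin z (u ++ y ∷ []))

      module _ (x : BitString) where
        n Px Jx : ℕ
        n = length x
        Px = width n
        Jx = steps n

        open Values (pad n)

        ts : List (Fin ns)
        ts = map bitSym (tailBits x)

        gap : ℕ
        gap = Px ∸ suc (length ts)

        tail<Px : suc (length ts) ≤ Px
        tail<Px = s≤s (≤-trans (≤-trans (≤-reflexive (length-map bitSym (tailBits x))) (length-tail x)) (≤-trans (≤-trans (m≤n+m n (time n)) (m≤m+n _ ρ)) (n≤1+n _)))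

        time≤gap : time n ≤ suc gap
        time≤gap = ≤-trans (≤-trans (≤-reflexive (sym (m+n∸n≡m (time n) n))) (∸-mono {time n + n} {Px ∸ 1} {n} {length ts} (≤-trans (m≤m+n (time n + n) ρ) (n≤1+n _))
          (≤-trans (≤-reflexive (length-map bitSym (tailBits x))) (length-tail x)))) (n≤1+n _)

        q₀ : List Cl
        q₀ = headC (headSym x , startN) ∷ map plain (ts ++ replicate gap zero)

        length-q₀ : length q₀ ≡ Px
        length-q₀ = trans (cong suc (trans (length-map plain (ts ++ replicate gap zero)) (trans (length-++ ts) (cong (length ts +_) (length-replicate gap)))))
          (m+[n∸m]≡n tail<Px)

        init-tape : inputTape x ≡ tape [] (headSym x) ts
        init-tape = shape x
          where
          shape : ∀ x → inputTape {ex} x ≡ tape [] (headSym x) (map bitSym (tailBits x))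
          shape []      = refl
          shape (_ ∷ _) = refl

        runs-h : qruns Jx (buf (plain zero)) q₀ ≡ accPaths N (time n) (nInit N x)
        runs-h = from-ring (uncons-snoc final (ts ++ replicate gap zero) zero)
          where
          open ≡-Reasoning
          enough : budget (time n) ≤ Jx
          enough = ≤-trans (≤-by (Px + 3) (ar (time n) Px)) ≤-refl
            where
            ar : ∀ t P → t * (P + 2) + (P + 1) + (P + 3) ≡ (t + 2) * (P + 2)
            ar = solve-∀
          from-ring : (∃ λ z → ∃ λ Z → z ∷ Z ≡ (ts ++ replicate gap zero) ++ zero ∷ [] × initOf z Z ≡ ts ++ replicate gap zero × lastOf z Z ≡ zero) →
                      qruns Jx (buf (plain zero)) q₀ ≡ accPaths N (time n) (nInit N x)
          from-ring (z , Z , ring , eu , ey) = begin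
              qruns Jx (buf (plain zero)) q₀
                ≡⟨ cong₂ (λ y u → qruns Jx (buf (plain y)) (headC (headSym x , startN) ∷ map plain u)) (sym ey) (sym eu) ⟩
              launch Jx startN (headSym x) z Z
                -- The blank in the initial buffer is the left neighbour of the head and belongs to
                -- the gap, which therefore has `suc gap` cells.
                ≡⟨ simulate (time n) (nconf startN (tape [] (headSym x) ts)) (trans (cong (λ t → haltsWithin N (time n) (nconf startN t)) (sym init-tape)) (halts x))
                     (suc gap) z Z Jx (trans ring (trans (++-assoc ts _ _) (cong (ts ++_) (trans (replicate-snoc gap zero) (sym (++-identityʳ _)))))) time≤gap lenZ enough ⟩
              accPaths N (time n) (nconf startN (tape [] (headSym x) ts))
                ≡⟨ cong (λ t → accPaths N (time n) (nconf startN t)) (sym init-tape) ⟩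
              accPaths N (time n) (nInit N x) ∎
            where
            lenZ : length Z ≡ suc (pad n)
            lenZ = cong pred (trans (cong length ring) (trans (length-++ (ts ++ replicate gap zero)) (trans (+-comm _ 1)
              (trans (cong suc (sym (length-map plain (ts ++ replicate gap zero)))) length-q₀))))

        Ex₀ Qx : ℕ
        Ex₀ = stateNo (buf (plain zero)) + queueVal (map cellNo q₀)
        Qx = queueVal (map val (quotaBlocks x Jx))

        cs : List ℕ
        cs = frontNo x ∷ (map bitNo (tailBits x) ++ replicate gap 0)

        Px≤Jx : Px ≤ Jx
        Px≤Jx = ≤-trans (m≤m+n Px 2) (≤-trans (≤-reflexive (sym (*-identityˡ (Px + 2)))) (*-monoˡ-≤ (Px + 2) (≤-trans (s≤s z≤n) (m≤n+m 2 (time n)))))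

        length-cs : length cs ≡ Px
        length-cs = trans (cong suc (trans (length-++ (map bitNo (tailBits x))) (cong₂ _+_ (trans (length-map bitNo (tailBits x)) (sym (length-map bitSym (tailBits x)))) (length-replicate gap))))
          (m+[n∸m]≡n tail<Px)

        Ex₀-cs : Ex₀ ≡ queueVal cs
        Ex₀-cs = trans (sym (+-assoc (stateNo (buf (plain zero))) _ _)) (cong (λ l → frontNo x + B * queueVal l)
          (trans (cong (map cellNo) (map-++ plain ts (replicate gap zero))) (trans (map-++ cellNo (map plain ts) _)
            (cong₂ _++_ (trans (sym (map-∘ ts)) (sym (map-∘ (tailBits x)))) (zeros gap)))))
          where
          zeros : ∀ k → map cellNo (map plain (replicate k zero)) ≡ replicate k 0
          zeros zero = refl
          zeros (suc k) = cong (0 ∷_) (zeros k)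

        quota-digits : map val (quotaBlocks x Jx) ≡ map (D₀ ∸_) cs ++ (replicate (Jx ∸ Px) D₀ ++ Tf ∷ [])
        quota-digits = cong₂ _∷_ (block-value (m∸n≤m D₀ (frontNo x))) (begin
          map val (map (λ b → block (D₀ ∸ bitNo b)) (tailBits x) ++ rest)
            ≡⟨ map-++ val (map (λ b → block (D₀ ∸ bitNo b)) (tailBits x)) rest ⟩
          map val (map (λ b → block (D₀ ∸ bitNo b)) (tailBits x)) ++ map val rest
            ≡⟨ cong₂ _++_ (trans (sym (map-∘ (tailBits x))) (trans (map-cong (λ b → block-value (m∸n≤m D₀ (bitNo b))) (tailBits x)) (map-∘ (tailBits x)))) rest-digits ⟩
          map (D₀ ∸_) (map bitNo (tailBits x)) ++ (map (D₀ ∸_) (replicate gap 0) ++ (replicate (Jx ∸ Px) D₀ ++ Tf ∷ []))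
            ≡⟨ ++-assoc (map (D₀ ∸_) (map bitNo (tailBits x))) _ _ ⟨
          (map (D₀ ∸_) (map bitNo (tailBits x)) ++ map (D₀ ∸_) (replicate gap 0)) ++ (replicate (Jx ∸ Px) D₀ ++ Tf ∷ [])
            ≡⟨ cong (_++ (replicate (Jx ∸ Px) D₀ ++ Tf ∷ [])) (sym (map-++ (D₀ ∸_) (map bitNo (tailBits x)) _)) ⟩
          map (D₀ ∸_) (map bitNo (tailBits x) ++ replicate gap 0) ++ (replicate (Jx ∸ Px) D₀ ++ Tf ∷ []) ∎)
          where
          open ≡-Reasoning
          rest : List (List Bool)
          rest = replicate (Jx ∸ suc (length (tailBits x))) (block D₀) ++ (block Tf ∷ [])
          count-eq : Jx ∸ suc (length (tailBits x)) ≡ gap + (Jx ∸ Px)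
          count-eq = trans (cong (λ l → Jx ∸ suc l) (sym (length-map bitSym (tailBits x))))
            (trans (cong (_∸ suc (length ts)) (sym (m+[n∸m]≡n Px≤Jx))) (trans (cong (_∸ suc (length ts)) (+-comm Px (Jx ∸ Px)))
              (trans (+-∸-assoc (Jx ∸ Px) tail<Px) (+-comm (Jx ∸ Px) gap))))
          fulls : ∀ k → map val (replicate k (block D₀) ++ block Tf ∷ []) ≡ replicate k D₀ ++ Tf ∷ []
          fulls zero = cong (_∷ []) (block-value (≤-trans (state-bound wipe) κ≤D₀))
          fulls (suc k) = cong₂ _∷_ (block-value ≤-refl) (fulls k)
          split : ∀ g k → replicate (g + k) D₀ ++ Tf ∷ [] ≡ map (D₀ ∸_) (replicate g 0) ++ (replicate k D₀ ++ Tf ∷ [])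
          split zero k = refl
          split (suc g) k = cong (D₀ ∷_) (split g k)
          rest-digits : map val rest ≡ map (D₀ ∸_) (replicate gap 0) ++ (replicate (Jx ∸ Px) D₀ ++ Tf ∷ [])
          rest-digits = trans (fulls _) (trans (cong (λ k → replicate k D₀ ++ Tf ∷ []) count-eq) (split gap (Jx ∸ Px)))

        balance : Ex₀ + Qx ≡ target Jx Tf
        balance = trans (cong₂ _+_ Ex₀-cs (cong queueVal quota-digits)) (trans (complement cs _ (le-front ∷ les))
          (trans (cong₂ target length-cs (tail-value (Jx ∸ Px))) (trans (target-+ Px (Jx ∸ Px) Tf) (cong (λ m → target m Tf) (m+[n∸m]≡n Px≤Jx)))))
          where
          le-front : frontNo x ≤ D₀
          le-front = ≤-trans (key-bound (codeSt (buf (plain zero))) (codeCl (headC (headSym x , startN)))) κ≤D₀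
          les : All (_≤ D₀) (map bitNo (tailBits x) ++ replicate gap 0)
          les = ++⁺ (map⁺ (universal (λ b → ≤-trans (cell-bound (plain (bitSym b))) κ≤D₀) (tailBits x))) (zeros gap)
            where
            zeros : ∀ k → All (_≤ D₀) (replicate k 0)
            zeros zero = []
            zeros (suc k) = z≤n ∷ zeros k

        val-quota : val (quotaBits x Jx) ≡ 1 + 2 * Qx
        val-quota = trans (+-comm _ 1) (cong (λ z → 1 + 2 * z) (val-concat {quotaBlocks x Jx} widths))
          where
          widths : All Width (quotaBlocks x Jx)
          widths = block-width (D₀ ∸ frontNo x) ∷ ++⁺ (map⁺ (universal (λ b → block-width (D₀ ∸ bitNo b)) (tailBits x)))
            (++⁺ (widths-replicate (Jx ∸ suc (length (tailBits x))) D₀) (block-width Tf ∷ []))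

        facts : ℕ → ℕ
        facts k = k ! * (Jx * length tiles ∸ k) !

        game-value : SSstar (φ x) ≡ facts Jx * accPaths N (time n) (nInit N x)
        game-value = begin
          SSstar (φ x)
            ≡⟨ SSstar-gameScore (φ x) ⟩
          gameScore (gameOf (parseList (φ x)))
            ≡⟨ cong (gameScore ∘ gameOf) (trans (parseList-encNums (gameNumbers x (pad n) Jx)) (cong (true ,_) reversed)) ⟩
          score (map val (reverse (reverse ws))) 1 0 0 (val (quotaBits x Jx)) 0
            ≡⟨ cong₂ (λ l q → score l 1 0 0 q 0) (cong (map val) (reverse-involutive ws)) val-quota ⟩
          score (map val (itemBits (pad n) Jx)) 0 0 0 (1 + 2 * Qx) 1
            ≡⟨ cong (λ l → score l 0 0 0 (1 + 2 * Qx) 1) (trans (items-values 0 Jx) (cong (map (2 *_)) (trans (map-cong *-identityˡ (items Jx)) (map-id (items Jx))))) ⟩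
          score items2 0 0 0 (1 + 2 * Qx) 1
            ≡⟨ sym (+-identityʳ _) ⟩
          0 ! * 0 ! * score items2 0 0 0 (1 + 2 * Qx) 1
            ≡⟨ score-after 1 items2 0 0 (1 + 2 * Qx) ⟩
          sum (map (after 1 items2 0 0 (1 + 2 * Qx)) (allSubsets (length items2)))
            ≡⟨ sum-allSubsets items2 (λ k v → k ! * (length items2 ∸ k) ! * pivotal (1 + 2 * Qx ∸ v) 1) ⟩
          subsum items2 (λ k v → k ! * (length items2 ∸ k) ! * pivotal (1 + 2 * Qx ∸ v) 1)
            ≡⟨ subsum-scale 2 (items Jx) _ ⟩
          subsum (items Jx) (λ k v → k ! * (length items2 ∸ k) ! * pivotal (1 + 2 * Qx ∸ 2 * v) 1)
            ≡⟨ subsum-cong (items Jx) exact ⟩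
          subsum (items Jx) (λ k v → when (Ex₀ + v ≡ᵇ target Jx Tf) (facts k))
            ≡⟨ subsum-qruns Jx (buf (plain zero)) q₀ facts length-q₀ ⟩
          facts Jx * qruns Jx (buf (plain zero)) q₀
            ≡⟨ cong (facts Jx *_) runs-h ⟩
          facts Jx * accPaths N (time n) (nInit N x) ∎
          where
          open ≡-Reasoning
          ws : List (List Bool)
          ws = (true ∷ []) ∷ itemBits (pad n) Jx
          items2 : List ℕ
          items2 = map (2 *_) (items Jx)
          reversed : reverse (gameNumbers x (pad n) Jx) ≡ (true ∷ []) ∷ quotaBits x Jx ∷ reverse ws
          reversed = reverse-++ ws (quotaBits x Jx ∷ (true ∷ []) ∷ [])
          exact : ∀ k v → k ! * (length items2 ∸ k) ! * pivotal (1 + 2 * Qx ∸ 2 * v) 1 ≡ when (Ex₀ + v ≡ᵇ target Jx Tf) (facts k)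
          exact k v = trans (cong₂ (λ l p → k ! * (l ∸ k) ! * p) (trans (length-map (2 *_) (items Jx)) (length-items Jx)) (trans (pivotal-double Qx v) (cong (λ b → when b 1) same)))
            (times (Ex₀ + v ≡ᵇ target Jx Tf) (facts k))
            where
            same : (Qx ≡ᵇ v) ≡ (Ex₀ + v ≡ᵇ target Jx Tf)
            same = ≡ᵇ-cong (λ { refl → balance }) (λ eq → +-cancelˡ-≡ Ex₀ Qx v (trans balance (sym eq)))
            times : ∀ b f → f * when b 1 ≡ when b f
            times true  f = *-identityʳ f
            times false f = *-zeroʳ f

    module _ {A : Set} ⦃ eA : Enc A ⦄ {f : A → ℕ} (p : PT f) where
      timeₚ : PT (λ a → time (f a))
      timeₚ = constPT c₀ *ₚ powₚ p k₀ +ₚ constPT c₀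

      padₚ : PT (λ a → pad (f a))
      padₚ = timeₚ +ₚ p +ₚ constPT ρ

      stepsₚ : PT (λ a → steps (f a))
      stepsₚ = (timeₚ +ₚ constPT 2) *ₚ (sucₚ (sucₚ padₚ) +ₚ constPT 2)

    -- A tile belongs to the fixed machine, so its blocks are constants; only the numbers of zero
    -- blocks depend on the input.
    weightBitsₚ : ∀ τ → PT {ℕ × ℕ} (λ z → weightBits τ (proj₂ z) (proj₁ z))
    weightBitsₚ τ = constPT false ∷ₚ concatₚ (replicateₚ fstPT (constPT (block 0)) ++ₚ (constPT (block (D₀ ∸ key τ)) ∷ₚ (constPT (block (nextNo τ)) ∷ₚ
      (replicateₚ sndPT (constPT (block 0)) ++ₚ (constPT (block (outNo τ)) ∷ₚ constPT [])))))

    tileListₚ : ∀ ts → PT {ℕ × ℕ} (λ z → map (λ τ → weightBits τ (proj₂ z) (proj₁ z)) ts)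
    tileListₚ []       = constPT []
    tileListₚ (τ ∷ ts) = weightBitsₚ τ ∷ₚ tileListₚ ts

    len : PT {BitString} length
    len = lengthₚ idPT

    itemBitsₚ : PT {BitString} (λ x → itemBits (pad (length x)) (steps (length x)))
    itemBitsₚ = concatMapₚ {X = ℕ} {E = ℕ} {Y = List Bool} {f = λ z → map (λ τ → weightBits τ (proj₂ z) (proj₁ z)) tiles} (tileListₚ tiles) (upFrom₀ₚ (stepsₚ len)) (padₚ len)

    frontₚ : PT {BitString} (λ x → block (D₀ ∸ frontNo x))
    frontₚ = respPT same (ifPT (nullₚ idPT) (constPT (block (D₀ ∸ frontNo []))) (ifPT (headBitₚ idPT) (constPT (block (D₀ ∸ frontNo (true ∷ [])))) (constPT (block (D₀ ∸ frontNo (false ∷ []))))))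
      where
      same : ∀ x → (if null x then block (D₀ ∸ frontNo []) else (if headBit x then block (D₀ ∸ frontNo (true ∷ [])) else block (D₀ ∸ frontNo (false ∷ [])))) ≡ block (D₀ ∸ frontNo x)
      same []          = refl
      same (true ∷ _)  = refl
      same (false ∷ _) = refl

    bitBlockₚ : PT {Bool × ⊤} (λ z → block (D₀ ∸ bitNo (proj₁ z)))
    bitBlockₚ = respPT (λ z → same (proj₁ z)) (ifPT fstPT (constPT (block (D₀ ∸ bitNo true))) (constPT (block (D₀ ∸ bitNo false))))
      where
      same : ∀ b → (if b then block (D₀ ∸ bitNo true) else block (D₀ ∸ bitNo false)) ≡ block (D₀ ∸ bitNo b)
      same true  = refl
      same false = refl

    quotaBitsₚ : PT {BitString} (λ x → quotaBits x (steps (length x)))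
    quotaBitsₚ = constPT true ∷ₚ concatₚ (frontₚ ∷ₚ (mapₚ {X = Bool} {E = ⊤} {Y = List Bool} bitBlockₚ (tailBitsₚ idPT) (constPT tt) ++ₚ
      (replicateₚ (stepsₚ len ∸ₚ sucₚ (lengthₚ (tailBitsₚ idPT))) (constPT (block D₀)) ++ₚ constPT (block Tf ∷ []))))

    φₚ : PT φ
    φₚ = concatMapₚ {X = List Bool} {E = ⊤} {Y = Bool} {f = λ z → encNum (proj₁ z)} (encNumₚ fstPT)
      (constPT (true ∷ []) ∷ₚ (itemBitsₚ ++ₚ (quotaBitsₚ ∷ₚ constPT ((true ∷ []) ∷ [])))) (constPT tt)

    others : ℕ
    others = length tiles ∸ 1

    factor : ℕ → ℕ
    factor n = steps n ! * (steps n * others) !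

    candidate : ℕ → BitString → BitString
    candidate n y = divSeq (steps n * others) (divSeq (steps n) y)

    candidate-floor : ∀ n y → Floor (factor n) (readMSB 0 y) (readMSB 0 (candidate n y))
    candidate-floor n y = floor-compose (steps n !) ((steps n * others) !) (readMSB 0 y) (readMSB 0 (divSeq (steps n) y)) (readMSB 0 (candidate n y))
      (floor-divSeq (steps n) y) (floor-divSeq (steps n * others) (divSeq (steps n) y))

    choose : BitString → BitString → ℕ → BitString
    choose y r n = if anyBit (candidate n y) then candidate n y else r

    ψbits : BitString → BitString
    ψbits y = strip (foldl (choose y) [] (upFrom 0 (suc (length y))))

    ψ : ℕ → ℕ
    ψ m = readMSB 0 (ψbits (toBin m))

    factor-pos : ∀ n → 1 ≤ factor n
    factor-pos n = *-mono-≤ (!-pos (steps n)) (!-pos (steps n * others))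

    time-mono : ∀ {m n} → m ≤ n → time m ≤ time n
    time-mono le = +-monoˡ-≤ c₀ (*-monoʳ-≤ c₀ (^-monoˡ-≤ k₀ le))

    pad-mono : ∀ {m n} → m ≤ n → pad m ≤ pad n
    pad-mono le = +-monoˡ-≤ ρ (+-mono-≤ (time-mono le) le)

    steps-mono : ∀ {m n} → m ≤ n → steps m ≤ steps n
    steps-mono le = *-mono-≤ (+-monoˡ-≤ 2 (time-mono le)) (+-monoˡ-≤ 2 (s≤s (s≤s (pad-mono le))))

    -- Passing to `suc n` widens the queue by at least one cell, and this lengthens each of the
    -- `time n + 2` rounds by at least one step.
    steps-gap : ∀ n → steps n + (time n + 2) ≤ steps (suc n)
    steps-gap n = ≤-trans (≤-reflexive (ar (time n + 2) (width n + 2))) (*-mono-≤ (+-monoˡ-≤ 2 (time-mono (n≤1+n n))) (s≤s (s≤s wider)))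
      where
      ar : ∀ a b → a * b + a ≡ a * suc b
      ar = solve-∀
      wider : suc (pad n + 2) ≤ pad (suc n) + 2
      wider = +-monoˡ-≤ 2 (≤-trans (≤-reflexive (cong (_+ ρ) (sym (+-suc (time n) n)))) (+-monoˡ-≤ ρ (+-monoˡ-≤ (suc n) (time-mono (n≤1+n n)))))

    width≤steps : ∀ n → width n ≤ steps n
    width≤steps n = ≤-trans (m≤m+n (width n) 2) (≤-trans (≤-reflexive (sym (*-identityˡ (width n + 2)))) (*-monoˡ-≤ (width n + 2) (≤-trans (s≤s z≤n) (m≤n+m 2 (time n)))))

    -- The larger factorial contains at least `time n + 2` new factors, each at least
    -- `suc (steps n)` and hence at least `ρ`. So many of them outweigh `ρ ^ time n`, the bound on
    -- the count, and the two in excess make the inequality strict.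
    factor-gap : ∀ n n′ h → h ≤ ρ ^ time n → n < n′ → factor n * h < factor n′
    factor-gap n n′ h h≤ lt = ≤-trans (*-monoʳ-< (factor n) {{factor≢0}} below) (≤-trans (≤-reflexive (ar (j !) (l !) (suc j ^ (t + 2))))
      (*-mono-≤ (≤-trans (!-grows j (t + 2)) (!-mono (≤-trans (steps-gap n) (steps-mono lt)))) (!-mono (*-monoˡ-≤ others (steps-mono (<⇒≤ lt))))))
      where
      j l t : ℕ
      j = steps n
      l = steps n * others
      t = time n
      factor≢0 : NonZero (factor n)
      factor≢0 = Data.Nat.>-nonZero (factor-pos n)
      ar : ∀ a b p → a * b * p ≡ a * p * b
      ar = solve-∀
      ρ≤j : ρ ≤ suc j
      ρ≤j = ≤-trans (m≤n+m ρ (time n + n)) (≤-trans (≤-trans (n≤1+n _) (n≤1+n _)) (≤-trans (width≤steps n) (n≤1+n j)))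
      twice : ∀ x → 1 ≤ x → x < suc j * (suc j * x)
      twice x pos = ≤-trans (+-monoˡ-≤ x pos) (≤-trans (+-monoʳ-≤ x (≤-trans (≤-trans (≤-reflexive (sym (+-identityʳ x))) (*-monoˡ-≤ x 1≤j)) (*-monoʳ-≤ j (m≤m+n x (j * x))))) (+-monoˡ-≤ (j * (suc j * x)) (m≤m+n x (j * x))))
        where
        1≤j : 1 ≤ j
        1≤j = ≤-trans (s≤s z≤n) (width≤steps n)
      below : h < suc j ^ (t + 2)
      below = ≤-trans (s≤s (≤-trans h≤ (^-monoˡ-≤ t ρ≤j))) (≤-trans (twice (suc j ^ t) (m^n>0 (suc j) t)) (≤-reflexive (cong (suc j ^_) (+-comm 2 t))))

    module _ (y : BitString) (n h : ℕ) (h≤ : h ≤ ρ ^ time n) (eq : readMSB 0 y ≡ factor n * h) where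

      value : ℕ → ℕ
      value n′ = readMSB 0 (candidate n′ y)

      skips : ∀ n′ r → value n′ ≡ 0 → choose y r n′ ≡ r
      skips n′ r z = cong (λ b → if b then candidate n′ y else r) (trans (anyBit-readMSB 0 (candidate n′ y)) (cong (not ∘ isZero) z))

      all-skip : ∀ k s r → (∀ n′ → s ≤ n′ → value n′ ≡ 0) → foldl (choose y) r (upFrom s k) ≡ r
      all-skip zero s r z = refl
      all-skip (suc k) s r z = trans (cong (λ q → foldl (choose y) q (upFrom (suc s) k)) (skips s r (z s ≤-refl))) (all-skip k (suc s) r (λ n′ le → z n′ (≤-trans (n≤1+n s) le)))

      below-zero : ∀ n′ → factor n * h < factor n′ → value n′ ≡ 0
      below-zero n′ lt = floor-zero (factor n′) (readMSB 0 y) (value n′) (≤-<-trans (≤-reflexive eq) lt) (candidate-floor n′ y)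

      later-zero : ∀ n′ → suc n ≤ n′ → value n′ ≡ 0
      later-zero n′ lt = below-zero n′ (factor-gap n n′ h h≤ lt)

      exact : value n ≡ h
      exact = floor-exact (factor n) (readMSB 0 y) h (value n) eq (candidate-floor n y)

      decoded : readMSB 0 (ψbits y) ≡ h
      decoded = trans (strip-readMSB (foldl (choose y) [] (upFrom 0 (suc (length y))))) (byCase h refl)
        where
        open ≡-Reasoning
        byCase : ∀ h₁ → h₁ ≡ h → readMSB 0 (foldl (choose y) [] (upFrom 0 (suc (length y)))) ≡ h
        -- If the count is 0 then so is the value; no candidate is ever chosen, and the initial `[]`
        -- denotes 0.
        byCase zero refl = cong (readMSB 0) (all-skip (suc (length y)) 0 [] (λ n′ _ → below-zero n′ (≤-trans (s≤s (≤-reflexive (*-zeroʳ (factor n)))) (factor-pos n′))))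
        byCase (suc h′) refl = begin
          readMSB 0 (foldl (choose y) [] (upFrom 0 (suc (length y))))
            ≡⟨ cong (λ l → readMSB 0 (foldl (choose y) [] l)) (trans (cong (upFrom 0) split) (upFrom-++ 0 n (suc (length y ∸ n)))) ⟩
          readMSB 0 (foldl (choose y) [] (upFrom 0 n ++ n ∷ upFrom (suc n) (length y ∸ n)))
            ≡⟨ cong (readMSB 0) (foldl-++ (choose y) [] (upFrom 0 n) _) ⟩
          readMSB 0 (foldl (choose y) (choose y (foldl (choose y) [] (upFrom 0 n)) n) (upFrom (suc n) (length y ∸ n)))
            ≡⟨ cong (readMSB 0) (all-skip (length y ∸ n) (suc n) _ later-zero) ⟩
          readMSB 0 (choose y (foldl (choose y) [] (upFrom 0 n)) n)
            ≡⟨ cong (λ b → readMSB 0 (if b then candidate n y else foldl (choose y) [] (upFrom 0 n))) (trans (anyBit-readMSB 0 (candidate n y)) (cong (not ∘ isZero) exact)) ⟩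
          readMSB 0 (candidate n y)
            ≡⟨ exact ⟩
          h ∎
          where
          -- A nonzero value is at least the factorial of `steps n`, which exceeds n; hence its
          -- binary length is at least n, and n is among the lengths tried.
          2^n≤ : 2 ^ n ≤ readMSB 0 y
          2^n≤ = ≤-trans (≤-trans (≤-reflexive (sym (*-identityˡ (2 ^ n)))) (!-grows 1 n)) (≤-trans (!-mono (≤-trans (s≤s (≤-trans (m≤n+m n (time n)) (≤-trans (m≤m+n _ ρ) (n≤1+n _)))) (width≤steps n)))
            (≤-trans (≤-trans (≤-reflexive (sym (*-identityʳ (steps n !)))) (*-monoʳ-≤ (steps n !) (!-pos (steps n * others))))
              (≤-trans (≤-trans (≤-reflexive (sym (*-identityʳ (factor n)))) (*-monoʳ-≤ (factor n) (s≤s z≤n))) (≤-reflexive (sym eq)))))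
          n≤len : n ≤ length y
          n≤len = ≮⇒≥ (λ lt → <⇒≱ (readMSB<2^ y) (≤-trans (^-monoʳ-≤ 2 (<⇒≤ lt)) 2^n≤))
          split : suc (length y) ≡ n + suc (length y ∸ n)
          split = trans (cong suc (sym (m+[n∸m]≡n n≤len))) (sym (+-suc n _))

    candidateₚ : ∀ {A : Set} ⦃ eA : Enc A ⦄ {n : A → ℕ} {y : A → BitString} → PT n → PT y → PT (λ a → candidate (n a) (y a))
    candidateₚ pn py = divSeqₚ (stepsₚ pn *ₚ constPT others) (divSeqₚ (stepsₚ pn) py)

    ψₚ : PT ψbits
    ψₚ = stripₚ (foldₚ {X = ℕ} {E = BitString} {B = BitString} {f = λ z → choose (proj₁ (proj₂ z)) (proj₂ (proj₂ z)) (proj₁ z)}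
      (ifPT (anyBitₚ c) c (snd′ₚ sndPT)) (upFrom₀ₚ (sucₚ len)) idPT (constPT []) var bound)
      where
      c : PT {ℕ × (BitString × BitString)} (λ z → candidate (proj₁ z) (proj₁ (proj₂ z)))
      c = candidateₚ fstPT (fst′ₚ sndPT)
      bound : ∀ n y r → size (choose y r n) ≤ size r + (size n + size y)
      bound n y r = either (anyBit (candidate n y)) (candidate n y)
        (≤-reflexive (trans (size-divSeq (steps n * others) (divSeq (steps n) y)) (size-divSeq (steps n) y)))
        where
        either : ∀ b w → size w ≤ size y → size (if b then w else r) ≤ size r + (size n + size y)
        either true  w le = ≤-trans le (≤-trans (m≤n+m (size y) (size n)) (m≤n+m _ (size r)))
        either false w le = m≤m+n _ _

    module _ (halts : ∀ x → haltsWithin N (poly c₀ k₀ ∣ x ∣ₛ) (nInit N x) ≡ true) where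
      recovers : ∀ x → accPaths N (poly c₀ k₀ ∣ x ∣ₛ) (nInit N x) ≡ ψ (SSstar (φ x))
      recovers x = sym (decoded (toBin (SSstar (φ x))) (length x) (accPaths N (time (length x)) (nInit N x)) (accPaths-≤ N (time (length x)) (nInit N x))
        (trans (readMSB-toBin (SSstar (φ x))) (trans (game-value halts x) (cong (λ l → steps (length x) ! * l ! * accPaths N (time (length x)) (nInit N x))
          (sym (trans (*-distribˡ-∸ (steps (length x)) (length tiles) 1) (cong (steps (length x) * length tiles ∸_) (*-identityʳ (steps (length x))))))))))

theorem4 : SharpP SSstar ×
    ((h : BitString → ℕ) → SharpP h →
    Σ (BitString → BitString) λ φ → Σ (ℕ → ℕ) λ ψ →
    PolyTimeComputable φ × PolyTimeComputableℕ ψ ×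
    ((x : BitString) → h x ≡ ψ (SSstar (φ x))))
theorem4 = SSstar-sharpP , λ h (N , c , k , halts , counts) → let open Reduction.Recovery N c k in
  φ , ψ , PT⇒PolyTime φₚ , (ψbits , PT⇒PolyTime ψₚ , λ m → sym (toBin-strip (foldl (choose (toBin m)) [] (upFrom 0 (suc (length (toBin m))))))) , λ x → trans (counts x) (recovers halts x)
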